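{- Let $k\ge 1$ and $\ell\ge 0$ be integers and let $\mu\in\mathrm{Par}^k_\ell$. Let $\theta=k^\ell/\mu$, where $k^\ell=(k,\dots,k)$ ($\ell$ parts). Then the modified Hall–Littlewood polynomial $H_\mu(\mathbf x;t)=H(\Delta^+_\ell;\mu)$ satisfies \[ H_\mu \;=\; \mathfrak s^{(k)}_{k^\ell}\cdot u_{\mathrm{creading}(Z_{\theta})}\;=\;\sum_{T\in \mathrm{SMT}^k(\mathrm{creading}(Z_{\theta})\,;\,k^\ell)} t^{\mathrm{spin}(T)}\,\mathfrak s^{(k)}_{\mathrm{inside}(T)}. \]
   Context: Let $t$ be an indeterminate and $\Lambda=\mathbb Z[t][h_1,h_2,\dots]$ the ring of symmetric functions in $\mathbf x=(x_1,x_2,\dots)$ over $\mathbb Z[t]$, $h_d$ the complete homogeneous symmetric function, $h_0=1$, $h_d=0$ for $d<0$. For $\gamma\in\mathbb Z^\ell$ put $s_\gamma=\det(h_{\gamma_i+j-i})_{1\le i,j\le \ell}$. Let $\Delta^+_\ell=\{(i,j):1\le i<j\le \ell\}$ with partial order $(a,b)\le(c,d)$ iff $a\ge c$ and $b\le d$; a root ideal is an upper order ideal $\Psi\subseteq\Delta^+_\ell$, and an indexed root ideal of length $\ell$ is a pair $(\Psi,\gamma)$ with $\gamma\in\mathbb Z^\ell$. With $\epsilon_i$ the $i$-th unit vector, the Catalan function is $H(\Psi;\gamma)=\prod_{(i,j)\in\Psi}(1-tR_{ij})^{ -1}s_\gamma$, where $R_{ij}s_\beta=s_{\beta+\epsilon_i-\epsilon_j}$;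 i.e. $H(\Psi;\gamma)=\sum_{m:\Psi\to\mathbb Z_{\ge0}}t^{\sum_\delta m_\delta}s_{\gamma+\sum_{(i,j)\in\Psi}m_{ij}(\epsilon_i-\epsilon_j)}$, which lies in $\Lambda$; $H(\varnothing;\emptyset)=1$ for $\ell=0$. Fix $k\ge1$. $\mathrm{Par}^k_\ell=\{\mu\in\mathbb Z^\ell: k\ge\mu_1\ge\dots\ge\mu_\ell\ge0\}$ and $\mathrm{Par}^k$ is the set of partitions with all parts $\le k$. For $\mu\in\mathrm{Par}^k_\ell$ let $\Delta^k(\mu)=\{(i,j)\in\Delta^+_\ell: k-\mu_i+i<j\}$ and $\mathfrak s^{(k)}_\mu=H(\Delta^k(\mu);\mu)$ (appending zeros to $\mu$ does not change it, so $\mathfrak s^{(k)}_\mu$ is defined for $\mu\in\mathrm{Par}^k$). Let $\Lambda^k$ be the $\mathbb Z[t]$-span of $\{H(\Delta^+_{\ell(\mu)};\mu):\mu\in\mathrm{Par}^k\}$; $\{\mathfrak s^{(k)}_\mu\}_{\mu\in\mathrm{Par}^k}$ is a $\mathbb Z[t]$-basis of $\Lambda^k$. Strong tableaux: a $(k+1)$-core is a partition with no box of hook length $k+1$; the bijection $\mathfrak p$ from $(k+1)$-cores to $\mathrm{Par}^k$ sends $\kappa$ to $\lambda$ where $\lambda_r$ is the number of boxes in row $r$ of $\kappa$ with hook length $\le k$. A strong cover $\tau\Rightarrow\kappa$ is a pair of $(k+1)$-cores with $\tau\subseteq\kappa$ and $|\mathfrak p(\tau)|+1=|\mathfrak p(\kappa)|$;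 a strong marked cover $\tau\xRightarrow{r}\kappa$ is a strong cover together with a positive integer $r$ equal to the smallest row index of some connected component of $\kappa/\tau$. Its spin is $c(h-1)+N$, where $c$ is the number of connected components of $\kappa/\tau$, $h$ the number of rows of each component (all components have the same height), and $N$ the number of components lying entirely in rows $>r$. For a word $w=w_1\cdots w_m$ of positive integers, a strong tableau $T$ marked by $w$ is a sequence of strong marked covers $\kappa^{(0)}\xRightarrow{w_m}\kappa^{(1)}\xRightarrow{w_{m-1}}\cdots\xRightarrow{w_1}\kappa^{(m)}$; $\mathrm{inside}(T)=\mathfrak p(\kappa^{(0)})$, $\mathrm{outside}(T)=\mathfrak p(\kappa^{(m)})$, $\mathrm{spin}(T)$ is the sum of the spins of its covers, and $\mathrm{SMT}^k(w;\mu)$ is the set of such $T$ with outside $\mu$. The strong Pieri operators $u_p$ ($p\ge1$) are the $\mathbb Z[t]$-linear operators on $\Lambda^k$, acting on the right, with $\mathfrak s^{(k)}_\mu\cdot u_p=\sum_{T\in\mathrm{SMT}^k(p;\mu)}t^{\mathrm{spin}(T)}\mathfrak s^{(k)}_{\mathrm{inside}(T)}$; for a word $w=w_1\cdots w_d$, $u_w=u_{w_1}\cdots u_{w_d}$ with $f\cdot u_w=(\cdots((f\cdot u_{w_1})\cdot u_{w_2})\cdots)\cdot u_{w_d}$. For a skew shape $\theta$ (English notation), the superstandard tableau $Z_\theta$ fills every box of row $i$ with $i$. The column reading word $\mathrm{creading}(T)$ of a filling $T$ concatenates its columns from left to right, each column read from bottom to top. -}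

module Defs where

open import Data.Bool using (Bool; true; false; not; _∧_; if_then_else_)
open import Data.Nat as ℕ using (ℕ; zero; suc; _+_; _*_; _∸_; _≤ᵇ_; _<ᵇ_; _≡ᵇ_; _⊓_; _⊔_; _≤_; _≥_; _<_)
open import Data.Integer as ℤ using (ℤ; +_; -[1+_]; -_)
open import Data.Fin using (Fin; toℕ; punchIn) renaming (zero to fzero; suc to fsuc)
open import Data.List using (List; []; _∷_; _++_; map; concatMap; length; upTo; allFin; lookup; foldr; foldl; reverse)
open import Relation.Binary.PropositionalEquality using (_≡_)
open import Data.Product using (_×_; _,_; proj₁; proj₂)

filterB : {A : Set} → (A → Bool) → List A → List A
filterB p [] = []
filterB p (x ∷ xs) = if p x then x ∷ filterB p xs else filterB p xs

allB : {A : Set} → (A → Bool) → List A → Bool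
allB p [] = true
allB p (x ∷ xs) = p x ∧ allB p xs

sumN : List ℕ → ℕ
sumN = foldr _+_ 0

range : ℕ → List ℕ
range n = map suc (upTo n)

-- 1-indexed lookup with default 0 (partitions padded by zeros)
nth : List ℕ → ℕ → ℕ
nth _ zero = 0
nth [] (suc _) = 0
nth (x ∷ xs) (suc zero) = x
nth (x ∷ xs) (suc (suc n)) = nth xs (suc n)

eqL : List ℕ → List ℕ → Bool
eqL [] [] = true
eqL (x ∷ xs) (y ∷ ys) = (x ≡ᵇ y) ∧ eqL xs ys
eqL _ _ = false

-- Λ = ℤ[t][h₁,h₂,…] : the h_d are algebraically independent generators,
-- so Λ is the polynomial ring over ℤ[t] in the h_d.  An element is a
-- finite formal sum of terms  c · t^e · h_{α₁} ⋯ h_{α_r}  (monomial α a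
-- weakly increasing list of positive integers), compared coefficientwise.

Mono : Set
Mono = List ℕ

Term : Set
Term = ℤ × ℕ × Mono

Poly : Set
Poly = List Term

insM : ℕ → Mono → Mono
insM x [] = x ∷ []
insM x (y ∷ ys) = if x ≤ᵇ y then x ∷ y ∷ ys else y ∷ insM x ys

mulM : Mono → Mono → Mono
mulM a b = foldr insM b a

zeroP : Poly
zeroP = []

oneP : Poly
oneP = (+ 1 , 0 , []) ∷ []

_+P_ : Poly → Poly → Poly
p +P q = p ++ q

negP : Poly → Poly
negP = map (λ { (c , e , m) → (- c , e , m) })

_*P_ : Poly → Poly → Poly
p *P q = concatMap (λ { (c , e , m) → map (λ { (c' , e' , m') → (c ℤ.* c' , e + e' , mulM m m') }) q }) p

sumP : List Poly → Poly
sumP = foldr _+P_ zeroP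

tpow : ℕ → Poly → Poly
tpow n = map (λ { (c , e , m) → (c , n + e , m) })

coeff : Poly → ℕ → Mono → ℤ
coeff p n α = foldr (λ { (c , e , m) acc → if (e ≡ᵇ n) ∧ eqL m α then c ℤ.+ acc else acc }) (+ 0) p

_≈_ : Poly → Poly → Set
p ≈ q = ∀ (n : ℕ) (α : Mono) → coeff p n α ≡ coeff q n α

infix 4 _≈_

hh : ℤ → Poly
hh (+ zero) = oneP
hh (+ suc d) = (+ 1 , 0 , suc d ∷ []) ∷ []
hh -[1+ _ ] = zeroP

sgn : ℕ → Poly → Poly
sgn zero p = p
sgn (suc zero) p = negP p
sgn (suc (suc n)) p = sgn n p

det : (n : ℕ) → (Fin n → Fin n → Poly) → Poly
det zero M = oneP
det (suc n) M =
  sumP (map (λ j → sgn (toℕ j) (M fzero j *P det n (λ r c → M (fsuc r) (punchIn j c))))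
            (allFin (suc n)))

sγ : List ℤ → Poly
sγ γ = det (length γ) (λ i j → hh ((lookup γ i ℤ.+ + toℕ j) ℤ.- + toℕ i))

-- Root ideals (as lists of pairs (i,j), 1 ≤ i < j ≤ ℓ) and Catalan functions

Δ⁺ : ℕ → List (ℕ × ℕ)
Δ⁺ ℓ = concatMap (λ i → map (λ j → (i , j)) (filterB (λ j → i <ᵇ j) (range ℓ))) (range ℓ)

Δᵏ : ℕ → List ℕ → List (ℕ × ℕ)
Δᵏ k μ = filterB (λ { (i , j) → ((k ∸ nth μ i) + i) <ᵇ j }) (Δ⁺ (length μ))

addAt : ℕ → ℤ → List ℤ → List ℤ
addAt _ z [] = []
addAt zero z xs = xs
addAt (suc zero) z (x ∷ xs) = (x ℤ.+ z) ∷ xs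
addAt (suc (suc i)) z (x ∷ xs) = x ∷ addAt (suc i) z xs

-- all maps m : Ψ → {0..N}, recorded as (Σ m , γ + Σ m_ij (ε_i - ε_j))
assign : ℕ → List (ℕ × ℕ) → List ℤ → List (ℕ × List ℤ)
assign N [] γ = (0 , γ) ∷ []
assign N ((i , j) ∷ Ψ) γ =
  concatMap (λ m → map (λ { (tot , β) → (m + tot , addAt i (+ m) (addAt j (- (+ m)) β)) })
                       (assign N Ψ γ))
            (upTo (suc N))

-- Truncation of H(Ψ;γ) = Σ_{m : Ψ → ℤ≥0} t^{Σm} s_{γ+Σ m_ij(ε_i-ε_j)}
-- to the maps with all values ≤ N.  (Only finitely many terms are nonzero,
-- so H(Ψ;γ) is the eventual value of HTr Ψ γ N as N → ∞.)
HTr : List (ℕ × ℕ) → List ℤ → ℕ → Poly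
HTr Ψ γ N = sumP (map (λ { (tot , β) → tpow tot (sγ β) }) (assign N Ψ γ))

kSchurTr : ℕ → List ℕ → ℕ → Poly
kSchurTr k lm N = HTr (Δᵏ k lm) (map +_ lm) N

Box : Set
Box = ℕ × ℕ    -- (row, column), 1-indexed

boxes : List ℕ → List Box
boxes lm = concatMap (λ r → map (λ c → (r , c)) (range (nth lm r))) (range (length lm))

conj : List ℕ → ℕ → ℕ
conj lm c = length (filterB (λ x → c ≤ᵇ x) lm)

hook : List ℕ → ℕ → ℕ → ℕ
hook lm r c = suc ((nth lm r ∸ c) + (conj lm c ∸ r))

isCoreᵇ : ℕ → List ℕ → Bool
isCoreᵇ m lm = allB (λ { (r , c) → not (hook lm r c ≡ᵇ m) }) (boxes lm)

nonzero : ℕ → Bool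
nonzero zero = false
nonzero (suc _) = true

-- 𝔭 : (k+1)-cores → Par^k
𝔭 : ℕ → List ℕ → List ℕ
𝔭 k κ = filterB nonzero
          (map (λ r → length (filterB (λ c → hook κ r c ≤ᵇ k) (range (nth κ r)))) (range (length κ)))

decreasingᵇ : List ℕ → Bool
decreasingᵇ [] = true
decreasingᵇ (x ∷ []) = true
decreasingᵇ (x ∷ y ∷ xs) = (y ≤ᵇ x) ∧ decreasingᵇ (y ∷ xs)

choices : List ℕ → List (List ℕ)
choices [] = [] ∷ []
choices (x ∷ xs) = concatMap (λ a → map (a ∷_) (choices xs)) (upTo (suc x))

-- all partitions contained in κ (each listed once, without zero parts)
subPartitions : List ℕ → List (List ℕ)
subPartitions κ = map (filterB nonzero) (filterB decreasingᵇ (choices κ))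

strongCovers : ℕ → List ℕ → List (List ℕ)
strongCovers k κ =
  filterB (λ τ → isCoreᵇ (suc k) τ ∧ (suc (sumN (𝔭 k τ)) ≡ᵇ sumN (𝔭 k κ))) (subPartitions κ)

skew : List ℕ → List ℕ → List Box
skew τ κ = filterB (λ { (r , c) → nth τ r <ᵇ c }) (boxes κ)

eqB : Box → Box → Bool
eqB (r , c) (r' , c') = (r ≡ᵇ r') ∧ (c ≡ᵇ c')

adjB : Box → Box → Bool
adjB (r , c) (r' , c') =
  ((r ≡ᵇ r') ∧ ((suc c ≡ᵇ c') Data.Bool.∨ (suc c' ≡ᵇ c))) Data.Bool.∨
  ((c ≡ᵇ c') ∧ ((suc r ≡ᵇ r') Data.Bool.∨ (suc r' ≡ᵇ r)))

anyB : {A : Set} → (A → Bool) → List A → Bool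
anyB p xs = not (allB (λ x → not (p x)) xs)

memB : List Box → Box → Bool
memB C b = anyB (eqB b) C

closeC : ℕ → List Box → List Box → List Box
closeC zero all' cur = cur
closeC (suc n) all' cur =
  closeC n all' (filterB (λ b → anyB (λ c → eqB b c Data.Bool.∨ adjB b c) cur) all')

compsF : ℕ → List Box → List (List Box)
compsF zero _ = []
compsF (suc f) [] = []
compsF (suc f) (b ∷ bs) =
  let C = closeC (length (b ∷ bs)) (b ∷ bs) (b ∷ [])
  in C ∷ compsF f (filterB (λ x → not (memB C x)) (b ∷ bs))

components : List Box → List (List Box)
components bs = compsF (length bs) bs

minRow : List Box → ℕ
minRow [] = 0
minRow ((r , _) ∷ bs) = foldr (λ x acc → proj₁ x ⊓ acc) r bs

maxRow : List Box → ℕ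
maxRow [] = 0
maxRow ((r , _) ∷ bs) = foldr (λ x acc → proj₁ x ⊔ acc) r bs

heightC : List Box → ℕ
heightC C = suc (maxRow C ∸ minRow C)

-- Strong marked covers τ ⇒ʳ κ with their spin: (τ , r , spin)

markedCovers : ℕ → List ℕ → List (List ℕ × ℕ × ℕ)
markedCovers k κ =
  concatMap (λ τ →
    let cs = components (skew τ κ) in
    map (λ C → (τ , minRow C ,
                length cs * (heightC C ∸ 1)
                + length (filterB (λ D → minRow C <ᵇ minRow D) cs)))
        cs)
  (strongCovers k κ)

-- Strong tableaux marked by w = w₁⋯w_m with outside core κ:
-- κ⁽⁰⁾ ⇒^{w_m} ⋯ ⇒^{w₁} κ⁽ᵐ⁾ = κ, recorded as (list of cores κ⁽⁰⁾…κ⁽ᵐ⁾, spin).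
SMT : ℕ → List ℕ → List ℕ → List (List (List ℕ) × ℕ)
SMT k [] κ = ((κ ∷ []) , 0) ∷ []
SMT k (w ∷ ws) κ =
  concatMap (λ { (τ , r , sp) →
      if r ≡ᵇ w
      then map (λ { (cs , s) → (cs ++ (κ ∷ []) , s + sp) }) (SMT k ws τ)
      else [] })
    (markedCovers k κ)

insideCore : List (List ℕ) → List ℕ
insideCore [] = []
insideCore (κ ∷ _) = κ

-- Strong Pieri operators on formal ℤ[t]-combinations of the basis
-- {s^(k)_λ}; a combination Σ t^n s^(k)_{𝔭(τ)} is a list of (n , τ)
-- with τ the (k+1)-core of the index (𝔭 is a bijection).

uOp : ℕ → ℕ → List (ℕ × List ℕ) → List (ℕ × List ℕ)
uOp k p comb =
  concatMap (λ { (n , κ) →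
     concatMap (λ { (τ , r , sp) → if r ≡ᵇ p then (n + sp , τ) ∷ [] else [] })
               (markedCovers k κ) })
    comb

uWord : ℕ → List ℕ → List (ℕ × List ℕ) → List (ℕ × List ℕ)
uWord k ws comb = foldl (λ acc p → uOp k p acc) comb ws

realizeTr : ℕ → ℕ → List (ℕ × List ℕ) → Poly
realizeTr k N comb = sumP (map (λ { (n , τ) → tpow n (kSchurTr k (𝔭 k τ) N) }) comb)

-- column reading word of the superstandard tableau of θ = k^ℓ / μ

creadingZ : ℕ → List ℕ → List ℕ
creadingZ k μ =
  concatMap (λ c → filterB (λ i → nth μ i <ᵇ c) (reverse (range (length μ)))) (range k)

replicateN : ℕ → ℕ → List ℕ
replicateN zero _ = []
replicateN (suc n) x = x ∷ replicateN n x

{-# OPTIONS --safe #-}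
-- Fix a monomial α and let S γ be its coefficient in s_γ, an antisymmetric functional of γ; then the
-- coefficients of H(Ψ;γ) form the t-series HL Ψ S γ.  Column c of Z_θ consists of the rows below the
-- i₀ rows of μ that reach it, and reading it turns 𝔰_κ into H(Δᵏ(ν); ν - 1) with 1 the indicator of
-- these rows: this is 𝔰_κ again for a translated S, which keeps its antisymmetry in the rows from i₀ on.
-- Peeling off the columns from the last one therefore leaves the root ideal of k^ℓ, which is Δ⁺, and
-- lowers its weight k^ℓ to μ.
-- A single letter p is a Pieri rule.  Write the Catalan function F_p of weight ν - ε_p - … as
-- Q_p + t F_{d p}, where (p , d p) is the removable root of row p.  Antisymmetry, climbed along the
-- chain p, d⁻¹ p, …, shows that Q_p is either zero or t^{c(h-1)} times the 𝔰 of the core obtained by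
-- removing the ribbons with a lowest component starting in row p, and the powers of t from the
-- recursion count the components below the marked one.  Combinatorially, strong covers of a
-- (k+1)-core are exactly these simultaneous removals of translated ribbons.
module Submission where

-- Everything is tied to one row map d with d r + ν r = k + 1 + r. It gives the first root column of
-- each row of Δᵏ(ν), and on the core it shifts beads by k + 1, so that κ r = ν r + κ (d r); hence
-- the Catalan functions and the ribbons can follow the same induction. The ring is replaced by an
-- integer functional S of which three things are known: it sees only the rows below ℓ, it is
-- antisymmetric from row i₀ on, and it vanishes on weights with a negative tail sum from a row ≥
-- i₀. Full antisymmetry is out of reach, since translating S by the indicator of a column breaks it
-- across rows i₀ - 1 and i₀. The rows above i₀ make up for this: they are full (ν = k), so d z = z
-- + 1 there and no exchange is ever made in them. On the combinatorial side the obstacle is that a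
-- strong cover is given only by containment and size. A lifting argument on beads puts every proper
-- subcore inside a swap, which forces covers to be swaps. The truncation bound ℓ·ℓ·k comes from the
-- statistic Σ (r + 1) γ_r, which every raising operator lowers.

open import Defs
open import Data.Bool using (Bool; true; false; T; not; _∧_; _∨_; if_then_else_)
open import Data.Bool.Properties using (∧-identityʳ; ∧-zeroʳ; ∨-zeroʳ)
open import Data.Empty using (⊥; ⊥-elim)
open import Data.Fin using (Fin; toℕ; punchIn) renaming (zero to fzero; suc to fsuc)
open import Data.Integer as ℤ using (ℤ; +_; -[1+_]; -_)
import Data.Integer.Properties as ℤP
import Data.Integer.Tactic.RingSolver as ℤS
open import Data.List using (List; []; _∷_; _++_; map; concatMap; length; upTo; applyUpTo; foldr; allFin; tabulate; lookup; reverse)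
open import Data.List.Membership.Propositional using (_∈_)
open import Data.List.Membership.Propositional.Properties using (∈-upTo⁺; ∈-upTo⁻; ∈-map⁺; ∈-map⁻; ∈-++⁻; ∈-++⁺ˡ; ∈-++⁺ʳ)
open import Data.List.Properties using (map-++; ++-assoc; upTo-∷ʳ; map-cong; length-map; length-upTo; length-++; ++-identityʳ; map-∘; map-cong-local; map-tabulate; tabulate-cong; map-upTo; concatMap-++; reverse-++)
open import Data.List.Relation.Binary.Permutation.Propositional using (_↭_; ↭-refl; ↭-trans; refl; prep; swap; trans)
open import Data.List.Relation.Binary.Permutation.Propositional.Properties using (++⁺; ++⁺ˡ; ++⁺ʳ; ++-comm; shift)
open import Data.List.Relation.Binary.Pointwise as Pw using (Pointwise; []; _∷_)
open import Data.List.Relation.Unary.All as All using (All; []; _∷_)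
open import Data.List.Relation.Unary.Any using (here; there)
open import Data.List.Relation.Unary.Linked using (Linked; []; [-]; _∷_)
open import Data.Nat as ℕ using (ℕ; zero; suc; _+_; _*_; _∸_; _≤ᵇ_; _<ᵇ_; _≡ᵇ_; _⊓_; _⊔_; _≤_; _≥_; _>_; _<_; z≤n; s≤s; _≤?_; _<?_; _≟_)
open import Data.Nat.Properties
open import Data.Product using (_×_; _,_; proj₁; proj₂; Σ; ∃)
open import Data.Sum using (_⊎_; inj₁; inj₂)
open import Data.Unit using (⊤; tt)
open import Relation.Binary.PropositionalEquality hiding (trans)
open import Relation.Binary.PropositionalEquality using () renaming (trans to infixr 5 _∙_)
open import Relation.Nullary using (yes; no; ¬_)

-- Linear arithmetic over ℕ by certificates (Farkas multipliers): a linear form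
-- is the list of its constant and coefficients, evaluated against 1 ∷ atoms.

data Ex : Set where
  va : ℕ → Ex
  li : ℕ → Ex
  su : Ex → Ex
  _⊕_ : Ex → Ex → Ex
  _⊛_ : ℕ → Ex → Ex

infixl 7 _⊕_
infixl 8 _⊛_
infix 6 _≼_ _≺_ _≛_

data Fm : Set where
  _≼_ _≛_ : Ex → Ex → Fm
  ff : Fm

_≺_ : Ex → Ex → Fm
a ≺ b = su a ≼ b

v0 v1 v2 v3 v4 v5 v6 v7 v8 v9 v10 v11 v12 v13 : Ex
v0 = va 0
v1 = va 1
v2 = va 2
v3 = va 3
v4 = va 4
v5 = va 5
v6 = va 6
v7 = va 7
v8 = va 8
v9 = va 9
v10 = va 10
v11 = va 11
v12 = va 12
v13 = va 13

atom : List ℕ → ℕ → ℕ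
atom [] _ = 0
atom (x ∷ xs) zero = x
atom (x ∷ xs) (suc i) = atom xs i

ev : List ℕ → Ex → ℕ
ev ρ (va i) = atom ρ i
ev ρ (li c) = c
ev ρ (su e) = suc (ev ρ e)
ev ρ (a ⊕ b) = ev ρ a + ev ρ b
ev ρ (c ⊛ e) = c * ev ρ e

⟦_⟧ : Fm → List ℕ → Set
⟦ a ≼ b ⟧ ρ = ev ρ a ≤ ev ρ b
⟦ a ≛ b ⟧ ρ = ev ρ a ≡ ev ρ b
⟦ ff ⟧ ρ = ⊥

dot : List ℕ → List ℕ → ℕ
dot _ [] = 0
dot [] (_ ∷ _) = 0
dot (x ∷ ρ) (c ∷ cs) = c * x + dot ρ cs

unit : ℕ → List ℕ
unit zero = 1 ∷ []
unit (suc i) = 0 ∷ unit i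

addL : List ℕ → List ℕ → List ℕ
addL [] b = b
addL (x ∷ a) [] = x ∷ a
addL (x ∷ a) (y ∷ b) = (x + y) ∷ addL a b

lin : Ex → List ℕ
lin (va i) = 0 ∷ unit i
lin (li c) = c ∷ []
lin (su e) = addL (1 ∷ []) (lin e)
lin (a ⊕ b) = addL (lin a) (lin b)
lin (c ⊛ e) = map (c *_) (lin e)

dot-unit : ∀ ρ i → dot ρ (unit i) ≡ atom ρ i
dot-unit [] zero = refl
dot-unit [] (suc i) = refl
dot-unit (x ∷ ρ) zero = +-identityʳ (x + 0) ∙ +-identityʳ x
dot-unit (x ∷ ρ) (suc i) = dot-unit ρ i

interchange : ∀ a b c d → (a + b) + (c + d) ≡ (a + c) + (b + d)
interchange a b c d = +-assoc a b (c + d)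
  ∙ cong (λ z → a + z) (sym (+-assoc b c d) ∙ cong (_+ d) (+-comm b c) ∙ +-assoc c b d) ∙ sym (+-assoc a c (b + d))

dot-add : ∀ ρ a b → dot ρ (addL a b) ≡ dot ρ a + dot ρ b
dot-add ρ [] b = refl
dot-add ρ (x ∷ a) [] = sym (+-identityʳ _)
dot-add [] (x ∷ a) (y ∷ b) = refl
dot-add (z ∷ ρ) (x ∷ a) (y ∷ b) =
  cong₂ _+_ (*-distribʳ-+ z x y) (dot-add ρ a b) ∙ interchange (x * z) (y * z) (dot ρ a) (dot ρ b)

dot-scale : ∀ ρ c a → dot ρ (map (c *_) a) ≡ c * dot ρ a
dot-scale ρ c [] = sym (*-zeroʳ c)
dot-scale [] c (x ∷ a) = sym (*-zeroʳ c)
dot-scale (z ∷ ρ) c (x ∷ a) =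
  cong₂ _+_ (*-assoc c x z) (dot-scale ρ c a) ∙ sym (*-distribˡ-+ c (x * z) (dot ρ a))

lin-ok : ∀ ρ e → dot (1 ∷ ρ) (lin e) ≡ ev ρ e
lin-ok ρ (va i) = dot-unit ρ i
lin-ok ρ (li c) = +-identityʳ _ ∙ *-identityʳ c
lin-ok ρ (su e) = dot-add (1 ∷ ρ) (1 ∷ []) (lin e) ∙ cong suc (lin-ok ρ e)
lin-ok ρ (a ⊕ b) = dot-add (1 ∷ ρ) (lin a) (lin b) ∙ cong₂ _+_ (lin-ok ρ a) (lin-ok ρ b)
lin-ok ρ (c ⊛ e) = dot-scale (1 ∷ ρ) c (lin e) ∙ cong (c *_) (lin-ok ρ e)

geL : List ℕ → List ℕ → Bool
geL a [] = true
geL [] (y ∷ b) = (y ≤ᵇ 0) ∧ geL [] b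
geL (x ∷ a) (y ∷ b) = (y ≤ᵇ x) ∧ geL a b

∧-split : ∀ {a b} → T (a ∧ b) → T a × T b
∧-split {true} t = tt , t

geL-ok : ∀ ρ a b → T (geL a b) → dot ρ b ≤ dot ρ a
geL-ok ρ a [] _ = z≤n
geL-ok [] a (y ∷ b) _ = z≤n
geL-ok (z ∷ ρ) [] (y ∷ b) t with ∧-split {y ≤ᵇ 0} t
... | p , q = +-mono-≤ (*-monoˡ-≤ z (≤ᵇ⇒≤ y 0 p)) (geL-ok ρ [] b q)
geL-ok (z ∷ ρ) (x ∷ a) (y ∷ b) t with ∧-split {y ≤ᵇ x} t
... | p , q = +-mono-≤ (*-monoˡ-≤ z (≤ᵇ⇒≤ y x p)) (geL-ok ρ a b q)

Ineqs : Set
Ineqs = List (Ex × Ex)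

-- An equation becomes two opposite inequalities, so in a certificate it takes two consecutive
-- multipliers.
ineqs : List Fm → Ineqs
ineqs [] = []
ineqs (a ≼ b ∷ hs) = (a , b) ∷ ineqs hs
ineqs (a ≛ b ∷ hs) = (a , b) ∷ (b , a) ∷ ineqs hs
ineqs (ff ∷ hs) = ineqs hs

comb : List ℕ → Ineqs → List ℕ × List ℕ
comb (c ∷ cs) ((a , b) ∷ rs) =
  addL (map (c *_) (lin a)) (proj₁ (comb cs rs)) , addL (map (c *_) (lin b)) (proj₂ (comb cs rs))
comb _ _ = [] , []

Holds : List ℕ → Ineqs → Set
Holds ρ [] = ⊤
Holds ρ ((a , b) ∷ rs) = (ev ρ a ≤ ev ρ b) × Holds ρ rs

comb-ok : ∀ ρ cs rs → Holds ρ rs → dot (1 ∷ ρ) (proj₁ (comb cs rs)) ≤ dot (1 ∷ ρ) (proj₂ (comb cs rs))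
comb-ok ρ [] rs _ = z≤n
comb-ok ρ (c ∷ cs) [] _ = z≤n
comb-ok ρ (c ∷ cs) ((a , b) ∷ rs) (h , hs) = subst₂ _≤_ (sym (side a _)) (sym (side b _))
  (+-mono-≤ (*-monoʳ-≤ c h) (comb-ok ρ cs rs hs))
  where
  side : ∀ e r → dot (1 ∷ ρ) (addL (map (c *_) (lin e)) r) ≡ c * ev ρ e + dot (1 ∷ ρ) r
  side e r = dot-add (1 ∷ ρ) (map (c *_) (lin e)) r
    ∙ cong (_+ dot (1 ∷ ρ) r) (dot-scale (1 ∷ ρ) c (lin e) ∙ cong (c *_) (lin-ok ρ e))

-- The weighted sum of the inequalities reads left ≤ right, while coefficientwise left ≥ 1 + right.
-- Atoms are natural numbers, so the coefficientwise comparison survives evaluation and contradicts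
-- the sum.
refutes : List ℕ → Ineqs → Bool
refutes cs rs = geL (proj₁ (comb cs rs)) (addL (1 ∷ []) (proj₂ (comb cs rs)))

refutes-ok : ∀ ρ cs rs → T (refutes cs rs) → Holds ρ rs → ⊥
refutes-ok ρ cs rs t h = <-irrefl refl (≤-trans
  (subst (_≤ dot (1 ∷ ρ) (proj₁ (comb cs rs))) (dot-add (1 ∷ ρ) (1 ∷ []) (proj₂ (comb cs rs)))
    (geL-ok (1 ∷ ρ) (proj₁ (comb cs rs)) (addL (1 ∷ []) (proj₂ (comb cs rs))) t))
  (comb-ok ρ cs rs h))

_⟶_ : List Fm → Fm → List ℕ → Set
([] ⟶ g) ρ = ⟦ g ⟧ ρ
((h ∷ hs) ⟶ g) ρ = ⟦ h ⟧ ρ → (hs ⟶ g) ρ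

-- The negated goal is put in front of the hypotheses, so the first multiplier of a certificate
-- belongs to it. An equation as goal needs one certificate for each direction.
valid : List Fm → Fm → List ℕ × List ℕ → Bool
valid hs (a ≼ b) (cs , _) = refutes cs ((su b , a) ∷ ineqs hs)
valid hs (a ≛ b) (cs , ds) = refutes cs ((su b , a) ∷ ineqs hs) ∧ refutes ds ((su a , b) ∷ ineqs hs)
valid hs ff (cs , _) = refutes cs (ineqs hs)

≤-by : ∀ ρ cs a b rs → T (refutes cs ((su b , a) ∷ rs)) → Holds ρ rs → ev ρ a ≤ ev ρ b
≤-by ρ cs a b rs t h with ev ρ a ≤? ev ρ b
... | yes p = p
... | no ¬p = ⊥-elim (refutes-ok ρ cs _ t (≰⇒> ¬p , h))

conclude : ∀ ρ hs g c → T (valid hs g c) → Holds ρ (ineqs hs) → ⟦ g ⟧ ρ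
conclude ρ hs (a ≼ b) (cs , _) t h = ≤-by ρ cs a b _ t h
conclude ρ hs (a ≛ b) (cs , ds) t h with ∧-split {refutes cs ((su b , a) ∷ ineqs hs)} t
... | p , q = ≤-antisym (≤-by ρ cs a b _ p h) (≤-by ρ ds b a _ q h)
conclude ρ hs ff (cs , _) t h = refutes-ok ρ cs _ t h

intro : ∀ ρ hs g → (Holds ρ (ineqs hs) → ⟦ g ⟧ ρ) → (hs ⟶ g) ρ
intro ρ [] g f = f tt
intro ρ (a ≼ b ∷ hs) g f h = intro ρ hs g (λ r → f (h , r))
intro ρ (a ≛ b ∷ hs) g f h = intro ρ hs g (λ r → f (≤-reflexive h , ≤-reflexive (sym h) , r))
intro ρ (ff ∷ hs) g f h = ⊥-elim h

-- The implicit argument is the truth of a closed Boolean, so a correct certificate is accepted by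
-- mere evaluation.
lia : ∀ ρ hs g c → {_ : T (valid hs g c)} → (hs ⟶ g) ρ
lia ρ hs g c {t} = intro ρ hs g (conclude ρ hs g c t)

-- Root ideals and antisymmetric functionals

W : Set
W = ℕ → ℤ

Root : Set
Root = ℕ × ℕ

Ser : Set
Ser = ℕ → ℤ

sh : Ser → Ser
sh f zero = + 0
sh f (suc n) = f n

sh-cong : ∀ {f g : Ser} → (∀ n → f n ≡ g n) → ∀ n → sh f n ≡ sh g n
sh-cong p zero = refl
sh-cong p (suc n) = p n

ι : ℕ → ℕ → ℕ
ι r i = if r ≡ᵇ i then 1 else 0

≡ᵇ-refl : ∀ r → (r ≡ᵇ r) ≡ true
≡ᵇ-refl zero = refl
≡ᵇ-refl (suc r) = ≡ᵇ-refl r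

≡ᵇ-no : ∀ r i → r ≢ i → (r ≡ᵇ i) ≡ false
≡ᵇ-no zero zero p = ⊥-elim (p refl)
≡ᵇ-no zero (suc i) p = refl
≡ᵇ-no (suc r) zero p = refl
≡ᵇ-no (suc r) (suc i) p = ≡ᵇ-no r i (λ q → p (cong suc q))

ι-eq : ∀ r → ι r r ≡ 1
ι-eq r rewrite ≡ᵇ-refl r = refl

ι-no : ∀ r i → r ≢ i → ι r i ≡ 0
ι-no r i p rewrite ≡ᵇ-no r i p = refl

rt : Root → W
rt (i , j) r = + ι r i ℤ.- + ι r j

R : Root → W → W
R δ γ r = γ r ℤ.+ rt δ r

inv : Root → (W → Ser) → W → Ser
inv δ f γ zero = f γ zero
inv δ f γ (suc n) = f γ (suc n) ℤ.+ inv δ f (R δ γ) n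

-- As a power series in t the infinite sum over exponents is harmless: only total exponents up to n
-- reach degree n. Its comparison with the truncated sums of the statement is postponed to `Cut-HL`.
HL : List Root → (W → ℤ) → W → Ser
HL [] S γ zero = S γ
HL [] S γ (suc n) = + 0
HL (δ ∷ Ψ) S = inv δ (HL Ψ S)

-- Weights are functions on all of ℕ but only their first ℓ values count; all equalities of weights
-- are taken in this pointwise sense, which also replaces function extensionality.
Agree : ℕ → W → W → Set
Agree ℓ γ γ' = ∀ r → r < ℓ → γ r ≡ γ' r

R-cong : ∀ {ℓ} δ {γ γ'} → Agree ℓ γ γ' → Agree ℓ (R δ γ) (R δ γ')
R-cong δ p r q = cong (ℤ._+ rt δ r) (p r q)

x+y+z : ∀ x y z → (x ℤ.+ y) ℤ.+ z ≡ (x ℤ.+ z) ℤ.+ y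
x+y+z = ℤS.solve-∀

R-comm : ∀ a b γ r → R a (R b γ) r ≡ R b (R a γ) r
R-comm a b γ r = x+y+z (γ r) (rt b r) (rt a r)

Respects : ℕ → (W → Ser) → Set
Respects ℓ f = ∀ {γ γ'} → Agree ℓ γ γ' → ∀ n → f γ n ≡ f γ' n

inv-resp : ∀ {ℓ} δ {f} → Respects ℓ f → Respects ℓ (inv δ f)
inv-resp δ h p zero = h p zero
inv-resp δ h p (suc n) = cong₂ ℤ._+_ (h p (suc n)) (inv-resp δ h (R-cong δ p) n)

inv-cong : ∀ δ {f g : W → Ser} → (∀ γ n → f γ n ≡ g γ n) → ∀ γ n → inv δ f γ n ≡ inv δ g γ n
inv-cong δ h γ zero = h γ zero
inv-cong δ h γ (suc n) = cong₂ ℤ._+_ (h γ (suc n)) (inv-cong δ h (R δ γ) n)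

-- Both sides are the coefficient of (1 - tR_a)⁻¹(1 - tR_b)⁻¹: unfold one step on each side.
inv-comm : ∀ {ℓ} a b {f} → Respects ℓ f → ∀ γ n → inv a (inv b f) γ n ≡ inv b (inv a f) γ n
inv-comm a b h γ zero = refl
inv-comm a b {f} h γ (suc zero) = x+y+z (f γ 1) (f (R b γ) 0) (f (R a γ) 0)
inv-comm {ℓ} a b {f} h γ (suc (suc m)) =
  cong (λ x → inv b f γ (suc (suc m)) ℤ.+ x) (inv-comm a b h (R a γ) (suc m))
  ∙ rearr (f γ (suc (suc m))) (inv b f (R b γ) (suc m)) (inv a f (R a γ) (suc m)) _
  ∙ cong (λ x → inv a f γ (suc (suc m)) ℤ.+ (inv b f (R b γ) (suc m) ℤ.+ x))
      (sym (inv-comm a b h (R b (R a γ)) m)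
       ∙ inv-resp {ℓ} a (inv-resp b h) (λ r _ → R-comm b a γ r) m)
  ∙ cong (λ x → inv a f γ (suc (suc m)) ℤ.+ x) (inv-comm a b h (R b γ) (suc m))
  where
  rearr : ∀ p q r s → (p ℤ.+ q) ℤ.+ (r ℤ.+ s) ≡ (p ℤ.+ r) ℤ.+ (q ℤ.+ s)
  rearr = ℤS.solve-∀

Local : ℕ → (W → ℤ) → Set
Local ℓ S = ∀ {γ γ'} → Agree ℓ γ γ' → S γ ≡ S γ'

HL-resp : ∀ {ℓ S} → Local ℓ S → ∀ Ψ → Respects ℓ (HL Ψ S)
HL-resp h [] p zero = h p
HL-resp h [] p (suc n) = refl
HL-resp h (δ ∷ Ψ) = inv-resp δ (HL-resp h Ψ)

-- The operators commute, so any root can be brought to the front before it is peeled off.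
HL-↭ : ∀ {ℓ S} → Local ℓ S → ∀ {Ψ Ψ'} → Ψ ↭ Ψ' → ∀ γ n → HL Ψ S γ n ≡ HL Ψ' S γ n
HL-↭ h refl γ n = refl
HL-↭ h (prep δ p) γ n = inv-cong δ (HL-↭ h p) γ n
HL-↭ h (swap {xs} a b p) γ n =
  inv-comm a b (HL-resp h xs) γ n ∙ inv-cong b (inv-cong a (HL-↭ h p)) γ n
HL-↭ h (trans p q) γ n = HL-↭ h p γ n ∙ HL-↭ h q γ n

-- Raising operators commute with translations of weights. This is what allows a box subtracted from
-- the weight to be hidden in the functional.
HL-translate : ∀ {ℓ S} → Local ℓ S → (ω : W) → ∀ Ψ γ n →
  HL Ψ (λ β → S (λ r → β r ℤ.- ω r)) γ n ≡ HL Ψ S (λ r → γ r ℤ.- ω r) n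
HL-translate h ω [] γ zero = refl
HL-translate h ω [] γ (suc n) = refl
HL-translate h ω (δ ∷ Ψ) γ zero = HL-translate h ω Ψ γ zero
HL-translate h ω (δ ∷ Ψ) γ (suc n) = cong₂ ℤ._+_ (HL-translate h ω Ψ γ (suc n))
  (HL-translate h ω (δ ∷ Ψ) (R δ γ) n
   ∙ HL-resp h (δ ∷ Ψ) (λ r _ → x+y+z (γ r) (rt δ r) (- ω r)) n)

swi : ℕ → ℕ → ℕ
swi z r = if r ≡ᵇ z then suc z else (if r ≡ᵇ suc z then z else r)

swi-z : ∀ z → swi z z ≡ suc z
swi-z z rewrite ≡ᵇ-refl z = refl

swi-sz : ∀ z → swi z (suc z) ≡ z
swi-sz z rewrite ≡ᵇ-no (suc z) z (λ ()) | ≡ᵇ-refl z = refl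

swi-other : ∀ z r → r ≢ z → r ≢ suc z → swi z r ≡ r
swi-other z r p q rewrite ≡ᵇ-no r z p | ≡ᵇ-no r (suc z) q = refl

data Pos (z r : ℕ) : Set where
  at-z : r ≡ z → Pos z r
  at-sz : r ≡ suc z → Pos z r
  off : r ≢ z → r ≢ suc z → Pos z r

pos : ∀ z r → Pos z r
pos z r with r ≟ z | r ≟ suc z
... | yes p | _ = at-z p
... | no p | yes q = at-sz q
... | no p | no q = off p q

swi-invol : ∀ z r → swi z (swi z r) ≡ r
swi-invol z r with pos z r
... | at-z refl = cong (swi z) (swi-z z) ∙ swi-sz z
... | at-sz refl = cong (swi z) (swi-sz z) ∙ swi-z z
... | off p q = cong (swi z) (swi-other z r p q) ∙ swi-other z r p q

ι-swi : ∀ z r i → ι (swi z r) (swi z i) ≡ ι r i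
ι-swi z r i with r ≟ i
... | yes refl = ι-eq (swi z r) ∙ sym (ι-eq r)
... | no p = ι-no (swi z r) (swi z i) (λ q → p (sym (swi-invol z r) ∙ cong (swi z) q ∙ swi-invol z i)) ∙ sym (ι-no r i p)

-- The action on weights of exchanging rows z and z+1 of the Jacobi–Trudi determinant.
sw : ℕ → W → W
sw z γ r = γ (swi z r) ℤ.+ rt (suc z , z) r

swr : ℕ → Root → Root
swr z (i , j) = swi z i , swi z j

R-sw : ∀ z δ γ r → R δ (sw z γ) r ≡ sw z (R (swr z δ) γ) r
R-sw z (i , j) γ r
  rewrite sym (ι-swi z r i) | sym (ι-swi z r j) = x+y+z (γ (swi z r)) _ _

AntiAt : (W → ℤ) → ℕ → Set
AntiAt S z = ∀ γ → S (sw z γ) ≡ - S γ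

-- Exchanging two rows conjugates each raising operator into the one of the relabelled root; the
-- sign comes from S alone.
HL-sw : ∀ {ℓ S z} → Local ℓ S → AntiAt S z → ∀ Ψ γ n → HL Ψ S (sw z γ) n ≡ - HL (map (swr z) Ψ) S γ n
HL-sw h a [] γ zero = a γ
HL-sw h a [] γ (suc n) = refl
HL-sw h a (δ ∷ Ψ) γ zero = HL-sw h a Ψ γ zero
HL-sw {ℓ} {S} {z} h a (δ ∷ Ψ) γ (suc n) =
  cong₂ ℤ._+_ (HL-sw h a Ψ γ (suc n))
    (HL-resp h (δ ∷ Ψ) (λ r _ → R-sw z δ γ r) n ∙ HL-sw h a (δ ∷ Ψ) (R (swr z δ) γ) n)
  ∙ sym (ℤP.neg-distrib-+ (HL (map (swr z) Ψ) S γ (suc n)) _)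

cat : ∀ {A : Set} → ℕ → (ℕ → List A) → List A
cat zero f = []
cat (suc n) f = cat n f ++ f n

cat-cong : ∀ {A : Set} n {f g : ℕ → List A} → (∀ i → i < n → f i ↭ g i) → cat n f ↭ cat n g
cat-cong zero h = ↭-refl
cat-cong (suc n) h = ++⁺ (cat-cong n (λ i p → h i (<-trans p (n<1+n n)))) (h n (n<1+n n))

map-cat : ∀ {A B : Set} (h : A → B) n f → map h (cat n f) ≡ cat n (λ i → map h (f i))
map-cat h zero f = refl
map-cat h (suc n) f = map-++ h (cat n f) (f n) ∙ cong (_++ map h (f n)) (map-cat h n f)

cat-swi : ∀ {A : Set} z n (f : ℕ → List A) → suc z < n → cat n (λ i → f (swi z i)) ↭ cat n f
cat-swi z (suc n) f p with n ≟ suc z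
... | yes refl = ↭-trans (++⁺ (++⁺ (cat-cong z (λ i q → ≡⇒ (cong f (swi-other z i
                     (λ e → (lia (i ∷ z ∷ []) (v0 ≺ v1 ∷ v0 ≛ v1 ∷ []) (ff) ((1 ∷ 0 ∷ 1 ∷ []) , [])) q e) (λ e → (lia (i ∷ z ∷ []) (v0 ≺ v1 ∷ v0 ≛ su v1 ∷ []) (ff) ((1 ∷ 0 ∷ 1 ∷ []) , [])) q e)))))
                     (≡⇒ (cong f (swi-z z)))) (≡⇒ (cong f (swi-sz z))))
                   (reord (cat z f) (f (suc z)) (f z))
  where
  ≡⇒ : ∀ {a b : List _} → a ≡ b → a ↭ b
  ≡⇒ refl = ↭-refl
  reord : ∀ (a b c : List _) → (a ++ b) ++ c ↭ (a ++ c) ++ b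
  reord a b c rewrite ++-assoc a b c | ++-assoc a c b = ++⁺ˡ a (++-comm b c)
... | no q rewrite swi-other z n (λ e → (lia (z ∷ n ∷ []) (su v0 ≺ su v1 ∷ v1 ≛ v0 ∷ []) (ff) ((1 ∷ 1 ∷ []) , [])) p e) q =
  ++⁺ʳ (f n) (cat-swi z n f (≤∧≢⇒< (ℕ.s≤s⁻¹ p) (λ e → q (sym e))))

cat-remove : ∀ {A : Set} n (f g : ℕ → List A) x i → i < n → f i ↭ x ∷ g i → (∀ j → j < n → j ≢ i → f j ↭ g j) →
  cat n f ↭ x ∷ cat n g
cat-remove (suc n) f g x i p h k with i ≟ n
... | yes refl = ↭-trans (++⁺ (cat-cong n (λ j q → k j (<-trans q (n<1+n n)) (<⇒≢ q))) h)
                         (shift x (cat n g) (g n))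
... | no q = ++⁺ (cat-remove n f g x i (≤∧≢⇒< (ℕ.s≤s⁻¹ p) q) h (λ j r → k j (<-trans r (n<1+n n))))
                 (k n (n<1+n n) (λ e → q (sym e)))

opt : Bool → Root → List Root
opt b δ = if b then δ ∷ [] else []

rowR : ℕ → (ℕ → ℕ) → ℕ → List Root
rowR ℓ e i = cat ℓ (λ j → opt (e i ≤ᵇ j) (i , j))

-- A root ideal is stored by the first column of each row; a start at or beyond ℓ is an empty row.
-- Removing the first root of a row is then an increment of one value of e.
roots : ℕ → (ℕ → ℕ) → List Root
roots ℓ e = cat ℓ (rowR ℓ e)

inc : ℕ → (ℕ → ℕ) → ℕ → ℕ
inc w e r = ι r w + e r

inc-eq : ∀ w e → inc w e w ≡ suc (e w)
inc-eq w e rewrite ι-eq w = refl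

inc-no : ∀ w e r → r ≢ w → inc w e r ≡ e r
inc-no w e r p rewrite ι-no r w p = refl

≤ᵇ-yes : ∀ {a b} → a ≤ b → (a ≤ᵇ b) ≡ true
≤ᵇ-yes {a} {b} p with a ≤ᵇ b in eq
... | true = refl
... | false = ⊥-elim (subst T eq (≤⇒≤ᵇ p))

≤ᵇ-no : ∀ {a b} → b < a → (a ≤ᵇ b) ≡ false
≤ᵇ-no {a} {b} p with a ≤ᵇ b in eq
... | false = refl
... | true = ⊥-elim (<⇒≱ p (≤ᵇ⇒≤ a b (subst T (sym eq) _)))

≤ᵇ-iff : ∀ {a b c d} → (a ≤ b → c ≤ d) → (c ≤ d → a ≤ b) → (a ≤ᵇ b) ≡ (c ≤ᵇ d)
≤ᵇ-iff {a} {b} f g with a ≤? b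
... | yes p = ≤ᵇ-yes p ∙ sym (≤ᵇ-yes (f p))
... | no p = ≤ᵇ-no (≰⇒> p) ∙ sym (≤ᵇ-no (≰⇒> (λ q → p (g q))))

reflexive : ∀ {A : Set} {a b : List A} → a ≡ b → a ↭ b
reflexive refl = ↭-refl

roots-cong : ∀ ℓ {e e'} → (∀ r → r < ℓ → e r ≡ e' r) → roots ℓ e ↭ roots ℓ e'
roots-cong ℓ h = cat-cong ℓ (λ i p → cat-cong ℓ (λ j _ → reflexive (cong (λ x → opt (x ≤ᵇ j) (i , j)) (h i p))))

roots-remove : ∀ ℓ e r → r < ℓ → e r < ℓ → roots ℓ e ↭ (r , e r) ∷ roots ℓ (inc r e)
roots-remove ℓ e r p q = cat-remove ℓ _ _ (r , e r) r p
  (cat-remove ℓ _ _ (r , e r) (e r) q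
    (reflexive (cong (λ b → opt b (r , e r)) (≤ᵇ-yes {e r} ≤-refl)
      ∙ cong (λ b → (r , e r) ∷ opt b (r , e r)) (sym (≤ᵇ-no (subst (e r <_) (sym (inc-eq r e)) (n<1+n (e r)))))))
    (λ j _ ne → reflexive (cong (λ b → opt b (r , j)) (≤ᵇ-iff
      (λ s → subst (_≤ j) (sym (inc-eq r e)) (≤∧≢⇒< s (λ x → ne (sym x))))
      (λ s → ≤-trans (n≤1+n (e r)) (subst (_≤ j) (inc-eq r e) s))))))
  (λ i _ ne → cat-cong ℓ (λ j _ → reflexive (cong (λ x → opt (x ≤ᵇ j) (i , j)) (sym (inc-no r e i ne)))))

roots-out : ∀ ℓ e r → ℓ ≤ e r → roots ℓ e ↭ roots ℓ (inc r e)
roots-out ℓ e r q = cat-cong ℓ (λ i _ → cat-cong ℓ (λ j p → reflexive (cong (λ b → opt b (i , j)) (same i j p))))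
  where
  same : ∀ i j → j < ℓ → (e i ≤ᵇ j) ≡ (inc r e i ≤ᵇ j)
  same i j p with i ≟ r
  ... | yes refl = ≤ᵇ-no (<-≤-trans p q) ∙ sym (≤ᵇ-no (subst (j <_) (sym (inc-eq i e)) (m≤n⇒m≤1+n (<-≤-trans p q))))
  ... | no ne = cong (_≤ᵇ j) (sym (inc-no r e i ne))

Free : ℕ → (ℕ → ℕ) → ℕ → Set
Free ℓ e z = ∀ r → r < ℓ → e r ≢ z

map-opt : ∀ (f : Root → Root) b δ → map f (opt b δ) ≡ opt b (f δ)
map-opt f false δ = refl
map-opt f true δ = refl

-- Equal starts make the rows z and z + 1 interchangeable. Since no row starts at z + 1, every row
-- has roots in both of the columns z and z + 1 or in neither, so the columns are interchangeable
-- too.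
roots-sw : ∀ ℓ e z → suc z < ℓ → e z ≡ e (suc z) → Free ℓ e (suc z) → map (swr z) (roots ℓ e) ↭ roots ℓ e
roots-sw ℓ e z p q fr = ↭-trans (reflexive (map-cat (swr z) ℓ _))
  (↭-trans (cat-cong ℓ (λ i r → ↭-trans (reflexive (map-cat (swr z) ℓ _))
      (↭-trans (cat-cong ℓ (λ j _ → reflexive (entry i j r)))
        (cat-swi z ℓ (λ j → opt (e (swi z i) ≤ᵇ j) (swi z i , j)) p))))
    (cat-swi z ℓ (rowR ℓ e) p))
  where
  e-swi : ∀ i → e (swi z i) ≡ e i
  e-swi i with pos z i
  ... | at-z refl = cong e (swi-z z) ∙ sym q
  ... | at-sz refl = cong e (swi-sz z) ∙ q
  ... | off a b = cong e (swi-other z i a b)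
  le : ∀ x j → x ≢ suc z → x ≤ j → x ≤ swi z j
  le x j ne h with pos z j
  ... | at-z refl rewrite swi-z z = m≤n⇒m≤1+n h
  ... | at-sz refl rewrite swi-sz z = ℕ.s≤s⁻¹ (≤∧≢⇒< h ne)
  ... | off a b rewrite swi-other z j a b = h
  entry : ∀ i j → i < ℓ → map (swr z) (opt (e i ≤ᵇ j) (i , j)) ≡ opt (e (swi z i) ≤ᵇ swi z j) (swi z i , swi z j)
  entry i j r = map-opt (swr z) (e i ≤ᵇ j) (i , j) ∙ cong (λ b → opt b (swi z i , swi z j))
    (cong (_≤ᵇ j) (sym (e-swi i)) ∙ ≤ᵇ-iff (le _ j ne)
       (λ h → subst (e (swi z i) ≤_) (swi-invol z j) (le _ (swi z j) ne h)))
    where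
    ne : e (swi z i) ≢ suc z
    ne x = fr i r (sym (e-swi i) ∙ x)

module Catalan (ℓ : ℕ) (S : W → ℤ) (loc : Local ℓ S) where

  H : (ℕ → ℕ) → W → Ser
  H e = HL (roots ℓ e) S

  H-cong : ∀ {e e' γ γ'} → (∀ r → r < ℓ → e r ≡ e' r) → Agree ℓ γ γ' → ∀ n → H e γ n ≡ H e' γ' n
  H-cong {e} p q n = HL-resp loc (roots ℓ e) q n ∙ HL-↭ loc (roots-cong ℓ p) _ n

  -- This is (1 - tR)⁻¹ = 1 + tR (1 - tR)⁻¹ for the first root of row r.
  H-remove : ∀ e r γ → r < ℓ → e r < ℓ → ∀ n →
    H e γ n ≡ H (inc r e) γ n ℤ.+ sh (H e (R (r , e r) γ)) n
  H-remove e r γ p q zero = HL-↭ loc (roots-remove ℓ e r p q) γ 0 ∙ sym (ℤP.+-identityʳ _)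
  H-remove e r γ p q (suc n) = HL-↭ loc (roots-remove ℓ e r p q) γ (suc n)
    ∙ cong (λ x → H (inc r e) γ (suc n) ℤ.+ x) (sym (HL-↭ loc (roots-remove ℓ e r p q) (R (r , e r) γ) n))

  H-out : ∀ e r γ → ℓ ≤ e r → ∀ n → H e γ n ≡ H (inc r e) γ n
  H-out e r γ q n = HL-↭ loc (roots-out ℓ e r q) γ n

  H-anti : ∀ e z γ → suc z < ℓ → AntiAt S z → e z ≡ e (suc z) → Free ℓ e (suc z) →
    ∀ n → H e (sw z γ) n ≡ - H e γ n
  H-anti e z γ p a q fr n = HL-sw loc a (roots ℓ e) γ n ∙ cong -_ (HL-↭ loc (roots-sw ℓ e z p q fr) γ n)

  x≡-x : ∀ x → x ≡ - x → x ≡ + 0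
  x≡-x (+ zero) _ = refl
  x≡-x (+ suc n) ()
  x≡-x -[1+ n ] ()

  q₁ : ∀ x → (+ 1 ℤ.+ x) ℤ.+ (+ 0 ℤ.- + 1) ≡ x
  q₁ = ℤS.solve-∀

  q₂ : ∀ x → x ℤ.+ (+ 1 ℤ.- + 0) ≡ + 1 ℤ.+ x
  q₂ = ℤS.solve-∀

  sw-fix : ∀ z γ → γ (suc z) ≡ + 1 ℤ.+ γ z → ∀ r → sw z γ r ≡ γ r
  sw-fix z γ h r with pos z r
  ... | at-z refl rewrite swi-z z | ι-no z (suc z) (<⇒≢ (n<1+n z)) | ι-eq z | h = q₁ (γ z)
  ... | at-sz refl rewrite swi-sz z | ι-eq z | ι-no (suc z) z (λ ()) | h = q₂ (γ z)
  ... | off a b rewrite swi-other z r a b | ι-no r z a | ι-no r (suc z) b = ℤP.+-identityʳ (γ r)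

  -- The weight is a fixed point of the exchange of rows z and z + 1, so the function equals its own
  -- negative.
  H-vanish : ∀ e z γ → suc z < ℓ → AntiAt S z → e z ≡ e (suc z) → Free ℓ e (suc z) →
    γ (suc z) ≡ + 1 ℤ.+ γ z → ∀ n → H e γ n ≡ + 0
  H-vanish e z γ p a q fr h n = x≡-x _
    (H-cong {e} (λ _ _ → refl) (λ r _ → sym (sw-fix z γ h r)) n ∙ H-anti e z γ p a q fr n)

  -- With the root (w , z) present the function vanishes, so removing that root leaves minus its
  -- extra term. The exchange at z carries the weight of that term from (w , z) to (w , z + 1) and
  -- absorbs the sign.
  H-mirror : ∀ e z w γ → suc z < ℓ → AntiAt S z → e z ≡ e (suc z) → Free ℓ e (suc z) →
    γ (suc z) ≡ + 1 ℤ.+ γ z → w < ℓ → e w ≡ z → w ≢ z → w ≢ suc z →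
    ∀ n → H (inc w e) γ n ≡ sh (H e (R (w , suc z) γ)) n
  H-mirror e z w γ p a q fr h wl ew w≢z w≢sz n =
    move (H-remove e w γ wl (subst (_< ℓ) (sym ew) (<-trans (n<1+n z) p)) n)
    where
    q₃ : ∀ x → ((+ 1 ℤ.+ x) ℤ.+ (+ 0 ℤ.- + 0)) ℤ.+ (+ 0 ℤ.- + 1) ≡ x ℤ.+ (+ 0 ℤ.- + 0)
    q₃ = ℤS.solve-∀
    q₄ : ∀ x → (x ℤ.+ (+ 0 ℤ.- + 1)) ℤ.+ (+ 1 ℤ.- + 0) ≡ (+ 1 ℤ.+ x) ℤ.+ (+ 0 ℤ.- + 1)
    q₄ = ℤS.solve-∀
    R-swap : ∀ r → sw z (R (w , z) γ) r ≡ R (w , suc z) γ r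
    R-swap r with pos z r
    ... | at-z refl rewrite swi-z z | ι-no z (suc z) (<⇒≢ (n<1+n z)) | ι-eq z | h
                          | ι-no z w (λ x → w≢z (sym x)) | ι-no (suc z) w (λ x → w≢sz (sym x)) | ι-no (suc z) z (λ ())
                          = q₃ (γ z)
    ... | at-sz refl rewrite swi-sz z | ι-eq z | ι-no (suc z) z (λ ()) | h
                          | ι-no z w (λ x → w≢z (sym x)) | ι-no (suc z) w (λ x → w≢sz (sym x))
                          = q₄ (γ z)
    ... | off b c rewrite swi-other z r b c | ι-no r z b | ι-no r (suc z) c = ℤP.+-identityʳ _
    step : ∀ m → H e (R (w , e w) γ) m ≡ - H e (R (w , suc z) γ) m
    step m rewrite ew = sym (ℤP.neg-involutive _) ∙ cong -_ (sym (H-anti e z (R (w , z) γ) p a q fr m)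
      ∙ H-cong {e} (λ _ _ → refl) (λ r _ → R-swap r) m)
    sh-neg : ∀ m → sh (λ i → - H e (R (w , suc z) γ) i) m ≡ - sh (H e (R (w , suc z) γ)) m
    sh-neg zero = refl
    sh-neg (suc m) = refl
    solveFor : ∀ x y → + 0 ≡ x ℤ.- y → x ≡ y
    solveFor x y k = sym (ring x y) ∙ cong (ℤ._+ y) (sym k) ∙ ℤP.+-identityˡ y
      where
      ring : ∀ x y → (x ℤ.- y) ℤ.+ y ≡ x
      ring = ℤS.solve-∀
    move : H e γ n ≡ H (inc w e) γ n ℤ.+ sh (H e (R (w , e w) γ)) n → H (inc w e) γ n ≡ sh (H e (R (w , suc z) γ)) n
    move k = solveFor _ _ (sym (H-vanish e z γ p a q fr h n) ∙ k
      ∙ cong (λ x → H (inc w e) γ n ℤ.+ x) (sh-cong step n ∙ sh-neg n))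

-- Climbing a chain of linked pairs of rows

shN : ℕ → Ser → Ser
shN zero f = f
shN (suc s) f = sh (shN s f)

shN-cong : ∀ s {f g : Ser} → (∀ n → f n ≡ g n) → ∀ n → shN s f n ≡ shN s g n
shN-cong zero p = p
shN-cong (suc s) p = sh-cong (shN-cong s p)

shN-0 : ∀ s n → shN s (λ _ → + 0) n ≡ + 0
shN-0 zero n = refl
shN-0 (suc s) zero = refl
shN-0 (suc s) (suc n) = shN-0 s n

shN-+ : ∀ a b f n → shN a (shN b f) n ≡ shN (a + b) f n
shN-+ zero b f n = refl
shN-+ (suc a) b f n = sh-cong (shN-+ a b f) n

set : ℕ → ℕ → (ℕ → ℕ) → ℕ → ℕ
set w x e r = if r ≡ᵇ w then x else e r

set-eq : ∀ w x e → set w x e w ≡ x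
set-eq w x e rewrite ≡ᵇ-refl w = refl

set-no : ∀ w x e r → r ≢ w → set w x e r ≡ e r
set-no w x e r p rewrite ≡ᵇ-no r w p = refl

inc-set : ∀ w x e → e w ≡ suc x → ∀ r → inc w (set w x e) r ≡ e r
inc-set w x e h r with r ≟ w
... | yes refl = inc-eq r (set r x e) ∙ cong suc (set-eq r x e) ∙ sym h
... | no p = inc-no w (set w x e) r p ∙ set-no w x e r p

R-at₁ : ∀ i j γ → i ≢ j → R (i , j) γ i ≡ + 1 ℤ.+ γ i
R-at₁ i j γ p rewrite ι-eq i | ι-no i j p = ring (γ i)
  where
  ring : ∀ x → x ℤ.+ (+ 1 ℤ.- + 0) ≡ + 1 ℤ.+ x
  ring = ℤS.solve-∀

R-at₂ : ∀ i j γ → i ≢ j → + 1 ℤ.+ R (i , j) γ j ≡ γ j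
R-at₂ i j γ p rewrite ι-eq j | ι-no j i (λ x → p (sym x)) = ring (γ j)
  where
  ring : ∀ x → + 1 ℤ.+ (x ℤ.+ (+ 0 ℤ.- + 1)) ≡ x
  ring = ℤS.solve-∀

R-off : ∀ i j γ r → r ≢ i → r ≢ j → R (i , j) γ r ≡ γ r
R-off i j γ r p q rewrite ι-no r i p | ι-no r j q = ℤP.+-identityʳ (γ r)

R-join : ∀ a b c γ r → R (a , b) (R (b , c) γ) r ≡ R (a , c) γ r
R-join a b c γ r = ring (γ r) (+ ι r a) (+ ι r b) (+ ι r c)
  where
  ring : ∀ x p q s → (x ℤ.+ (q ℤ.- s)) ℤ.+ (p ℤ.- q) ≡ x ℤ.+ (p ℤ.- s)
  ring = ℤS.solve-∀

-- Pairs of rows (Z i, Z i + 1), i ≤ m, linked by the starts of their roots: row Z i starts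
-- in column Z (i+1) and row Z i + 1 in the next column.
record Ladder (ℓ : ℕ) (e Z : ℕ → ℕ) (m : ℕ) : Set where
  field
    below : ∀ r → r < ℓ → Z m ≤ r → suc (Z m) < e r
    level : e (Z m) ≡ e (suc (Z m))
    left : ∀ i → i < m → e (Z i) ≡ Z (suc i)
    right : ∀ i → i < m → e (suc (Z i)) ≡ suc (Z (suc i))
    unique : ∀ i → i < m → ∀ r → r < Z (suc i) → e r ≡ suc (Z (suc i)) → r ≡ suc (Z i)
    step : ∀ i → i < m → suc (Z i) < Z (suc i)
    free : ∀ r → r < Z 0 → e r ≢ suc (Z 0)
    between : ∀ i → i < m → ∀ r → Z i ≤ r → r < Z m → suc (Z i) < e r

module _ {ℓ : ℕ} {Z : ℕ → ℕ} where

  steps-mono : ∀ m → (∀ i → i < m → suc (Z i) < Z (suc i)) → ∀ j → j ≤ m → ∀ i → i ≤ j → Z i ≤ Z j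
  steps-mono m st j jm i ij with i ≟ j
  steps-mono m st j jm i ij | yes refl = ≤-refl
  steps-mono m st zero jm i z≤n | no ne = ⊥-elim (ne refl)
  steps-mono m st (suc j) jm i ij | no ne =
    ≤-trans (steps-mono m st j (<⇒≤ jm) i (ℕ.s≤s⁻¹ (≤∧≢⇒< ij ne))) (≤-trans (n≤1+n _) (<⇒≤ (st j jm)))

  Z-mono : ∀ m {e} → Ladder ℓ e Z m → ∀ i → i ≤ m → Z i ≤ Z m
  Z-mono m lad i p = steps-mono m (Ladder.step lad) m ≤-refl i p

  -- Adding the root (w , z) moves the only start at z + 1 to z. Rows and columns z and z + 1 become
  -- exchangeable, and what remains above is a ladder with one pair less.
  module Lower {e m} (lad : Ladder ℓ e Z (suc m)) (inside : suc (Z (suc m)) < ℓ) where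
    open Ladder lad
    w z : ℕ
    w = suc (Z m)
    z = Z (suc m)
    e¹ : ℕ → ℕ
    e¹ = set w z e

    w<z : w < z
    w<z = step m (n<1+n m)
    e¹-no : ∀ r → r ≢ w → e¹ r ≡ e r
    e¹-no = set-no w z e
    e¹-w : e¹ w ≡ z
    e¹-w = set-eq w z e
    level¹ : e¹ z ≡ e¹ (suc z)
    level¹ = e¹-no z (λ x → <⇒≢ w<z (sym x)) ∙ level ∙ sym (e¹-no (suc z) (λ x → <⇒≢ (<-trans w<z (n<1+n z)) (sym x)))
    free¹ : Free ℓ e¹ (suc z)
    free¹ r rl x with r ≟ w
    ... | yes refl = <⇒≢ (n<1+n z) (sym e¹-w ∙ x)
    ... | no ne with r <? z
    ...   | yes r<z = ne (unique m (n<1+n m) r r<z (sym (e¹-no r ne) ∙ x))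
    ...   | no r≮z = <⇒≢ (below r rl (≮⇒≥ r≮z)) (sym x ∙ e¹-no r ne)
    restore : ∀ r → inc w e¹ r ≡ e r
    restore = inc-set w z e (right m (n<1+n m))

    ladder : Ladder ℓ e¹ Z m
    ladder = record
      { below = below¹
      ; level = e¹-no (Z m) (<⇒≢ (n<1+n _)) ∙ left m (n<1+n m) ∙ sym e¹-w
      ; left = λ i p → e¹-no (Z i) (<⇒≢ (<-trans (n<1+n _) (s≤s (lt i p)))) ∙ left i (<-trans p (n<1+n m))
      ; right = λ i p → e¹-no (suc (Z i)) (<⇒≢ (s≤s (lt i p))) ∙ right i (<-trans p (n<1+n m))
      ; unique = λ i p r q x → unique i (<-trans p (n<1+n m)) r q
          (sym (e¹-no r (<⇒≢ (≤-<-trans (<⇒≤ q) (s≤s (le (suc i) p))))) ∙ x)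
      ; step = λ i p → step i (<-trans p (n<1+n m))
      ; free = λ r q x → free r q (sym (e¹-no r (<⇒≢ (<-trans q (s≤s (le 0 z≤n))))) ∙ x)
      ; between = λ i p r q s → subst (suc (Z i) <_) (sym (e¹-no r (<⇒≢ (<-trans s (n<1+n _)))))
          (between i (<-trans p (n<1+n m)) r q (<-trans s (<-trans (n<1+n _) w<z)))
      }
      where
      le : ∀ i → i ≤ m → Z i ≤ Z m
      le i p = steps-mono m (λ i q → step i (<-trans q (n<1+n m))) m ≤-refl i p
      lt : ∀ i → i < m → Z i < Z m
      lt i p = ≤-trans (<-trans (n<1+n _) (step i (<-trans p (n<1+n m)))) (le (suc i) p)
      below¹ : ∀ r → r < ℓ → Z m ≤ r → suc (Z m) < e¹ r
      below¹ r rl q with r ≟ w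
      ... | yes refl = subst (w <_) (sym e¹-w) w<z
      ... | no ne = subst (w <_) (sym (e¹-no r ne)) (rest (r <? z))
        where
        rest : _ → w < e r
        rest (yes s) = between m (n<1+n m) r q s
        rest (no s) = <-trans (<-trans w<z (n<1+n z)) (below r rl (≮⇒≥ s))

    w≢z : w ≢ z
    w≢z = <⇒≢ w<z
    w≢sz : w ≢ suc z
    w≢sz = <⇒≢ (<-trans w<z (n<1+n z))

  record Weights (S : W → ℤ) (γ : W) (m : ℕ) : Set where
    field
      anti : ∀ i → i ≤ m → AntiAt S (Z i)
      rise : γ (suc (Z m)) ≡ + 1 ℤ.+ γ (Z m)
      flat : ∀ i → i < m → γ (Z i) ≡ γ (suc (Z i))

  -- Row w is the lower row of the flat pair above; the mirror step adds one to it, and that pair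
  -- becomes the rising one.
  lower-weights : ∀ {S γ m e} → Ladder ℓ e Z (suc m) → Weights S γ (suc m) → Weights S (R (suc (Z m) , suc (Z (suc m))) γ) m
  lower-weights {S} {γ} {m} lad wt = record
    { anti = λ i p → anti i (m≤n⇒m≤1+n p)
    ; rise = R-at₁ w (suc z) γ w≢sz ∙ cong (λ x → + 1 ℤ.+ x) (sym (flat m (n<1+n m)) ∙ sym (away (Z m) (n<1+n _)))
    ; flat = λ i p → away (Z i) (<-trans (n<1+n _) (s≤s (lt i p))) ∙ flat i (<-trans p (n<1+n m)) ∙ sym (away (suc (Z i)) (s≤s (lt i p)))
    }
    where
    open Weights wt
    w z : ℕ
    w = suc (Z m)
    z = Z (suc m)
    w<z : w < z
    w<z = Ladder.step lad m (n<1+n m)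
    w≢sz : w ≢ suc z
    w≢sz = <⇒≢ (<-trans w<z (n<1+n z))
    lt : ∀ i → i < m → Z i < Z m
    lt i p = ≤-trans (<-trans (n<1+n _) (Ladder.step lad i (<-trans p (n<1+n m)))) 
      (steps-mono m (λ i q → Ladder.step lad i (<-trans q (n<1+n m))) m ≤-refl (suc i) p)
    away : ∀ r → r < w → R (w , suc z) γ r ≡ γ r
    away r p = R-off w (suc z) γ r (<⇒≢ p) (<⇒≢ (<-trans p (<-trans w<z (n<1+n z))))

module Climbing (ℓ : ℕ) (S : W → ℤ) (loc : Local ℓ S) where
  open Catalan ℓ S loc

  free-end : ∀ {e Z} → Ladder ℓ e Z 0 → Free ℓ e (suc (Z 0))
  free-end {e} {Z} lad r rl x with r <? Z 0
  ... | yes q = Ladder.free lad r q x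
  ... | no q = <⇒≢ (Ladder.below lad r rl (≮⇒≥ q)) (sym x)

  -- Each mirror step goes up one pair at the price of a factor t. At the uppermost pair no row
  -- starts in the second column, so antisymmetry applies directly and kills everything.
  ladder-vanish : ∀ {Z} m e γ → Ladder ℓ e Z m → suc (Z m) < ℓ → Weights {ℓ} {Z} S γ m → ∀ n → H e γ n ≡ + 0
  ladder-vanish {Z} zero e γ lad p wt n =
    H-vanish e (Z 0) γ p (Weights.anti wt 0 z≤n) (Ladder.level lad) (free-end lad) (Weights.rise wt) n
  ladder-vanish {Z} (suc m) e γ lad p wt n =
    H-cong (λ r _ → sym (restore r)) (λ _ _ → refl) n
    ∙ H-mirror e¹ z w γ p (Weights.anti wt (suc m) ≤-refl) level¹ free¹ (Weights.rise wt)
        (<-trans w<z (<-trans (n<1+n z) p)) e¹-w w≢z w≢sz n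
    ∙ sh-cong (ladder-vanish m e¹ (R (w , suc z) γ) ladder (<-trans w<z (<-trans (n<1+n z) p)) (lower-weights lad wt)) n
    ∙ shN-0 1 n
    where
    open Lower lad p

  -- After the increment row u starts in the second column of the uppermost pair and prevents the
  -- vanishing. It takes part in one last mirror step, so m + 1 pairs give the factor t^(m + 1), and
  -- the shifts along the way compose to one root from u to the bottom.
  ladder-climb : ∀ {Z} m e γ u → Ladder ℓ e Z m → suc (Z m) < ℓ → Weights {ℓ} {Z} S γ m → u < Z 0 → e u ≡ Z 0 →
    ∀ n → H (inc u e) γ n ≡ shN (suc m) (H e (R (u , suc (Z m)) γ)) n
  ladder-climb {Z} zero e γ u lad p wt u< eu n =
    H-mirror e (Z 0) u γ p (Weights.anti wt 0 z≤n) (Ladder.level lad) (free-end lad) (Weights.rise wt)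
      (<-trans u< (<-trans (n<1+n _) p)) eu (<⇒≢ u<) (<⇒≢ (<-trans u< (n<1+n _))) n
  ladder-climb {Z} (suc m) e γ u lad p wt u< eu n =
    H-cong (λ r _ → incs r) (λ _ _ → refl) n
    ∙ H-mirror (inc u e¹) z w γ p (Weights.anti wt (suc m) ≤-refl)
        (inc-no u e¹ z (>⇒≢ u<z) ∙ level¹ ∙ sym (inc-no u e¹ (suc z) (>⇒≢ (<-trans u<z (n<1+n z)))))
        free² (Weights.rise wt) w<ℓ (inc-no u e¹ w (>⇒≢ u<w) ∙ e¹-w) w≢z w≢sz n
    ∙ sh-cong (λ n → ladder-climb m e¹ γ¹ u ladder w<ℓ (lower-weights lad wt) u< (e¹-no u (<⇒≢ u<w) ∙ eu) n
        ∙ shN-cong (suc m) (λ n → H-cong {e¹} (λ _ _ → refl) (λ r _ → R-join u w (suc z) γ r) n ∙ drop n) n) n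
    where
    open Lower lad p
    w<ℓ : w < ℓ
    w<ℓ = <-trans w<z (<-trans (n<1+n z) p)
    u<w : u < w
    u<w = <-≤-trans u< (≤-trans (Z-mono m ladder 0 z≤n) (n≤1+n _))
    u<z : u < z
    u<z = <-trans u<w w<z
    γ¹ γ² : W
    γ¹ = R (w , suc z) γ
    γ² = R (u , suc z) γ
    incs : ∀ r → inc u e r ≡ inc w (inc u e¹) r
    incs r = cong (λ x → ι r u + x) (sym (restore r)) ∙ (lia ((ι r u) ∷ (ι r w) ∷ (e¹ r) ∷ []) [] (v0 ⊕ (v1 ⊕ v2) ≛ v1 ⊕ (v0 ⊕ v2)) ((1 ∷ []) , (1 ∷ [])))
    free² : Free ℓ (inc u e¹) (suc z)
    free² r rl x with r ≟ u
    ... | yes refl = <⇒≢ (<-≤-trans (n<1+n _) (≤-trans (s≤s (Z-mono m ladder 0 z≤n)) (<⇒≤ w<z)))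
                       (suc-injective (sym (cong suc (e¹-no r (<⇒≢ u<w) ∙ eu)) ∙ sym (inc-eq r e¹) ∙ x))
    ... | no ne = free¹ r rl (sym (inc-no u e¹ r ne) ∙ x)
    z≢sz : z ≢ suc z
    z≢sz = <⇒≢ (n<1+n z)
    -- The root (w , z) added on the way up is removed again: its extra term is antisymmetric at z.
    drop : ∀ n → H e¹ γ² n ≡ H e γ² n
    drop n = H-remove e¹ w γ² w<ℓ (subst (_< ℓ) (sym e¹-w) (<-trans (n<1+n z) p)) n
      ∙ cong₂ ℤ._+_ (H-cong (λ r _ → restore r) (λ _ _ → refl) n)
          (sh-cong (λ n → H-vanish e¹ z (R (w , e¹ w) γ²) p (Weights.anti wt (suc m) ≤-refl) level¹ free¹ rise³ n) n ∙ shN-0 1 n)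
      ∙ ℤP.+-identityʳ _
      where
      rise³ : R (w , e¹ w) γ² (suc z) ≡ + 1 ℤ.+ R (w , e¹ w) γ² z
      rise³ rewrite e¹-w = R-off w z γ² (suc z) (>⇒≢ (<-trans w<z (n<1+n z))) (≢-sym z≢sz)
        ∙ inj (R-at₂ u (suc z) γ (<⇒≢ (<-trans u<z (n<1+n z))) ∙ Weights.rise wt)
        ∙ sym (R-off u (suc z) γ z (>⇒≢ u<z) z≢sz)
        ∙ sym (R-at₂ w z γ² w≢z)
        where
        inj : ∀ {a b} → + 1 ℤ.+ a ≡ + 1 ℤ.+ b → a ≡ b
        inj {a} {b} q = sym (ℤP.pred-suc a) ∙ cong ℤ.pred q ∙ ℤP.pred-suc b

-- Indicators of row intervals and iterates of the row map

ind : ℕ → ℕ → ℕ → ℕ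
ind a zero r = 0
ind a (suc m) r = ind a m r + ι r (a + m)

ind-low : ∀ a m r → r < a → ind a m r ≡ 0
ind-low a zero r p = refl
ind-low a (suc m) r p = cong₂ _+_ (ind-low a m r p) (ι-no r (a + m) (<⇒≢ (<-≤-trans p (m≤m+n a m))))

ind-high : ∀ a m r → a + m ≤ r → ind a m r ≡ 0
ind-high a zero r p = refl
ind-high a (suc m) r p = cong₂ _+_ (ind-high a m r (<⇒≤ q)) (ι-no r (a + m) (>⇒≢ q))
  where
  q : a + m < r
  q = subst (_≤ r) (+-suc a m) p

ind-in : ∀ a m r → a ≤ r → r < a + m → ind a m r ≡ 1
ind-in a zero r p q = ⊥-elim ((lia (a ∷ r ∷ []) (v0 ≼ v1 ∷ v1 ≺ v0 ⊕ (li 0) ∷ []) (ff) ((1 ∷ 1 ∷ []) , [])) p q)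
ind-in a (suc m) r p q with r ≟ a + m
... | yes refl = cong₂ _+_ (ind-high a m (a + m) ≤-refl) (ι-eq (a + m))
... | no ne = cong₂ _+_ (ind-in a m r p (≤∧≢⇒< (ℕ.s≤s⁻¹ (subst (r <_) (+-suc a m) q)) ne)) (ι-no r (a + m) ne)

ind-≤1 : ∀ a m r → ind a m r ≤ 1
ind-≤1 a m r with r <? a | r <? a + m
... | yes p | _ = ≤-trans (≤-reflexive (ind-low a m r p)) z≤n
... | no p | yes q = ≤-reflexive (ind-in a m r (≮⇒≥ p) q)
... | no p | no q = ≤-trans (≤-reflexive (ind-high a m r (≮⇒≥ q))) z≤n

it : (ℕ → ℕ) → ℕ → ℕ → ℕ
it d zero x = x
it d (suc j) x = d (it d j x)

module RowMap (d : ℕ → ℕ) (mono : ∀ r → d r < d (suc r)) (up : ∀ r → r < d r) where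

  d-add : ∀ r i → d r + i ≤ d (r + i)
  d-add r zero = ≤-reflexive (+-identityʳ _ ∙ cong d (sym (+-identityʳ r)))
  d-add r (suc i) = subst₂ _≤_ (sym (+-suc (d r) i)) (cong d (sym (+-suc r i))) (≤-<-trans (d-add r i) (mono (r + i)))

  d-le : ∀ {a b} → a ≤ b → d a ≤ d b
  d-le {a} {b} p = subst (λ x → d a ≤ d x) (m+[n∸m]≡n p) (≤-trans (m≤m+n (d a) (b ∸ a)) (d-add a (b ∸ a)))

  d-lt : ∀ {a b} → a < b → d a < d b
  d-lt {a} p = <-≤-trans (mono a) (d-le p)

  d-lt⁻¹ : ∀ {a b} → d a < d b → a < b
  d-lt⁻¹ {a} {b} p with a <? b
  ... | yes q = q
  ... | no q = ⊥-elim (<⇒≱ p (d-le (≮⇒≥ q)))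

  d-inj : ∀ {a b} → d a ≡ d b → a ≡ b
  d-inj {a} {b} p with a <? b | b <? a
  ... | yes q | _ = ⊥-elim (<⇒≢ (d-lt q) p)
  ... | no _ | yes q = ⊥-elim (>⇒≢ (d-lt q) p)
  ... | no q | no q' = ≤-antisym (≮⇒≥ q') (≮⇒≥ q)

  -- A preimage of x lies above row x because r < d r, so the search is finite.
  preimage? : ∀ x → (∃ λ r → d r ≡ x) ⊎ (∀ r → d r ≢ x)
  preimage? x = search x (λ r q e → <⇒≱ (up r) (≤-trans (≤-reflexive e) q))
    where
    search : ∀ b → (∀ r → b ≤ r → d r ≢ x) → (∃ λ r → d r ≡ x) ⊎ (∀ r → d r ≢ x)
    search zero h = inj₂ (λ r → h r z≤n)
    search (suc b) h with d b ≟ x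
    ... | yes e = inj₁ (b , e)
    ... | no ne = search b λ r q → case r q (r ≟ b)
      where
      case : ∀ r → b ≤ r → _ → d r ≢ x
      case r q (yes refl) = ne
      case r q (no z) = h r (≤∧≢⇒< q (λ y → z (sym y)))

  it-le : ∀ {i j} x → i ≤ j → it d i x ≤ it d j x
  it-le {i} {zero} x z≤n = ≤-refl
  it-le {i} {suc j} x p with i ≟ suc j
  ... | yes refl = ≤-refl
  ... | no ne = ≤-trans (it-le x (ℕ.s≤s⁻¹ (≤∧≢⇒< p ne))) (<⇒≤ (up _))

  it-+ : ∀ a b x → it d (a + b) x ≡ it d a (it d b x)
  it-+ zero b x = refl
  it-+ (suc a) b x = cong d (it-+ a b x)

-- Modified row starts for which the pairs x_t + i, x_t + i + 1 with x_t = it d t y form a ladder.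
module Build (d : ℕ → ℕ) (mono : ∀ r → d r < d (suc r)) (up : ∀ r → r < d r) (ℓ y m i : ℕ) (e : ℕ → ℕ)
  (sep : ∀ t → t ≤ m → suc (it d t y + i) < it d (suc t) y)
  (blk : ∀ t → t ≤ m → d (it d t y + i) ≡ it d (suc t) y + i)
  (blk' : ∀ t → t ≤ m → d (suc (it d t y + i)) ≡ suc (it d (suc t) y + i))
  (raised : ∀ r → it d m y ≤ r → r ≤ it d m y + i → e r ≡ suc (d r))
  (beyond : ∀ r → it d m y + i < r → e r ≡ d r)
  -- An earlier row either keeps its start, which is then not y + i + 1, or had it lowered to at
  -- most y + i. In both cases the second column of the uppermost pair stays free.
  (before : ∀ r → r < it d m y → (e r ≡ d r × d r ≢ suc (y + i)) ⊎ (e r ≤ y + i × d r ≤ suc (y + i)))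
  where
  open RowMap d mono up

  Z : ℕ → ℕ
  Z t = it d t y + i
  p : ℕ
  p = it d m y

  first : ∀ t → suc (y + i) < it d (suc t) y
  first t = <-≤-trans (sep 0 z≤n) (it-le {1} {suc t} y (s≤s z≤n))

  normal : ∀ t r → r < p → it d (suc t) y + i ≤ d r → e r ≡ d r
  normal t r q h with before r q
  ... | inj₁ (x , _) = x
  ... | inj₂ (_ , x) = ⊥-elim ((lia (t' ∷ i ∷ (d r) ∷ y ∷ []) (v0 ⊕ v1 ≼ v2 ∷ v2 ≼ su (v3 ⊕ v1) ∷ su (v3 ⊕ v1) ≺ v0 ∷ []) (ff) ((1 ∷ 1 ∷ 1 ∷ []) , [])) h x (first t))
    where t' = it d (suc t) y

  high : ∀ r → p ≤ r → r ≤ p + i → suc (p + i) < e r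
  high r q h = subst (suc (p + i) <_) (sym (raised r q h)) (<-trans (sep m ≤-refl) (s≤s (d-le q)))

  ladder : Ladder ℓ e Z m
  ladder = record
    { below = λ r _ q → below r q (r ≤? p + i)
    ; level = raised (p + i) (m≤m+n p i) ≤-refl ∙ cong suc (blk m ≤-refl) ∙ sym (blk' m ≤-refl) ∙ sym (beyond _ ≤-refl)
    ; left = λ t q → normal t (Z t) (lt t q (it d t y + i) (n≤1+n _)) (≤-reflexive (sym (blk t (<⇒≤ q)))) ∙ blk t (<⇒≤ q)
    ; right = λ t q → normal t (suc (Z t)) (lt t q _ ≤-refl)
        (≤-trans (n≤1+n _) (≤-reflexive (sym (blk' t (<⇒≤ q))))) ∙ blk' t (<⇒≤ q)
    ; unique = λ t q r s x → unique t q r s x (r <? p)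
    ; step = λ t q → ≤-trans (sep t (<⇒≤ q)) (m≤m+n _ i)
    ; free = λ r s x → free r s x (r <? p)
    ; between = λ t q r s u → between t q r s u (r <? p)
    }
    where
    lt : ∀ t → t < m → ∀ r → r ≤ suc (it d t y + i) → r < p
    lt t q r h = ≤-<-trans h (<-≤-trans (sep t (<⇒≤ q)) (it-le y q))
    below : ∀ r → p + i ≤ r → _ → suc (p + i) < e r
    below r q (yes h) = high r (≤-trans (m≤m+n p i) q) h
    below r q (no h) = subst (suc (p + i) <_) (sym (beyond r (≰⇒> h)))
      (≤-trans (≤-trans (sep m ≤-refl) (≤-trans (m≤m+n _ i) (n≤1+n _))) (≤-trans (≤-reflexive (sym (blk' m ≤-refl))) (d-le (≰⇒> h))))
    unique : ∀ t → t < m → ∀ r → r < Z (suc t) → e r ≡ suc (Z (suc t)) → _ → r ≡ suc (Z t)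
    unique t q r s x (yes h) with before r h
    ... | inj₁ (b , _) = d-inj (sym b ∙ x ∙ sym (blk' t (<⇒≤ q)))
    ... | inj₂ (b , _) = ⊥-elim ((lia ((e r) ∷ y ∷ i ∷ t' ∷ []) (v0 ≼ v1 ⊕ v2 ∷ v0 ≛ su (v3 ⊕ v2) ∷ su (v1 ⊕ v2) ≺ v3 ∷ []) (ff) ((1 ∷ 0 ∷ 1 ∷ 1 ∷ []) , [])) b x (first t))
      where t' = it d (suc t) y
    unique t q r s x (no h) = ⊥-elim ((lia (p ∷ i ∷ (e r) ∷ t' ∷ []) (su (v0 ⊕ v1) ≺ v2 ∷ v2 ≛ su (v3 ⊕ v1) ∷ v3 ≼ v0 ∷ []) (ff) ((1 ∷ 1 ∷ 0 ∷ 1 ∷ []) , []))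
        (high r (≮⇒≥ h) (<⇒≤ (<-≤-trans s (+-monoˡ-≤ i (it-le y q))))) x (it-le y q))
      where t' = it d (suc t) y
    free : ∀ r → r < Z 0 → e r ≡ suc (Z 0) → _ → ⊥
    free r s x (yes h) with before r h
    ... | inj₁ (b , c) = c (sym b ∙ x)
    ... | inj₂ (b , _) = <⇒≱ (≤-reflexive (sym x)) b
    free r s x (no h) = (lia (p ∷ i ∷ (e r) ∷ y ∷ []) (su (v0 ⊕ v1) ≺ v2 ∷ v2 ≛ su (v3 ⊕ v1) ∷ v3 ≼ v0 ∷ []) (ff) ((1 ∷ 1 ∷ 0 ∷ 1 ∷ []) , []))
        (high r (≮⇒≥ h) (<⇒≤ (<-≤-trans s (+-monoˡ-≤ i (it-le {0} {m} y z≤n))))) x (it-le {0} {m} y z≤n)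
    between : ∀ t → t < m → ∀ r → Z t ≤ r → r < Z m → _ → suc (Z t) < e r
    between t q r s u (yes h) = subst (suc (Z t) <_) (sym (normal t r h ge))
      (<-≤-trans (<-≤-trans (sep t (<⇒≤ q)) (m≤m+n _ i)) ge)
      where
      ge : it d (suc t) y + i ≤ d r
      ge = ≤-trans (≤-reflexive (sym (blk t (<⇒≤ q)))) (d-le s)
    between t q r s u (no h) = ≤-trans (s≤s (s≤s (+-monoˡ-≤ i (it-le y (<⇒≤ q))))) (high r (≮⇒≥ h) (<⇒≤ u))

-- The Pieri recursion on root ideals

-- Weights are kept as differences of natural numbers so that their equations fall to the
-- certificates over ℕ.
wt : (ℕ → ℕ) → (ℕ → ℕ) → W
wt a b r = + a r ℤ.- + b r

diff-eq : ∀ a b a' b' → a + b' ≡ a' + b → + a ℤ.- + b ≡ + a' ℤ.- + b'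
diff-eq a b a' b' h = ring₁ (+ a) (+ b) (+ b') ∙ cong (λ x → (x ℤ.- + b) ℤ.- + b') (cong +_ h) ∙ ring₂ (+ a') (+ b) (+ b')
  where
  ring₁ : ∀ x y z → x ℤ.- y ≡ ((x ℤ.+ z) ℤ.- y) ℤ.- z
  ring₁ = ℤS.solve-∀
  ring₂ : ∀ x y z → ((x ℤ.+ y) ℤ.- y) ℤ.- z ≡ x ℤ.- z
  ring₂ = ℤS.solve-∀

diff-suc : ∀ a b a' b' → a + b' ≡ suc (a' + b) → + a ℤ.- + b ≡ + 1 ℤ.+ (+ a' ℤ.- + b')
diff-suc a b a' b' h = diff-eq a b (suc a') b' h ∙ ring (+ a') (+ b')
  where
  ring : ∀ x y → (+ 1 ℤ.+ x) ℤ.- y ≡ + 1 ℤ.+ (x ℤ.- y)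
  ring = ℤS.solve-∀

R-wt : ∀ i j a b r → R (i , j) (wt a b) r ≡ wt (λ s → a s + ι s i) (λ s → b s + ι s j) r
R-wt i j a b r = ring (+ a r) (+ b r) (+ ι r i) (+ ι r j)
  where
  ring : ∀ x y p q → (x ℤ.- y) ℤ.+ (p ℤ.- q) ≡ (x ℤ.+ p) ℤ.- (y ℤ.+ q)
  ring = ℤS.solve-∀

-- c + 1 blocks of i + 1 rows, starting at p0, d p0, d² p0, …; the rows q, …, q + i - 1
-- are mapped by d onto the rows of the first block other than p0.
record Tower (d : ℕ → ℕ) (p0 c i q : ℕ) : Set where
  field
    top : ∀ r → d r ≢ p0
    blk : ∀ j i' → j ≤ c → i' ≤ i → d (it d j p0 + i') ≡ it d (suc j) p0 + i'
    sep : it d c p0 + i < it d (suc c) p0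
    rais : ∀ i' → i' < i → d (q + i') ≡ p0 + suc i'

-- Maximality of the blocks. Without it, increasing the start of the last bottom row would make it
-- collide with the start of the next row.
Last : (ℕ → ℕ) → ℕ → ℕ → ℕ → Set
Last d p0 c i = d (suc (it d c p0 + i)) ≢ suc (it d (suc c) p0 + i)

module Towers (d : ℕ → ℕ) (mono : ∀ r → d r < d (suc r)) (up : ∀ r → r < d r) where
  open RowMap d mono up

  module _ {p0 c i q} (tw : Tower d p0 c i q) where
    open Tower tw

    -- A tower records only the separation at its bottom; the others are pulled back along the
    -- strictly increasing d.
    seps : ∀ j → j ≤ c → it d j p0 + i < it d (suc j) p0
    seps j jc = down (c ∸ j) j (m+[n∸m]≡n jc)
      where
      down : ∀ t j → j + t ≡ c → it d j p0 + i < it d (suc j) p0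
      down zero j e = subst (λ x → it d x p0 + i < it d (suc x) p0) (sym e ∙ +-identityʳ j) sep
      down (suc t) j e = d-lt⁻¹ (subst (_< it d (suc (suc j)) p0) (sym (blk j i (≤-trans (m≤m+n j (suc t)) (≤-reflexive e)) ≤-refl))
        (down t (suc j) (sym (+-suc j t) ∙ e)))

    restrict : ∀ {i'} → i' ≤ i → Tower d p0 c i' q
    restrict h = record { top = top ; blk = λ j a p q → blk j a p (≤-trans q h)
      ; sep = ≤-<-trans (+-monoʳ-≤ (it d c p0) h) sep ; rais = λ a p → rais a (<-≤-trans p h) }

-- In the application `low` is what the later letters of the same column still have to subtract. The
-- rows above `i0`, where S need not be antisymmetric, are the full ones.
module Stages (d : ℕ → ℕ) (mono : ∀ r → d r < d (suc r)) (up : ∀ r → r < d r) (k : ℕ) (ν : ℕ → ℕ) (code : ∀ r → d r + ν r ≡ suc (k + r))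
  (ℓ : ℕ) (S : W → ℤ) (loc : Local ℓ S) (i0 : ℕ)
  (anti : ∀ z → i0 ≤ z → suc z < ℓ → AntiAt S z) (full : ∀ z → z < i0 → d z ≡ suc z) (low : ℕ → ℕ) where
  open RowMap d mono up
  open Towers d mono up
  open Catalan ℓ S loc
  open Climbing ℓ S loc

  -- The family interpolating between the two root ideals of the Pieri rule: with m = 1 and m' = 0
  -- only row P is changed, and with m = i + 1 and m' = i it is the row map of the swapped core.
  -- `γS` does the same for the weights.
  eS : ℕ → ℕ → ℕ → ℕ → ℕ → ℕ
  eS P m q m' r = (d r + ind P m r) ∸ ind q m' r

  γS : ℕ → ℕ → ℕ → ℕ → W
  γS P m q m' = wt (λ r → ν r + ind q m' r) (λ r → low r + ind P m r)

  γS-rise : ∀ P m q m' r s → (ν s + ind q m' s) + (low r + ind P m r) ≡ suc ((ν r + ind q m' r) + (low s + ind P m s)) →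
    γS P m q m' s ≡ + 1 ℤ.+ γS P m q m' r
  γS-rise P m q m' r s = diff-suc (ν s + ind q m' s) (low s + ind P m s) (ν r + ind q m' r) (low r + ind P m r)

  γS-flat : ∀ P m q m' r s → (ν r + ind q m' r) + (low s + ind P m s) ≡ (ν s + ind q m' s) + (low r + ind P m r) →
    γS P m q m' r ≡ γS P m q m' s
  γS-flat P m q m' r s = diff-eq (ν r + ind q m' r) (low r + ind P m r) (ν s + ind q m' s) (low s + ind P m s)

  eS-spec : ∀ P m q m' r → eS P m q m' r + ind q m' r ≡ d r + ind P m r
  eS-spec P m q m' r = m∸n+n≡m (≤-trans (ind-≤1 q m' r) (≤-trans (≤-<-trans z≤n (up r)) (m≤m+n (d r) _)))

  -- The ladder used to enlarge blocks of i + 1 rows: in each block the pair consists of its last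
  -- row and the row just after it. It may start at a later block y when the chain cannot be
  -- followed up to p0.
  module Pair (y m i q m' : ℕ)
    (sep : ∀ t → t ≤ m → suc (it d t y + i) < it d (suc t) y)
    (blk : ∀ t → t ≤ m → d (it d t y + i) ≡ it d (suc t) y + i)
    (blk' : ∀ t → t ≤ m → d (suc (it d t y + i)) ≡ suc (it d (suc t) y + i))
    (i0≤P : i0 ≤ it d m y)
    (qrows : ∀ i' → i' < m' → d (q + i') ≤ suc (y + i))
    (freeY : ∀ r → d r ≡ suc (y + i) → q ≤ r × r < q + m')
    (lowU : ∀ t → t ≤ m → low (it d t y + i) ≡ low (suc (it d t y + i)))
    where
    P : ℕ
    P = it d m y
    e : ℕ → ℕ
    e = eS P (suc i) q m'
    Z : ℕ → ℕ
    Z t = it d t y + i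

    first : ∀ t → suc (y + i) < it d (suc t) y
    first t = <-≤-trans (sep 0 z≤n) (it-le {1} {suc t} y (s≤s z≤n))

    in-q : ∀ m″ → m″ ≤ m' → ∀ r → (q ≤ r × r < q + m″ × d r ≤ suc (y + i)) ⊎ (ind q m″ r ≡ 0 × (r < q ⊎ q + m″ ≤ r))
    in-q m″ h r with r <? q | r <? q + m″
    ... | yes a | _ = inj₂ (ind-low q m″ r a , inj₁ a)
    ... | no a | no b = inj₂ (ind-high q m″ r (≮⇒≥ b) , inj₂ (≮⇒≥ b))
    ... | no a | yes b = inj₁ (≮⇒≥ a , b , subst (λ x → d x ≤ suc (y + i)) (m+[n∸m]≡n (≮⇒≥ a))
            (qrows (r ∸ q) (<-≤-trans (+-cancelˡ-< q _ _ (subst (_< q + m″) (sym (m+[n∸m]≡n (≮⇒≥ a))) b)) h)))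

    q-out : ∀ m″ → m″ ≤ m' → ∀ r → suc (y + i) < d r → ind q m″ r ≡ 0
    q-out m″ h r g with in-q m″ h r
    ... | inj₁ (_ , _ , x) = ⊥-elim (<⇒≱ g x)
    ... | inj₂ (x , _) = x

    far : ∀ r → P ≤ r → suc (y + i) < d r
    far r h = <-≤-trans (first m) (d-le h)

    ladder : Ladder ℓ e Z m
    ladder = Build.ladder d mono up ℓ y m i e sep blk blk' raised beyond before
      where
      raised : ∀ r → P ≤ r → r ≤ P + i → e r ≡ suc (d r)
      raised r h g = (lia ((e r) ∷ (ind q m' r) ∷ (d r) ∷ (ind P (suc i) r) ∷ []) (v0 ⊕ v1 ≛ v2 ⊕ v3 ∷ v1 ≛ li 0 ∷ v3 ≛ li 1 ∷ []) (v0 ≛ su v2) ((1 ∷ 1 ∷ 0 ∷ 0 ∷ 0 ∷ 1 ∷ []) , (1 ∷ 0 ∷ 1 ∷ 1 ∷ 0 ∷ 0 ∷ 1 ∷ [])))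
        (eS-spec P (suc i) q m' r) (q-out m' ≤-refl r (far r h)) (ind-in P (suc i) r h (subst (r <_) (sym (+-suc P i)) (s≤s g)))
      beyond : ∀ r → P + i < r → e r ≡ d r
      beyond r h = (lia ((e r) ∷ (ind q m' r) ∷ (d r) ∷ (ind P (suc i) r) ∷ []) (v0 ⊕ v1 ≛ v2 ⊕ v3 ∷ v1 ≛ li 0 ∷ v3 ≛ li 0 ∷ []) (v0 ≛ v2) ((1 ∷ 1 ∷ 0 ∷ 0 ∷ 0 ∷ 1 ∷ []) , (1 ∷ 0 ∷ 1 ∷ 1 ∷ [])))
        (eS-spec P (suc i) q m' r) (q-out m' ≤-refl r (far r (≤-trans (m≤m+n P i) (<⇒≤ h)))) (ind-high P (suc i) r (subst (_≤ r) (sym (+-suc P i)) h))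
      before : ∀ r → r < P → (e r ≡ d r × d r ≢ suc (y + i)) ⊎ (e r ≤ y + i × d r ≤ suc (y + i))
      before r h with in-q m' ≤-refl r
      ... | inj₁ (a , b , x) = inj₂ ((lia ((e r) ∷ (ind q m' r) ∷ (d r) ∷ (ind P (suc i) r) ∷ y ∷ i ∷ []) (v0 ⊕ v1 ≛ v2 ⊕ v3 ∷ v1 ≛ li 1 ∷ v3 ≛ li 0 ∷ v2 ≼ su (v4 ⊕ v5) ∷ []) (v0 ≼ v4 ⊕ v5) ((1 ∷ 1 ∷ 0 ∷ 0 ∷ 1 ∷ 1 ∷ 0 ∷ 1 ∷ []) , []))
            (eS-spec P (suc i) q m' r) (ind-in q m' r a b) (ind-low P (suc i) r h) x , x)
      ... | inj₂ (z , o) = inj₁ ((lia ((e r) ∷ (ind q m' r) ∷ (d r) ∷ (ind P (suc i) r) ∷ []) (v0 ⊕ v1 ≛ v2 ⊕ v3 ∷ v1 ≛ li 0 ∷ v3 ≛ li 0 ∷ []) (v0 ≛ v2) ((1 ∷ 1 ∷ 0 ∷ 0 ∷ 0 ∷ 1 ∷ []) , (1 ∷ 0 ∷ 1 ∷ 1 ∷ [])))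
            (eS-spec P (suc i) q m' r) z (ind-low P (suc i) r h) , λ x → outside o (freeY r x))
        where
        outside : r < q ⊎ q + m' ≤ r → q ≤ r × r < q + m' → ⊥
        outside (inj₁ a) (b , _) = <⇒≱ a b
        outside (inj₂ a) (_ , b) = <⇒≱ b a

    ν-flat : ∀ t → t ≤ m → ν (Z t) ≡ ν (suc (Z t))
    ν-flat t h = (lia ((d (Z t)) ∷ (ν (Z t)) ∷ k ∷ (Z t) ∷ (d (suc (Z t))) ∷ (ν (suc (Z t))) ∷ x ∷ []) (v0 ⊕ v1 ≛ su (v2 ⊕ v3) ∷ v4 ⊕ v5 ≛ su (v2 ⊕ (su v3)) ∷ v0 ≛ v6 ∷ v4 ≛ su v6 ∷ []) (v1 ≛ v5) ((1 ∷ 1 ∷ 0 ∷ 0 ∷ 1 ∷ 0 ∷ 1 ∷ 1 ∷ []) , (1 ∷ 0 ∷ 1 ∷ 1 ∷ 0 ∷ 1 ∷ 0 ∷ 0 ∷ 1 ∷ [])))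
      (code (Z t)) (code (suc (Z t))) (blk t h) (blk' t h)
      where
      x : ℕ
      x = it d (suc t) y + i

    Z-far : ∀ t → t ≤ m → suc (y + i) < d (Z t)
    Z-far t h = <-≤-trans (first t) (≤-trans (m≤m+n _ i) (≤-reflexive (sym (blk t h))))

    -- In a full row d z = z + 1, so its block would touch the next one, against the separation.
    -- Hence all exchanges of the ladder happen where S is antisymmetric.
    i0≤Z : ∀ t → t ≤ m → i0 ≤ Z t
    i0≤Z t h with t ≟ m | Z t <? i0
    ... | yes refl | _ = ≤-trans i0≤P (m≤m+n _ i)
    ... | no ne | no b = ≮⇒≥ b
    ... | no ne | yes b = ⊥-elim ((lia ((it d t y) ∷ i ∷ (it d (suc t) y) ∷ (d (Z t)) ∷ []) (su (v0 ⊕ v1) ≺ v2 ∷ v3 ≛ v2 ⊕ v1 ∷ v3 ≛ su (v0 ⊕ v1) ∷ []) (ff) ((1 ∷ 0 ∷ 1 ∷ 1 ∷ []) , []))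
            (sep t h) (blk t h) (full (Z t) b))

    antis : suc (P + i) < ℓ → ∀ t → t ≤ m → AntiAt S (Z t)
    antis pl t h = anti (Z t) (i0≤Z t h) (≤-<-trans (s≤s (+-monoˡ-≤ i (it-le y h))) pl)

    weights : ∀ m″ → m″ ≤ m' → suc (P + i) < ℓ → Weights {ℓ} {Z} S (γS P (suc i) q m″) m
    weights m″ hm pl = record
      { anti = antis pl
      ; rise = γS-rise P (suc i) q m″ (Z m) (suc (Z m)) ((lia ((ν (Z m)) ∷ (ν (suc (Z m))) ∷ (low (Z m)) ∷ (low (suc (Z m))) ∷ (ind q m″ (Z m)) ∷ (ind q m″ (suc (Z m))) ∷ (ind P (suc i) (Z m)) ∷ (ind P (suc i) (suc (Z m))) ∷ []) (v0 ≛ v1 ∷ v2 ≛ v3 ∷ v4 ≛ li 0 ∷ v5 ≛ li 0 ∷ v6 ≛ li 1 ∷ v7 ≛ li 0 ∷ []) (v1 ⊕ v5 ⊕ (v2 ⊕ v6) ≛ su (v0 ⊕ v4 ⊕ (v3 ⊕ v7))) ((1 ∷ 0 ∷ 1 ∷ 1 ∷ 0 ∷ 0 ∷ 0 ∷ 1 ∷ 0 ∷ 1 ∷ []) , (1 ∷ 1 ∷ 0 ∷ 0 ∷ 1 ∷ 1 ∷ 0 ∷ 0 ∷ 0 ∷ 0 ∷ 1 ∷ 1 ∷ [])))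
            (ν-flat m ≤-refl) (lowU m ≤-refl) (q-out m″ hm _ (Z-far m ≤-refl)) (q-out m″ hm _ (<-trans (Z-far m ≤-refl) (mono _)))
            (ind-in P (suc i) (Z m) (m≤m+n P i) (+-monoʳ-< P (n<1+n i))) (ind-high P (suc i) (suc (Z m)) (≤-reflexive (+-suc P i))))
      ; flat = λ t t<m → let lt = <-≤-trans (sep t (<⇒≤ t<m)) (it-le y t<m) in γS-flat P (suc i) q m″ (Z t) (suc (Z t)) ((lia ((ν (Z t)) ∷ (ν (suc (Z t))) ∷ (low (Z t)) ∷ (low (suc (Z t))) ∷ (ind q m″ (Z t)) ∷ (ind q m″ (suc (Z t))) ∷ (ind P (suc i) (Z t)) ∷ (ind P (suc i) (suc (Z t))) ∷ []) (v0 ≛ v1 ∷ v2 ≛ v3 ∷ v4 ≛ li 0 ∷ v5 ≛ li 0 ∷ v6 ≛ li 0 ∷ v7 ≛ li 0 ∷ []) (v0 ⊕ v4 ⊕ (v3 ⊕ v7) ≛ v1 ⊕ v5 ⊕ (v2 ⊕ v6)) ((1 ∷ 1 ∷ 0 ∷ 0 ∷ 1 ∷ 1 ∷ 0 ∷ 0 ∷ 0 ∷ 0 ∷ 0 ∷ 1 ∷ []) , (1 ∷ 0 ∷ 1 ∷ 1 ∷ 0 ∷ 0 ∷ 0 ∷ 1 ∷ 0 ∷ 1 ∷ [])))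
            (ν-flat t (<⇒≤ t<m)) (lowU t (<⇒≤ t<m)) (q-out m″ hm _ (Z-far t (<⇒≤ t<m))) (q-out m″ hm _ (<-trans (Z-far t (<⇒≤ t<m)) (mono _)))
            (ind-low P (suc i) (Z t) (<-trans (n<1+n _) lt)) (ind-low P (suc i) (suc (Z t)) lt))
      }

    -- Row u starts too early to belong to a pair and row x lies below the last pair, so the shift
    -- is invisible to the ladder.
    off-weights : ∀ {γ} u x → d u ≡ suc (y + i) → suc (P + i) < x → Weights {ℓ} {Z} S γ m → Weights {ℓ} {Z} S (R (u , x) γ) m
    off-weights {γ} u x du hx w = record
      { anti = Weights.anti w
      ; rise = same _ (<-trans (Z-far m ≤-refl) (mono _)) ≤-refl ∙ Weights.rise w ∙ cong (λ v → + 1 ℤ.+ v) (sym (same _ (Z-far m ≤-refl) (n≤1+n _)))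
      ; flat = λ t t<m → same _ (Z-far t (<⇒≤ t<m)) (≤-trans (n≤1+n _) (s≤s (le t t<m))) ∙ Weights.flat w t t<m
          ∙ sym (same _ (<-trans (Z-far t (<⇒≤ t<m)) (mono _)) (s≤s (le t t<m)))
      }
      where
      le : ∀ t → t < m → Z t ≤ P + i
      le t t<m = +-monoˡ-≤ i (it-le y (<⇒≤ t<m))
      same : ∀ r → suc (y + i) < d r → r ≤ suc (P + i) → R (u , x) γ r ≡ γ r
      same r a b = R-off u x γ r (λ { refl → <⇒≢ a (sym du) }) (<⇒≢ (≤-<-trans b hx))

  module Column (p0 c : ℕ) (i0≤P : i0 ≤ it d c p0) (top-p0 : ∀ r → d r ≢ p0)
    (lowU : ∀ z → i0 ≤ z → (∀ m → m ≤ c → it d m p0 ≢ suc z) → low z ≡ low (suc z)) where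
    P : ℕ
    P = it d c p0

    open Tower

    Up : ℕ → ℕ → Set
    Up i j = d (suc (it d j p0 + i)) ≡ suc (it d (suc j) p0 + i)

    -- The chain is followed upwards from the bottom block. If the row after block j + 1 is an
    -- image, strict monotonicity leaves only the row after block j as its preimage; otherwise the
    -- ladder has its free end there.
    find : ∀ {i q} → Tower d p0 c i q → ∀ j → j ≤ c → (∀ j' → j ≤ j' → j' ≤ c → Up i j') →
      (∃ λ b → b ≤ c × (∀ j' → b ≤ j' → j' ≤ c → Up i j') × (∀ r → d r ≢ suc (it d b p0 + i)))
      ⊎ ((∀ j' → j' ≤ c → Up i j') × ∃ λ u → d u ≡ suc (p0 + i))
    find {i} tw j jc h with preimage? (suc (it d j p0 + i))
    find {i} tw j jc h | inj₂ no-row = inj₁ (j , jc , h , no-row)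
    find {i} tw zero jc h | inj₁ u = inj₂ ((λ j' → h j' z≤n) , u)
    find {i} tw (suc j) jc h | inj₁ (u , du) = find tw j (<⇒≤ jc) h'
      where
      base : d (it d j p0 + i) ≡ it d (suc j) p0 + i
      base = blk tw j i (<⇒≤ jc) ≤-refl
      level : Up i j
      level = ≤-antisym
        (≤-trans (d-le (d-lt⁻¹ (≤-trans (≤-reflexive (cong suc base)) (≤-reflexive (sym du))))) (≤-reflexive du))
        (≤-trans (≤-reflexive (cong suc (sym base))) (mono _))
      h' : ∀ j' → j ≤ j' → j' ≤ c → Up i j'
      h' j' a b with j ≟ j'
      ... | yes refl = level
      ... | no ne = h j' (≤∧≢⇒< a ne) b

    it≢ : ∀ {i} t → suc (it d t p0 + i) < it d (suc t) p0 → ∀ m → m ≤ c → it d m p0 ≢ suc (it d t p0 + i)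
    it≢ {i} t sp m mc e with m ≤? t
    ... | yes q = <⇒≢ (s≤s (≤-trans (it-le p0 q) (m≤m+n _ i))) e
    ... | no q = <⇒≢ (<-≤-trans sp (it-le p0 (≰⇒> q))) (sym e)

    -- The bottom block touches its image, so pairs in successive blocks would overlap and no ladder
    -- is available. Here the last row of the block and the next one already have equal starts and
    -- no obstruction, and one exchange suffices.
    vanish-no-room : ∀ i q → Tower d p0 c i q → suc (P + i) < ℓ → Up i c → it d (suc c) p0 ≤ suc (P + i) →
      ∀ n → H (eS P (suc i) q i) (γS P (suc i) q i) n ≡ + 0
    vanish-no-room i q tw pl upc h n = H-vanish e z (γS P (suc i) q i) pl (anti z (≤-trans i0≤P (m≤m+n P i)) pl) level free rise n
      where
      z : ℕ
      z = P + i
      e : ℕ → ℕ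
      e = eS P (suc i) q i
      dP : d P ≡ suc z
      dP = ≤-antisym h (sep tw)
      q-out : ∀ r → d P ≤ d r → ind q i r ≡ 0
      q-out r g with r <? q | r <? q + i
      ... | yes a | _ = ind-low q i r a
      ... | no a | no b = ind-high q i r (≮⇒≥ b)
      ... | no a | yes b = ⊥-elim (<⇒≱ (s≤s (≤-trans (≤-reflexive (cong d (sym (m+[n∸m]≡n (≮⇒≥ a))) ∙ rais tw (r ∸ q) r-q<i))
             (≤-trans (+-monoʳ-≤ p0 r-q<i) (+-monoˡ-≤ i (it-le {0} {c} p0 z≤n))))) (≤-trans (≤-reflexive (sym dP)) g))
        where
        r-q<i : r ∸ q < i
        r-q<i = +-cancelˡ-< q _ _ (subst (_< q + i) (sym (m+[n∸m]≡n (≮⇒≥ a))) b)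
      at-e : ∀ r → P ≤ r → r ≤ z → e r ≡ suc (d r)
      at-e r a b = (lia ((e r) ∷ (ind q i r) ∷ (d r) ∷ (ind P (suc i) r) ∷ []) (v0 ⊕ v1 ≛ v2 ⊕ v3 ∷ v1 ≛ li 0 ∷ v3 ≛ li 1 ∷ []) (v0 ≛ su v2) ((1 ∷ 1 ∷ 0 ∷ 0 ∷ 0 ∷ 1 ∷ []) , (1 ∷ 0 ∷ 1 ∷ 1 ∷ 0 ∷ 0 ∷ 1 ∷ [])))
        (eS-spec P (suc i) q i r) (q-out r (d-le a)) (ind-in P (suc i) r a (subst (r <_) (sym (+-suc P i)) (s≤s b)))
      after-e : ∀ r → z < r → e r ≡ d r
      after-e r a = (lia ((e r) ∷ (ind q i r) ∷ (d r) ∷ (ind P (suc i) r) ∷ []) (v0 ⊕ v1 ≛ v2 ⊕ v3 ∷ v1 ≛ li 0 ∷ v3 ≛ li 0 ∷ []) (v0 ≛ v2) ((1 ∷ 1 ∷ 0 ∷ 0 ∷ 0 ∷ 1 ∷ []) , (1 ∷ 0 ∷ 1 ∷ 1 ∷ [])))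
        (eS-spec P (suc i) q i r) (q-out r (d-le (≤-trans (m≤m+n P i) (<⇒≤ a)))) (ind-high P (suc i) r (subst (_≤ r) (sym (+-suc P i)) a))
      level : e z ≡ e (suc z)
      level = at-e z (m≤m+n P i) ≤-refl ∙ cong suc (blk tw c i ≤-refl ≤-refl) ∙ sym upc ∙ sym (after-e (suc z) ≤-refl)
      free : Free ℓ e (suc z)
      free r _ x with r <? P | r ≤? z
      ... | yes a | _ = <⇒≢ (≤-<-trans ((lia ((e r) ∷ (ind q i r) ∷ (d r) ∷ (ind P (suc i) r) ∷ []) (v0 ⊕ v1 ≛ v2 ⊕ v3 ∷ v3 ≛ li 0 ∷ []) (v0 ≼ v2) ((1 ∷ 1 ∷ 0 ∷ 1 ∷ []) , []))
               (eS-spec P (suc i) q i r) (ind-low P (suc i) r a)) (subst (d r <_) dP (d-lt a))) x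
      ... | no a | yes b = >⇒≢ (subst₂ _<_ dP (sym (at-e r (≮⇒≥ a) b)) (s≤s (d-le (≮⇒≥ a)))) x
      ... | no a | no b = >⇒≢ (subst₂ _<_ dP (sym (after-e r (≰⇒> b))) (d-lt (≤-<-trans (m≤m+n P i) (≰⇒> b)))) x
      rise : γS P (suc i) q i (suc z) ≡ + 1 ℤ.+ γS P (suc i) q i z
      rise = γS-rise P (suc i) q i z (suc z) ((lia ((d z) ∷ (ν z) ∷ k ∷ z ∷ (d (suc z)) ∷ (ν (suc z)) ∷ x ∷ (low z) ∷ (low (suc z)) ∷ (ind q i z) ∷ (ind q i (suc z)) ∷ (ind P (suc i) z) ∷ (ind P (suc i) (suc z)) ∷ []) (v0 ⊕ v1 ≛ su (v2 ⊕ v3) ∷ v4 ⊕ v5 ≛ su (v2 ⊕ (su v3)) ∷ v0 ≛ v6 ∷ v4 ≛ su v6 ∷ v7 ≛ v8 ∷ v9 ≛ li 0 ∷ v10 ≛ li 0 ∷ v11 ≛ li 1 ∷ v12 ≛ li 0 ∷ []) (v5 ⊕ v10 ⊕ (v7 ⊕ v11) ≛ su (v1 ⊕ v9 ⊕ (v8 ⊕ v12))) ((1 ∷ 0 ∷ 1 ∷ 1 ∷ 0 ∷ 1 ∷ 0 ∷ 0 ∷ 1 ∷ 1 ∷ 0 ∷ 0 ∷ 0 ∷ 1 ∷ 0 ∷ 1 ∷ []) , (1 ∷ 1 ∷ 0 ∷ 0 ∷ 1 ∷ 0 ∷ 1 ∷ 1 ∷ 0 ∷ 0 ∷ 1 ∷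 1 ∷ 0 ∷ 0 ∷ 0 ∷ 0 ∷ 1 ∷ 1 ∷ [])))
            (code z) (code (suc z)) (blk tw c i ≤-refl ≤-refl) upc
            (lowU z (≤-trans i0≤P (m≤m+n P i)) (λ m mc → <⇒≢ (s≤s (≤-trans (it-le p0 mc) (m≤m+n P i)))))
            (q-out z (d-le (m≤m+n P i))) (q-out (suc z) (d-le (≤-trans (m≤m+n P i) (n≤1+n _))))
            (ind-in P (suc i) z (m≤m+n P i) (+-monoʳ-< P (n<1+n i))) (ind-high P (suc i) (suc z) (≤-reflexive (+-suc P i))))
        where
        x : ℕ
        x = it d (suc c) p0 + i

    -- Adding one row to each of the c + 1 blocks is one climb over c + 1 pairs, which explains the
    -- exponent. `Stuck` couples the vanishing with the nonexistence of a taller tower, since both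
    -- sides of the Pieri rule must fail together.
    Grown : ℕ → ℕ → Set
    Grown i q = ∃ λ q' → Tower d p0 c (suc i) q' × (∀ n → H (eS P (suc i) q i) (γS P (suc i) q i) n
      ≡ shN (suc c) (H (eS P (suc (suc i)) q' (suc i)) (γS P (suc (suc i)) q' (suc i))) n)

    Stuck : ℕ → ℕ → Set
    Stuck i q = (∀ n → H (eS P (suc i) q i) (γS P (suc i) q i) n ≡ + 0) × (∀ q' → Tower d p0 c (suc i) q' → ⊥)

    module Room (i q : ℕ) (tw : Tower d p0 c i q) (pl : suc (P + i) < ℓ)
      (room : suc (P + i) < it d (suc c) p0) where

      seps-from : ∀ b → (∀ j' → b ≤ j' → j' ≤ c → Up i j') → ∀ j → b ≤ j → j ≤ c → suc (it d j p0 + i) < it d (suc j) p0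
      seps-from b ups j bj jc = down (c ∸ j) j (m+[n∸m]≡n jc) bj
        where
        down : ∀ t j → j + t ≡ c → b ≤ j → suc (it d j p0 + i) < it d (suc j) p0
        down zero j refl _ = subst (λ x → suc (it d x p0 + i) < it d (suc x) p0) (+-identityʳ j) room
        down (suc t) j refl bj = d-lt⁻¹ (subst (_< it d (suc (suc j)) p0) (sym (ups j bj (m≤m+n j (suc t))))
          (down t (suc j) (sym (+-suc j t)) (m≤n⇒m≤1+n bj)))

      low-pair : ∀ t → suc (it d t p0 + i) < it d (suc t) p0 → i0 ≤ it d t p0 + i → low (it d t p0 + i) ≡ low (suc (it d t p0 + i))
      low-pair t sp h = lowU (it d t p0 + i) h (it≢ t sp)

      i0≤Zj : ∀ j → j ≤ c → suc (it d j p0 + i) < it d (suc j) p0 → i0 ≤ it d j p0 + i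
      i0≤Zj j h sp with j ≟ c | it d j p0 + i <? i0
      ... | yes refl | _ = ≤-trans i0≤P (m≤m+n _ i)
      ... | no _ | no g = ≮⇒≥ g
      ... | no _ | yes g = ⊥-elim ((lia (x ∷ i ∷ x' ∷ (d (x + i)) ∷ []) (su (v0 ⊕ v1) ≺ v2 ∷ v3 ≛ v2 ⊕ v1 ∷ v3 ≛ su (v0 ⊕ v1) ∷ []) (ff) ((1 ∷ 0 ∷ 1 ∷ 1 ∷ []) , []))
              sp (blk tw j i h ≤-refl) (full _ g))
        where
        x = it d j p0
        x' = it d (suc j) p0

      -- The row missing from the image of d at block b frees the top of the ladder over the blocks
      -- b, ..., c, so the function vanishes. The same missing row is one that a taller tower would
      -- have to hit.
      stuck : ∀ b → b ≤ c → (∀ j' → b ≤ j' → j' ≤ c → Up i j') → (∀ r → d r ≢ suc (it d b p0 + i)) → Stuck i q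
      stuck b bc ups none = subst (λ P → ∀ n → H (eS P (suc i) q i) (γS P (suc i) q i) n ≡ + 0) (sym P≡)
            (ladder-vanish m (eS (it d m y) (suc i) q i) _ Pr.ladder (subst (λ P → suc (P + i) < ℓ) P≡ pl)
              (Pr.weights i ≤-refl (subst (λ P → suc (P + i) < ℓ) P≡ pl)))
        , no-tower b bc none
        where
        y m : ℕ
        y = it d b p0
        m = c ∸ b
        m+b : m + b ≡ c
        m+b = m∸n+n≡m bc
        P≡ : P ≡ it d m y
        P≡ = cong (λ x → it d x p0) (sym m+b) ∙ it-+ m b p0
        along : (f : ℕ → ℕ → Set) → (∀ j → j ≤ c → b ≤ j → f (it d j p0) (it d (suc j) p0)) → ∀ t → t ≤ m → f (it d t y) (it d (suc t) y)
        along f h t tm = subst (λ x → f x (d x)) (it-+ t b p0) (h (t + b) (subst (t + b ≤_) m+b (+-monoˡ-≤ b tm)) (m≤n+m b t))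
        no-tower : ∀ b → b ≤ c → (∀ r → d r ≢ suc (it d b p0 + i)) → ∀ q' → Tower d p0 c (suc i) q' → ⊥
        no-tower zero _ n q' tw' = n (q' + i) (rais tw' i (n<1+n i) ∙ +-suc p0 i)
        no-tower (suc b) h n q' tw' = n _ (blk tw' b (suc i) (<⇒≤ h) ≤-refl ∙ +-suc _ i)
        module Pr = Pair y m i q i
          (along (λ x x' → suc (x + i) < x') (λ j h g → seps-from b ups j g h))
          (along (λ x x' → d (x + i) ≡ x' + i) (λ j h _ → blk tw j i h ≤-refl))
          (along (λ x x' → d (suc (x + i)) ≡ suc (x' + i)) (λ j h g → ups j g h))
          (subst (i0 ≤_) P≡ i0≤P)
          (λ i' h → ≤-trans (≤-reflexive (rais tw i' h)) (≤-trans (≤-trans (+-monoʳ-≤ p0 h) (n≤1+n _)) (s≤s (+-monoˡ-≤ i (it-le {0} {b} p0 z≤n)))))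
          (λ r e → ⊥-elim (none r e))
          (along (λ x _ → low (x + i) ≡ low (suc (x + i))) (λ j h g → low-pair j (seps-from b ups j g h) (i0≤Zj j h (seps-from b ups j g h))))

      module Success (ups : ∀ j' → j' ≤ c → Up i j') (q' : ℕ) (rais' : ∀ i' → i' < suc i → d (q' + i') ≡ p0 + suc i')
        (ind-q : ∀ r → ind q' i r ≡ ind q i r) where
        seps' : ∀ j → j ≤ c → suc (it d j p0 + i) < it d (suc j) p0
        seps' j = seps-from 0 (λ j' _ → ups j') j z≤n
        u v : ℕ
        u = q' + i
        v = suc (P + i)
        e : ℕ → ℕ
        e = eS P (suc i) q' (suc i)
        γ : W
        γ = γS P (suc i) q' i

        du : d u ≡ suc (p0 + i)
        du = rais' i (n<1+n i) ∙ +-suc p0 i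

        u<p0 : u < p0
        u<p0 = d-lt⁻¹ (subst (_< d p0) (sym du) (seps' 0 z≤n))

        module Pr = Pair p0 c i q' (suc i) seps' (λ t h → blk tw t i h ≤-refl) ups i0≤P
          (λ i' h → ≤-trans (≤-reflexive (rais' i' h)) (≤-trans (+-monoʳ-≤ p0 h) (≤-reflexive (+-suc p0 i))))
          (λ r x → subst (λ y → q' ≤ y × y < q' + suc i) (sym (d-inj (x ∙ sym du))) (m≤m+n q' i , +-monoʳ-< q' (n<1+n i)))
          (λ t h → low-pair t (seps' t h) (i0≤Zj t h (seps' t h)))

        wts : Weights {ℓ} {Pr.Z} S γ c
        wts = Pr.weights i (n≤1+n i) pl

        e-u : e u ≡ p0 + i
        e-u = (lia ((e u) ∷ (ind q' (suc i) u) ∷ (d u) ∷ (ind P (suc i) u) ∷ p0 ∷ i ∷ []) (v0 ⊕ v1 ≛ v2 ⊕ v3 ∷ v1 ≛ li 1 ∷ v3 ≛ li 0 ∷ v2 ≛ su (v4 ⊕ v5) ∷ []) (v0 ≛ v4 ⊕ v5) ((1 ∷ 1 ∷ 0 ∷ 0 ∷ 1 ∷ 1 ∷ 0 ∷ 1 ∷ []) , (1 ∷ 0 ∷ 1 ∷ 1 ∷ 0 ∷ 0 ∷ 0 ∷ 0 ∷ 1 ∷ [])))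
          (eS-spec P (suc i) q' (suc i) u) (ind-in q' (suc i) u (m≤m+n q' i) (+-monoʳ-< q' (n<1+n i)))
          (ind-low P (suc i) u (<-≤-trans u<p0 (it-le {0} {c} p0 z≤n))) du

        e-v : e v ≡ d v
        e-v = (lia ((e v) ∷ (ind q' (suc i) v) ∷ (d v) ∷ (ind P (suc i) v) ∷ []) (v0 ⊕ v1 ≛ v2 ⊕ v3 ∷ v1 ≛ li 0 ∷ v3 ≛ li 0 ∷ []) (v0 ≛ v2) ((1 ∷ 1 ∷ 0 ∷ 0 ∷ 0 ∷ 1 ∷ []) , (1 ∷ 0 ∷ 1 ∷ 1 ∷ [])))
          (eS-spec P (suc i) q' (suc i) v) (Pr.q-out (suc i) ≤-refl v (Pr.far v (≤-trans (m≤m+n P i) (n≤1+n _))))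
          (ind-high P (suc i) v (≤-reflexive (+-suc P i)))

        -- In `e` row u has been lowered already, which is the ideal that `ladder-climb` starts
        -- from; the ideal of the current stage has that one root less.
        start : ∀ r → eS P (suc i) q i r ≡ inc u e r
        start r = (lia (e₀ ∷ (ind q i r) ∷ (d r) ∷ (ind P (suc i) r) ∷ (e r) ∷ (ind q' i r) ∷ (ι r (q' + i)) ∷ []) (v0 ⊕ v1 ≛ v2 ⊕ v3 ∷ v4 ⊕ (v5 ⊕ v6) ≛ v2 ⊕ v3 ∷ v5 ≛ v1 ∷ []) (v0 ≛ v6 ⊕ v4) ((1 ∷ 1 ∷ 0 ∷ 0 ∷ 1 ∷ 1 ∷ []) , (1 ∷ 0 ∷ 1 ∷ 1 ∷ 0 ∷ 0 ∷ 1 ∷ [])))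
          (eS-spec P (suc i) q i r) (eS-spec P (suc i) q' (suc i) r) (ind-q r)
          where
          e₀ : ℕ
          e₀ = eS P (suc i) q i r

        finish : ∀ r → inc v e r ≡ eS P (suc (suc i)) q' (suc i) r
        finish r = (lia (e₁ ∷ (ind q' i r) ∷ (ι r (q' + i)) ∷ (d r) ∷ (ind P (suc i) r) ∷ (ι r (P + suc i)) ∷ (e r) ∷ (ι r v) ∷ []) (v0 ⊕ (v1 ⊕ v2) ≛ v3 ⊕ (v4 ⊕ v5) ∷ v6 ⊕ (v1 ⊕ v2) ≛ v3 ⊕ v4 ∷ v5 ≛ v7 ∷ []) (v7 ⊕ v6 ≛ v0) ((1 ∷ 0 ∷ 1 ∷ 1 ∷ 0 ∷ 0 ∷ 1 ∷ []) , (1 ∷ 1 ∷ 0 ∷ 0 ∷ 1 ∷ 1 ∷ [])))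
          (eS-spec P (suc (suc i)) q' (suc i) r) (eS-spec P (suc i) q' (suc i) r) (cong (ι r) (+-suc P i))
          where
          e₁ : ℕ
          e₁ = eS P (suc (suc i)) q' (suc i) r

        γ-start : ∀ r → γS P (suc i) q i r ≡ γ r
        γ-start r = cong (λ x → + (ν r + x) ℤ.- + (low r + ind P (suc i) r)) (sym (ind-q r))

        γ-finish : ∀ r → R (u , v) γ r ≡ γS P (suc (suc i)) q' (suc i) r
        γ-finish r = R-wt u v (λ r → ν r + ind q' i r) (λ r → low r + ind P (suc i) r) r
          ∙ diff-eq (ν r + ind q' i r + ι r u) (low r + ind P (suc i) r + ι r v) (ν r + ind q' (suc i) r) (low r + ind P (suc (suc i)) r) ((lia ((ι r (P + suc i)) ∷ (ι r v) ∷ (ν r) ∷ (ind q' i r) ∷ (ι r u) ∷ (low r) ∷ (ind P (suc i) r) ∷ []) (v0 ≛ v1 ∷ []) (v2 ⊕ v3 ⊕ v4 ⊕ (v5 ⊕ (v6 ⊕ v0)) ≛ v2 ⊕ (v3 ⊕ v4) ⊕ (v5 ⊕ v6 ⊕ v1)) ((1 ∷ 1 ∷ []) , (1 ∷ 0 ∷ 1 ∷ []))) (cong (ι r) (+-suc P i)))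

        -- The extra term of the removed root (v , d v) vanishes: for it d the ladder has a free end.
        removed : ∀ n → H e (R (u , v) γ) n ≡ H (inc v e) (R (u , v) γ) n
        removed n with d v <? ℓ
        ... | no h = H-out e v _ (subst (ℓ ≤_) (sym e-v) (≮⇒≥ h)) n
        ... | yes h = H-remove e v _ pl (subst (_< ℓ) (sym e-v) h) n
            ∙ cong (λ x → H (inc v e) (R (u , v) γ) n ℤ.+ x) (sh-cong (λ n → H-cong {e} (λ _ _ → refl) (λ r _ → merge r) n
                ∙ ladder-vanish c e (R (u , e v) γ) Pr.ladder pl
                    (Pr.off-weights u (e v) du (subst (v <_) (sym e-v) (up v)) wts) n) n ∙ shN-0 1 n)
            ∙ ℤP.+-identityʳ _
          where
          merge : ∀ r → R (v , e v) (R (u , v) γ) r ≡ R (u , e v) γ r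
          merge r = R-comm (v , e v) (u , v) γ r ∙ R-join u v (e v) γ r

        grown : Grown i q
        grown = q' , tower , λ n → H-cong (λ r _ → start r) (λ r _ → γ-start r) n
          ∙ ladder-climb c e γ u Pr.ladder pl wts (<-≤-trans u<p0 (m≤m+n p0 i)) e-u n
          ∙ shN-cong (suc c) (λ n → removed n ∙ H-cong (λ r _ → finish r) (λ r _ → γ-finish r) n) n
          where
          blks : ∀ j i' → j ≤ c → i' ≤ suc i → d (it d j p0 + i') ≡ it d (suc j) p0 + i'
          blks j i' a b with i' ≟ suc i
          ... | yes refl = cong d (+-suc _ i) ∙ ups j a ∙ sym (+-suc _ i)
          ... | no ne = blk tw j i' a (ℕ.s≤s⁻¹ (≤∧≢⇒< b ne))
          tower : Tower d p0 c (suc i) q'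
          tower = record { top = top-p0 ; blk = blks ; sep = subst (_< it d (suc c) p0) (sym (+-suc P i)) (seps' c ≤-refl) ; rais = rais' }

      -- At i = 0 the raised rows form an empty interval and its position is fixed only now. Later
      -- the new row is forced to be q + i because d is strictly increasing.
      pick : ∀ {i q} → Tower d p0 c i q → ∀ u → d u ≡ suc (p0 + i) →
        ∃ λ q' → (∀ i' → i' < suc i → d (q' + i') ≡ p0 + suc i') × (∀ r → ind q' i r ≡ ind q i r)
      pick {zero} tw u du = u , (λ { zero _ → cong d (+-identityʳ u) ∙ du ∙ sym (+-suc p0 0) ; (suc _) (s≤s ()) }) , (λ r → refl)
      pick {suc i} {q} tw u du = q , go , (λ r → refl)
        where
        base : d (q + i) ≡ suc (p0 + i)
        base = rais tw i (n<1+n i) ∙ +-suc p0 i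
        du' : d u ≡ suc (suc (p0 + i))
        du' = du ∙ cong suc (+-suc p0 i)
        next : d (suc (q + i)) ≡ suc (suc (p0 + i))
        next = ≤-antisym (≤-trans (d-le (d-lt⁻¹ (subst₂ _<_ (sym base) (sym du') ≤-refl))) (≤-reflexive du'))
                         (subst (_< d (suc (q + i))) base (mono _))
        go : ∀ i' → i' < suc (suc i) → d (q + i') ≡ p0 + suc i'
        go i' h with i' ≟ suc i
        ... | yes refl = cong d (+-suc q i) ∙ next ∙ cong suc (sym (+-suc p0 i)) ∙ sym (+-suc p0 (suc i))
        ... | no ne = rais tw i' (≤∧≢⇒< (ℕ.s≤s⁻¹ h) ne)

    advance : ∀ i q → Tower d p0 c i q → suc (P + i) < ℓ → Up i c → Grown i q ⊎ Stuck i q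
    advance i q tw pl upc with suc (P + i) <? it d (suc c) p0
    ... | no h = inj₂ (vanish-no-room i q tw pl upc (≮⇒≥ h) ,
            λ q' tw' → h (subst (_< it d (suc c) p0) (+-suc P i) (sep tw')))
    ... | yes h = go (find tw c ≤-refl (λ j' a b → subst (Up i) (≤-antisym a b) upc))
      where
      go : _ → Grown i q ⊎ Stuck i q
      go (inj₁ (b , bc , ups , none)) = inj₂ (Room.stuck i q tw pl h b bc ups none)
      go (inj₂ (ups , u , du)) with Room.pick i q tw pl h tw u du
      ... | q' , rais' , ind-q = inj₁ (Room.Success.grown i q tw pl h ups q' rais' ind-q)

    -- `Q` is the initial stage: row P alone has lost a box and its first root. In `Found` every one
    -- of the i enlargements contributes t^(c + 1), so the exponent is the number of ribbons times
    -- their height minus one.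
    Found Absent : Set
    Q : Ser
    Q = H (eS P 1 0 0) (γS P 1 0 0)
    Found = ∃ λ i → ∃ λ q → Tower d p0 c i q × Last d p0 c i × P + i < ℓ ×
      (∀ n → Q n ≡ shN (i * suc c) (H (eS P (suc i) q i) (γS P (suc i) q i)) n)
    Absent = (∀ n → Q n ≡ + 0) × (∀ i q → Tower d p0 c i q → Last d p0 c i → ⊥)

    -- Enlarging must end before row ℓ: while it is possible, ν is constant on the bottom block and
    -- the row after it, and it is positive at P but zero from ℓ on. This justifies the fuel ℓ ∸ P.
    decide : P < ℓ → 0 < ν P → (∀ r → ℓ ≤ r → ν r ≡ 0) → Found ⊎ Absent
    decide P<ℓ νP>0 ν-out = go (ℓ ∸ P) 0 0 (≤-reflexive (sym (cong (_+ (ℓ ∸ P)) (+-identityʳ P) ∙ m+[n∸m]≡n (<⇒≤ P<ℓ))))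
        tower₀ (subst (_< ℓ) (sym (+-identityʳ P)) P<ℓ) (λ n → refl)
      where
      tower₀ : Tower d p0 c 0 0
      tower₀ = record { top = top-p0 ; blk = λ { j zero _ _ → cong d (+-identityʳ _) ∙ sym (+-identityʳ _) }
        ; sep = subst (_< d P) (sym (+-identityʳ P)) (up P) ; rais = λ _ () }
      go : ∀ f i q → ℓ ≤ P + i + f → Tower d p0 c i q → P + i < ℓ →
        (∀ n → Q n ≡ shN (i * suc c) (H (eS P (suc i) q i) (γS P (suc i) q i)) n) → Found ⊎ Absent
      go f i q lf tw pl hq with d (suc (P + i)) ≟ suc (it d (suc c) p0 + i)
      go f i q lf tw pl hq | no last = inj₁ (i , q , tw , last , pl , hq)
      go zero i q lf tw pl hq | yes e = ⊥-elim (<⇒≱ pl (subst (ℓ ≤_) (+-identityʳ _) lf))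
      go (suc f) i q lf tw pl hq | yes e with suc (P + i) <? ℓ
      ... | no out = ⊥-elim ((lia ((d (suc (P + i))) ∷ (ν (suc (P + i))) ∷ k ∷ P ∷ i ∷ (d P) ∷ (ν P) ∷ []) (v0 ⊕ v1 ≛ su (v2 ⊕ (su (v3 ⊕ v4))) ∷ v5 ⊕ v6 ≛ su (v2 ⊕ v3) ∷ v0 ≛ su (v5 ⊕ v4) ∷ v1 ≛ li 0 ∷ li 0 ≺ v6 ∷ []) (ff) ((0 ∷ 1 ∷ 1 ∷ 0 ∷ 1 ∷ 0 ∷ 1 ∷ 0 ∷ 1 ∷ []) , []))
               (code _) (code P) e (ν-out _ (≮⇒≥ out)) νP>0)
      ... | yes pl' with advance i q tw pl' e
      ...   | inj₁ (q' , tw' , hq') = go f (suc i) q' (≤-trans lf (≤-reflexive (lia (P ∷ i ∷ f ∷ []) [] (v0 ⊕ v1 ⊕ (su v2) ≛ v0 ⊕ (su v1) ⊕ v2) ((1 ∷ []) , (1 ∷ []))))) tw' (subst (_< ℓ) (sym (+-suc P i)) pl')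
              (λ n → hq n ∙ shN-cong (i * suc c) hq' n ∙ shN-+ (i * suc c) (suc c) _ n
                ∙ cong (λ s → shN s (H (eS P (suc (suc i)) q' (suc i)) (γS P (suc (suc i)) q' (suc i))) n) (+-comm (i * suc c) (suc c)))
      ...   | inj₂ (h0 , none) = inj₂ ((λ n → hq n ∙ shN-cong (i * suc c) h0 n ∙ shN-0 (i * suc c) n) , absent)
              where
              absent : ∀ i' q' → Tower d p0 c i' q' → Last d p0 c i' → ⊥
              absent i' q' tw' last' with i' ≤? i
              ... | no h = none q' (restrict tw' (≰⇒> h))
              ... | yes h with i' ≟ i
              ...   | yes refl = last' e
              ...   | no ne = last' (cong d (sym (+-suc P i')) ∙ blk tw c (suc i') ≤-refl (≤∧≢⇒< h ne) ∙ +-suc _ i')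

-- Cores and their strong covers

-- A (k+1)-core κ (rows from 0) with its bounded partition ν: row d r is the first row
-- whose bead r - κ lies k + 1 or more below that of row r.
record Core (k ℓ : ℕ) (κ ν d : ℕ → ℕ) : Set where
  field
    code : ∀ r → d r + ν r ≡ suc (k + r)
    κ-d : ∀ r → κ r ≡ ν r + κ (d r)
    desc : ∀ r → κ (suc r) ≤ κ r
    zero-from : ∀ r → ℓ ≤ r → κ r ≡ 0
    up : ∀ r → r < d r
    mono : ∀ r → d r < d (suc r)

  desc-le : ∀ {a b} → a ≤ b → κ b ≤ κ a
  desc-le {a} {b} p = subst (λ x → κ x ≤ κ a) (m+[n∸m]≡n p) (go (b ∸ a))
    where
    go : ∀ t → κ (a + t) ≤ κ a
    go zero = ≤-reflexive (cong κ (+-identityʳ a))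
    go (suc t) = ≤-trans (≤-trans (≤-reflexive (cong κ (+-suc a t))) (desc (a + t))) (go t)

  ν-out : ∀ r → ℓ ≤ r → ν r ≡ 0
  ν-out r p = m+n≡0⇒m≡0 (ν r) (sym (κ-d r) ∙ zero-from r p)

-- The beads r - κ r increase strictly and d shifts every bead by k + 1, so d cannot reverse or
-- merge rows.
row-map-mono : ∀ k (κ ν d : ℕ → ℕ) → (∀ r → d r + ν r ≡ suc (k + r)) → (∀ r → κ r ≡ ν r + κ (d r)) →
  (∀ {a b} → a ≤ b → κ b ≤ κ a) → ∀ r → d r < d (suc r)
row-map-mono k κ ν d code κ-d desc-le r with d r <? d (suc r)
... | yes p = p
... | no p = ⊥-elim ((lia ((d r) ∷ (ν r) ∷ k ∷ r ∷ (d (suc r)) ∷ (ν (suc r)) ∷ (κ r) ∷ (κ (d r)) ∷ (κ (suc r)) ∷ (κ (d (suc r))) ∷ []) (v0 ⊕ v1 ≛ su (v2 ⊕ v3) ∷ v4 ⊕ v5 ≛ su (v2 ⊕ (su v3)) ∷ v6 ≛ v1 ⊕ v7 ∷ v8 ≛ v5 ⊕ v9 ∷ v8 ≼ v6 ∷ v7 ≼ v9 ∷ v4 ≼ v0 ∷ []) (ff) ((1 ∷ 0 ∷ 0 ∷ 1 ∷ 1 ∷ 0 ∷ 0 ∷ 1 ∷ 1 ∷ 1 ∷ 1 ∷ []) , []))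
    (code r) (code (suc r)) (κ-d r) (κ-d (suc r)) (desc-le (n≤1+n r)) (desc-le (≮⇒≥ p)) (≮⇒≥ p))

-- Unrolling κ r = ν r + κ (d r) makes κ r the sum of ν over the orbit of r. Each step moves down at
-- least one row, so ℓ steps reach the region where ν is zero.
module CoreOf (k ℓ : ℕ) (ν d : ℕ → ℕ) (code : ∀ r → d r + ν r ≡ suc (k + r)) (mono : ∀ r → d r < d (suc r))
  (up : ∀ r → r < d r) (ν-out : ∀ r → ℓ ≤ r → ν r ≡ 0) where
  open RowMap d mono up

  part : ℕ → ℕ → ℕ
  part zero r = 0
  part (suc f) r = ν r + part f (d r)

  ν-le : ∀ {a b} → a ≤ b → ν b ≤ ν a
  ν-le {a} {b} p = (lia ((d a) ∷ (ν a) ∷ k ∷ a ∷ (d b) ∷ (ν b) ∷ b ∷ (b ∸ a) ∷ []) (v0 ⊕ v1 ≛ su (v2 ⊕ v3) ∷ v4 ⊕ v5 ≛ su (v2 ⊕ v6) ∷ v0 ⊕ v7 ≼ v4 ∷ v3 ⊕ v7 ≛ v6 ∷ []) (v5 ≼ v1) ((1 ∷ 0 ∷ 1 ∷ 1 ∷ 0 ∷ 1 ∷ 0 ∷ 1 ∷ []) , []))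
    (code a) (code b) (subst (λ x → d a + (b ∸ a) ≤ d x) (m+[n∸m]≡n p) (d-add a (b ∸ a))) (m+[n∸m]≡n p)

  part-le : ∀ f {a b} → a ≤ b → part f b ≤ part f a
  part-le zero p = z≤n
  part-le (suc f) p = +-mono-≤ (ν-le p) (part-le f (d-le p))

  part-out : ∀ f r → ℓ ≤ r → part f r ≡ 0
  part-out zero r p = refl
  part-out (suc f) r p = cong₂ _+_ (ν-out r p) (part-out f (d r) (≤-trans p (<⇒≤ (up r))))

  part-stable : ∀ f r → ℓ ≤ r + f → part f r ≡ part (suc f) r
  part-stable zero r p = sym (part-out 1 r (subst (ℓ ≤_) (+-identityʳ r) p))
  part-stable (suc f) r p = cong (λ x → ν r + x) (part-stable f (d r) (≤-trans p (≤-trans (≤-reflexive (+-suc r f)) (+-monoˡ-≤ f (up r)))))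

  core : Core k ℓ (part ℓ) ν d
  core = record { code = code ; κ-d = λ r → part-stable ℓ r (m≤n+m ℓ r) ; desc = λ r → part-le ℓ (n≤1+n r)
                ; zero-from = part-out ℓ ; up = up ; mono = mono }

sumTo : ℕ → (ℕ → ℕ) → ℕ
sumTo zero f = 0
sumTo (suc n) f = sumTo n f + f n

sumTo-cong : ∀ n {f g : ℕ → ℕ} → (∀ i → i < n → f i ≡ g i) → sumTo n f ≡ sumTo n g
sumTo-cong zero h = refl
sumTo-cong (suc n) h = cong₂ _+_ (sumTo-cong n (λ i p → h i (<-trans p (n<1+n n)))) (h n (n<1+n n))

sumTo-+ : ∀ n f g → sumTo n (λ i → f i + g i) ≡ sumTo n f + sumTo n g
sumTo-+ zero f g = refl
sumTo-+ (suc n) f g = cong (_+ (f n + g n)) (sumTo-+ n f g) ∙ interchange (sumTo n f) (sumTo n g) (f n) (g n)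

sumTo-mono : ∀ n {f g : ℕ → ℕ} → (∀ i → i < n → f i ≤ g i) → sumTo n f ≤ sumTo n g
sumTo-mono zero h = z≤n
sumTo-mono (suc n) h = +-mono-≤ (sumTo-mono n (λ i p → h i (<-trans p (n<1+n n)))) (h n (n<1+n n))

sumTo-zero : ∀ n f → (∀ i → i < n → f i ≡ 0) → sumTo n f ≡ 0
sumTo-zero zero f h = refl
sumTo-zero (suc n) f h = cong₂ _+_ (sumTo-zero n f (λ i p → h i (<-trans p (n<1+n n)))) (h n (n<1+n n))

sumTo-ι : ∀ n a → a < n → sumTo n (λ r → ι r a) ≡ 1
sumTo-ι (suc n) a p with a ≟ n
... | yes refl = cong₂ _+_ (sumTo-zero n (λ r → ι r n) (λ i q → ι-no i n (<⇒≢ q))) (ι-eq n)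
... | no ne = cong₂ _+_ (sumTo-ι n a (≤∧≢⇒< (ℕ.s≤s⁻¹ p) ne)) (ι-no n a (λ x → ne (sym x)))

sumTo-ind : ∀ n a m → a + m ≤ n → sumTo n (ind a m) ≡ m
sumTo-ind n a zero p = sumTo-zero n (ind a 0) (λ _ _ → refl)
sumTo-ind n a (suc m) p = sumTo-+ n (ind a m) (λ r → ι r (a + m))
  ∙ cong₂ _+_ (sumTo-ind n a m (≤-trans (+-monoʳ-≤ a (n≤1+n m)) p)) (sumTo-ι n (a + m) (≤-trans (≤-reflexive (sym (+-suc a m))) p))
  ∙ +-comm m 1

Blocks : (ℕ → ℕ) → ℕ → ℕ → ℕ → ℕ → Set
Blocks d p0 c i r = ∃ λ j → ∃ λ i' → j ≤ c × i' ≤ i × r ≡ it d j p0 + i'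

-- The core κ' obtained from κ by removing the c + 1 ribbons of height i + 1 of a tower:
-- the j-th ribbon occupies the rows it d j p0 + i', i' ≤ i.
record Swapping {k ℓ : ℕ} {κ ν d : ℕ → ℕ} (A : Core k ℓ κ ν d) (p0 c i q : ℕ) : Set where
  field
    tower : Tower d p0 c i q
    last : Last d p0 c i
    inside : it d c p0 + i < ℓ
    κ' ν' d' : ℕ → ℕ
    core' : Core k ℓ κ' ν' d'
    d'-def : ∀ r → d' r ≡ (d r + ind (it d c p0) (suc i) r) ∸ ind q i r
    ν'-spec : ∀ r → ν' r + ind (it d c p0) (suc i) r ≡ ν r + ind q i r
    size : suc (sumTo ℓ ν') ≡ sumTo ℓ ν
    block? : ∀ r → Blocks d p0 c i r ⊎ ¬ Blocks d p0 c i r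
    κ-same : ∀ r → ¬ Blocks d p0 c i r → κ' r ≡ κ r
    κ'≤κ : ∀ r → κ' r ≤ κ r
    κ'<κ : ∀ j i' → j ≤ c → i' ≤ i → κ' (it d j p0 + i') < κ (it d j p0 + i')
    κ'-step : ∀ j i' → j ≤ c → i' < i → suc (κ' (it d j p0 + i')) ≡ κ (it d j p0 + suc i')
    κ'-end : ∀ j → j ≤ c → κ (suc (it d j p0 + i)) ≤ κ' (it d j p0 + i)
    d'-chain : ∀ j → j < c → d' (it d j p0 + i) ≡ it d (suc j) p0 + i
    d'-bottom : d' (it d c p0 + i) ≡ suc (it d (suc c) p0 + i)
    X-free : ∀ a → ¬ Blocks d p0 c i (it d (suc c) p0 + a)
    row-next : ∀ j i' → j ≤ c → i' ≤ i → it d j p0 + i' < it d (suc j) p0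

module Swapped (k ℓ : ℕ) (κ ν d : ℕ → ℕ) (co : Core k ℓ κ ν d) (p0 c i q : ℕ) (tw : Tower d p0 c i q)
  (last : Last d p0 c i) (inside : it d c p0 + i < ℓ) where
  open Core co
  open RowMap d mono up
  open Towers d mono up
  open Tower tw
  P X : ℕ
  P = it d c p0
  X = it d (suc c) p0

  row : ℕ → ℕ → ℕ
  row j i' = it d j p0 + i'

  p0≤P : p0 ≤ P
  p0≤P = it-le {0} {c} p0 z≤n

  last< : suc (X + i) < d (suc (P + i))
  last< = ≤∧≢⇒< (≤-trans (≤-reflexive (cong suc (sym (blk c i ≤-refl ≤-refl)))) (mono (P + i))) (λ x → last (sym x))

  q<p0 : ∀ i' → i' < i → q + i' < p0
  q<p0 i' h = d-lt⁻¹ (subst (_< d p0) (sym (rais i' h)) (≤-<-trans (+-monoʳ-≤ p0 h) (seps tw 0 z≤n)))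

  -- By the code equation ν moves opposite to the starts: i + 1 rows lose a box and i rows gain one,
  -- for a net loss of exactly one.
  d' ν' : ℕ → ℕ
  d' r = (d r + ind P (suc i) r) ∸ ind q i r
  ν' r = (ν r + ind q i r) ∸ ind P (suc i) r

  d'-spec : ∀ r → d' r + ind q i r ≡ d r + ind P (suc i) r
  d'-spec r = m∸n+n≡m (≤-trans (ind-≤1 q i r) (≤-trans (≤-<-trans z≤n (up r)) (m≤m+n (d r) _)))

  data Kind (r : ℕ) : Set where
    bottom : ∀ i' → i' ≤ i → r ≡ P + i' → ind P (suc i) r ≡ 1 → ind q i r ≡ 0 → Kind r
    raised : ∀ i' → i' < i → r ≡ q + i' → ind P (suc i) r ≡ 0 → ind q i r ≡ 1 → Kind r
    other : ¬ (P ≤ r × r ≤ P + i) → ¬ (q ≤ r × r < q + i) → ind P (suc i) r ≡ 0 → ind q i r ≡ 0 → Kind r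

  kind : ∀ r → Kind r
  kind r with P ≤? r | r ≤? P + i | q ≤? r | r <? q + i
  ... | yes a | yes b | _ | _ = bottom (r ∸ P) (+-cancelˡ-≤ P _ _ (subst (_≤ P + i) (sym (m+[n∸m]≡n a)) b)) (sym (m+[n∸m]≡n a))
          (ind-in P (suc i) r a (subst (r <_) (sym (+-suc P i)) (s≤s b))) (q-none i ≤-refl)
    where
    q-none : ∀ m → m ≤ i → ind q m r ≡ 0
    q-none zero _ = refl
    q-none (suc m) h = cong₂ _+_ (q-none m (<⇒≤ h)) (ι-no r (q + m) (>⇒≢ (<-≤-trans (q<p0 m h) (≤-trans p0≤P a))))
  ... | yes a | no b | yes a' | yes b' = ⊥-elim (<⇒≱ (above (r ∸ q) (+-cancelˡ-< q _ _ (subst (_< q + i) (sym (m+[n∸m]≡n a')) b'))) (≤-trans p0≤P a))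
    where
    above : ∀ t → t < i → r < p0
    above t h = subst (_< p0) (m+[n∸m]≡n a') (q<p0 (r ∸ q) (+-cancelˡ-< q _ _ (subst (_< q + i) (sym (m+[n∸m]≡n a')) b')))
  ... | yes a | no b | yes a' | no b' = other (λ x → b (proj₂ x)) (λ x → b' (proj₂ x)) (ind-high P (suc i) r (subst (_≤ r) (sym (+-suc P i)) (≰⇒> b))) (ind-high q i r (≮⇒≥ b'))
  ... | yes a | no b | no a' | _ = other (λ x → b (proj₂ x)) (λ x → a' (proj₁ x)) (ind-high P (suc i) r (subst (_≤ r) (sym (+-suc P i)) (≰⇒> b))) (ind-low q i r (≰⇒> a'))
  ... | no a | _ | yes a' | yes b' = raised (r ∸ q) (+-cancelˡ-< q _ _ (subst (_< q + i) (sym (m+[n∸m]≡n a')) b')) (sym (m+[n∸m]≡n a')) (ind-low P (suc i) r (≰⇒> a)) (ind-in q i r a' b')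
  ... | no a | _ | yes a' | no b' = other (λ x → a (proj₁ x)) (λ x → b' (proj₂ x)) (ind-low P (suc i) r (≰⇒> a)) (ind-high q i r (≮⇒≥ b'))
  ... | no a | _ | no a' | _ = other (λ x → a (proj₁ x)) (λ x → a' (proj₁ x)) (ind-low P (suc i) r (≰⇒> a)) (ind-low q i r (≰⇒> a'))

  ν-block : ∀ i' → i' ≤ i → ν (P + i') ≡ ν P
  ν-block i' h = (lia ((d (P + i')) ∷ (ν (P + i')) ∷ k ∷ P ∷ i' ∷ (d P) ∷ (ν P) ∷ []) (v0 ⊕ v1 ≛ su (v2 ⊕ (v3 ⊕ v4)) ∷ v5 ⊕ v6 ≛ su (v2 ⊕ v3) ∷ v0 ≛ v5 ⊕ v4 ∷ []) (v1 ≛ v6) ((1 ∷ 1 ∷ 0 ∷ 0 ∷ 1 ∷ 0 ∷ 1 ∷ []) , (1 ∷ 0 ∷ 1 ∷ 1 ∷ 0 ∷ 1 ∷ [])))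
    (code _) (code P) (blk c i' ≤-refl h)

  ν-drop : ν (suc (P + i)) < ν P
  ν-drop = (lia ((d (suc (P + i))) ∷ (ν (suc (P + i))) ∷ k ∷ P ∷ i ∷ (d P) ∷ (ν P) ∷ []) (v0 ⊕ v1 ≛ su (v2 ⊕ (su (v3 ⊕ v4))) ∷ v5 ⊕ v6 ≛ su (v2 ⊕ v3) ∷ su (v5 ⊕ v4) ≺ v0 ∷ []) (v1 ≺ v6) ((1 ∷ 1 ∷ 0 ∷ 0 ∷ 1 ∷ 1 ∷ []) , []))
    (code _) (code P) last<

  ν'-spec : ∀ r → ν' r + ind P (suc i) r ≡ ν r + ind q i r
  ν'-spec r with kind r
  ... | bottom i' h refl x y = m∸n+n≡m (≤-trans (≤-reflexive x) (≤-trans (≤-<-trans z≤n ν-drop) (≤-trans (≤-reflexive (sym (ν-block i' h))) (m≤m+n _ _))))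
  ... | raised _ _ _ x _ rewrite x = +-identityʳ _
  ... | other _ _ x _ rewrite x = +-identityʳ _

  code' : ∀ r → d' r + ν' r ≡ suc (k + r)
  code' r = (lia ((d' r) ∷ (ind q i r) ∷ (d r) ∷ (ind P (suc i) r) ∷ (ν' r) ∷ (ν r) ∷ k ∷ r ∷ []) (v0 ⊕ v1 ≛ v2 ⊕ v3 ∷ v4 ⊕ v3 ≛ v5 ⊕ v1 ∷ v2 ⊕ v5 ≛ su (v6 ⊕ v7) ∷ []) (v0 ⊕ v4 ≛ su (v6 ⊕ v7)) ((1 ∷ 1 ∷ 0 ∷ 1 ∷ 0 ∷ 1 ∷ []) , (1 ∷ 0 ∷ 1 ∷ 0 ∷ 1 ∷ 0 ∷ 1 ∷ [])))
    (d'-spec r) (ν'-spec r) (code r)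

  up' : ∀ r → r < d' r
  up' r with kind r
  ... | bottom _ _ _ x y = (lia ((d' r) ∷ (ind q i r) ∷ (d r) ∷ (ind P (suc i) r) ∷ r ∷ []) (v0 ⊕ v1 ≛ v2 ⊕ v3 ∷ v1 ≛ li 0 ∷ v4 ≺ v2 ∷ []) (v4 ≺ v0) ((1 ∷ 0 ∷ 1 ∷ 1 ∷ 0 ∷ 1 ∷ []) , [])) (d'-spec r) y (up r)
  ... | other _ _ x y = (lia ((d' r) ∷ (ind q i r) ∷ (d r) ∷ (ind P (suc i) r) ∷ r ∷ []) (v0 ⊕ v1 ≛ v2 ⊕ v3 ∷ v1 ≛ li 0 ∷ v4 ≺ v2 ∷ []) (v4 ≺ v0) ((1 ∷ 0 ∷ 1 ∷ 1 ∷ 0 ∷ 1 ∷ []) , [])) (d'-spec r) y (up r)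
  ... | raised i' h refl x y = (lia ((d' (q + i')) ∷ (ind q i (q + i')) ∷ (d (q + i')) ∷ (ind P (suc i) (q + i')) ∷ p0 ∷ i' ∷ q ∷ []) (v0 ⊕ v1 ≛ v2 ⊕ v3 ∷ v1 ≛ li 1 ∷ v2 ≛ v4 ⊕ (su v5) ∷ v6 ⊕ v5 ≺ v4 ∷ []) (v6 ⊕ v5 ≺ v0) ((1 ∷ 0 ∷ 1 ∷ 1 ∷ 0 ∷ 0 ∷ 1 ∷ 1 ∷ []) , []))
      (d'-spec _) y (rais i' h) (q<p0 i' h)

  -- Only two boundaries are critical. After the bottom block `last` provides the gap; before row q
  -- the value p0, next below the start of q, is not taken because p0 is outside the image of d.
  mono' : ∀ r → d' r < d' (suc r)
  mono' r with kind r | kind (suc r)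
  ... | bottom i' h refl x y | other a b x' y' = (lia ((d' r) ∷ (ind q i r) ∷ (d r) ∷ (ind P (suc i) r) ∷ (d' (suc r)) ∷ (ind q i (suc r)) ∷ (d (suc r)) ∷ (ind P (suc i) (suc r)) ∷ []) (v0 ⊕ v1 ≛ v2 ⊕ v3 ∷ v4 ⊕ v5 ≛ v6 ⊕ v7 ∷ v1 ≛ li 0 ∷ v5 ≛ li 0 ∷ v3 ≛ li 1 ∷ su v2 ≺ v6 ∷ []) (v0 ≺ v4) ((1 ∷ 1 ∷ 0 ∷ 0 ∷ 1 ∷ 0 ∷ 0 ∷ 1 ∷ 0 ∷ 1 ∷ 0 ∷ 1 ∷ []) , []))
        (d'-spec r) (d'-spec (suc r)) y y' x gap
    where
    i'≡i : i' ≡ i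
    i'≡i with i' ≟ i
    ... | yes e = e
    ... | no ne = ⊥-elim (a (≤-trans (m≤m+n P i') (n≤1+n _) , +-monoʳ-< P (≤∧≢⇒< h ne)))
    gap : suc (d (P + i')) < d (suc (P + i'))
    gap = subst (λ t → suc (d (P + t)) < d (suc (P + t))) (sym i'≡i) (subst (λ t → suc t < d (suc (P + i))) (sym (blk c i ≤-refl ≤-refl)) last<)
  ... | bottom i' h e x y | raised i″ h″ e″ x' y' = ⊥-elim (<⇒≱ (q<p0 i″ h″) (≤-trans p0≤P (≤-trans (m≤m+n P i') (≤-trans (≤-trans (≤-reflexive (sym e)) (n≤1+n r)) (≤-reflexive e″)))))
  ... | bottom _ _ _ x y | bottom _ _ _ x' y' = (lia ((d' r) ∷ (ind q i r) ∷ (d r) ∷ (ind P (suc i) r) ∷ (d' (suc r)) ∷ (ind q i (suc r)) ∷ (d (suc r)) ∷ (ind P (suc i) (suc r)) ∷ []) (v0 ⊕ v1 ≛ v2 ⊕ v3 ∷ v4 ⊕ v5 ≛ v6 ⊕ v7 ∷ v1 ≛ li 0 ∷ v5 ≛ li 0 ∷ v3 ≛ li 1 ∷ v7 ≛ li 1 ∷ v2 ≺ v6 ∷ []) (v0 ≺ v4) ((1 ∷ 1 ∷ 0 ∷ 0 ∷ 1 ∷ 0 ∷ 0 ∷ 1 ∷ 0 ∷ 1 ∷ 0 ∷ 0 ∷ 1 ∷ 1 ∷ []) , []))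
        (d'-spec r) (d'-spec (suc r)) y y' x x' (mono r)
  ... | raised _ _ _ x y | k' = (lia ((d' r) ∷ (ind q i r) ∷ (d r) ∷ (ind P (suc i) r) ∷ (d' (suc r)) ∷ (ind q i (suc r)) ∷ (d (suc r)) ∷ (ind P (suc i) (suc r)) ∷ []) (v0 ⊕ v1 ≛ v2 ⊕ v3 ∷ v4 ⊕ v5 ≛ v6 ⊕ v7 ∷ v1 ≛ li 1 ∷ v5 ≼ li 1 ∷ v3 ≛ li 0 ∷ v2 ≺ v6 ∷ []) (v0 ≺ v4) ((1 ∷ 1 ∷ 0 ∷ 0 ∷ 1 ∷ 0 ∷ 1 ∷ 1 ∷ 1 ∷ 0 ∷ 1 ∷ []) , []))
        (d'-spec r) (d'-spec (suc r)) y (ind-≤1 q i (suc r)) x (mono r)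
  ... | other _ _ x y | bottom _ _ _ x' y' = (lia ((d' r) ∷ (ind q i r) ∷ (d r) ∷ (ind P (suc i) r) ∷ (d' (suc r)) ∷ (ind q i (suc r)) ∷ (d (suc r)) ∷ (ind P (suc i) (suc r)) ∷ []) (v0 ⊕ v1 ≛ v2 ⊕ v3 ∷ v4 ⊕ v5 ≛ v6 ⊕ v7 ∷ v1 ≛ li 0 ∷ v5 ≛ li 0 ∷ v3 ≛ li 0 ∷ v2 ≺ v6 ∷ []) (v0 ≺ v4) ((1 ∷ 1 ∷ 0 ∷ 0 ∷ 1 ∷ 0 ∷ 0 ∷ 1 ∷ 0 ∷ 1 ∷ 0 ∷ 1 ∷ []) , []))
        (d'-spec r) (d'-spec (suc r)) y y' x (mono r)
  ... | other _ _ x y | other _ _ x' y' = (lia ((d' r) ∷ (ind q i r) ∷ (d r) ∷ (ind P (suc i) r) ∷ (d' (suc r)) ∷ (ind q i (suc r)) ∷ (d (suc r)) ∷ (ind P (suc i) (suc r)) ∷ []) (v0 ⊕ v1 ≛ v2 ⊕ v3 ∷ v4 ⊕ v5 ≛ v6 ⊕ v7 ∷ v1 ≛ li 0 ∷ v5 ≛ li 0 ∷ v3 ≛ li 0 ∷ v2 ≺ v6 ∷ []) (v0 ≺ v4) ((1 ∷ 1 ∷ 0 ∷ 0 ∷ 1 ∷ 0 ∷ 0 ∷ 1 ∷ 0 ∷ 1 ∷ 0 ∷ 1 ∷ []) , []))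
        (d'-spec r) (d'-spec (suc r)) y y' x (mono r)
  ... | other a b x y | raised zero h e x' y' = (lia ((d' r) ∷ (ind q i r) ∷ (d r) ∷ (ind P (suc i) r) ∷ (d' (suc r)) ∷ (ind q i (suc r)) ∷ (d (suc r)) ∷ (ind P (suc i) (suc r)) ∷ []) (v0 ⊕ v1 ≛ v2 ⊕ v3 ∷ v4 ⊕ v5 ≛ v6 ⊕ v7 ∷ v1 ≛ li 0 ∷ v5 ≛ li 1 ∷ v3 ≛ li 0 ∷ su v2 ≺ v6 ∷ []) (v0 ≺ v4) ((1 ∷ 1 ∷ 0 ∷ 0 ∷ 1 ∷ 0 ∷ 0 ∷ 1 ∷ 0 ∷ 1 ∷ 0 ∷ 1 ∷ []) , []))
        (d'-spec r) (d'-spec (suc r)) y y' x (≤∧≢⇒< (mono r) (λ z → top r (suc-injective (z ∙ cong d e ∙ rais 0 h ∙ +-comm p0 1))))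
  ... | other a b x y | raised (suc t) h e x' y' = ⊥-elim (b (subst (λ z → q ≤ z × z < q + i) (suc-injective (sym (+-suc q t) ∙ sym e)) (m≤m+n q t , +-monoʳ-< q (<⇒≤ h))))

  ν'-out : ∀ r → ℓ ≤ r → ν' r ≡ 0
  ν'-out r h = m+n≡0⇒m≡0 (ν' r) (ν'-spec r ∙ cong₂ _+_ (ν-out r h) (q-none i ≤-refl))
    where
    q-none : ∀ m → m ≤ i → ind q m r ≡ 0
    q-none zero _ = refl
    q-none (suc m) g = cong₂ _+_ (q-none m (<⇒≤ g)) (ι-no r (q + m) (>⇒≢ (<-≤-trans (q<p0 m g)
      (≤-trans p0≤P (≤-trans (≤-trans (m≤m+n P i) (<⇒≤ inside)) h)))))

  module C' = CoreOf k ℓ ν' d' code' mono' up' ν'-out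
  κ' : ℕ → ℕ
  κ' = C'.part ℓ
  core' : Core k ℓ κ' ν' d'
  core' = C'.core

  size : suc (sumTo ℓ ν') ≡ sumTo ℓ ν
  size = (lia (a ∷ b ∷ c' ∷ e ∷ i ∷ []) (v0 ⊕ v1 ≛ v2 ⊕ v3 ∷ v1 ≛ su v4 ∷ v3 ≛ v4 ∷ []) (su v0 ≛ v2) ((1 ∷ 1 ∷ 0 ∷ 0 ∷ 1 ∷ 1 ∷ []) , (1 ∷ 0 ∷ 1 ∷ 1 ∷ 0 ∷ 0 ∷ 1 ∷ [])))
    (sym (sumTo-+ ℓ ν' (ind P (suc i))) ∙ sumTo-cong ℓ (λ r _ → ν'-spec r) ∙ sumTo-+ ℓ ν (ind q i))
    (sumTo-ind ℓ P (suc i) (≤-trans (≤-reflexive (+-suc P i)) inside))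
    (fits i refl)
    where
    a b c' e : ℕ
    a = sumTo ℓ ν'
    b = sumTo ℓ (ind P (suc i))
    c' = sumTo ℓ ν
    e = sumTo ℓ (ind q i)
    fits : ∀ m → m ≡ i → sumTo ℓ (ind q m) ≡ m
    fits zero _ = sumTo-zero ℓ (ind q 0) (λ _ _ → refl)
    fits (suc m) x = sumTo-ind ℓ q (suc m) (≤-trans (≤-reflexive (+-suc q m)) (≤-trans (q<p0 m (≤-reflexive x)) (≤-trans p0≤P (≤-trans (m≤m+n P i) (<⇒≤ inside)))))

  InBlock : ℕ → Set
  InBlock = Blocks d p0 c i

  inBlock? : ∀ r → InBlock r ⊎ ¬ InBlock r
  inBlock? r = go c ≤-refl (λ j i' a b e → ⊥-elim (<⇒≱ b a))
    where
    go : ∀ t → t ≤ c → (∀ j i' → j ≤ c → t < j → r ≡ row j i' → ¬ i' ≤ i) → InBlock r ⊎ ¬ InBlock r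
    go t tc h with it d t p0 ≤? r | r ≤? it d t p0 + i
    go t tc h | yes a | yes b = inj₁ (t , r ∸ it d t p0 , tc , +-cancelˡ-≤ (it d t p0) _ _ (subst (_≤ it d t p0 + i) (sym (m+[n∸m]≡n a)) b) , sym (m+[n∸m]≡n a))
    go zero tc h | no a | _ = inj₂ λ { (zero , i' , _ , b , e) → a (≤-trans (m≤m+n p0 i') (≤-reflexive (sym e))) ; (suc j , i' , jc , b , e) → h (suc j) i' jc (s≤s z≤n) e b }
    go zero tc h | yes _ | no a = inj₂ λ { (zero , i' , _ , b , e) → a (≤-trans (≤-reflexive e) (+-monoʳ-≤ p0 b)) ; (suc j , i' , jc , b , e) → h (suc j) i' jc (s≤s z≤n) e b }
    go (suc t) tc h | no a | _ = go t (<⇒≤ tc) λ j i' jc tj e b → next j i' jc tj e b (suc t ≟ j)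
      where
      next : ∀ j i' → j ≤ c → t < j → r ≡ row j i' → i' ≤ i → _ → ⊥
      next j i' jc tj e b (yes refl) = a (≤-trans (m≤m+n _ i') (≤-reflexive (sym e)))
      next j i' jc tj e b (no ne) = h j i' jc (≤∧≢⇒< tj ne) e b
    go (suc t) tc h | yes _ | no a = go t (<⇒≤ tc) λ j i' jc tj e b → next j i' jc tj e b (suc t ≟ j)
      where
      next : ∀ j i' → j ≤ c → t < j → r ≡ row j i' → i' ≤ i → _ → ⊥
      next j i' jc tj e b (yes refl) = a (≤-trans (≤-reflexive e) (+-monoʳ-≤ _ b))
      next j i' jc tj e b (no ne) = h j i' jc (≤∧≢⇒< tj ne) e b

  row-c : ∀ j i' → j ≤ c → i' ≤ i → row j i' ≤ P + i
  row-c j i' jc h = +-mono-≤ (it-le p0 jc) h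

  row-next : ∀ j i' → j ≤ c → i' ≤ i → row j i' < it d (suc j) p0
  row-next j i' jc h = ≤-<-trans (+-monoʳ-≤ _ h) (seps tw j jc)

  -- The number of boxes that a ribbon has in its row i'. It is read off below the bottom block and
  -- is the same for every ribbon, which makes the ribbons translates of each other.
  wd : ℕ → ℕ
  wd i' = suc (κ (X + i') ∸ κ (X + suc i'))

  wd-spec : ∀ i' → wd i' + κ (X + suc i') ≡ suc (κ (X + i'))
  wd-spec i' = cong suc (m∸n+n≡m (desc-le (+-monoʳ-≤ X (n≤1+n i'))))

  ν-pair : ∀ j i' → j ≤ c → i' < i → ν (row j i') ≡ ν (row j (suc i'))
  ν-pair j i' jc h = (lia ((d a) ∷ (ν a) ∷ k ∷ x ∷ i' ∷ (d b) ∷ (ν b) ∷ x' ∷ []) (v0 ⊕ v1 ≛ su (v2 ⊕ (v3 ⊕ v4)) ∷ v5 ⊕ v6 ≛ su (v2 ⊕ (v3 ⊕ (su v4))) ∷ v0 ≛ v7 ⊕ v4 ∷ v5 ≛ v7 ⊕ (su v4) ∷ []) (v1 ≛ v6) ((1 ∷ 1 ∷ 0 ∷ 0 ∷ 1 ∷ 0 ∷ 1 ∷ 1 ∷ []) , (1 ∷ 0 ∷ 1 ∷ 1 ∷ 0 ∷ 1 ∷ 0 ∷ 0 ∷ 1 ∷ [])))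
    (code a) (code b) (blk j i' jc (<⇒≤ h)) (blk j (suc i') jc h)
    where
    x x' a b : ℕ
    x = it d j p0
    x' = it d (suc j) p0
    a = row j i'
    b = row j (suc i')

  -- Two consecutive rows of a block have equal ν, so passing to the next block does not change the
  -- difference of their lengths.
  slope : ∀ t j i' → j + t ≡ suc c → i' < i → κ (row j i') + κ (X + suc i') ≡ κ (row j (suc i')) + κ (X + i')
  slope zero j i' e h with sym (+-identityʳ j) ∙ e
  ... | refl = +-comm (κ (X + i')) _
  slope (suc t) j i' e h = (lia ((κ a) ∷ (ν a) ∷ (κ (d a)) ∷ (κ b) ∷ (ν b) ∷ (κ (d b)) ∷ (κ a') ∷ (κ b') ∷ y ∷ z ∷ []) (v0 ≛ v1 ⊕ v2 ∷ v3 ≛ v4 ⊕ v5 ∷ v1 ≛ v4 ∷ v2 ≛ v6 ∷ v5 ≛ v7 ∷ v6 ⊕ v8 ≛ v7 ⊕ v9 ∷ []) (v0 ⊕ v8 ≛ v3 ⊕ v9) ((1 ∷ 1 ∷ 0 ∷ 0 ∷ 1 ∷ 1 ∷ 0 ∷ 1 ∷ 0 ∷ 0 ∷ 1 ∷ 1 ∷ []) , (1 ∷ 0 ∷ 1 ∷ 1 ∷ 0 ∷ 0 ∷ 1 ∷ 0 ∷ 1 ∷ 1 ∷ 0 ∷ 0 ∷ 1 ∷ [])))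
    (κ-d a) (κ-d b) (ν-pair j i' jc h) (cong κ (blk j i' jc (<⇒≤ h))) (cong κ (blk j (suc i') jc h)) (slope t (suc j) i' (sym (+-suc j t) ∙ e) h)
    where
    jc : j ≤ c
    jc = ℕ.s≤s⁻¹ (≤-trans (s≤s (m≤m+n j t)) (≤-reflexive (sym (+-suc j t) ∙ e)))
    a b a' b' y z : ℕ
    a = row j i'
    b = row j (suc i')
    a' = row (suc j) i'
    b' = row (suc j) (suc i')
    y = κ (X + suc i')
    z = κ (X + i')

  Cmp : ℕ → Set
  Cmp r = (∀ j i' → j ≤ c → i' ≤ i → r ≡ row j i' → κ r ≡ κ' r + wd i') × (¬ InBlock r → κ' r ≡ κ r)

  -- Induction from row ℓ upwards: the lengths in row r are determined by those in the rows d r and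
  -- d' r, and the fuel decreases because d' r lies further down.
  cmp : ∀ f r → ℓ ≤ r + f → Cmp r
  cmp zero r h = (λ j i' jc hi e → ⊥-elim (<⇒≱ inside (≤-trans (subst (ℓ ≤_) (+-identityʳ r) h) (≤-trans (≤-reflexive e) (row-c j i' jc hi)))))
    , λ _ → Core.zero-from core' r h' ∙ sym (zero-from r h')
    where
    h' : ℓ ≤ r
    h' = subst (ℓ ≤_) (+-identityʳ r) h
  cmp (suc f) r h = inside-block , outside
    where
    ih : Cmp (d' r)
    ih = cmp f (d' r) (≤-trans h (≤-trans (≤-reflexive (+-suc r f)) (+-monoˡ-≤ f (up' r))))
    κ'-d : κ' r ≡ ν' r + κ' (d' r)
    κ'-d = Core.κ-d core' r

    not-q : ∀ j i' → j ≤ c → i' ≤ i → ∀ t → t < i → row j i' ≢ q + t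
    not-q j i' jc hi t ti e = <⇒≢ (≤-<-trans (+-monoʳ-≤ p0 ti) (<-≤-trans (seps tw 0 z≤n) (≤-trans (it-le {1} {suc j} p0 (s≤s z≤n)) (m≤m+n _ i'))))
      (sym (rais t ti) ∙ cong d (sym e) ∙ blk j i' jc hi)

    inside-block : ∀ j i' → j ≤ c → i' ≤ i → r ≡ row j i' → κ r ≡ κ' r + wd i'
    inside-block j i' jc hi e with kind r
    ... | raised t ti e' _ _ = ⊥-elim (not-q j i' jc hi t ti (sym e ∙ e'))
    ... | bottom i″ hi″ e″ x y = subst (λ z → κ r ≡ κ' r + wd z) i″≡ ((lia ((κ r) ∷ (ν r) ∷ (κ (d r)) ∷ (κ' r) ∷ (ν' r) ∷ (κ' (d' r)) ∷ (ind P (suc i) r) ∷ (ind q i r) ∷ (κ (X + i″)) ∷ (κ (X + suc i″)) ∷ (wd i″) ∷ []) (v0 ≛ v1 ⊕ v2 ∷ v3 ≛ v4 ⊕ v5 ∷ v4 ⊕ v6 ≛ v1 ⊕ v7 ∷ v6 ≛ li 1 ∷ v7 ≛ li 0 ∷ v2 ≛ v8 ∷ v5 ≛ v9 ∷ v10 ⊕ v9 ≛ su v8 ∷ []) (v0 ≛ v3 ⊕ v10) ((1 ∷ 1 ∷ 0 ∷ 0 ∷ 1 ∷ 0 ∷ 1 ∷ 1 ∷ 0 ∷ 0 ∷ 0 ∷ 1 ∷ 0 ∷ 0 ∷ 1 ∷ 0 ∷ 1 ∷ []) , (1 ∷ 0 ∷ 1 ∷ 1 ∷ 0 ∷ 1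 ∷ 0 ∷ 0 ∷ 1 ∷ 1 ∷ 0 ∷ 0 ∷ 1 ∷ 1 ∷ 0 ∷ 1 ∷ [])))
          (κ-d r) κ'-d (ν'-spec r) x y (cong κ dr) (proj₂ ih free ∙ cong κ d'r) (wd-spec i″))
      where
      dr : d r ≡ X + i″
      dr = cong d e″ ∙ blk c i″ ≤-refl hi″
      d'r : d' r ≡ X + suc i″
      d'r = (lia ((d' r) ∷ (ind q i r) ∷ (d r) ∷ (ind P (suc i) r) ∷ X ∷ i″ ∷ []) (v0 ⊕ v1 ≛ v2 ⊕ v3 ∷ v1 ≛ li 0 ∷ v3 ≛ li 1 ∷ v2 ≛ v4 ⊕ v5 ∷ []) (v0 ≛ v4 ⊕ (su v5)) ((1 ∷ 1 ∷ 0 ∷ 0 ∷ 0 ∷ 1 ∷ 0 ∷ 1 ∷ []) , (1 ∷ 0 ∷ 1 ∷ 1 ∷ 0 ∷ 0 ∷ 1 ∷ 0 ∷ 1 ∷ []))) (d'-spec r) y x dr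
      free : ¬ InBlock (d' r)
      free (j , t , jc , ti , e) = <⇒≱ (seps tw c ≤-refl) (≤-trans (m≤m+n X (suc i″)) (≤-trans (≤-reflexive (sym d'r ∙ e)) (row-c j t jc ti)))
      i″≡ : i″ ≡ i'
      i″≡ with j ≟ c
      ... | yes refl = +-cancelˡ-≡ P _ _ (sym e″ ∙ e)
      ... | no ne = ⊥-elim (<⇒≱ (row-next j i' jc hi) (≤-trans (it-le p0 (≤∧≢⇒< jc ne)) (≤-trans (m≤m+n P i″) (≤-reflexive (sym e″ ∙ e)))))
    ... | other a b x y = (lia ((κ r) ∷ (ν r) ∷ (κ (d r)) ∷ (κ' r) ∷ (ν' r) ∷ (κ' (d' r)) ∷ (ind P (suc i) r) ∷ (ind q i r) ∷ (κ (d' r)) ∷ (wd i') ∷ []) (v0 ≛ v1 ⊕ v2 ∷ v3 ≛ v4 ⊕ v5 ∷ v4 ⊕ v6 ≛ v1 ⊕ v7 ∷ v6 ≛ li 0 ∷ v7 ≛ li 0 ∷ v2 ≛ v8 ∷ v8 ≛ v5 ⊕ v9 ∷ []) (v0 ≛ v3 ⊕ v9) ((1 ∷ 1 ∷ 0 ∷ 0 ∷ 1 ∷ 0 ∷ 1 ∷ 1 ∷ 0 ∷ 0 ∷ 0 ∷ 1 ∷ 0 ∷ 1 ∷ []) , (1 ∷ 0 ∷ 1 ∷ 1 ∷ 0 ∷ 1 ∷ 0 ∷ 0 ∷ 0 ∷ 1 ∷ 0 ∷ 0 ∷ 1 ∷ 0 ∷ 1 ∷ [])))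
          (κ-d r) κ'-d (ν'-spec r) x y (cong κ (sym d'r)) (proj₁ ih (suc j) i' j<c hi (d'r ∙ cong d e ∙ blk j i' jc hi))
      where
      d'r : d' r ≡ d r
      d'r = (lia ((d' r) ∷ (ind q i r) ∷ (d r) ∷ (ind P (suc i) r) ∷ []) (v0 ⊕ v1 ≛ v2 ⊕ v3 ∷ v1 ≛ li 0 ∷ v3 ≛ li 0 ∷ []) (v0 ≛ v2) ((1 ∷ 1 ∷ 0 ∷ 0 ∷ 0 ∷ 1 ∷ []) , (1 ∷ 0 ∷ 1 ∷ 1 ∷ []))) (d'-spec r) y x
      j<c : j < c
      j<c = ≤∧≢⇒< jc λ { refl → a (subst (λ z → P ≤ z × z ≤ P + i) (sym e) (m≤m+n P i' , +-monoʳ-≤ P hi)) }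

    outside : ¬ InBlock r → κ' r ≡ κ r
    outside nb with kind r
    ... | bottom i' hi e _ _ = ⊥-elim (nb (c , i' , ≤-refl , hi , e))
    -- Row q + t gains a box in ν' but continues with row p0 + t of κ' in place of row p0 + t + 1 of
    -- κ; the former is shorter by one, so the length of row q + t stays the same.
    ... | raised t ti e x y = (lia ((κ r) ∷ (ν r) ∷ (κ (d r)) ∷ (κ' r) ∷ (ν' r) ∷ (κ' (d' r)) ∷ (ind P (suc i) r) ∷ (ind q i r) ∷ (κ (p0 + suc t)) ∷ (κ (d' r)) ∷ (wd t) ∷ (κ (p0 + t)) ∷ (κ (X + suc t)) ∷ (κ (X + t)) ∷ []) (v0 ≛ v1 ⊕ v2 ∷ v3 ≛ v4 ⊕ v5 ∷ v4 ⊕ v6 ≛ v1 ⊕ v7 ∷ v6 ≛ li 0 ∷ v7 ≛ li 1 ∷ v2 ≛ v8 ∷ v9 ≛ v5 ⊕ v10 ∷ v9 ≛ v11 ∷ v11 ⊕ v12 ≛ v8 ⊕ v13 ∷ v10 ⊕ v12 ≛ su v13 ∷ []) (v3 ≛ v0) ((1 ∷ 0 ∷ 1 ∷ 1 ∷ 0 ∷ 1 ∷ 0 ∷ 0 ∷ 0 ∷ 1 ∷ 0 ∷ 0 ∷ 1 ∷ 0 ∷ 1 ∷ 1 ∷ 0 ∷ 1 ∷ 0 ∷ 0 ∷ 1 ∷ []) , (1 ∷ 1 ∷ 0 ∷ 0 ∷ 1 ∷ 0 ∷ 1 ∷ 1 ∷ 0 ∷ 0 ∷ 1 ∷ 1 ∷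 0 ∷ 1 ∷ 0 ∷ 0 ∷ 1 ∷ 0 ∷ 1 ∷ 1 ∷ [])))
          (κ-d r) κ'-d (ν'-spec r) x y (cong κ dr) (proj₁ ih 0 t z≤n (<⇒≤ ti) d'r) (cong κ d'r) (slope (suc c) 0 t refl ti) (wd-spec t)
      where
      dr : d r ≡ p0 + suc t
      dr = cong d e ∙ rais t ti
      d'r : d' r ≡ p0 + t
      d'r = (lia ((d' r) ∷ (ind q i r) ∷ (d r) ∷ (ind P (suc i) r) ∷ p0 ∷ t ∷ []) (v0 ⊕ v1 ≛ v2 ⊕ v3 ∷ v1 ≛ li 1 ∷ v3 ≛ li 0 ∷ v2 ≛ v4 ⊕ (su v5) ∷ []) (v0 ≛ v4 ⊕ v5) ((1 ∷ 1 ∷ 0 ∷ 0 ∷ 1 ∷ 1 ∷ 0 ∷ 1 ∷ []) , (1 ∷ 0 ∷ 1 ∷ 1 ∷ 0 ∷ 0 ∷ 0 ∷ 0 ∷ 1 ∷ []))) (d'-spec r) y x dr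
    ... | other a b x y = (lia ((κ r) ∷ (ν r) ∷ (κ (d r)) ∷ (κ' r) ∷ (ν' r) ∷ (κ' (d' r)) ∷ (ind P (suc i) r) ∷ (ind q i r) ∷ []) (v0 ≛ v1 ⊕ v2 ∷ v3 ≛ v4 ⊕ v5 ∷ v4 ⊕ v6 ≛ v1 ⊕ v7 ∷ v6 ≛ li 0 ∷ v7 ≛ li 0 ∷ v5 ≛ v2 ∷ []) (v3 ≛ v0) ((1 ∷ 0 ∷ 1 ∷ 1 ∷ 0 ∷ 1 ∷ 0 ∷ 0 ∷ 0 ∷ 1 ∷ 0 ∷ 1 ∷ []) , (1 ∷ 1 ∷ 0 ∷ 0 ∷ 1 ∷ 0 ∷ 1 ∷ 1 ∷ 0 ∷ 0 ∷ 0 ∷ 0 ∷ 1 ∷ [])))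
          (κ-d r) κ'-d (ν'-spec r) x y (proj₂ ih free ∙ cong κ d'r)
      where
      d'r : d' r ≡ d r
      d'r = (lia ((d' r) ∷ (ind q i r) ∷ (d r) ∷ (ind P (suc i) r) ∷ []) (v0 ⊕ v1 ≛ v2 ⊕ v3 ∷ v1 ≛ li 0 ∷ v3 ≛ li 0 ∷ []) (v0 ≛ v2) ((1 ∷ 1 ∷ 0 ∷ 0 ∷ 0 ∷ 1 ∷ []) , (1 ∷ 0 ∷ 1 ∷ 1 ∷ []))) (d'-spec r) y x
      free : ¬ InBlock (d' r)
      free (zero , zero , _ , _ , e) = top r (sym d'r ∙ e ∙ +-identityʳ p0)
      free (zero , suc t , _ , ti , e) = b (subst (λ z → q ≤ z × z < q + i) (sym (d-inj (sym d'r ∙ e ∙ sym (rais t ti)))) (m≤m+n q t , +-monoʳ-< q ti))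
      free (suc j , t , jc , ti , e) = nb (j , t , <⇒≤ jc , ti , d-inj (sym d'r ∙ e ∙ sym (blk j t (<⇒≤ jc) ti)))

  cmp-all : ∀ r → Cmp r
  cmp-all r = cmp ℓ r (m≤n+m ℓ r)

  κ-block : ∀ j i' → j ≤ c → i' ≤ i → κ (row j i') ≡ κ' (row j i') + wd i'
  κ-block j i' jc hi = proj₁ (cmp-all _) j i' jc hi refl

  κ-same : ∀ r → ¬ InBlock r → κ' r ≡ κ r
  κ-same r = proj₂ (cmp-all r)

  κ'≤κ : ∀ r → κ' r ≤ κ r
  κ'≤κ r with inBlock? r
  ... | inj₁ (j , i' , jc , hi , e) = subst (λ z → κ' z ≤ κ z) (sym e) (≤-trans (m≤m+n _ (wd i')) (≤-reflexive (sym (κ-block j i' jc hi))))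
  ... | inj₂ nb = ≤-reflexive (κ-same r nb)

  -- This is the ribbon condition: consecutive rows of a removed piece share exactly one column.
  κ'-step : ∀ j i' → j ≤ c → i' < i → suc (κ' (row j i')) ≡ κ (row j (suc i'))
  κ'-step j i' jc hi = (lia ((κ (row j i')) ∷ (κ' (row j i')) ∷ (wd i') ∷ (κ (X + suc i')) ∷ (κ (row j (suc i'))) ∷ (κ (X + i')) ∷ []) (v0 ≛ v1 ⊕ v2 ∷ v0 ⊕ v3 ≛ v4 ⊕ v5 ∷ v2 ⊕ v3 ≛ su v5 ∷ []) (su v1 ≛ v4) ((1 ∷ 0 ∷ 1 ∷ 1 ∷ 0 ∷ 0 ∷ 1 ∷ []) , (1 ∷ 1 ∷ 0 ∷ 0 ∷ 1 ∷ 1 ∷ [])))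
    (κ-block j i' jc (<⇒≤ hi)) (slope (suc c ∸ j) j i' (m+[n∸m]≡n (m≤n⇒m≤1+n jc)) hi) (wd-spec i')

  d'-chain : ∀ j → j < c → d' (row j i) ≡ row (suc j) i
  d'-chain j j<c with kind (row j i)
  ... | bottom i' _ e' _ _ = ⊥-elim (<⇒≱ (row-next j i (<⇒≤ j<c) ≤-refl) (≤-trans (it-le p0 j<c) (≤-trans (m≤m+n P i') (≤-reflexive (sym e')))))
  ... | raised t' ti e' _ _ = ⊥-elim (<⇒≢ (≤-<-trans (+-monoʳ-≤ p0 ti) (<-≤-trans (seps tw 0 z≤n) (≤-trans (it-le {1} {suc j} p0 (s≤s z≤n)) (m≤m+n _ i))))
          (sym (rais t' ti) ∙ cong d (sym e') ∙ blk j i (<⇒≤ j<c) ≤-refl))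
  ... | other _ _ x' y' = (lia ((d' b) ∷ (ind q i b) ∷ (d b) ∷ (ind P (suc i) b) ∷ y ∷ []) (v0 ⊕ v1 ≛ v2 ⊕ v3 ∷ v1 ≛ li 0 ∷ v3 ≛ li 0 ∷ v2 ≛ v4 ∷ []) (v0 ≛ v4) ((1 ∷ 1 ∷ 0 ∷ 0 ∷ 0 ∷ 1 ∷ 0 ∷ 1 ∷ []) , (1 ∷ 0 ∷ 1 ∷ 1 ∷ 0 ∷ 0 ∷ 0 ∷ 0 ∷ 1 ∷ []))) (d'-spec b) y' x' (blk j i (<⇒≤ j<c) ≤-refl)
    where
    b y : ℕ
    b = row j i
    y = row (suc j) i

  -- A ribbon does not continue below its last row. At the bottom this is maximality, through the
  -- drop of ν after the block; higher up it is inherited from the next block through d.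
  κ'-end : ∀ t j → j + t ≡ c → κ (suc (row j i)) ≤ κ' (row j i)
  κ'-end zero j e with sym (+-identityʳ j) ∙ e
  ... | refl = (lia ((κ a) ∷ (ν a) ∷ (κ (d a)) ∷ (κ (P + i)) ∷ (κ' (P + i)) ∷ (wd i) ∷ (ν (P + i)) ∷ (κ (d (P + i))) ∷ (κ (X + i)) ∷ (κ (X + suc i)) ∷ (ν P) ∷ []) (v0 ≛ v1 ⊕ v2 ∷ v3 ≛ v4 ⊕ v5 ∷ v3 ≛ v6 ⊕ v7 ∷ v7 ≛ v8 ∷ v5 ⊕ v9 ≛ su v8 ∷ v2 ≼ v9 ∷ v1 ≺ v10 ∷ v6 ≛ v10 ∷ []) (v0 ≼ v4) ((1 ∷ 1 ∷ 0 ∷ 1 ∷ 0 ∷ 0 ∷ 1 ∷ 0 ∷ 1 ∷ 1 ∷ 0 ∷ 1 ∷ 1 ∷ 0 ∷ 1 ∷ []) , []))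
    (κ-d a) (κ-block c i ≤-refl ≤-refl) (κ-d (P + i)) (cong κ (blk c i ≤-refl ≤-refl)) (wd-spec i) (desc-le (≤-trans (≤-reflexive (+-suc X i)) (<⇒≤ last<))) ν-drop (ν-block i ≤-refl)
    where
    a : ℕ
    a = suc (P + i)
  κ'-end (suc t) j e = (lia ((κ a) ∷ (ν a) ∷ (κ (d a)) ∷ (κ' b) ∷ (ν' b) ∷ (κ' (d' b)) ∷ (ind P (suc i) b) ∷ (ν b) ∷ (ind q i b) ∷ (κ x) ∷ (κ' y) ∷ []) (v0 ≛ v1 ⊕ v2 ∷ v3 ≛ v4 ⊕ v5 ∷ v4 ⊕ v6 ≛ v7 ⊕ v8 ∷ v6 ≛ li 0 ∷ v2 ≼ v9 ∷ v9 ≼ v10 ∷ v5 ≛ v10 ∷ v1 ≼ v7 ∷ []) (v0 ≼ v3) ((1 ∷ 1 ∷ 0 ∷ 0 ∷ 1 ∷ 0 ∷ 1 ∷ 1 ∷ 0 ∷ 1 ∷ 1 ∷ 0 ∷ 1 ∷ 1 ∷ []) , []))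
    (κ-d a) (Core.κ-d core' b) (ν'-spec b) indP (desc-le (≤-trans (s≤s (≤-reflexive (sym (blk j i jc ≤-refl)))) (mono b))) (κ'-end t (suc j) (sym (+-suc j t) ∙ e)) (cong κ' d'b)
    ((lia ((d b) ∷ (ν b) ∷ k ∷ b ∷ (d (suc b)) ∷ (ν (suc b)) ∷ []) (v0 ⊕ v1 ≛ su (v2 ⊕ v3) ∷ v4 ⊕ v5 ≛ su (v2 ⊕ (su v3)) ∷ v0 ≺ v4 ∷ []) (v5 ≼ v1) ((1 ∷ 0 ∷ 1 ∷ 1 ∷ 0 ∷ 1 ∷ []) , [])) (code b) (code (suc b)) (mono b))
    where
    a b x y : ℕ
    b = row j i
    a = suc b
    y = row (suc j) i
    x = suc y
    j<c : j < c
    j<c = ≤-trans (s≤s (m≤m+n j t)) (≤-reflexive (sym (+-suc j t) ∙ e))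
    jc : j ≤ c
    jc = <⇒≤ j<c
    indP : ind P (suc i) b ≡ 0
    indP = ind-low P (suc i) b (<-≤-trans (row-next j i jc ≤-refl) (it-le p0 j<c))
    d'b : d' b ≡ y
    d'b = d'-chain j j<c

  d'-bottom : d' (P + i) ≡ suc (X + i)
  d'-bottom with kind (P + i)
  ... | bottom _ _ _ x y = (lia ((d' b) ∷ (ind q i b) ∷ (d b) ∷ (ind P (suc i) b) ∷ X ∷ i ∷ []) (v0 ⊕ v1 ≛ v2 ⊕ v3 ∷ v1 ≛ li 0 ∷ v3 ≛ li 1 ∷ v2 ≛ v4 ⊕ v5 ∷ []) (v0 ≛ su (v4 ⊕ v5)) ((1 ∷ 1 ∷ 0 ∷ 0 ∷ 0 ∷ 1 ∷ 0 ∷ 1 ∷ []) , (1 ∷ 0 ∷ 1 ∷ 1 ∷ 0 ∷ 0 ∷ 1 ∷ 0 ∷ 1 ∷ []))) (d'-spec b) y x (blk c i ≤-refl ≤-refl)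
    where
    b : ℕ
    b = P + i
  ... | raised t ti e _ _ = ⊥-elim (<⇒≱ (q<p0 t ti) (≤-trans p0≤P (≤-trans (m≤m+n P i) (≤-reflexive e))))
  ... | other a _ _ _ = ⊥-elim (a (m≤m+n P i , ≤-refl))

  X-free : ∀ a → ¬ InBlock (X + a)
  X-free a (j , t , jc , ti , e) = <⇒≱ (seps tw c ≤-refl) (≤-trans (m≤m+n X a) (≤-trans (≤-reflexive e) (row-c j t jc ti)))

  swapping : Swapping co p0 c i q
  swapping = record { tower = tw ; last = last ; inside = inside ; κ' = κ' ; ν' = ν' ; d' = d' ; core' = core'
    ; d'-def = λ r → refl ; ν'-spec = ν'-spec ; size = size ; block? = inBlock? ; κ-same = κ-same ; κ'≤κ = κ'≤κ
    ; κ'<κ = λ j i' a b → ≤-trans (m<m+n _ {wd i'} (s≤s z≤n)) (≤-reflexive (sym (κ-block j i' a b)))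
    ; κ'-step = κ'-step ; κ'-end = λ j jc → κ'-end (c ∸ j) j (m+[n∸m]≡n jc) ; d'-chain = d'-chain ; d'-bottom = d'-bottom
    ; X-free = X-free ; row-next = row-next }

-- Every proper subcore lies inside a swap

module Lift (k ℓ : ℕ) (κ ν d : ℕ → ℕ) (A : Core k ℓ κ ν d) (τ ντ dτ : ℕ → ℕ) (B : Core k ℓ τ ντ dτ)
  (sub : ∀ r → τ r ≤ κ r) where
  open Core A
  open RowMap d mono up
  module B = Core B

  -- Comparison of bead positions: row r of a partition carries the bead r - κ r.
  G : (ℕ → ℕ) → ℕ → ℕ → Set
  G κ a b = b + τ a ≤ a + κ b

  -- Both row maps move a bead by k + 1, so comparisons of beads can be transported down, and by
  -- `G-d⁻¹` back up.
  G-d : ∀ {κ ν d} → Core k ℓ κ ν d → ∀ a b → G κ a b → G κ (dτ a) (d b)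
  G-d {κ} {ν} {d} C a b g = (lia (b ∷ (τ a) ∷ a ∷ (κ b) ∷ (ν b) ∷ (κ (d b)) ∷ (d b) ∷ k ∷ (ντ a) ∷ (τ (dτ a)) ∷ (dτ a) ∷ []) (v0 ⊕ v1 ≼ v2 ⊕ v3 ∷ v3 ≛ v4 ⊕ v5 ∷ v6 ⊕ v4 ≛ su (v7 ⊕ v0) ∷ v1 ≛ v8 ⊕ v9 ∷ v10 ⊕ v8 ≛ su (v7 ⊕ v2) ∷ []) (v6 ⊕ v9 ≼ v10 ⊕ v5) ((1 ∷ 1 ∷ 1 ∷ 0 ∷ 1 ∷ 0 ∷ 0 ∷ 1 ∷ 0 ∷ 1 ∷ []) , []))
    g (Core.κ-d C b) (Core.code C b) (B.κ-d a) (B.code a)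

  G-d⁻¹ : ∀ {κ ν d} → Core k ℓ κ ν d → ∀ a b → G κ (dτ a) (d b) → G κ a b
  G-d⁻¹ {κ} {ν} {d} C a b g = (lia ((d b) ∷ (τ (dτ a)) ∷ (dτ a) ∷ (κ (d b)) ∷ (κ b) ∷ (ν b) ∷ k ∷ b ∷ (τ a) ∷ (ντ a) ∷ a ∷ []) (v0 ⊕ v1 ≼ v2 ⊕ v3 ∷ v4 ≛ v5 ⊕ v3 ∷ v0 ⊕ v5 ≛ su (v6 ⊕ v7) ∷ v8 ≛ v9 ⊕ v1 ∷ v2 ⊕ v9 ≛ su (v6 ⊕ v10) ∷ []) (v7 ⊕ v8 ≼ v10 ⊕ v4) ((1 ∷ 1 ∷ 0 ∷ 1 ∷ 0 ∷ 1 ∷ 1 ∷ 0 ∷ 1 ∷ []) , []))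
    g (Core.κ-d C b) (Core.code C b) (B.κ-d a) (B.code a)

  G-later : ∀ κ {a a' b} → a ≤ a' → G κ a b → G κ a' b
  G-later κ {a} {a'} {b} p g = (lia (b ∷ (τ a) ∷ a ∷ (κ b) ∷ a' ∷ (τ a') ∷ []) (v0 ⊕ v1 ≼ v2 ⊕ v3 ∷ v2 ≼ v4 ∷ v5 ≼ v1 ∷ []) (v0 ⊕ v5 ≼ v4 ⊕ v3) ((1 ∷ 1 ∷ 1 ∷ 1 ∷ []) , [])) g p (B.desc-le p)

  first-diff : ∀ n → (∀ r → r < n → τ r ≡ κ r) ⊎ (∃ λ p → τ p < κ p × (∀ r → r < p → τ r ≡ κ r))
  first-diff zero = inj₁ λ r ()
  first-diff (suc n) with first-diff n
  ... | inj₂ x = inj₂ x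
  ... | inj₁ h with τ n <? κ n
  ...   | yes q = inj₂ (n , q , h)
  ...   | no q = inj₁ λ r p → case r p (r ≟ n)
    where
    case : ∀ r → r < suc n → _ → τ r ≡ κ r
    case r p (yes refl) = ≤-antisym (sub n) (≮⇒≥ q)
    case r p (no ne) = h r (≤∧≢⇒< (ℕ.s≤s⁻¹ p) ne)

  Result : Set
  Result = ∃ λ p0 → ∃ λ c → ∃ λ i → ∃ λ q → Σ (Swapping A p0 c i q) λ swp → ∀ r → τ r ≤ Swapping.κ' swp r

  consecutive : ∀ a b n → d a ≡ b → (∀ t → t < n → ∃ λ u → d u ≡ b + suc t) → ∀ t → t ≤ n → d (a + t) ≡ b + t
  consecutive a b n e h zero _ = cong d (+-identityʳ a) ∙ e ∙ sym (+-identityʳ b)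
  consecutive a b n e h (suc t) p with h t p
  ... | u , du = ≤-antisym
      (≤-trans (≤-trans (≤-reflexive (cong d (+-suc a t))) (d-le (d-lt⁻¹ (subst₂ _<_ (sym prev) (sym du) (+-monoʳ-< b (n<1+n t)))))) (≤-reflexive du))
      (≤-trans (≤-reflexive (+-suc b t ∙ cong suc (sym prev))) (≤-trans (mono (a + t)) (≤-reflexive (cong d (sym (+-suc a t))))))
    where
    prev : d (a + t) ≡ b + t
    prev = consecutive a b n e h t (<⇒≤ p)

  module From (p : ℕ) (τp<κp : τ p < κ p) (agree : ∀ r → r < p → τ r ≡ κ r) where

    -- If d u = p, then u lies above p and carries the same bead in both cores, so the bead of κ in
    -- row p is a bead of τ as well. But above row p the beads of τ are smaller ones of κ, and from
    -- row p on they are larger.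
    p-top : ∀ u → d u ≢ p
    p-top u e with dτ u <? p
    ... | yes q = (lia ((κ u) ∷ (ν u) ∷ (κ p) ∷ (d u) ∷ k ∷ u ∷ p ∷ (τ u) ∷ (ντ u) ∷ (τ (dτ u)) ∷ (dτ u) ∷ (κ (dτ u)) ∷ []) (v0 ≛ v1 ⊕ v2 ∷ v3 ⊕ v1 ≛ su (v4 ⊕ v5) ∷ v3 ≛ v6 ∷ v7 ≛ v8 ⊕ v9 ∷ v10 ⊕ v8 ≛ su (v4 ⊕ v5) ∷ v7 ≛ v0 ∷ v9 ≛ v11 ∷ v2 ≼ v11 ∷ v10 ≺ v6 ∷ []) (ff) ((1 ∷ 0 ∷ 1 ∷ 0 ∷ 0 ∷ 1 ∷ 0 ∷ 1 ∷ 0 ∷ 1 ∷ 1 ∷ 0 ∷ 0 ∷ 1 ∷ 1 ∷ 1 ∷ []) , []))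
          (κ-d u ∙ cong (λ x → ν u + κ x) e) (code u) e (B.κ-d u) (B.code u) (agree u u<p) (agree (dτ u) q) (desc-le (<⇒≤ q)) q
      where
      u<p : u < p
      u<p = subst (u <_) e (up u)
    ... | no q = (lia ((κ u) ∷ (ν u) ∷ (κ p) ∷ (d u) ∷ k ∷ u ∷ p ∷ (τ u) ∷ (ντ u) ∷ (τ (dτ u)) ∷ (dτ u) ∷ (τ p) ∷ []) (v0 ≛ v1 ⊕ v2 ∷ v3 ⊕ v1 ≛ su (v4 ⊕ v5) ∷ v3 ≛ v6 ∷ v7 ≛ v8 ⊕ v9 ∷ v10 ⊕ v8 ≛ su (v4 ⊕ v5) ∷ v7 ≛ v0 ∷ v9 ≼ v11 ∷ v11 ≺ v2 ∷ v6 ≼ v10 ∷ []) (ff) ((0 ∷ 1 ∷ 0 ∷ 1 ∷ 1 ∷ 0 ∷ 1 ∷ 0 ∷ 1 ∷ 0 ∷ 0 ∷ 1 ∷ 1 ∷ 1 ∷ 1 ∷ []) , []))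
          (κ-d u ∙ cong (λ x → ν u + κ x) e) (code u) e (B.κ-d u) (B.code u) (agree u u<p) (B.desc-le (≮⇒≥ q)) τp<κp (≮⇒≥ q)
      where
      u<p : u < p
      u<p = subst (u <_) e (up u)

    -- Row s ends the connected piece of the difference that begins in row p; rows are linked as
    -- long as they share a column. The zero rows from ℓ on stop the search.
    chunk : ∃ λ s → p ≤ s × τ s < κ s × κ (suc s) ≤ τ s × (∀ r → p ≤ r → r < s → τ r < κ (suc r))
    chunk = go ℓ p ≤-refl τp<κp (λ r a b → ⊥-elim (<⇒≱ b a)) (m≤n+m ℓ p)
      where
      go : ∀ f s → p ≤ s → τ s < κ s → (∀ r → p ≤ r → r < s → τ r < κ (suc r)) → ℓ ≤ s + f →
        ∃ λ s → p ≤ s × τ s < κ s × κ (suc s) ≤ τ s × (∀ r → p ≤ r → r < s → τ r < κ (suc r))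
      go zero s ps lt h g = ⊥-elim (<⇒≱ lt (≤-trans (≤-reflexive (zero-from s (subst (ℓ ≤_) (+-identityʳ s) g))) z≤n))
      go (suc f) s ps lt h g with κ (suc s) ≤? τ s
      ... | yes q = s , ps , lt , q , h
      ... | no q = go f (suc s) (m≤n⇒m≤1+n ps) (≤-<-trans (B.desc s) (≰⇒> q)) h' (subst (ℓ ≤_) (+-suc s f) g)
        where
        h' : ∀ r → p ≤ r → r < suc s → τ r < κ (suc r)
        h' r a b with r ≟ s
        ... | yes refl = ≰⇒> q
        ... | no ne = h r a (≤∧≢⇒< (ℕ.s≤s⁻¹ b) ne)

    module Chunk (s : ℕ) (p≤s : p ≤ s) (τs<κs : τ s < κ s) (end : κ (suc s) ≤ τ s) (linked : ∀ r → p ≤ r → r < s → τ r < κ (suc r)) where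

      -- The search for a row outside the image of d goes upwards from s and ends at p at the
      -- latest, by `p-top`. The rows passed on the way are images, which later gives gapless
      -- blocks.
      lowest-top : ∃ λ p0 → p ≤ p0 × p0 ≤ s × (∀ u → d u ≢ p0) × (∀ r → p0 < r → r ≤ s → ∃ λ u → d u ≡ r)
      lowest-top = go s p≤s ≤-refl (λ r a b → ⊥-elim (<⇒≱ a b))
        where
        go : ∀ t → p ≤ t → t ≤ s → (∀ r → t < r → r ≤ s → ∃ λ u → d u ≡ r) → ∃ λ p0 → p ≤ p0 × p0 ≤ s × (∀ u → d u ≢ p0) × (∀ r → p0 < r → r ≤ s → ∃ λ u → d u ≡ r)
        go t pt ts h with preimage? t
        ... | inj₂ none = t , pt , ts , none , h
        go zero pt ts h | inj₁ (u , e) = ⊥-elim (p-top u (e ∙ sym (n≤0⇒n≡0 pt)))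
        go (suc t) pt ts h | inj₁ (u , e) with p ≟ suc t
        ... | yes refl = ⊥-elim (p-top u e)
        ... | no ne = go t (ℕ.s≤s⁻¹ (≤∧≢⇒< pt ne)) (<⇒≤ ts) h'
          where
          h' : ∀ r → t < r → r ≤ s → ∃ λ u → d u ≡ r
          h' r a b with suc t ≟ r
          ... | yes refl = u , e
          ... | no ne' = h r (≤∧≢⇒< a ne') b

      module Top (p0 : ℕ) (p≤p0 : p ≤ p0) (p0≤s : p0 ≤ s) (top : ∀ u → d u ≢ p0) (nontop : ∀ r → p0 < r → r ≤ s → ∃ λ u → d u ≡ r) where

        -- The chain from p0 is followed as far as it stays within rows up to s. The distance from
        -- its last row to s then fixes the tentative height of the ribbons.
        deepest : ∃ λ J → it d J p0 ≤ s × s < it d (suc J) p0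
        deepest = go s 0 p0≤s (m≤m+n s p0)
          where
          go : ∀ f j → it d j p0 ≤ s → s ≤ f + it d j p0 → ∃ λ J → it d J p0 ≤ s × s < it d (suc J) p0
          go f j h g with it d (suc j) p0 ≤? s
          ... | no q = j , h , ≰⇒> q
          go zero j h g | yes q = ⊥-elim (<⇒≱ (up (it d j p0)) (≤-trans q g))
          go (suc f) j h g | yes q = go f (suc j) q (≤-trans g (≤-trans (≤-reflexive (sym (+-suc f _))) (+-monoʳ-≤ f (up (it d j p0)))))

        module Descend (J : ℕ) (x≤s : it d J p0 ≤ s) (s<x : s < it d (suc J) p0) where
          h : ℕ
          h = s ∸ it d J p0
          x+h : it d J p0 + h ≡ s
          x+h = m+[n∸m]≡n x≤s

          x : ℕ → ℕ
          x t = it d (t + J) p0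
          -- The row of τ carrying the bead of row s shifted by t (k + 1).
          F : ℕ → ℕ
          F zero = s
          F (suc t) = dτ (F t)

          sep : ∀ t → x t + h < x (suc t)
          sep zero = subst (_< x 1) (sym x+h) s<x
          sep (suc t) = <-≤-trans (+-monoʳ-< (x (suc t)) (+-cancelˡ-< (x t) _ _ (subst (x t + h <_) (sym (m+[n∸m]≡n (<⇒≤ (up (x t))))) (sep t))))
            (≤-trans (d-add (x t) (x (suc t) ∸ x t)) (≤-reflexive (cong d (m+[n∸m]≡n (<⇒≤ (up (x t)))))))

          -- All rows after p0 and up to s are images of d, so on these blocks d runs through
          -- consecutive rows without a gap.
          early : ∀ j → j < J → ∀ i' → i' ≤ h → d (it d j p0 + i') ≡ it d (suc j) p0 + i'
          early j jJ = consecutive (it d j p0) (it d (suc j) p0) h refl λ t th → nontop _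
            (≤-trans (s≤s (it-le {0} {suc j} p0 z≤n)) (≤-trans (s≤s (m≤m+n _ t)) (≤-reflexive (sym (+-suc _ t)))))
            (≤-trans (+-mono-≤ (it-le p0 jJ) th) (≤-reflexive x+h))

          lifts : ∃ λ q → ∀ i' → i' < h → d (q + i') ≡ p0 + suc i'
          lifts with h in eq
          ... | zero = 0 , λ i' ()
          ... | suc h' = proj₁ q₀ , λ i' l → consecutive (proj₁ q₀) (suc p0) h' (proj₂ q₀)
                   (λ t th → inS (suc (suc p0 + t)) (suc p0 + suc t) (sym (+-suc (suc p0) t)) (≤-trans (s≤s (m≤m+n p0 t)) (n≤1+n _)) ((lia (p0 ∷ y ∷ z ∷ s ∷ h' ∷ t ∷ []) (v0 ≼ v1 ∷ v1 ⊕ v2 ≛ v3 ∷ v2 ≛ su v4 ∷ v5 ≺ v4 ∷ []) (su ((su v0) ⊕ v5) ≼ v3) ((1 ∷ 1 ∷ 1 ∷ 0 ∷ 0 ∷ 1 ∷ 1 ∷ []) , [])) (it-le {0} {J} p0 z≤n) x+h eq th))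
                   i' (ℕ.s≤s⁻¹ l) ∙ sym (+-suc p0 i')
            where
            y z : ℕ
            y = it d J p0
            z = s ∸ it d J p0
            inS : ∀ a b → a ≡ b → p0 < a → a ≤ s → ∃ λ u → d u ≡ b
            inS a b refl = nontop a
            q₀ : ∃ λ u → d u ≡ suc p0
            q₀ = nontop (suc p0) ≤-refl ((lia (p0 ∷ y ∷ z ∷ s ∷ h' ∷ []) (v0 ≼ v1 ∷ v1 ⊕ v2 ≛ v3 ∷ v2 ≛ su v4 ∷ []) (su v0 ≼ v3) ((1 ∷ 1 ∷ 1 ∷ 0 ∷ 0 ∷ 1 ∷ []) , [])) (it-le {0} {J} p0 z≤n) x+h eq)

          -- The tracked bead of τ lies strictly between the beads of κ in row x t + h and in the
          -- next row. As long as this persists the ribbons have to reach one block further down.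
          -- `shifted` is the linking of the first block transported along the two row maps.
          record State (t : ℕ) : Set where
            field
              blk : ∀ j → j < t + J → ∀ i' → i' ≤ h → d (it d j p0 + i') ≡ it d (suc j) p0 + i'
              below : (x t + h) + τ (F t) < F t + κ (x t + h)
              above : F t + κ (suc (x t + h)) < suc (x t + h) + τ (F t)
              inner : ∀ t' → t' ≤ t → ∀ i' → i' < h → G κ (x t' + i') (suc (x t' + i'))
              shifted : ∃ λ g → g + h ≡ F t × g ≤ x t × (∀ i' → i' < h → G κ (g + i') (suc (x t + i')))
              rows : ∀ t' → t' ≤ t → F t' ≤ x t' + h

          G-linked : ∀ r → p ≤ r → r < s → G κ r (suc r)
          G-linked r a b = (lia ((τ r) ∷ (κ (suc r)) ∷ r ∷ []) (v0 ≺ v1 ∷ []) ((su v2) ⊕ v0 ≼ v2 ⊕ v1) ((1 ∷ 1 ∷ []) , [])) (linked r a b)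

          p≤it : ∀ j → p ≤ it d j p0
          p≤it j = ≤-trans p≤p0 (it-le {0} {j} p0 z≤n)

          init : State 0
          init = record
            { blk = early
            ; below = subst (λ y → y + τ s < s + κ y) (sym x+h) (+-monoʳ-< s τs<κs)
            ; above = subst (λ y → s + κ (suc y) < suc y + τ s) (sym x+h) (s≤s (+-monoʳ-≤ s end))
            ; inner = λ { zero _ → g₀ }
            ; shifted = it d J p0 , x+h , ≤-refl , g₀
            ; rows = λ { zero _ → ≤-reflexive (sym x+h) }
            }
            where
            g₀ : ∀ i' → i' < h → G κ (it d J p0 + i') (suc (it d J p0 + i'))
            g₀ i' l = G-linked _ (≤-trans (p≤it J) (m≤m+n _ i')) (<-≤-trans (+-monoʳ-< _ l) (≤-reflexive x+h))

          scan : ∀ a b n → (∀ i' → i' ≤ n → d (a + i') ≡ b + i') ⊎ (d a ≢ b) ⊎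
            (∃ λ i → i < n × (∀ i' → i' ≤ i → d (a + i') ≡ b + i') × d (suc (a + i)) ≢ suc (b + i))
          scan a b zero with d a ≟ b
          ... | yes e = inj₁ λ { zero _ → cong d (+-identityʳ a) ∙ e ∙ sym (+-identityʳ b) }
          ... | no ne = inj₂ (inj₁ ne)
          scan a b (suc n) with scan a b n
          ... | inj₂ (inj₁ ne) = inj₂ (inj₁ ne)
          ... | inj₂ (inj₂ (i , l , u , v)) = inj₂ (inj₂ (i , <-trans l (n<1+n n) , u , v))
          ... | inj₁ u with d (suc (a + n)) ≟ suc (b + n)
          ...   | no ne = inj₂ (inj₂ (n , n<1+n n , u , ne))
          ...   | yes e = inj₁ u'
            where
            u' : ∀ i' → i' ≤ suc n → d (a + i') ≡ b + i'
            u' i' l with i' ≟ suc n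
            ... | yes refl = cong d (+-suc a n) ∙ e ∙ sym (+-suc b n)
            ... | no ne = u i' (ℕ.s≤s⁻¹ (≤∧≢⇒< l ne))

          -- The descent stops in two ways. Either d leaves a gap inside the block, and the ribbons
          -- are cut to that smaller height; or they keep the full height h and the bead comparison
          -- `deep` below the bottom block protects their last rows.
          module Stop (t : ℕ) (st : State t) (i : ℕ) (i≤h : i ≤ h) (level : ∀ i' → i' ≤ i → d (x t + i') ≡ x (suc t) + i')
            (last : d (suc (x t + i)) ≢ suc (x (suc t) + i))
            (deep : i ≡ h → G κ (F (suc t)) (suc (x (suc t) + h))) where
            open State st

            tower : Tower d p0 (t + J) i (proj₁ lifts)
            tower = record { top = top ; blk = blks ; sep = ≤-<-trans (+-monoʳ-≤ (x t) i≤h) (sep t)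
              ; rais = λ i' l → proj₂ lifts i' (<-≤-trans l i≤h) }
              where
              blks : ∀ j i' → j ≤ t + J → i' ≤ i → d (it d j p0 + i') ≡ it d (suc j) p0 + i'
              blks j i' a b with j ≟ t + J
              ... | yes refl = level i' b
              ... | no ne = blk j (≤∧≢⇒< a ne) i' (≤-trans b i≤h)

            -- From row ℓ on ν is zero and d is a translation, so the block could be extended,
            -- against `last`.
            inside : x t + i < ℓ
            inside with x t + i <? ℓ
            ... | yes q = q
            ... | no q = ⊥-elim (last ((lia ((d a) ∷ (ν a) ∷ k ∷ a ∷ (d (suc a)) ∷ (ν (suc a)) ∷ b ∷ []) (v0 ⊕ v1 ≛ su (v2 ⊕ v3) ∷ v4 ⊕ v5 ≛ su (v2 ⊕ (su v3)) ∷ v1 ≛ li 0 ∷ v5 ≛ li 0 ∷ v0 ≛ v6 ∷ []) (v4 ≛ su v6) ((1 ∷ 0 ∷ 1 ∷ 1 ∷ 0 ∷ 1 ∷ 0 ∷ 0 ∷ 0 ∷ 1 ∷ []) , (1 ∷ 1 ∷ 0 ∷ 0 ∷ 1 ∷ 0 ∷ 0 ∷ 1 ∷ 0 ∷ 0 ∷ 1 ∷ [])))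
                    (code a) (code (suc a)) (ν-out a (≮⇒≥ q)) (ν-out (suc a) (m≤n⇒m≤1+n (≮⇒≥ q))) (level i ≤-refl)))
              where
              a b : ℕ
              a = x t + i
              b = x (suc t) + i

            swp : Swapping A p0 (t + J) i (proj₁ lifts)
            swp = Swapped.swapping k ℓ κ ν d A p0 (t + J) i (proj₁ lifts) tower last inside
            open Swapping swp using (κ'; core'; d'-bottom; d'-chain; κ-same; X-free; κ'-end; κ'-step; row-next) renaming (block? to inBlock?)
            row : ℕ → ℕ → ℕ
            row j i' = it d j p0 + i'
            X : ℕ
            X = it d (suc (t + J)) p0

            -- In κ' the row map sends the last row of the bottom ribbon to the row for which `deep`
            -- holds, so the comparison can be pulled back through `d'` and `dτ` block by block.
            ends : i ≡ h → ∀ t' → t' ≤ t → G κ' (F t') (x t' + h)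
            ends refl t' tt' = go (t ∸ t') t' (m+[n∸m]≡n tt')
              where
              go : ∀ f t' → t' + f ≡ t → G κ' (F t') (x t' + h)
              go zero t' e with sym (+-identityʳ t') ∙ e
              ... | refl = G-d⁻¹ core' (F t) (x t + h) (subst (G κ' (F (suc t))) (sym d'-bottom)
                    (subst (λ y → suc (X + h) + τ (F (suc t)) ≤ F (suc t) + y)
                      (sym (cong κ' (sym (+-suc X h)) ∙ κ-same _ (X-free (suc h)) ∙ cong κ (+-suc X h))) (deep refl)))
              go (suc f) t' e = G-d⁻¹ core' (F t') (x t' + h) (subst (G κ' (F (suc t'))) (sym (d'-chain (t' + J) (+-monoˡ-< J t'<t)))
                    (go f (suc t') (sym (+-suc t' f) ∙ e)))
                where
                t'<t : t' < t
                t'<t = ≤-trans (s≤s (m≤m+n t' f)) (≤-reflexive (sym (+-suc t' f) ∙ e))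

            strict : ∀ j i' → j ≤ t + J → i' < h → τ (row j i') < κ (suc (row j i'))
            strict j i' a l with j ≤? J
            ... | yes jJ = linked _ (≤-trans (p≤it j) (m≤m+n _ i')) (<-≤-trans (+-monoʳ-< _ l) (≤-trans (+-monoˡ-≤ h (it-le p0 jJ)) (≤-reflexive x+h)))
            ... | no nj = unG _ (subst (λ z → G κ (it d z p0 + i') (suc (it d z p0 + i'))) (m∸n+n≡m (<⇒≤ (≰⇒> nj)))
                    (inner (j ∸ J) (≤-trans (∸-monoˡ-≤ J a) (≤-reflexive (m+n∸n≡m t J))) i' l))
              where
              unG : ∀ r → G κ r (suc r) → τ r < κ (suc r)
              unG r g = (lia (r ∷ (τ r) ∷ (κ (suc r)) ∷ []) ((su v0) ⊕ v1 ≼ v0 ⊕ v2 ∷ []) (v1 ≺ v2) ((1 ∷ 1 ∷ []) , [])) g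

            full-end : ∀ j → j ≤ t + J → i ≡ h → τ (row j h) ≤ κ' (row j h)
            full-end j a e with j <? J
            ... | yes jJ = <⇒≤ (<-≤-trans (linked _ (≤-trans (p≤it j) (m≤m+n _ h)) (<-≤-trans (subst (λ z → row j z < it d (suc j) p0) e (row-next j i a ≤-refl)) (≤-trans (it-le p0 jJ) x≤s)))
                    (subst (λ z → κ (suc (row j z)) ≤ κ' (row j z)) e (κ'-end j a)))
            ... | no nj = subst (λ z → τ (it d z p0 + h) ≤ κ' (it d z p0 + h)) (m∸n+n≡m (≮⇒≥ nj)) (fin (j ∸ J) (≤-trans (∸-monoˡ-≤ J a) (≤-reflexive (m+n∸n≡m t J))))
              where
              fin : ∀ t' → t' ≤ t → τ (x t' + h) ≤ κ' (x t' + h)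
              fin t' l = (lia (b ∷ (τ b) ∷ (κ' b) ∷ []) (v0 ⊕ v1 ≼ v0 ⊕ v2 ∷ []) (v1 ≼ v2) ((1 ∷ 1 ∷ []) , [])) (G-later κ' (rows t' l) (ends e t' l))
                where
                b : ℕ
                b = x t' + h

            -- Inner rows of a ribbon lose only boxes outside τ because τ links them. For the last
            -- row of a shortened ribbon linking and `κ'-end` suffice; for one of full height the
            -- bead comparison decides.
            contains : ∀ r → τ r ≤ κ' r
            contains r with inBlock? r
            ... | inj₂ nb = ≤-trans (sub r) (≤-reflexive (sym (κ-same r nb)))
            ... | inj₁ (j , i' , a , b , refl) with i' <? i
            ...   | yes l = ℕ.s≤s⁻¹ (≤-trans (strict j i' a (<-≤-trans l i≤h)) (≤-reflexive (cong κ (sym (+-suc (it d j p0) i')) ∙ sym (κ'-step j i' a l))))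
            ...   | no nl with ≤-antisym b (≮⇒≥ nl)
            ...     | refl with i' <? h
            ...       | yes l = ≤-trans (<⇒≤ (strict j i' a l)) (κ'-end j a)
            ...       | no l with ≤-antisym i≤h (≮⇒≥ l)
            ...         | e = subst (λ z → τ (it d j p0 + z) ≤ κ' (it d j p0 + z)) (sym e) (full-end j a e)

            result : Result
            result = p0 , t + J , i , proj₁ lifts , swp , contains

          -- The whole block is mapped without a gap and the tracked bead is still below that of the
          -- following row, so all the conditions move to the image block.
          next : ∀ t → State t → (∀ i' → i' ≤ h → d (x t + i') ≡ x (suc t) + i') → ¬ G κ (F (suc t)) (suc (x (suc t) + h)) → State (suc t)
          next t st all ng = record
            { blk = blk'
            ; below = subst (λ y → y + τ (F (suc t)) < F (suc t) + κ y) (all h ≤-refl) below'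
            ; above = ≰⇒> ng
            ; inner = inner'
            ; shifted = g' , g'+h , g'≤x , shifted'
            ; rows = rows'
            }
            where
            open State st
            e f : ℕ
            e = x t + h
            f = F t
            below' : d e + τ (dτ f) < dτ f + κ (d e)
            below' = (lia (e ∷ (τ f) ∷ f ∷ (κ e) ∷ (ν e) ∷ (κ (d e)) ∷ (d e) ∷ k ∷ (ντ f) ∷ (τ (dτ f)) ∷ (dτ f) ∷ []) (v0 ⊕ v1 ≺ v2 ⊕ v3 ∷ v3 ≛ v4 ⊕ v5 ∷ v6 ⊕ v4 ≛ su (v7 ⊕ v0) ∷ v1 ≛ v8 ⊕ v9 ∷ v10 ⊕ v8 ≛ su (v7 ⊕ v2) ∷ []) (v6 ⊕ v9 ≺ v10 ⊕ v5) ((1 ∷ 1 ∷ 1 ∷ 0 ∷ 1 ∷ 0 ∷ 0 ∷ 1 ∷ 0 ∷ 1 ∷ []) , []))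
              below (κ-d e) (code e) (B.κ-d f) (B.code f)
            blk' : ∀ j → j < suc t + J → ∀ i' → i' ≤ h → d (it d j p0 + i') ≡ it d (suc j) p0 + i'
            blk' j l i' b with j ≟ t + J
            ... | yes refl = all i' b
            ... | no ne = blk j (≤∧≢⇒< (ℕ.s≤s⁻¹ l) ne) i' b
            F≤ : F (suc t) ≤ x (suc t) + h
            F≤ with F (suc t) ≤? x (suc t) + h
            ... | yes q = q
            ... | no q = ⊥-elim ((lia (f' ∷ (κ (suc e')) ∷ e' ∷ (τ f') ∷ (κ f') ∷ []) (v0 ⊕ v1 ≺ (su v2) ⊕ v3 ∷ v3 ≼ v4 ∷ v4 ≼ v1 ∷ su v2 ≼ v0 ∷ []) (ff) ((1 ∷ 1 ∷ 1 ∷ 1 ∷ []) , [])) (≰⇒> ng) (sub f') (desc-le (≰⇒> q)) (≰⇒> q))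
              where
              e' f' : ℕ
              e' = x (suc t) + h
              f' = F (suc t)
            rows' : ∀ t' → t' ≤ suc t → F t' ≤ x t' + h
            rows' t' l with t' ≟ suc t
            ... | yes refl = F≤
            ... | no ne = rows t' (ℕ.s≤s⁻¹ (≤∧≢⇒< l ne))
            g g' : ℕ
            g = proj₁ shifted
            h≤F : h ≤ F (suc t)
            h≤F = ≤-trans (m≤n+m h g) (≤-trans (≤-reflexive (proj₁ (proj₂ shifted))) (<⇒≤ (B.up f)))
            g' = F (suc t) ∸ h
            g'+h : g' + h ≡ F (suc t)
            g'+h = m∸n+n≡m h≤F
            g'≤x : g' ≤ x (suc t)
            g'≤x = +-cancelʳ-≤ h _ _ (≤-trans (≤-reflexive g'+h) F≤)
            module RB = RowMap dτ B.mono B.up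
            dτ-le : ∀ i' → i' ≤ h → dτ (g + i') ≤ g' + i'
            dτ-le i' l = (lia ((dτ (g + i')) ∷ y ∷ F' ∷ i' ∷ h ∷ g' ∷ []) (v0 ⊕ v1 ≼ v2 ∷ v3 ⊕ v1 ≛ v4 ∷ v5 ⊕ v4 ≛ v2 ∷ []) (v0 ≼ v5 ⊕ v3) ((1 ∷ 1 ∷ 0 ∷ 1 ∷ 0 ∷ 1 ∷ []) , []))
              (≤-trans (RB.d-add (g + i') y) (≤-reflexive (cong dτ (+-assoc g i' y ∙ cong (λ z → g + z) (m+[n∸m]≡n l) ∙ proj₁ (proj₂ shifted)))))
              (m+[n∸m]≡n l) g'+h
              where
              y F' : ℕ
              y = h ∸ i'
              F' = dτ (F t)
            shifted' : ∀ i' → i' < h → G κ (g' + i') (suc (x (suc t) + i'))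
            shifted' i' l = G-later κ (dτ-le i' (<⇒≤ l)) (subst (G κ (dτ (g + i'))) (cong d (sym (+-suc (x t) i')) ∙ all (suc i') l ∙ +-suc (x (suc t)) i')
              (G-d A (g + i') (suc (x t + i')) (proj₂ (proj₂ (proj₂ shifted)) i' l)))
            inner' : ∀ t' → t' ≤ suc t → ∀ i' → i' < h → G κ (x t' + i') (suc (x t' + i'))
            inner' t' l with t' ≟ suc t
            ... | yes refl = λ i' a → G-later κ (+-monoˡ-≤ i' g'≤x) (shifted' i' a)
            ... | no ne = inner t' (ℕ.s≤s⁻¹ (≤∧≢⇒< l ne))

          -- The rows x t increase strictly, which bounds the descent. From row ℓ on κ is zero, its
          -- beads are consecutive integers, and no bead of τ fits strictly between two of them.
          run : ∀ f t → State t → ℓ ≤ x t + f → Result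
          run zero t st g = ⊥-elim ((lia (e ∷ (τ f) ∷ f ∷ (κ e) ∷ (κ (suc e)) ∷ []) (v0 ⊕ v1 ≺ v2 ⊕ v3 ∷ v2 ⊕ v4 ≺ (su v0) ⊕ v1 ∷ v3 ≛ li 0 ∷ []) (ff) ((1 ∷ 1 ∷ 1 ∷ []) , []))
              (State.below st) (State.above st) (zero-from e ℓ≤e))
            where
            e f : ℕ
            e = x t + h
            f = F t
            ℓ≤e : ℓ ≤ x t + h
            ℓ≤e = ≤-trans (subst (ℓ ≤_) (+-identityʳ (x t)) g) (m≤m+n (x t) h)
          run (suc f) t st g with scan (x t) (x (suc t)) h
          ... | inj₂ (inj₁ ne) = ⊥-elim (ne refl)
          ... | inj₂ (inj₂ (i , l , u , v)) = Stop.result t st i (<⇒≤ l) u v (λ e → ⊥-elim (<⇒≢ l e))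
          ... | inj₁ all with suc (x (suc t) + h) + τ (F (suc t)) ≤? F (suc t) + κ (suc (x (suc t) + h))
          ...   | no ng = run f (suc t) (next t st all ng) (≤-trans g (≤-trans (≤-reflexive (+-suc (x t) f)) (+-monoˡ-≤ f (up (x t)))))
          ...   | yes gd = Stop.result t st h ≤-refl all last (λ _ → gd)
            where
            -- If the row after the block were mapped without a gap as well, the comparison `gd`
            -- pulled back along d would contradict `above`.
            last : d (suc (x t + h)) ≢ suc (x (suc t) + h)
            last e = <⇒≱ (State.above st) (G-d⁻¹ A (F t) (suc (x t + h)) (subst (G κ (F (suc t))) (sym e) gd))

  lift : (∃ λ r → τ r < κ r) → Result
  lift (r , lt) with first-diff (suc r)
  ... | inj₁ h = ⊥-elim (<⇒≢ lt (h r (n<1+n r)))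
  ... | inj₂ (p , lt' , agree) with From.chunk p lt' agree
  ...   | s , ps , τs , end , linked with From.Chunk.lowest-top p lt' agree s ps τs end linked
  ...     | p0 , a , b , top , nontop with From.Chunk.Top.deepest p lt' agree s ps τs end linked p0 a b top nontop
  ...       | J , xs , sx = From.Chunk.Top.Descend.run p lt' agree s ps τs end linked p0 a b top nontop J xs sx ℓ 0
                (From.Chunk.Top.Descend.init p lt' agree s ps τs end linked p0 a b top nontop J xs sx) (m≤n+m ℓ _)

-- A larger d r means a smaller ν r and no larger κ (d r), so their sum κ r allows only one value of
-- d r.
core-unique : ∀ {k ℓ κ ν d τ ντ dτ} → Core k ℓ κ ν d → Core k ℓ τ ντ dτ → (∀ r → τ r ≡ κ r) → ∀ r → ντ r ≡ ν r
core-unique {k} {ℓ} {κ} {ν} {d} {τ} {ντ} {dτ} A B e r with d r <? dτ r | dτ r <? d r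
... | no p | no q = (lia ((d r) ∷ (ν r) ∷ k ∷ r ∷ (dτ r) ∷ (ντ r) ∷ []) (v0 ⊕ v1 ≛ su (v2 ⊕ v3) ∷ v4 ⊕ v5 ≛ su (v2 ⊕ v3) ∷ v0 ≼ v4 ∷ v4 ≼ v0 ∷ []) (v5 ≛ v1) ((1 ∷ 0 ∷ 1 ∷ 1 ∷ 0 ∷ 1 ∷ []) , (1 ∷ 1 ∷ 0 ∷ 0 ∷ 1 ∷ 0 ∷ 1 ∷ []))) (Core.code A r) (Core.code B r) (≮⇒≥ q) (≮⇒≥ p)
... | yes p | _ = ⊥-elim ((lia ((κ r) ∷ (ν r) ∷ (κ (d r)) ∷ (τ r) ∷ (ντ r) ∷ (τ (dτ r)) ∷ (κ (dτ r)) ∷ (d r) ∷ k ∷ r ∷ (dτ r) ∷ []) (v0 ≛ v1 ⊕ v2 ∷ v3 ≛ v4 ⊕ v5 ∷ v3 ≛ v0 ∷ v5 ≛ v6 ∷ v6 ≼ v2 ∷ v7 ⊕ v1 ≛ su (v8 ⊕ v9) ∷ v10 ⊕ v4 ≛ su (v8 ⊕ v9) ∷ v7 ≺ v10 ∷ []) (ff) ((0 ∷ 1 ∷ 1 ∷ 0 ∷ 0 ∷ 1 ∷ 1 ∷ 0 ∷ 1 ∷ 0 ∷ 1 ∷ 1 ∷ 0 ∷ 1 ∷ []) , []))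
    (Core.κ-d A r) (Core.κ-d B r) (e r) (e (dτ r)) (Core.desc-le A (<⇒≤ p)) (Core.code A r) (Core.code B r) p)
... | no _ | yes p = ⊥-elim ((lia ((κ r) ∷ (ν r) ∷ (κ (d r)) ∷ (τ r) ∷ (ντ r) ∷ (τ (dτ r)) ∷ (κ (dτ r)) ∷ (d r) ∷ k ∷ r ∷ (dτ r) ∷ []) (v0 ≛ v1 ⊕ v2 ∷ v3 ≛ v4 ⊕ v5 ∷ v3 ≛ v0 ∷ v5 ≛ v6 ∷ v2 ≼ v6 ∷ v7 ⊕ v1 ≛ su (v8 ⊕ v9) ∷ v10 ⊕ v4 ≛ su (v8 ⊕ v9) ∷ v10 ≺ v7 ∷ []) (ff) ((1 ∷ 0 ∷ 0 ∷ 1 ∷ 1 ∷ 0 ∷ 0 ∷ 1 ∷ 1 ∷ 1 ∷ 0 ∷ 0 ∷ 1 ∷ 1 ∷ []) , []))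
    (Core.κ-d A r) (Core.κ-d B r) (e r) (e (dτ r)) (Core.desc-le A (<⇒≤ p)) (Core.code A r) (Core.code B r) p)

sumTo-less : ∀ n (f g : ℕ → ℕ) a → (∀ i → f i ≤ g i) → a < n → f a < g a → sumTo n f < sumTo n g
sumTo-less (suc n) f g a h p q with a ≟ n
... | yes refl = +-mono-≤-< (sumTo-mono n (λ i _ → h i)) q
... | no ne = +-mono-<-≤ (sumTo-less n f g a h (≤∧≢⇒< (ℕ.s≤s⁻¹ p) ne) q) (h n)

-- Repeated lifting leads from κ down to τ, and every swap lowers the size of the bounded partition
-- by one. The recursion is on the number of boxes of κ, which also drops.
size-mono : ∀ n {k ℓ κ ν d τ ντ dτ} → Core k ℓ κ ν d → Core k ℓ τ ντ dτ → (∀ r → τ r ≤ κ r) → sumTo ℓ κ ≤ n →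
  (∀ r → τ r ≡ κ r) ⊎ sumTo ℓ ντ < sumTo ℓ ν
size-mono n {k} {ℓ} {κ} {ν} {d} {τ} {ντ} {dτ} A B sub b with Lift.first-diff k ℓ κ ν d A τ ντ dτ B sub ℓ
... | inj₁ h = inj₁ eq
  where
  eq : ∀ r → τ r ≡ κ r
  eq r with r <? ℓ
  ... | yes p = h r p
  ... | no p = Core.zero-from B r (≮⇒≥ p) ∙ sym (Core.zero-from A r (≮⇒≥ p))
... | inj₂ (p , lt , _) with Lift.lift k ℓ κ ν d A τ ντ dτ B sub (p , lt)
...   | p0 , c , i , q , swp , con = inj₂ (finish n b)
  where
  open Swapping swp
  smaller : sumTo ℓ κ' < sumTo ℓ κ
  smaller = sumTo-less ℓ κ' κ (it d c p0 + i) κ'≤κ inside (κ'<κ c i ≤-refl ≤-refl)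
  finish : ∀ n → sumTo ℓ κ ≤ n → sumTo ℓ ντ < sumTo ℓ ν
  finish zero b = ⊥-elim (<⇒≱ smaller (≤-trans b z≤n))
  finish (suc n) b with size-mono n core' B con (ℕ.s≤s⁻¹ (≤-trans smaller b))
  ... | inj₁ e = ≤-reflexive (cong suc (sumTo-cong ℓ (λ r _ → core-unique core' B e r)) ∙ size)
  ... | inj₂ l = <-trans l (≤-reflexive size)

-- A strong cover drops the size of 𝔭 by one, so it is a swap: a proper subcore already lies inside some swap.
classify : ∀ {k ℓ κ ν d τ ντ dτ} (A : Core k ℓ κ ν d) → Core k ℓ τ ντ dτ → (∀ r → τ r ≤ κ r) →
  suc (sumTo ℓ ντ) ≡ sumTo ℓ ν →
  ∃ λ p0 → ∃ λ c → ∃ λ i → ∃ λ q → Σ (Swapping A p0 c i q) λ swp → ∀ r → τ r ≡ Swapping.κ' swp r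
classify {k} {ℓ} {κ} {ν} {d} {τ} {ντ} {dτ} A B sub e with Lift.first-diff k ℓ κ ν d A τ ντ dτ B sub ℓ
... | inj₁ h = ⊥-elim (<⇒≢ (n<1+n (sumTo ℓ ντ)) (sumTo-cong ℓ (λ r _ → core-unique A B eq r) ∙ sym e))
  where
  eq : ∀ r → τ r ≡ κ r
  eq r with r <? ℓ
  ... | yes p = h r p
  ... | no p = Core.zero-from B r (≮⇒≥ p) ∙ sym (Core.zero-from A r (≮⇒≥ p))
... | inj₂ (p , lt , _) with Lift.lift k ℓ κ ν d A τ ντ dτ B sub (p , lt)
...   | p0 , c , i , q , swp , con = p0 , c , i , q , swp , eq
  where
  open Swapping swp
  eq : ∀ r → τ r ≡ κ' r
  eq with size-mono (sumTo ℓ κ') core' B con ≤-refl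
  ... | inj₁ x = x
  ... | inj₂ l = ⊥-elim (<⇒≢ l (suc-injective (e ∙ sym size)))

-- Partitions as lists

range-suc : ∀ n → range (suc n) ≡ range n ++ (suc n ∷ [])
range-suc n = cong (map suc) (sym (upTo-∷ʳ n)) ∙ map-++ suc (upTo n) (n ∷ [])

length-range : ∀ n → length (range n) ≡ n
length-range n = length-map suc (upTo n) ∙ length-upTo n

filterB-++ : ∀ {A : Set} (p : A → Bool) xs ys → filterB p (xs ++ ys) ≡ filterB p xs ++ filterB p ys
filterB-++ p [] ys = refl
filterB-++ p (x ∷ xs) ys with p x
... | true = cong (x ∷_) (filterB-++ p xs ys)
... | false = filterB-++ p xs ys

filterB-cong : ∀ {A : Set} {p q : A → Bool} xs → All (λ x → p x ≡ q x) xs → filterB p xs ≡ filterB q xs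
filterB-cong [] [] = refl
filterB-cong {p = p} {q} (x ∷ xs) (e ∷ h) rewrite e with q x
... | true = cong (x ∷_) (filterB-cong xs h)
... | false = filterB-cong xs h

T-true : ∀ {b} → T b → b ≡ true
T-true {true} _ = refl

true-T : ∀ {b} → b ≡ true → T b
true-T refl = tt

<ᵇ-no : ∀ {a b} → b ≤ a → (a <ᵇ b) ≡ false
<ᵇ-no {a} {b} q with a <ᵇ b in eq
... | false = refl
... | true = ⊥-elim (<⇒≱ (<ᵇ⇒< a b (true-T eq)) q)

allB-All : ∀ {A : Set} (p : A → Bool) xs → T (allB p xs) → All (λ x → T (p x)) xs
allB-All p [] _ = []
allB-All p (x ∷ xs) t with p x in eq
... | true = true-T eq ∷ allB-All p xs t

All-allB : ∀ {A : Set} (p : A → Bool) xs → All (λ x → T (p x)) xs → T (allB p xs)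
All-allB p [] [] = tt
All-allB p (x ∷ xs) (h ∷ hs) with p x
... | true = All-allB p xs hs

All-++ : ∀ {A : Set} {P : A → Set} {xs ys} → All P xs → All P ys → All P (xs ++ ys)
All-++ [] h = h
All-++ (x ∷ xs) h = x ∷ All-++ xs h

All-++ˡ : ∀ {A : Set} {P : A → Set} xs {ys} → All P (xs ++ ys) → All P xs
All-++ˡ [] h = []
All-++ˡ (x ∷ xs) (p ∷ h) = p ∷ All-++ˡ xs h

All-++ʳ : ∀ {A : Set} {P : A → Set} xs {ys} → All P (xs ++ ys) → All P ys
All-++ʳ [] h = h
All-++ʳ (x ∷ xs) (p ∷ h) = All-++ʳ xs h

All-map : ∀ {A B : Set} {P : B → Set} {f : A → B} xs → All (λ x → P (f x)) xs → All P (map f xs)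
All-map [] [] = []
All-map (x ∷ xs) (p ∷ h) = p ∷ All-map xs h

map-All : ∀ {A B : Set} {P : B → Set} {f : A → B} xs → All P (map f xs) → All (λ x → P (f x)) xs
map-All [] [] = []
map-All (x ∷ xs) (p ∷ h) = p ∷ map-All xs h

All-concatMap : ∀ {A B : Set} {P : B → Set} {f : A → List B} xs → All (λ x → All P (f x)) xs → All P (concatMap f xs)
All-concatMap [] [] = []
All-concatMap (x ∷ xs) (p ∷ h) = All-++ p (All-concatMap xs h)

concatMap-All : ∀ {A B : Set} {P : B → Set} {f : A → List B} xs → All P (concatMap f xs) → All (λ x → All P (f x)) xs
concatMap-All [] _ = []
concatMap-All {f = f} (x ∷ xs) h = All-++ˡ (f x) h ∷ concatMap-All xs (All-++ʳ (f x) h)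

All-range : ∀ {P : ℕ → Set} n → (∀ c → c < n → P (suc c)) → All P (range n)
All-range {P} zero h = []
All-range {P} (suc n) h = subst (All P) (sym (range-suc n))
  (All-++ (All-range n (λ c p → h c (<-trans p (n<1+n n)))) (h n (n<1+n n) ∷ []))

range-All : ∀ {P : ℕ → Set} n → All P (range n) → ∀ c → c < n → P (suc c)
range-All {P} (suc n) h c p with c ≟ n | subst (All P) (range-suc n) h
... | yes refl | h' with All-++ʳ (range n) h'
...   | x ∷ [] = x
range-All {P} (suc n) h c p | no ne | h' = range-All n (All-++ˡ (range n) h') c (≤∧≢⇒< (ℕ.s≤s⁻¹ p) ne)

count : ℕ → (ℕ → Bool) → ℕ
count n p = length (filterB p (range n))

count-suc : ∀ n p → count (suc n) p ≡ count n p + (if p (suc n) then 1 else 0)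
count-suc n p = cong (λ xs → length (filterB p xs)) (range-suc n)
  ∙ cong length (filterB-++ p (range n) (suc n ∷ []))
  ∙ length-++ (filterB p (range n))
  ∙ cong (λ x → count n p + x) (one (suc n))
  where
  one : ∀ c → length (filterB p (c ∷ [])) ≡ (if p c then 1 else 0)
  one c with p c
  ... | true = refl
  ... | false = refl

count-threshold : ∀ n c0 p → c0 ≤ n → (∀ c → 1 ≤ c → c ≤ c0 → p c ≡ false) → (∀ c → c0 < c → c ≤ n → p c ≡ true) → count n p + c0 ≡ n
count-threshold zero zero p _ _ _ = refl
count-threshold (suc n) c0 p h lo hi with c0 ≟ suc n
... | yes refl = cong (_+ suc n) (count-suc n p ∙ cong (λ b → count n p + (if b then 1 else 0)) (lo (suc n) (s≤s z≤n) ≤-refl))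
  ∙ (lia (x ∷ n ∷ []) (v0 ⊕ v1 ≛ v1 ∷ []) (v0 ⊕ (li 0) ⊕ (su v1) ≛ su v1) ((1 ∷ 1 ∷ []) , (1 ∷ []))) (count-threshold n n p ≤-refl (λ c a b → lo c a (m≤n⇒m≤1+n b)) (λ c a b → ⊥-elim (<⇒≱ a b)))
  where
  x : ℕ
  x = count n p
... | no ne = cong (_+ c0) (count-suc n p ∙ cong (λ b → count n p + (if b then 1 else 0)) (hi (suc n) (≤∧≢⇒< h ne) ≤-refl))
  ∙ (lia (x ∷ c0 ∷ n ∷ []) (v0 ⊕ v1 ≛ v2 ∷ []) (v0 ⊕ (li 1) ⊕ v1 ≛ su v2) ((1 ∷ 1 ∷ []) , (1 ∷ 0 ∷ 1 ∷ []))) (count-threshold n c0 p (ℕ.s≤s⁻¹ (≤∧≢⇒< h ne)) lo (λ c a b → hi c a (m≤n⇒m≤1+n b)))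
  where
  x : ℕ
  x = count n p

threshold : ∀ n (p : ℕ → Bool) → (∀ c → 1 ≤ c → c < n → p c ≡ true → p (suc c) ≡ true) →
  ∃ λ c0 → c0 ≤ n × (∀ c → 1 ≤ c → c ≤ c0 → p c ≡ false) × (∀ c → c0 < c → c ≤ n → p c ≡ true)
threshold zero p h = 0 , z≤n , (λ c a b → ⊥-elim (<⇒≱ a b)) , (λ c a b → ⊥-elim (<⇒≱ a b))
threshold (suc n) p h with p (suc n) in eq
... | false = suc n , ≤-refl , (λ c a b → none c a b (n ∸ c)) , (λ c a b → ⊥-elim (<⇒≱ a b))
  where
  contra : ∀ {b : Bool} → b ≡ true → b ≡ false → ⊥
  contra refl ()
  climb : ∀ t c → 1 ≤ c → c + t ≡ suc n → p c ≡ true → ⊥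
  climb zero c a e q = contra q (cong p (sym (+-identityʳ c) ∙ e) ∙ eq)
  climb (suc t) c a e q = climb t (suc c) (s≤s z≤n) (sym (+-suc c t) ∙ e) (h c a (≤-trans (s≤s (m≤m+n c t)) (≤-reflexive (sym (+-suc c t) ∙ e))) q)
  none : ∀ c → 1 ≤ c → c ≤ suc n → ℕ → p c ≡ false
  none c a b _ with p c in e
  ... | false = refl
  ... | true = ⊥-elim (climb (suc n ∸ c) c a (m+[n∸m]≡n b) e)
... | true with threshold n p (λ c a b → h c a (m≤n⇒m≤1+n b))
...   | c0 , le , lo , hi = c0 , m≤n⇒m≤1+n le , lo , hi'
  where
  hi' : ∀ c → c0 < c → c ≤ suc n → p c ≡ true
  hi' c a b with c ≟ suc n
  ... | yes refl = eq
  ... | no ne = hi c a (ℕ.s≤s⁻¹ (≤∧≢⇒< b ne))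

Desc : List ℕ → Set
Desc L = ∀ r → nth L (suc (suc r)) ≤ nth L (suc r)

linked-desc : ∀ {L} → Linked _≥_ L → Desc L
linked-desc [] r = z≤n
linked-desc [-] r = z≤n
linked-desc (h ∷ hs) zero = h
linked-desc (h ∷ hs) (suc r) = linked-desc hs r

desc-≤ : ∀ {L} → Desc L → ∀ {a b} → a ≤ b → nth L (suc b) ≤ nth L (suc a)
desc-≤ {L} h {a} {b} p = subst (λ x → nth L (suc x) ≤ nth L (suc a)) (m+[n∸m]≡n p) (go (b ∸ a))
  where
  go : ∀ t → nth L (suc (a + t)) ≤ nth L (suc a)
  go zero = ≤-reflexive (cong (λ x → nth L (suc x)) (+-identityʳ a))
  go (suc t) = ≤-trans (≤-trans (≤-reflexive (cong (λ x → nth L (suc x)) (+-suc a t))) (h (a + t))) (go t)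

nth-out : ∀ L r → length L ≤ r → nth L (suc r) ≡ 0
nth-out [] r _ = refl
nth-out (x ∷ L) (suc r) (s≤s p) = nth-out L r p

nth-pos : ∀ {L} → All (_> 0) L → ∀ r → r < length L → 0 < nth L (suc r)
nth-pos (h ∷ hs) zero p = h
nth-pos (h ∷ hs) (suc r) (s≤s p) = nth-pos hs r p

conj-galois : ∀ L → Desc L → ∀ c → 1 ≤ c → ∀ r → (suc r ≤ conj L c → c ≤ nth L (suc r)) × (c ≤ nth L (suc r) → suc r ≤ conj L c)
conj-galois [] h c c1 r = (λ ()) , (λ q → ⊥-elim (<⇒≱ c1 q))
conj-galois (x ∷ L) h c c1 r with c ≤ᵇ x in eq
... | true = go r
  where
  c≤x : c ≤ x
  c≤x = ≤ᵇ⇒≤ c x (true-T eq)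
  go : ∀ r → (suc r ≤ suc (conj L c) → c ≤ nth (x ∷ L) (suc r)) × (c ≤ nth (x ∷ L) (suc r) → suc r ≤ suc (conj L c))
  go zero = (λ _ → c≤x) , (λ _ → s≤s z≤n)
  go (suc r) with conj-galois L (λ r → h (suc r)) c c1 r
  ... | f , g = (λ q → f (ℕ.s≤s⁻¹ q)) , (λ q → s≤s (g q))
... | false = (λ q → ⊥-elim (<⇒≱ x<c (≤-trans (proj₁ (conj-galois L (λ r → h (suc r)) c c1 0) (≤-trans (s≤s z≤n) q)) (h 0))))
            , (λ q → ⊥-elim (<⇒≱ x<c (≤-trans q (desc-≤ {x ∷ L} h {0} {r} z≤n))))
  where
  x<c : x < c
  x<c = ≰⇒> (λ q → subst T eq (≤⇒≤ᵇ q))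

opaque
  rowCount : ℕ → List ℕ → ℕ → ℕ
  rowCount k L r = count (nth L r) (λ c → hook L r c ≤ᵇ k)

  rowCount-def : ∀ k L r → rowCount k L r ≡ count (nth L r) (λ c → hook L r c ≤ᵇ k)
  rowCount-def k L r = refl

  -- The condition k - ν + i < j for 1-based i and j says that the 0-based column is at least k + 1
  -- + r - ν, with r the 0-based row.
  rowStart : ℕ → List ℕ → ℕ → ℕ
  rowStart k L r = suc (k + r) ∸ rowCount k L (suc r)

  rowStart-def : ∀ k L r → rowStart k L r ≡ suc (k + r) ∸ rowCount k L (suc r)
  rowStart-def k L r = refl

IsCore : ℕ → List ℕ → Set
IsCore k L = ∀ r c → r < length L → 1 ≤ c → c ≤ nth L (suc r) → hook L (suc r) c ≢ suc k

row-length : ∀ L r → 0 < nth L (suc r) → r < length L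
row-length L r p with r <? length L
... | yes q = q
... | no q = ⊥-elim (<⇒≢ p (sym (nth-out L r (≮⇒≥ q))))

hook-parts : ∀ L → Desc L → ∀ r c → 1 ≤ c → c ≤ nth L (suc r) → hook L (suc r) c + c + r ≡ nth L (suc r) + conj L c
hook-parts L h r c c1 le = (lia (a ∷ c ∷ x ∷ b ∷ r ∷ y ∷ []) (v0 ⊕ v1 ≛ v2 ∷ v3 ⊕ (su v4) ≛ v5 ∷ []) ((su (v0 ⊕ v3)) ⊕ v1 ⊕ v4 ≛ v2 ⊕ v5) ((1 ∷ 1 ∷ 0 ∷ 1 ∷ []) , (1 ∷ 0 ∷ 1 ∷ 0 ∷ 1 ∷ []))) (m∸n+n≡m le) (m∸n+n≡m (proj₂ (conj-galois L h c c1 r) le))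
  where
  a b x y : ℕ
  x = nth L (suc r)
  y = conj L c
  a = x ∸ c
  b = y ∸ suc r

≤ᵇ-false : ∀ {a b} → (a ≤ᵇ b) ≡ false → b < a
≤ᵇ-false eq = ≰⇒> (λ q → subst T eq (≤⇒≤ᵇ q))

≤ᵇ-true : ∀ {a b} → (a ≤ᵇ b) ≡ true → a ≤ b
≤ᵇ-true {a} {b} eq = ≤ᵇ⇒≤ a b (true-T eq)

module FromList (k : ℕ) (L : List ℕ) (h : Desc L) (noHook : IsCore k L) where
  K : ℕ → ℕ
  K r = nth L (suc r)

  module _ (r : ℕ) where
    p : ℕ → Bool
    p c = hook L (suc r) c ≤ᵇ k

    conj-desc : ∀ c → 1 ≤ c → conj L (suc c) ≤ conj L c
    conj-desc c c1 with conj L (suc c) in eq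
    ... | zero = z≤n
    ... | suc m = proj₂ (conj-galois L h c c1 m) (≤-trans (n≤1+n c) (proj₁ (conj-galois L h (suc c) (s≤s z≤n) m) (≤-reflexive (sym eq))))

    closed : ∀ c → 1 ≤ c → c < K r → p c ≡ true → p (suc c) ≡ true
    closed c c1 lt e = ≤ᵇ-yes (≤-trans (≤-trans (n≤1+n _) smaller) (≤ᵇ-true {H₁} {k} e))
      where
      H₁ H₂ y₁ y₂ x : ℕ
      H₁ = hook L (suc r) c
      H₂ = hook L (suc r) (suc c)
      y₁ = conj L c
      y₂ = conj L (suc c)
      x = K r
      smaller : suc H₂ ≤ H₁
      smaller = (lia (H₁ ∷ c ∷ r ∷ x ∷ y₁ ∷ H₂ ∷ y₂ ∷ []) (v0 ⊕ v1 ⊕ v2 ≛ v3 ⊕ v4 ∷ v5 ⊕ (su v1) ⊕ v2 ≛ v3 ⊕ v6 ∷ v6 ≼ v4 ∷ []) (su v5 ≼ v0) ((1 ∷ 0 ∷ 1 ∷ 1 ∷ 0 ∷ 1 ∷ []) , []))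
        (hook-parts L h r c c1 (<⇒≤ lt)) (hook-parts L h r (suc c) (s≤s z≤n) lt) (conj-desc c c1)

    -- Hooks decrease along a row, so the large ones occupy the first c0 columns. The value k + 1
    -- does not occur: column c0 has hook at least k + 2 and column c0 + 1 at most k, and this pins
    -- the length of row d r to c0.
    row : ∃ λ c0 → rowCount k L (suc r) + c0 ≡ K r × rowCount k L (suc r) ≤ k × K (rowStart k L r) ≡ c0
    row with threshold (K r) p closed
    ... | c0 , le , lo , hi = c0 , total , ν≤k , ≤-antisym upper lower
      where
      ν d : ℕ
      ν = rowCount k L (suc r)
      d = rowStart k L r
      total : ν + c0 ≡ K r
      total = cong (_+ c0) (rowCount-def k L (suc r)) ∙ count-threshold (K r) c0 p le lo hi
      ν≤k : ν ≤ k
      ν≤k with c0 ≟ K r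
      ... | yes e = (lia (ν ∷ c0 ∷ x ∷ k ∷ []) (v0 ⊕ v1 ≛ v2 ∷ v1 ≛ v2 ∷ []) (v0 ≼ v3) ((1 ∷ 1 ∷ 0 ∷ 0 ∷ 1 ∷ []) , [])) total e
        where
        x : ℕ
        x = K r
      ... | no ne = (lia (H ∷ c0 ∷ r ∷ x ∷ y ∷ k ∷ ν ∷ []) (v0 ⊕ (su v1) ⊕ v2 ≛ v3 ⊕ v4 ∷ v0 ≼ v5 ∷ v6 ⊕ v1 ≛ v3 ∷ su v2 ≼ v4 ∷ []) (v6 ≼ v5) ((1 ∷ 0 ∷ 1 ∷ 1 ∷ 1 ∷ 0 ∷ 1 ∷ []) , []))
          (hook-parts L h r (suc c0) (s≤s z≤n) c0<K) (≤ᵇ-true (hi (suc c0) ≤-refl c0<K)) total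
          (proj₂ (conj-galois L h (suc c0) (s≤s z≤n) r) c0<K)
        where
        c0<K : c0 < K r
        c0<K = ≤∧≢⇒< le ne
        H x y : ℕ
        H = hook L (suc r) (suc c0)
        x = K r
        y = conj L (suc c0)
      d-spec : d + ν ≡ suc (k + r)
      d-spec = cong (_+ ν) (rowStart-def k L r) ∙ m∸n+n≡m (≤-trans ν≤k (≤-trans (m≤m+n k r) (n≤1+n _)))
      r<d : r < d
      r<d = (lia (d ∷ ν ∷ k ∷ r ∷ []) (v0 ⊕ v1 ≛ su (v2 ⊕ v3) ∷ v1 ≼ v2 ∷ []) (v3 ≺ v0) ((1 ∷ 0 ∷ 1 ∷ 1 ∷ []) , [])) d-spec ν≤k
      lower : c0 ≤ K d
      lower with c0 ≟ 0
      ... | yes refl = z≤n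
      ... | no ne = proj₁ (conj-galois L h c0 c1 d) ((lia (H ∷ c0 ∷ r ∷ x ∷ y ∷ k ∷ ν ∷ d ∷ []) (v0 ⊕ v1 ⊕ v2 ≛ v3 ⊕ v4 ∷ su v5 ≺ v0 ∷ v6 ⊕ v1 ≛ v3 ∷ v7 ⊕ v6 ≛ su (v5 ⊕ v2) ∷ []) (su v7 ≼ v4) ((1 ∷ 1 ∷ 0 ∷ 1 ∷ 0 ∷ 1 ∷ 1 ∷ []) , []))
              (hook-parts L h r c0 c1 le) (≤∧≢⇒< (≤ᵇ-false (lo c0 c1 ≤-refl)) (λ e → noHook r c0 (row-length L r (≤-trans c1 le)) c1 le (sym e))) total d-spec)
        where
        c1 : 1 ≤ c0
        c1 = n≢0⇒n>0 ne
        H x y : ℕ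
        H = hook L (suc r) c0
        x = K r
        y = conj L c0
      upper : K d ≤ c0
      upper with c0 ≟ K r
      ... | yes e = ≤-trans (desc-≤ {L} h (<⇒≤ r<d)) (≤-reflexive (sym e))
      ... | no ne = ≮⇒≥ λ q → <⇒≱ (proj₂ (conj-galois L h (suc c0) (s≤s z≤n) d) q)
              ((lia (H ∷ c0 ∷ r ∷ x ∷ y ∷ k ∷ ν ∷ d ∷ []) (v0 ⊕ (su v1) ⊕ v2 ≛ v3 ⊕ v4 ∷ v0 ≼ v5 ∷ v6 ⊕ v1 ≛ v3 ∷ v7 ⊕ v6 ≛ su (v5 ⊕ v2) ∷ []) (v4 ≼ v7) ((1 ∷ 0 ∷ 1 ∷ 1 ∷ 1 ∷ 0 ∷ 0 ∷ 1 ∷ []) , []))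
                (hook-parts L h r (suc c0) (s≤s z≤n) c0<K) (≤ᵇ-true (hi (suc c0) ≤-refl c0<K)) total d-spec)
        where
        c0<K : c0 < K r
        c0<K = ≤∧≢⇒< le ne
        H x y : ℕ
        H = hook L (suc r) (suc c0)
        x = K r
        y = conj L (suc c0)

  core : ∀ ℓ → length L ≤ ℓ → Core k ℓ K (λ r → rowCount k L (suc r)) (rowStart k L)
  core ℓ le = record { code = code ; κ-d = κ-d ; desc = h ; zero-from = λ r p → nth-out L r (≤-trans le p)
    ; up = λ r → (lia ((d r) ∷ (ν r) ∷ k ∷ r ∷ []) (v0 ⊕ v1 ≛ su (v2 ⊕ v3) ∷ v1 ≼ v2 ∷ []) (v3 ≺ v0) ((1 ∷ 0 ∷ 1 ∷ 1 ∷ []) , [])) (code r) (proj₁ (proj₂ (proj₂ (row r))))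
    ; mono = row-map-mono k K ν d code κ-d (desc-≤ {L} h) }
    where
    ν d : ℕ → ℕ
    ν r = rowCount k L (suc r)
    d = rowStart k L
    code : ∀ r → d r + ν r ≡ suc (k + r)
    code r = cong (_+ ν r) (rowStart-def k L r) ∙ m∸n+n≡m (≤-trans (proj₁ (proj₂ (proj₂ (row r)))) (≤-trans (m≤m+n k r) (n≤1+n _)))
    κ-d : ∀ r → K r ≡ ν r + K (d r)
    κ-d r = sym (proj₁ (proj₂ (row r))) ∙ cong (λ x → ν r + x) (sym (proj₂ (proj₂ (proj₂ (row r)))))

-- The converse reading of the row map: a column of row r that reaches down to row d r has hook
-- larger than k + 1, any other has hook at most k, so the value k + 1 is skipped.
module ToList (k ℓ : ℕ) (L : List ℕ) (ν d : ℕ → ℕ) (h : Desc L) (co : Core k ℓ (λ r → nth L (suc r)) ν d) where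
  open Core co

  K : ℕ → ℕ
  K r = nth L (suc r)

  big : ∀ r c → 1 ≤ c → c ≤ K (d r) → suc k < hook L (suc r) c
  big r c c1 le = (lia (H ∷ c ∷ r ∷ x ∷ y ∷ e ∷ n ∷ z ∷ k ∷ []) (v0 ⊕ v1 ⊕ v2 ≛ v3 ⊕ v4 ∷ su v5 ≼ v4 ∷ v3 ≛ v6 ⊕ v7 ∷ v5 ⊕ v6 ≛ su (v8 ⊕ v2) ∷ v1 ≼ v7 ∷ []) (su v8 ≺ v0) ((1 ∷ 0 ∷ 1 ∷ 1 ∷ 0 ∷ 1 ∷ 0 ∷ 1 ∷ 1 ∷ []) , []))
    (hook-parts L h r c c1 (≤-trans le (desc-le (<⇒≤ (up r))))) (proj₂ (conj-galois L h c c1 (d r)) le) (κ-d r) (code r) le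
    where
    H x y z e n : ℕ
    H = hook L (suc r) c
    x = K r
    y = conj L c
    e = d r
    z = K e
    n = ν r

  small : ∀ r c → 1 ≤ c → K (d r) < c → c ≤ K r → hook L (suc r) c ≤ k
  small r c c1 lt le = (lia (H ∷ c ∷ r ∷ x ∷ y ∷ e ∷ n ∷ z ∷ k ∷ []) (v0 ⊕ v1 ⊕ v2 ≛ v3 ⊕ v4 ∷ v4 ≼ v5 ∷ v3 ≛ v6 ⊕ v7 ∷ v5 ⊕ v6 ≛ su (v8 ⊕ v2) ∷ v7 ≺ v1 ∷ []) (v0 ≼ v8) ((1 ∷ 1 ∷ 0 ∷ 1 ∷ 1 ∷ 0 ∷ 1 ∷ 0 ∷ 1 ∷ []) , []))
    (hook-parts L h r c c1 le) (≮⇒≥ (λ q → <⇒≱ lt (proj₁ (conj-galois L h c c1 (d r)) q))) (κ-d r) (code r) lt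
    where
    H x y z e n : ℕ
    H = hook L (suc r) c
    x = K r
    y = conj L c
    e = d r
    z = K e
    n = ν r

  noHook : IsCore k L
  noHook r c _ c1 le e with K (d r) <? c
  ... | yes q = <⇒≱ (n<1+n k) (subst (_≤ k) e (small r c c1 q le))
  ... | no q = <⇒≢ (big r c c1 (≮⇒≥ q)) (sym e)

  rowCount-ν : ∀ r → rowCount k L (suc r) ≡ ν r
  rowCount-ν r = rowCount-def k L (suc r) ∙ +-cancelʳ-≡ (K (d r)) _ _ (count-threshold (K r) (K (d r)) (λ c → hook L (suc r) c ≤ᵇ k) (desc-le (<⇒≤ (up r)))
      (λ c a b → ≤ᵇ-no (<-trans (n<1+n k) (big r c a b))) (λ c a b → ≤ᵇ-yes (small r c (≤-trans (s≤s z≤n) a) a b)) ∙ κ-d r)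

isCore⇒ : ∀ k L → T (isCoreᵇ (suc k) L) → IsCore k L
isCore⇒ k L t r c rl c1 le e = notEq (range-All (nth L (suc r)) (map-All (range (nth L (suc r)))
    (range-All (length L) (concatMap-All (range (length L)) (allB-All _ (boxes L) t)) r rl)) (c ∸ 1) (≤-trans (≤-reflexive (m+[n∸m]≡n c1)) le))
  where
  notEq : T (not (hook L (suc r) (suc (c ∸ 1)) ≡ᵇ suc k)) → ⊥
  notEq q = subst T (cong (λ x → not (x ≡ᵇ suc k)) (cong (hook L (suc r)) (m+[n∸m]≡n c1) ∙ e) ∙ cong not (≡ᵇ-refl k)) q

⇒isCore : ∀ k L → IsCore k L → T (isCoreᵇ (suc k) L)
⇒isCore k L h = All-allB _ (boxes L) (All-concatMap (range (length L)) (All-range (length L) λ r rl →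
    All-map (range (nth L (suc r))) (All-range (nth L (suc r)) λ c cl → notEq r c (h r (suc c) rl (s≤s z≤n) cl))))
  where
  notEq : ∀ r c → hook L (suc r) (suc c) ≢ suc k → T (not (hook L (suc r) (suc c) ≡ᵇ suc k))
  notEq r c ne = true-T (cong not (≡ᵇ-no (hook L (suc r) (suc c)) (suc k) ne))

-- Strict growth of d makes ν weakly decreasing, so a zero in row r would propagate along the orbit
-- and force κ r = 0. Consequently 𝔭 drops no row of a core and indices are preserved.
ν-pos : ∀ {k ℓ κ ν d} → Core k ℓ κ ν d → ∀ r → 0 < κ r → 0 < ν r
ν-pos {k} {ℓ} {κ} {ν} {d} co r p with ν r in eq
... | suc _ = s≤s z≤n
... | zero = ⊥-elim (<⇒≢ p (sym (all-zero ℓ r ≤-refl (m≤n+m ℓ r))))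
  where
  open Core co
  ν0 : ∀ s → r ≤ s → ν s ≡ 0
  ν0 s le = go (s ∸ r) s (m+[n∸m]≡n le)
    where
    go : ∀ t s → r + t ≡ s → ν s ≡ 0
    go zero s e = cong ν (sym e ∙ +-identityʳ r) ∙ eq
    go (suc t) s e with go t (r + t) refl
    ... | z = subst (λ x → ν x ≡ 0) (sym (+-suc r t) ∙ e) ((lia ((d x) ∷ (ν x) ∷ k ∷ x ∷ (d (suc x)) ∷ (ν (suc x)) ∷ []) (v0 ⊕ v1 ≛ su (v2 ⊕ v3) ∷ v4 ⊕ v5 ≛ su (v2 ⊕ (su v3)) ∷ v0 ≺ v4 ∷ v1 ≛ li 0 ∷ []) (v5 ≛ li 0) ((1 ∷ 0 ∷ 1 ∷ 1 ∷ 0 ∷ 1 ∷ 1 ∷ []) , (1 ∷ [])))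
            (code x) (code (suc x)) (mono x) z)
      where
      x : ℕ
      x = r + t
  all-zero : ∀ f s → r ≤ s → ℓ ≤ s + f → κ s ≡ 0
  all-zero zero s a b = zero-from s (subst (ℓ ≤_) (+-identityʳ s) b)
  all-zero (suc f) s a b = κ-d s ∙ cong₂ _+_ (ν0 s a) (all-zero f (d s) (≤-trans a (<⇒≤ (up s)))
    (≤-trans b (≤-trans (≤-reflexive (+-suc s f)) (+-monoˡ-≤ f (up s)))))

nth-++-∷ʳ : ∀ xs (x : ℕ) r → nth (xs ++ (x ∷ [])) (suc r) ≡ (if r ≡ᵇ length xs then x else nth xs (suc r))
nth-++-∷ʳ [] x zero = refl
nth-++-∷ʳ [] x (suc r) = refl
nth-++-∷ʳ (y ∷ xs) x zero = refl
nth-++-∷ʳ (y ∷ xs) x (suc r) = nth-++-∷ʳ xs x r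

<ᵇ-suc : ∀ r → (r <ᵇ suc r) ≡ true
<ᵇ-suc zero = refl
<ᵇ-suc (suc r) = <ᵇ-suc r

nth-map-range : ∀ (f : ℕ → ℕ) n r → nth (map f (range n)) (suc r) ≡ (if r <ᵇ n then f (suc r) else 0)
nth-map-range f zero r = refl
nth-map-range f (suc n) r = cong (λ xs → nth (map f xs) (suc r)) (range-suc n)
  ∙ cong (λ xs → nth xs (suc r)) (map-++ f (range n) (suc n ∷ []))
  ∙ nth-++-∷ʳ (map f (range n)) (f (suc n)) r
  ∙ cong (λ m → if r ≡ᵇ m then f (suc n) else nth (map f (range n)) (suc r)) (length-map f (range n) ∙ length-range n)
  ∙ last (r ≟ n)
  where
  last : _ → (if r ≡ᵇ n then f (suc n) else nth (map f (range n)) (suc r)) ≡ (if r <ᵇ suc n then f (suc r) else 0)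
  last (yes refl) = cong (λ b → if b then f (suc n) else nth (map f (range n)) (suc r)) (≡ᵇ-refl r)
    ∙ cong (λ b → if b then f (suc r) else 0) (sym (<ᵇ-suc r))
  last (no ne) = cong (λ b → if b then f (suc n) else nth (map f (range n)) (suc r)) (≡ᵇ-no r n ne)
    ∙ nth-map-range f n r
    ∙ cong (λ b → if b then f (suc r) else 0) (≤ᵇ-iff {suc r} {n} {suc r} {suc n} (λ p → m≤n⇒m≤1+n p) (λ p → ≤∧≢⇒< (ℕ.s≤s⁻¹ p) ne))

filterB-nonzero : ∀ {L} → All (_> 0) L → filterB nonzero L ≡ L
filterB-nonzero [] = refl
filterB-nonzero (s≤s h ∷ hs) = cong (_ ∷_) (filterB-nonzero hs)

sumN-map-range : ∀ (f : ℕ → ℕ) n → sumN (map f (range n)) ≡ sumTo n (λ r → f (suc r))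
sumN-map-range f zero = refl
sumN-map-range f (suc n) = cong (λ xs → sumN (map f xs)) (range-suc n) ∙ cong sumN (map-++ f (range n) (suc n ∷ [])) ∙ sumN-∷ʳ (map f (range n)) (f (suc n)) ∙ cong (_+ f (suc n)) (sumN-map-range f n)
  where
  sumN-∷ʳ : ∀ xs x → sumN (xs ++ (x ∷ [])) ≡ sumN xs + x
  sumN-∷ʳ [] x = +-identityʳ x
  sumN-∷ʳ (y ∷ xs) x = cong (λ z → y + z) (sumN-∷ʳ xs x) ∙ sym (+-assoc y (sumN xs) x)

sumTo-extend : ∀ n m f → n ≤ m → (∀ r → n ≤ r → f r ≡ 0) → sumTo m f ≡ sumTo n f
sumTo-extend n zero f p h rewrite n≤0⇒n≡0 p = refl
sumTo-extend n (suc m) f p h with n ≟ suc m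
... | yes refl = refl
... | no ne = cong₂ _+_ (sumTo-extend n m f (ℕ.s≤s⁻¹ (≤∧≢⇒< p ne)) h) (h m (ℕ.s≤s⁻¹ (≤∧≢⇒< p ne))) ∙ +-identityʳ _

-- One bound ℓ serves a core and all cores below it, so that sums over rows and weights keep the
-- same range along a strong tableau.
record Good (k ℓ : ℕ) (L : List ℕ) : Set where
  field
    desc : Desc L
    positive : All (_> 0) L
    short : length L ≤ ℓ
    noHook : IsCore k L

  K ν d : ℕ → ℕ
  K r = nth L (suc r)
  ν r = rowCount k L (suc r)
  d = rowStart k L

  core : Core k ℓ K ν d
  core = FromList.core k L desc noHook ℓ short

  𝔭-rows : 𝔭 k L ≡ map (rowCount k L) (range (length L))
  𝔭-rows = cong (filterB nonzero) (map-cong (λ r → sym (rowCount-def k L r)) (range (length L))) ∙ filterB-nonzero (All-map (range (length L)) (All-range (length L) (λ r p → ν-pos core r (nth-pos positive r p))))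

  𝔭-nth : ∀ r → nth (𝔭 k L) (suc r) ≡ ν r
  𝔭-nth r = cong (λ xs → nth xs (suc r)) 𝔭-rows ∙ nth-map-range (rowCount k L) (length L) r ∙ inRange (r <? length L)
    where
    inRange : _ → (if r <ᵇ length L then ν r else 0) ≡ ν r
    inRange (yes p) = cong (λ b → if b then ν r else 0) (T-true (<⇒<ᵇ p))
    inRange (no p) = cong (λ b → if b then ν r else 0) (<ᵇ-no (≮⇒≥ p)) ∙ sym (Core.ν-out (FromList.core k L desc noHook (length L) ≤-refl) r (≮⇒≥ p))

  𝔭-length : length (𝔭 k L) ≡ length L
  𝔭-length = cong length 𝔭-rows ∙ length-map (rowCount k L) (range (length L)) ∙ length-range (length L)

  𝔭-sum : sumN (𝔭 k L) ≡ sumTo ℓ ν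
  𝔭-sum = cong sumN 𝔭-rows ∙ sumN-map-range (rowCount k L) (length L)
    ∙ sym (sumTo-extend (length L) ℓ ν short (λ r p → Core.ν-out (FromList.core k L desc noHook (length L) ≤-refl) r p))

-- Connected components of skew shapes

∈-filterB⁺ : ∀ {A : Set} (p : A → Bool) {x xs} → x ∈ xs → p x ≡ true → x ∈ filterB p xs
∈-filterB⁺ p {x} (here refl) e with p x
... | true = here refl
∈-filterB⁺ p {xs = y ∷ _} (there m) e with p y
... | true = there (∈-filterB⁺ p m e)
... | false = ∈-filterB⁺ p m e

∈-filterB⁻ : ∀ {A : Set} (p : A → Bool) {x} xs → x ∈ filterB p xs → x ∈ xs × p x ≡ true
∈-filterB⁻ p (y ∷ xs) m with p y in eq
∈-filterB⁻ p (y ∷ xs) (here refl) | true = here refl , eq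
∈-filterB⁻ p (y ∷ xs) (there m) | true with ∈-filterB⁻ p xs m
... | a , b = there a , b
∈-filterB⁻ p (y ∷ xs) m | false with ∈-filterB⁻ p xs m
... | a , b = there a , b

filterB-ext : ∀ {A : Set} {p q : A → Bool} xs → (∀ {x} → x ∈ xs → p x ≡ q x) → filterB p xs ≡ filterB q xs
filterB-ext xs h = filterB-cong xs (All.tabulate h)

length-filterB : ∀ {A : Set} (p : A → Bool) xs → length (filterB p xs) ≤ length xs
length-filterB p [] = z≤n
length-filterB p (x ∷ xs) with p x
... | true = s≤s (length-filterB p xs)
... | false = m≤n⇒m≤1+n (length-filterB p xs)

length-filterB-< : ∀ {A : Set} (p : A → Bool) {x xs} → x ∈ xs → p x ≡ false → length (filterB p xs) < length xs
length-filterB-< p {x} {_ ∷ xs} (here refl) e with p x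
... | false = s≤s (length-filterB p xs)
length-filterB-< p {xs = y ∷ xs} (there m) e with p y
... | true = s≤s (length-filterB-< p m e)
... | false = m≤n⇒m≤1+n (length-filterB-< p m e)

filterB-filterB : ∀ {A : Set} (p q : A → Bool) xs → filterB p (filterB q xs) ≡ filterB (λ x → q x ∧ p x) xs
filterB-filterB p q [] = refl
filterB-filterB p q (x ∷ xs) with q x
... | false = filterB-filterB p q xs
... | true with p x
...   | true = cong (x ∷_) (filterB-filterB p q xs)
...   | false = filterB-filterB p q xs

anyB⁺ : ∀ {A : Set} (p : A → Bool) {x xs} → x ∈ xs → p x ≡ true → anyB p xs ≡ true
anyB⁺ p {x} (here refl) e rewrite e = refl
anyB⁺ p {xs = y ∷ xs} (there m) e with p y
... | true = refl
... | false = anyB⁺ p m e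

anyB⁻ : ∀ {A : Set} (p : A → Bool) xs → anyB p xs ≡ true → ∃ λ x → x ∈ xs × p x ≡ true
anyB⁻ p (y ∷ xs) e with p y in eq
... | true = y , here refl , eq
... | false with anyB⁻ p xs e
...   | x , m , q = x , there m , q

iff-≡ : ∀ {a b : Bool} → (a ≡ true → b ≡ true) → (b ≡ true → a ≡ true) → a ≡ b
iff-≡ {true} {b} f g = sym (f refl)
iff-≡ {false} {false} f g = refl
iff-≡ {false} {true} f g = g refl

≡ᵇ-true : ∀ {a b} → (a ≡ᵇ b) ≡ true → a ≡ b
≡ᵇ-true {a} {b} e = ≡ᵇ⇒≡ a b (true-T e)

eqB-refl : ∀ b → eqB b b ≡ true
eqB-refl (r , c) rewrite ≡ᵇ-refl r | ≡ᵇ-refl c = refl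

∧-true : ∀ {a b} → a ∧ b ≡ true → a ≡ true × b ≡ true
∧-true {true} e = refl , e

∨-true : ∀ {a b} → a ∨ b ≡ true → a ≡ true ⊎ b ≡ true
∨-true {true} e = inj₁ refl
∨-true {false} e = inj₂ e

eqB-true : ∀ b b' → eqB b b' ≡ true → b ≡ b'
eqB-true (r , c) (r' , c') e with ∧-true {r ≡ᵇ r'} e
... | p , q = cong₂ _,_ (≡ᵇ-true p) (≡ᵇ-true q)

pigeonhole : ∀ {A : Set} (f : A → ℕ) a w xs → (∀ v → v < w → ∃ λ y → y ∈ xs × f y ≡ a + v) → w ≤ length xs
pigeonhole f a zero xs h = z≤n
pigeonhole f a (suc w) xs h with h w (n<1+n w)
... | y , m , e = ≤-trans (s≤s (pigeonhole f a w (filterB p xs) h')) (length-filterB-< p m (cong not (cong (_≡ᵇ (a + w)) e ∙ ≡ᵇ-refl (a + w))))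
  where
  p : _ → Bool
  p z = not (f z ≡ᵇ (a + w))
  h' : ∀ v → v < w → ∃ λ z → z ∈ filterB p xs × f z ≡ a + v
  h' v q with h v (<-trans q (n<1+n w))
  ... | z , mz , ez = z , ∈-filterB⁺ p mz (cong not (≡ᵇ-no (f z) (a + w) (λ x → <⇒≢ q (+-cancelˡ-≡ a _ _ (sym ez ∙ x))))) , ez

touch : Box → Box → Bool
touch x y = eqB x y ∨ adjB x y

-- A set of boxes labelled by component and ordered within each component by a depth function.
record Labelled (bs : List Box) (lab dep : Box → ℕ) : Set where
  field
    sound : ∀ {x y} → x ∈ bs → y ∈ bs → touch x y ≡ true → lab x ≡ lab y
    pred : ∀ {x y} → x ∈ bs → y ∈ bs → lab x ≡ lab y → dep y < dep x →
      ∃ λ z → z ∈ bs × lab z ≡ lab x × suc (dep z) ≡ dep x × touch x z ≡ true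
    succ : ∀ {x y} → x ∈ bs → y ∈ bs → lab x ≡ lab y → dep x < dep y →
      ∃ λ z → z ∈ bs × lab z ≡ lab x × dep z ≡ suc (dep x) × touch x z ≡ true
    uniq : ∀ {x y} → x ∈ bs → y ∈ bs → lab x ≡ lab y → dep x ≡ dep y → x ≡ y

module Closing {bs lab dep} (L : Labelled bs lab dep) where
  open Labelled L

  -- By `pred` all intermediate depths are attained, so the number of boxes bounds the spread of
  -- depths; hence as many rounds of closure as there are boxes suffice.
  spread : ∀ e {x b} → x ∈ bs → b ∈ bs → lab x ≡ lab b → dep x ≡ dep b + e → suc e ≤ length bs
  spread e {x} {b} mx mb l d = pigeonhole dep (dep b) (suc e) bs λ v q → down (e ∸ v) v (m+[n∸m]≡n (ℕ.s≤s⁻¹ q)) x mx l d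
    where
    down : ∀ t v {e} → v + t ≡ e → ∀ x → x ∈ bs → lab x ≡ lab b → dep x ≡ dep b + e → ∃ λ y → y ∈ bs × dep y ≡ dep b + v
    down zero v h x m l d = x , m , d ∙ cong (λ z → dep b + z) (sym h ∙ +-identityʳ v)
    down (suc t) v {e} h x m l d with pred m mb l (subst (dep b <_) (sym d) (m<m+n (dep b) (subst (0 <_) (sym (+-suc v t) ∙ h) (s≤s z≤n))))
    ... | z , mz , lz , dz , _ = down t v refl z mz (lz ∙ l) (suc-injective (dz ∙ d ∙ cong (λ w → dep b + w) (sym h ∙ +-suc v t) ∙ +-suc (dep b) (v + t)))

  -- The closure may run ahead of depth e, so its upper bound is only the label class. After enough
  -- rounds the lower bound `near` covers that class and both meet.
  record Inv (b : Box) (e : ℕ) (cur : List Box) : Set where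
    field
      from : ∀ {y} → y ∈ cur → y ∈ bs × lab y ≡ lab b
      near : ∀ {x} → x ∈ bs → lab x ≡ lab b → dep x ≤ dep b + e → dep b ≤ dep x + e → x ∈ cur

  grow : List Box → Box → Bool
  grow cur x = anyB (λ y → touch x y) cur

  grow-lab : ∀ {b e cur x} → Inv b e cur → x ∈ bs → grow cur x ≡ true → lab x ≡ lab b
  grow-lab {cur = cur} {x} I m t with anyB⁻ (λ y → touch x y) cur t
  ... | y , my , ty = sound m (proj₁ (Inv.from I my)) ty ∙ proj₂ (Inv.from I my)

  grow-near : ∀ {b e cur x} → b ∈ bs → Inv b e cur → x ∈ bs → lab x ≡ lab b → dep x ≤ dep b + suc e → dep b ≤ dep x + suc e → grow cur x ≡ true
  grow-near {b} {e} {cur} {x} mb I m l p q with dep x ≤? dep b + e | dep b ≤? dep x + e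
  ... | yes u | yes v = anyB⁺ (λ y → touch x y) (Inv.near I m l u v) (cong (_∨ adjB x x) (eqB-refl x))
  ... | no u | _ with pred m mb l (≤-<-trans (m≤m+n (dep b) e) (≰⇒> u))
  ...   | z , mz , lz , dz , tz = anyB⁺ (λ y → touch x y) (Inv.near I mz (lz ∙ l)
            ((lia (z' ∷ x' ∷ b' ∷ e ∷ []) (su v0 ≛ v1 ∷ v1 ≼ v2 ⊕ (su v3) ∷ []) (v0 ≼ v2 ⊕ v3) ((1 ∷ 1 ∷ 0 ∷ 1 ∷ []) , [])) dz p) ((lia (z' ∷ x' ∷ b' ∷ e ∷ []) (su v0 ≛ v1 ∷ v2 ⊕ v3 ≺ v1 ∷ []) (v2 ≼ v0 ⊕ v3) ((1 ∷ 0 ∷ 1 ∷ 1 ∷ []) , [])) dz (≰⇒> u))) tz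
    where
    x' b' z' : ℕ
    x' = dep x
    b' = dep b
    z' = dep z
  grow-near {b} {e} {cur} {x} mb I m l p q | yes u | no v with succ m mb l (≤-<-trans (m≤m+n (dep x) e) (≰⇒> v))
  ...   | z , mz , lz , dz , tz = anyB⁺ (λ y → touch x y) (Inv.near I mz (lz ∙ l)
            ((lia (z' ∷ x' ∷ e ∷ b' ∷ []) (v0 ≛ su v1 ∷ v1 ⊕ v2 ≺ v3 ∷ []) (v0 ≼ v3 ⊕ v2) ((1 ∷ 1 ∷ 0 ∷ 1 ∷ []) , [])) dz (≰⇒> v)) ((lia (z' ∷ x' ∷ b' ∷ e ∷ []) (v0 ≛ su v1 ∷ v2 ≼ v1 ⊕ (su v3) ∷ []) (v2 ≼ v0 ⊕ v3) ((1 ∷ 0 ∷ 1 ∷ 1 ∷ []) , [])) dz q)) tz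
    where
    x' b' z' : ℕ
    x' = dep x
    b' = dep b
    z' = dep z

  close : ∀ m e b cur → b ∈ bs → Inv b e cur →
    (∀ {x} → x ∈ bs → lab x ≡ lab b → dep x ≤ dep b + (e + suc m) × dep b ≤ dep x + (e + suc m)) →
    closeC (suc m) bs cur ≡ filterB (λ x → lab x ≡ᵇ lab b) bs
  close zero e b cur mb I h = filterB-ext bs λ {x} m → iff-≡
    (λ t → cong (_≡ᵇ lab b) (grow-lab I m t) ∙ ≡ᵇ-refl (lab b))
    (λ t → grow-near mb I m (≡ᵇ-true t) (subst (λ z → dep x ≤ dep b + z) (+-comm e 1) (proj₁ (h m (≡ᵇ-true t))))
             (subst (λ z → dep b ≤ dep x + z) (+-comm e 1) (proj₂ (h m (≡ᵇ-true t)))))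
  close (suc m) e b cur mb I h = close m (suc e) b (filterB (grow cur) bs) mb
    (record { from = λ my → let (a , t) = ∈-filterB⁻ (grow cur) bs my in a , grow-lab I a t
            ; near = λ mx l p q → ∈-filterB⁺ (grow cur) mx (grow-near mb I mx l p q) })
    (λ {x} mx l → let (p , q) = h mx l in subst (λ z → dep x ≤ dep b + z) (+-suc e (suc m)) p , subst (λ z → dep b ≤ dep x + z) (+-suc e (suc m)) q)

  component : ∀ b → b ∈ bs → closeC (length bs) bs (b ∷ []) ≡ filterB (λ x → lab x ≡ᵇ lab b) bs
  component b mb = go (length bs) refl
    where
    init : Inv b 0 (b ∷ [])
    init = record { from = λ { (here refl) → mb , refl }
      ; near = λ {x} m l p q → here (uniq m mb l (≤-antisym (subst (dep x ≤_) (+-identityʳ (dep b)) p) (subst (dep b ≤_) (+-identityʳ (dep x)) q))) }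
    nonempty : ∀ {x : Box} {xs} → x ∈ xs → length xs ≢ 0
    nonempty (here _) ()
    nonempty (there _) ()
    bound : ∀ {x y} → x ∈ bs → y ∈ bs → lab x ≡ lab y → dep x ≤ dep y + length bs
    bound {x} {y} mx my l with dep y ≤? dep x
    ... | no p = ≤-trans (<⇒≤ (≰⇒> p)) (m≤m+n _ _)
    ... | yes p = subst (_≤ dep y + length bs) (m+[n∸m]≡n p) (+-monoʳ-≤ (dep y) (<⇒≤ (spread (dep x ∸ dep y) mx my l (sym (m+[n∸m]≡n p)))))
    go : ∀ n → length bs ≡ n → closeC n bs (b ∷ []) ≡ filterB (λ x → lab x ≡ᵇ lab b) bs
    go zero e = ⊥-elim (nonempty mb e)
    go (suc m) e = close m 0 b (b ∷ []) mb init λ {x} mx l →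
      subst (λ n → dep x ≤ dep b + n) e (bound mx mb l) , subst (λ n → dep b ≤ dep x + n) e (bound mb mx (sym l))

interval : ℕ → ℕ → List ℕ
interval j zero = []
interval j (suc t) = j ∷ interval (suc j) t

length-interval : ∀ j t → length (interval j t) ≡ t
length-interval j zero = refl
length-interval j (suc t) = cong suc (length-interval (suc j) t)

-- Each new component is grown from the first remaining box. By `heads` that box has the least
-- remaining label, so the components come out in the order of their labels.
module Components {bs lab dep} (L : Labelled bs lab dep) (c : ℕ) (lab≤c : ∀ {x} → x ∈ bs → lab x ≤ c)
  (heads : ∀ j → j ≤ c → ∃ λ b → ∃ λ rest → filterB (λ x → j ≤ᵇ lab x) bs ≡ b ∷ rest × lab b ≡ j) where
  open Labelled L

  comp : ℕ → List Box
  comp j = filterB (λ x → lab x ≡ᵇ j) bs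

  after : ℕ → List Box
  after j = filterB (λ x → j ≤ᵇ lab x) bs

  after-lab : ∀ j → Labelled (after j) lab dep
  after-lab j = record
    { sound = λ mx my → sound (in-bs mx) (in-bs my)
    ; pred = λ mx my l d → let (z , mz , lz , r) = pred (in-bs mx) (in-bs my) l d in z , ∈-filterB⁺ _ mz (cong (j ≤ᵇ_) lz ∙ proj₂ (∈-filterB⁻ _ bs mx)) , lz , r
    ; succ = λ mx my l d → let (z , mz , lz , r) = succ (in-bs mx) (in-bs my) l d in z , ∈-filterB⁺ _ mz (cong (j ≤ᵇ_) lz ∙ proj₂ (∈-filterB⁻ _ bs mx)) , lz , r
    ; uniq = λ mx my → uniq (in-bs mx) (in-bs my)
    }
    where
    in-bs : ∀ {x} → x ∈ after j → x ∈ bs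
    in-bs m = proj₁ (∈-filterB⁻ _ bs m)

  components-from : ∀ t j f → j + t ≡ suc c → length (after j) ≤ f → compsF f (after j) ≡ map comp (interval j t)
  components-from zero j f e _ = cong (compsF f) empty ∙ none f
    where
    none : ∀ f → compsF f [] ≡ []
    none zero = refl
    none (suc f) = refl
    empty : after j ≡ []
    empty = filterB-none bs λ {x} m → ≤ᵇ-no (≤-trans (s≤s (lab≤c m)) (≤-reflexive (sym e ∙ +-identityʳ j)))
      where
      filterB-none : ∀ {p : Box → Bool} xs → (∀ {x} → x ∈ xs → p x ≡ false) → filterB p xs ≡ []
      filterB-none [] h = refl
      filterB-none {p} (x ∷ xs) h rewrite h (here refl) = filterB-none xs (λ m → h (there m))
  components-from (suc t) j f e le with heads j (ℕ.s≤s⁻¹ (≤-trans (s≤s (m≤m+n j t)) (≤-reflexive (sym (+-suc j t) ∙ e))))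
  ... | b , rest , eq , lb = go f (subst (λ xs → length xs ≤ f) eq le)
    where
    b∈ : b ∈ after j
    b∈ = subst (b ∈_) (sym eq) (here refl)
    C : List Box
    C = closeC (length (b ∷ rest)) (b ∷ rest) (b ∷ [])
    sub : ∀ x → (j ≤ᵇ lab x) ∧ (lab x ≡ᵇ lab b) ≡ (lab x ≡ᵇ j)
    sub x = iff-≡ (λ h → cong (lab x ≡ᵇ_) (sym lb) ∙ proj₂ (∧-true {j ≤ᵇ lab x} h))
      (λ h → cong₂ _∧_ (≤ᵇ-yes {j} {lab x} (≤-reflexive (sym (≡ᵇ-true {lab x} {j} h)))) (cong (lab x ≡ᵇ_) lb ∙ h))
    C≡ : C ≡ comp j
    C≡ = subst (λ xs → closeC (length xs) xs (b ∷ []) ≡ comp j) eq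
      (Closing.component (after-lab j) b b∈ ∙ filterB-filterB _ _ bs ∙ filterB-ext bs (λ {x} _ → sub x))
    mem : ∀ {x} → x ∈ bs → not (memB C x) ≡ not (lab x ≡ᵇ j)
    mem {x} m = cong not (cong (λ D → memB D x) C≡ ∙ iff-≡
      (λ h → let (y , my , ey) = anyB⁻ (eqB x) (comp j) h in subst (λ z → (lab z ≡ᵇ j) ≡ true) (sym (eqB-true x y ey)) (proj₂ (∈-filterB⁻ _ bs my)))
      (λ h → anyB⁺ (eqB x) (∈-filterB⁺ _ m h) (eqB-refl x)))
    next : filterB (λ x → not (memB C x)) (b ∷ rest) ≡ after (suc j)
    next = cong (filterB (λ x → not (memB C x))) (sym eq) ∙ filterB-filterB _ _ bs ∙ filterB-ext bs λ {x} m →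
      cong ((j ≤ᵇ lab x) ∧_) (mem m) ∙ iff-≡
        (λ h → let (p , q) = ∧-true {j ≤ᵇ lab x} h in ≤ᵇ-yes (≤∧≢⇒< (≤ᵇ-true {j} {lab x} p) (λ y → not-eq (lab x) j (sym y) q)))
        (λ h → cong₂ _∧_ (≤ᵇ-yes {j} {lab x} (<⇒≤ (≤ᵇ-true {suc j} {lab x} h))) (cong not (≡ᵇ-no (lab x) j (>⇒≢ (≤ᵇ-true {suc j} {lab x} h)))))
      where
      not-eq : ∀ a b → a ≡ b → not (a ≡ᵇ b) ≡ true → ⊥
      not-eq a b refl h rewrite ≡ᵇ-refl a with h
      ... | ()
    shorter : length (after (suc j)) < length (after j)
    shorter = subst (λ xs → length xs < length (after j)) (filterB-filterB _ _ bs ∙ filterB-ext bs (λ {x} m → iff-≡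
        (λ h → proj₂ (∧-true {j ≤ᵇ lab x} h)) (λ h → cong₂ _∧_ (≤ᵇ-yes {j} {lab x} (<⇒≤ (≤ᵇ-true {suc j} {lab x} h))) h)))
      (length-filterB-< (λ x → suc j ≤ᵇ lab x) b∈ (≤ᵇ-no (≤-reflexive (cong suc lb))))
    go : ∀ f → length (b ∷ rest) ≤ f → compsF f (after j) ≡ map comp (interval j (suc t))
    go (suc f) le' = cong (compsF (suc f)) eq ∙ cong₂ _∷_ C≡ (cong (compsF f) next
      ∙ components-from t (suc j) f (sym (+-suc j t) ∙ e) (ℕ.s≤s⁻¹ (≤-trans shorter (≤-trans (≤-reflexive (cong length eq)) le'))))

  components≡ : components bs ≡ map comp (interval 0 (suc c))
  components≡ = cong (λ xs → compsF (length bs) xs) (sym all) ∙ components-from (suc c) 0 (length bs) refl (length-filterB _ bs)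
    where
    all : after 0 ≡ bs
    all = keep bs
      where
      keep : ∀ xs → filterB (λ x → 0 ≤ᵇ lab x) xs ≡ xs
      keep [] = refl
      keep (x ∷ xs) = cong (x ∷_) (keep xs)

minRow-char : ∀ C m → (∃ λ b → b ∈ C × proj₁ b ≡ m) → (∀ {b} → b ∈ C → m ≤ proj₁ b) → minRow C ≡ m
minRow-char ((r , c) ∷ bs) m (b , mb , e) h = ≤-antisym (≤-trans (le bs mb) (≤-reflexive e)) (ge bs (h (here refl)) (λ x → h (there x)))
  where
  f : ∀ bs → ℕ
  f bs = foldr (λ x acc → proj₁ x ⊓ acc) r bs
  le-r : ∀ bs → f bs ≤ r
  le-r [] = ≤-refl
  le-r (x ∷ bs) = ≤-trans (m⊓n≤n (proj₁ x) _) (le-r bs)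
  le' : ∀ bs → b ∈ bs → f bs ≤ proj₁ b
  le' (x ∷ bs) (here refl) = m⊓n≤m (proj₁ x) _
  le' (x ∷ bs) (there p) = ≤-trans (m⊓n≤n (proj₁ x) _) (le' bs p)
  le : ∀ bs → b ∈ ((r , c) ∷ bs) → f bs ≤ proj₁ b
  le bs (here refl) = le-r bs
  le bs (there p) = le' bs p
  ge : ∀ bs → m ≤ r → (∀ {x} → x ∈ bs → m ≤ proj₁ x) → m ≤ f bs
  ge [] p _ = p
  ge (x ∷ bs) p q = ⊓-glb (q (here refl)) (ge bs p (λ y → q (there y)))

maxRow-char : ∀ C m → (∃ λ b → b ∈ C × proj₁ b ≡ m) → (∀ {b} → b ∈ C → proj₁ b ≤ m) → maxRow C ≡ m
maxRow-char ((r , c) ∷ bs) m (b , mb , e) h = ≤-antisym (ge bs (h (here refl)) (λ x → h (there x))) (≤-trans (≤-reflexive (sym e)) (le bs mb))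
  where
  f : ∀ bs → ℕ
  f bs = foldr (λ x acc → proj₁ x ⊔ acc) r bs
  le-r : ∀ bs → r ≤ f bs
  le-r [] = ≤-refl
  le-r (x ∷ bs) = ≤-trans (le-r bs) (m≤n⊔m (proj₁ x) _)
  le' : ∀ bs → b ∈ bs → proj₁ b ≤ f bs
  le' (x ∷ bs) (here refl) = m≤m⊔n (proj₁ x) _
  le' (x ∷ bs) (there p) = ≤-trans (le' bs p) (m≤n⊔m (proj₁ x) _)
  le : ∀ bs → b ∈ ((r , c) ∷ bs) → proj₁ b ≤ f bs
  le bs (here refl) = le-r bs
  le bs (there p) = le' bs p
  ge : ∀ bs → r ≤ m → (∀ {x} → x ∈ bs → proj₁ x ≤ m) → f bs ≤ m
  ge [] p _ = p
  ge (x ∷ bs) p q = ⊔-lub (q (here refl)) (ge bs p (λ y → q (there y)))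

∈-range⁺ : ∀ {n c} → 1 ≤ c → c ≤ n → c ∈ range n
∈-range⁺ {n} {suc c} _ p = ∈-map⁺ suc (∈-upTo⁺ p)

∈-range⁻ : ∀ {n c} → c ∈ range n → ∃ λ c' → c ≡ suc c' × c' < n
∈-range⁻ m with ∈-map⁻ suc m
... | c' , mc , e = c' , e , ∈-upTo⁻ mc

∈-cm⁺ : ∀ {A B : Set} (f : A → List B) {x y xs} → x ∈ xs → y ∈ f x → y ∈ concatMap f xs
∈-cm⁺ f (here refl) m = ∈-++⁺ˡ m
∈-cm⁺ f {xs = z ∷ xs} (there p) m = ∈-++⁺ʳ (f z) (∈-cm⁺ f p m)

∈-cm⁻ : ∀ {A B : Set} (f : A → List B) {y} xs → y ∈ concatMap f xs → ∃ λ x → x ∈ xs × y ∈ f x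
∈-cm⁻ f (x ∷ xs) m with ∈-++⁻ (f x) m
... | inj₁ p = x , here refl , p
... | inj₂ p with ∈-cm⁻ f xs p
...   | z , a , b = z , there a , b

∈-boxes⁺ : ∀ L r c → r < length L → 1 ≤ c → c ≤ nth L (suc r) → (suc r , c) ∈ boxes L
∈-boxes⁺ L r c p a b = ∈-cm⁺ _ (∈-range⁺ (s≤s z≤n) p) (∈-map⁺ _ (∈-range⁺ a b))

∈-boxes⁻ : ∀ L {b} → b ∈ boxes L → ∃ λ r → ∃ λ c → b ≡ (suc r , suc c) × r < length L × c < nth L (suc r)
∈-boxes⁻ L m with ∈-cm⁻ _ (range (length L)) m
... | r , mr , mb with ∈-range⁻ mr | ∈-map⁻ _ mb
...   | r' , refl , lr | c , mc , refl with ∈-range⁻ mc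
...     | c' , refl , lc = r' , c' , refl , lr , lc

Asc : ℕ → List Box → Set
Asc lo [] = ⊤
Asc lo (b ∷ bs) = lo ≤ proj₁ b × Asc (proj₁ b) bs

asc-weaken : ∀ {a b} bs → a ≤ b → Asc b bs → Asc a bs
asc-weaken [] p _ = tt
asc-weaken (x ∷ bs) p (h , hs) = ≤-trans p h , hs

asc-filterB : ∀ p bs {lo} → Asc lo bs → Asc lo (filterB p bs)
asc-filterB p [] _ = tt
asc-filterB p (b ∷ bs) (h , hs) with p b
... | true = h , asc-filterB p bs hs
... | false = asc-weaken (filterB p bs) h (asc-filterB p bs hs)

asc-head : ∀ {bs lo} → Asc lo bs → ∀ {x} → x ∈ bs → lo ≤ proj₁ x
asc-head (h , hs) (here refl) = h
asc-head (h , hs) (there m) = ≤-trans h (asc-head hs m)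

asc-boxes : ∀ L → Asc 0 (boxes L)
asc-boxes L = go (length L) (λ x → x) 0 (λ i → z≤n) (λ i → n≤1+n i)
  where
  open import Data.List using (applyUpTo)
  f : ℕ → List Box
  f r = map (λ c → (r , c)) (range (nth L r))
  row : ∀ lo r cs rest → lo ≤ r → Asc r rest → Asc lo (map (λ c → (r , c)) cs ++ rest)
  row lo r [] rest p h = asc-weaken rest p h
  row lo r (c ∷ cs) rest p h = p , row r r cs rest ≤-refl h
  go : ∀ n (g : ℕ → ℕ) lo → (∀ i → lo ≤ suc (g i)) → (∀ i → g i ≤ g (suc i)) → Asc lo (concatMap f (map suc (applyUpTo g n)))
  go zero g lo h m = tt
  go (suc n) g lo h m = row lo (suc (g 0)) (range (nth L (suc (g 0)))) _ (h 0)
    (go n (λ i → g (suc i)) (suc (g 0)) (λ i → s≤s (le i)) (λ i → m (suc i)))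
    where
    le : ∀ i → g 0 ≤ g (suc i)
    le zero = m 0
    le (suc i) = ≤-trans (le i) (m (suc i))

∈-interval : ∀ j t {y} → y ∈ interval j t → j ≤ y × y < j + t
∈-interval j (suc t) (here refl) = ≤-refl , m<m+n j (s≤s z≤n)
∈-interval j (suc t) {y} (there m) with ∈-interval (suc j) t m
... | a , b = <⇒≤ a , subst (y <_) (sym (+-suc j t)) b

touch-right : ∀ r c → touch (r , c) (r , suc c) ≡ true
touch-right r c rewrite ≡ᵇ-refl r | ≡ᵇ-refl c = ∨-zeroʳ _

touch-left : ∀ r c → touch (r , suc c) (r , c) ≡ true
touch-left r c rewrite ≡ᵇ-refl r | ≡ᵇ-refl c | ∨-zeroʳ (suc (suc c) ≡ᵇ c) = ∨-zeroʳ _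

touch-up : ∀ r c → touch (suc r , c) (r , c) ≡ true
touch-up r c rewrite ≡ᵇ-refl r | ≡ᵇ-refl c | ∨-zeroʳ (suc (suc r) ≡ᵇ r) | ∨-zeroʳ ((suc r ≡ᵇ r) ∧ ((suc c ≡ᵇ c) ∨ (suc c ≡ᵇ c))) = ∨-zeroʳ _

touch-down : ∀ r c → touch (r , c) (suc r , c) ≡ true
touch-down r c rewrite ≡ᵇ-refl r | ≡ᵇ-refl c | ∨-zeroʳ ((r ≡ᵇ suc r) ∧ ((suc c ≡ᵇ c) ∨ (suc c ≡ᵇ c))) = ∨-zeroʳ _

touch-cases : ∀ x y → touch x y ≡ true → proj₁ x ≡ proj₁ y ⊎ (proj₂ x ≡ proj₂ y × (suc (proj₁ x) ≡ proj₁ y ⊎ suc (proj₁ y) ≡ proj₁ x))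
touch-cases (r , c) (r' , c') t with ∨-true {eqB (r , c) (r' , c')} t
... | inj₁ e = inj₁ (cong proj₁ (eqB-true (r , c) (r' , c') e))
... | inj₂ a with ∨-true {(r ≡ᵇ r') ∧ ((suc c ≡ᵇ c') ∨ (suc c' ≡ᵇ c))} a
...   | inj₁ h = inj₁ (≡ᵇ-true (proj₁ (∧-true h)))
...   | inj₂ v with ∧-true {c ≡ᵇ c'} v
...     | p , q with ∨-true {suc r ≡ᵇ r'} q
...       | inj₁ u = inj₂ (≡ᵇ-true p , inj₁ (≡ᵇ-true u))
...       | inj₂ u = inj₂ (≡ᵇ-true p , inj₂ (≡ᵇ-true u))

-- Components and spins of the ribbons removed by a swap

rowLabel : (ℕ → ℕ) → ℕ → ℕ → ℕ
rowLabel x zero r = 0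
rowLabel x (suc j) r = if x (suc j) ≤ᵇ r then suc j else rowLabel x j r

module Ribbons {k ℓ : ℕ} {κ τ : List ℕ} (gκ : Good k ℓ κ) (descτ : Desc τ) {p0 c i q : ℕ}
  (swp : Swapping (Good.core gκ) p0 c i q) (eqK : ∀ r → nth τ (suc r) ≡ Swapping.κ' swp r) where
  open Good gκ using (K; d; desc)
  open Swapping swp using (block?; row-next)
  open RowMap d (Core.mono (Good.core gκ)) (Core.up (Good.core gκ))

  x : ℕ → ℕ
  x j = it d j p0
  K' : ℕ → ℕ
  K' r = nth τ (suc r)
  W₀ : ℕ
  W₀ = K 0

  below : ∀ j i' → j ≤ c → i' ≤ i → K' (x j + i') < K (x j + i')
  below j i' a b = subst (_< K (x j + i')) (sym (eqK _)) (Swapping.κ'<κ swp j i' a b)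
  step : ∀ j i' → j ≤ c → i' < i → suc (K' (x j + i')) ≡ K (x j + suc i')
  step j i' a b = cong suc (eqK _) ∙ Swapping.κ'-step swp j i' a b
  end : ∀ j → j ≤ c → K (suc (x j + i)) ≤ K' (x j + i)
  end j a = subst (K (suc (x j + i)) ≤_) (sym (eqK _)) (Swapping.κ'-end swp j a)

  bs : List Box
  bs = skew τ κ

  data InSkew : Box → Set where
    box : ∀ j i' c' → j ≤ c → i' ≤ i → K' (x j + i') < c' → c' ≤ K (x j + i') → InSkew (suc (x j + i') , c')

  ∈⇒ : ∀ {b} → b ∈ bs → InSkew b
  ∈⇒ m with ∈-filterB⁻ _ (boxes κ) m
  ... | mb , t with ∈-boxes⁻ κ mb
  ...   | r , c' , refl , rl , cl with block? r
  ...     | inj₁ (j , i' , a , b , refl) = box j i' (suc c') a b (<ᵇ⇒< _ _ (true-T t)) cl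
  ...     | inj₂ nb = ⊥-elim (<⇒≱ (<ᵇ⇒< _ _ (true-T t)) (≤-trans cl (≤-reflexive (sym (eqK r ∙ Swapping.κ-same swp r nb)))))

  ⇒∈ : ∀ {b} → InSkew b → b ∈ bs
  ⇒∈ (box j i' c' a b lo hi) = ∈-filterB⁺ _ (∈-boxes⁺ κ _ c' (row-length κ _ (≤-trans (s≤s z≤n) (≤-trans lo hi))) (≤-trans (s≤s z≤n) lo) hi) (T-true (<⇒<ᵇ lo))

  -- `dep` is the diagonal, row minus column, shifted by the largest part W₀ to stay in ℕ. A ribbon
  -- meets each diagonal at most once, and adjacent boxes lie on neighbouring diagonals.
  lab dep : Box → ℕ
  lab b = rowLabel x c (proj₁ b ∸ 1)
  dep b = proj₁ b + (W₀ ∸ proj₂ b)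

  label : ∀ j i' → j ≤ c → i' ≤ i → rowLabel x c (x j + i') ≡ j
  label j i' jc ii = go c ≤-refl jc
    where
    go : ∀ t → t ≤ c → j ≤ t → rowLabel x t (x j + i') ≡ j
    go zero _ z≤n = refl
    go (suc t) tc jt with j ≟ suc t
    ... | yes refl = cong (λ b → if b then suc t else rowLabel x t (x j + i')) (≤ᵇ-yes (m≤m+n (x j) i'))
    ... | no ne = cong (λ b → if b then suc t else rowLabel x t (x j + i')) (≤ᵇ-no (<-≤-trans (row-next j i' jc ii) (it-le p0 j<t)))
            ∙ go t (<⇒≤ tc) (ℕ.s≤s⁻¹ j<t)
      where
      j<t : j < suc t
      j<t = ≤∧≢⇒< jt ne

  K≤W : ∀ r → K r ≤ W₀
  K≤W r = desc-≤ {κ} desc {0} {r} z≤n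

  descK : ∀ {a b} → a ≤ b → K b ≤ K a
  descK = desc-≤ {κ} desc
  descK' : ∀ {a b} → a ≤ b → K' b ≤ K' a
  descK' = desc-≤ {τ} descτ

  co : ∀ {c' r} → c' ≤ K r → (W₀ ∸ c') + c' ≡ W₀
  co {c'} {r} h = m∸n+n≡m (≤-trans h (K≤W r))

  -- Within a block a vertical step keeps the label; out of the last row of a ribbon it would need a
  -- box in a column that `end` excludes.
  vertical : ∀ {b b'} → InSkew b → InSkew b' → proj₂ b ≡ proj₂ b' → suc (proj₁ b) ≡ proj₁ b' → lab b ≡ lab b'
  vertical (box j i' c' a b lo hi) (box j₂ i₂ .c' a₂ b₂ lo₂ hi₂) refl e with i' ≟ i
  ... | no ne = label j i' a b ∙ sym (cong (rowLabel x c) (suc-injective (sym e) ∙ sym (+-suc (x j) i')) ∙ label j (suc i') a (≤∧≢⇒< b ne))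
  ... | yes refl = ⊥-elim (<⇒≱ lo (≤-trans hi₂ (≤-trans (≤-reflexive (cong K (suc-injective (sym e)))) (end j a))))

  same-label : ∀ {j i' j₂ i₂} → j ≤ c → i' ≤ i → j₂ ≤ c → i₂ ≤ i → rowLabel x c (x j + i') ≡ rowLabel x c (x j₂ + i₂) → j ≡ j₂
  same-label a b a₂ b₂ e = sym (label _ _ a b) ∙ e ∙ label _ _ a₂ b₂

  labelled : Labelled bs lab dep
  labelled = record { sound = λ mx my → sound (∈⇒ mx) (∈⇒ my) ; pred = λ mx my → pred (∈⇒ mx) (∈⇒ my) ; succ = λ mx my → succ (∈⇒ mx) (∈⇒ my) ; uniq = λ mx my → uniq (∈⇒ mx) (∈⇒ my) }
    where
    sound : ∀ {b b'} → InSkew b → InSkew b' → touch b b' ≡ true → lab b ≡ lab b'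
    sound {b} {b'} s s' t with touch-cases b b' t
    ... | inj₁ e = cong (λ r → rowLabel x c (r ∸ 1)) e
    ... | inj₂ (e , inj₁ u) = vertical s s' e u
    ... | inj₂ (e , inj₂ u) = sym (vertical s' s (sym e) u)

    -- Going back along the ribbon means the right neighbour, or at the end of the row the box
    -- above, which belongs to the ribbon because consecutive rows share a column. `succ` is the
    -- reverse: left, else down.
    pred : ∀ {b b'} → InSkew b → InSkew b' → lab b ≡ lab b' → dep b' < dep b →
      ∃ λ z → z ∈ bs × lab z ≡ lab b × suc (dep z) ≡ dep b × touch b z ≡ true
    pred (box j i' c' a b lo hi) s' l lt with c' <? K (x j + i')
    ... | yes h = _ , ⇒∈ (box j i' (suc c') a b (m≤n⇒m≤1+n lo) h) , refl ,
          (lia (u ∷ c' ∷ w ∷ v ∷ y ∷ []) (v0 ⊕ v1 ≛ v2 ∷ v3 ⊕ (su v1) ≛ v2 ∷ []) (su (v4 ⊕ v3) ≛ v4 ⊕ v0) ((1 ∷ 0 ∷ 1 ∷ 1 ∷ []) , (1 ∷ 1 ∷ 0 ∷ 0 ∷ 1 ∷ []))) (co {r = x j + i'} hi) (co {r = x j + i'} h) , touch-right (suc (x j + i')) c'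
      where
      u v w y : ℕ
      u = W₀ ∸ c'
      v = W₀ ∸ suc c'
      w = W₀
      y = suc (x j + i')
    pred (box j zero c' a b lo hi) (box j₂ i₂ c₂ a₂ b₂ lo₂ hi₂) l lt | no h = ⊥-elim (first (same-label {i' = 0} {i₂ = i₂} a b a₂ b₂ l))
      where
      first : j ≡ j₂ → ⊥
      first refl = (lia (u ∷ c' ∷ w ∷ v ∷ c₂ ∷ k₀ ∷ k₂ ∷ y ∷ i₂ ∷ []) (v0 ⊕ v1 ≛ v2 ∷ v3 ⊕ v4 ≛ v2 ∷ v5 ≼ v1 ∷ v4 ≼ v6 ∷ v6 ≼ v5 ∷ (su (v7 ⊕ v8)) ⊕ v3 ≺ (su (v7 ⊕ (li 0))) ⊕ v0 ∷ []) (ff) ((1 ∷ 0 ∷ 0 ∷ 1 ∷ 1 ∷ 1 ∷ 1 ∷ 1 ∷ []) , []))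
        (co {r = x j + 0} hi) (co {r = x j + i₂} hi₂) (≮⇒≥ h) hi₂ (descK (+-monoʳ-≤ (x j) z≤n)) lt
        where
        u v w y k₀ k₂ : ℕ
        u = W₀ ∸ c'
        v = W₀ ∸ c₂
        w = W₀
        y = x j
        k₀ = K (x j + 0)
        k₂ = K (x j + i₂)
    pred (box j (suc i') c' a b lo hi) s' l lt | no h = (suc (x j + i') , c') ,
      ⇒∈ (box j i' c' a (<⇒≤ b) (≤-trans (≤-reflexive (step j i' a b)) (≮⇒≥ h)) (≤-trans hi (descK (+-monoʳ-≤ (x j) (n≤1+n i'))))) ,
      label j i' a (<⇒≤ b) ∙ sym (label j (suc i') a b) , cong (λ r → suc r + (W₀ ∸ c')) (sym (+-suc (x j) i')) ,
      (cong (λ r → touch (suc r , c') (suc (x j + i') , c')) (+-suc (x j) i') ∙ touch-up (suc (x j + i')) c')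

    succ : ∀ {b b'} → InSkew b → InSkew b' → lab b ≡ lab b' → dep b < dep b' →
      ∃ λ z → z ∈ bs × lab z ≡ lab b × dep z ≡ suc (dep b) × touch b z ≡ true
    succ (box j i' (suc c') a b lo hi) s' l lt with K' (x j + i') <? c'
    ... | yes h = _ , ⇒∈ (box j i' c' a b h (<⇒≤ hi)) , refl ,
          (lia (u ∷ c' ∷ w ∷ v ∷ y ∷ []) (v0 ⊕ (su v1) ≛ v2 ∷ v3 ⊕ v1 ≛ v2 ∷ []) (v4 ⊕ v3 ≛ su (v4 ⊕ v0)) ((1 ∷ 0 ∷ 1 ∷ 1 ∷ []) , (1 ∷ 1 ∷ 0 ∷ 0 ∷ 1 ∷ []))) (co {r = x j + i'} hi) (co {r = x j + i'} (<⇒≤ hi)) , touch-left (suc (x j + i')) c'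
      where
      u v w y : ℕ
      u = W₀ ∸ suc c'
      v = W₀ ∸ c'
      w = W₀
      y = suc (x j + i')
    succ (box j i' (suc c') a b lo hi) s' l lt | no h with i' ≟ i
    ... | no ne = (suc (suc (x j + i')) , suc c') ,
          subst (λ r → (suc r , suc c') ∈ bs) (+-suc (x j) i') (⇒∈ (box j (suc i') (suc c') a i'<i
            (<-≤-trans (below j (suc i') a i'<i) (≤-trans (≤-reflexive (sym (step j i' a i'<i))) lo)) (≤-trans (s≤s (≮⇒≥ h)) (≤-reflexive (step j i' a i'<i))))) ,
          cong (rowLabel x c) (sym (+-suc (x j) i')) ∙ label j (suc i') a i'<i ∙ sym (label j i' a b) , refl , touch-down (suc (x j + i')) (suc c')
      where
      i'<i : i' < i
      i'<i = ≤∧≢⇒< b ne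
    succ (box j i' (suc c') a b lo hi) (box j₂ i₂ c₂ a₂ b₂ lo₂ hi₂) l lt | no h | yes refl = ⊥-elim (last (same-label {i' = i'} {i₂ = i₂} a b a₂ b₂ l))
      where
      last : j ≡ j₂ → ⊥
      last refl = (lia (u ∷ c' ∷ w ∷ v ∷ c₂ ∷ k₀ ∷ k₂ ∷ i₂ ∷ i' ∷ y ∷ []) (v0 ⊕ (su v1) ≛ v2 ∷ v3 ⊕ v4 ≛ v2 ∷ v1 ≼ v5 ∷ v6 ≺ v4 ∷ v5 ≼ v6 ∷ v7 ≼ v8 ∷ (su (v9 ⊕ v8)) ⊕ v0 ≺ (su (v9 ⊕ v7)) ⊕ v3 ∷ []) (ff) ((0 ∷ 1 ∷ 1 ∷ 0 ∷ 1 ∷ 1 ∷ 1 ∷ 1 ∷ 1 ∷ []) , []))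
        (co {r = x j + i'} hi) (co {r = x j + i₂} hi₂) (≮⇒≥ h) lo₂ (descK' (+-monoʳ-≤ (x j) b₂)) b₂ lt
        where
        u v w y k₀ k₂ : ℕ
        u = W₀ ∸ suc c'
        v = W₀ ∸ c₂
        w = W₀
        y = x j
        k₀ = K' (x j + i')
        k₂ = K' (x j + i₂)

    earlier : ∀ j i' i₂ c' c₂ → j ≤ c → i₂ ≤ i → K' (x j + i') < c' → c' ≤ K (x j + i') → c₂ ≤ K (x j + i₂) → i' < i₂ →
      suc (x j + i') + (W₀ ∸ c') < suc (x j + i₂) + (W₀ ∸ c₂)
    earlier j i' i₂ c' c₂ a b₂ lo hi hi₂ lt = (lia (u ∷ c' ∷ w ∷ v ∷ c₂ ∷ k₀ ∷ k₂ ∷ k₁ ∷ i' ∷ i₂ ∷ y ∷ []) (v0 ⊕ v1 ≛ v2 ∷ v3 ⊕ v4 ≛ v2 ∷ v5 ≺ v1 ∷ v4 ≼ v6 ∷ v6 ≼ v7 ∷ su v5 ≛ v7 ∷ v8 ≺ v9 ∷ []) ((su (v10 ⊕ v8)) ⊕ v0 ≺ (su (v10 ⊕ v9)) ⊕ v3) ((1 ∷ 1 ∷ 0 ∷ 0 ∷ 1 ∷ 1 ∷ 1 ∷ 1 ∷ 0 ∷ 1 ∷ 1 ∷ []) , []))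
      (co {r = x j + i'} hi) (co {r = x j + i₂} hi₂) lo hi₂ (descK (+-monoʳ-≤ (x j) lt)) (step j i' a (<-≤-trans lt b₂)) lt
      where
      u v w y k₀ k₁ k₂ : ℕ
      u = W₀ ∸ c'
      v = W₀ ∸ c₂
      w = W₀
      y = x j
      k₀ = K' (x j + i')
      k₁ = K (x j + suc i')
      k₂ = K (x j + i₂)

    uniq : ∀ {b b'} → InSkew b → InSkew b' → lab b ≡ lab b' → dep b ≡ dep b' → b ≡ b'
    uniq (box j i' c' a b lo hi) (box j₂ i₂ c₂ a₂ b₂ lo₂ hi₂) l e = go (same-label {i' = i'} {i₂ = i₂} a b a₂ b₂ l)
      where
      go : j ≡ j₂ → _
      go refl with i' <? i₂ | i₂ <? i'
      ... | yes lt | _ = ⊥-elim (<⇒≢ (earlier j i' i₂ c' c₂ a b₂ lo hi hi₂ lt) e)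
      ... | no _ | yes lt = ⊥-elim (>⇒≢ (earlier j i₂ i' c₂ c' a b lo₂ hi₂ hi lt) e)
      ... | no p | no p' with ≤-antisym (≮⇒≥ p') (≮⇒≥ p)
      ...   | refl = cong (suc (x j + i') ,_) ((lia (u ∷ c' ∷ w ∷ v ∷ c₂ ∷ y ∷ []) (v0 ⊕ v1 ≛ v2 ∷ v3 ⊕ v4 ≛ v2 ∷ v5 ⊕ v0 ≛ v5 ⊕ v3 ∷ []) (v1 ≛ v4) ((1 ∷ 1 ∷ 0 ∷ 0 ∷ 1 ∷ 0 ∷ 1 ∷ []) , (1 ∷ 0 ∷ 1 ∷ 1 ∷ 0 ∷ 1 ∷ []))) (co {r = x j + i'} hi) (co {r = x j + i'} hi₂) e)
        where
        u v w y : ℕ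
        u = W₀ ∸ c'
        v = W₀ ∸ c₂
        w = W₀
        y = suc (x j + i')

  fb : ℕ → Box
  fb j = suc (x j + 0) , K (x j + 0)

  first-box : ∀ j → j ≤ c → InSkew (fb j)
  first-box j a = box j 0 _ a z≤n (below j 0 a z≤n) ≤-refl

  lab≤c : ∀ {b} → b ∈ bs → lab b ≤ c
  lab≤c m with ∈⇒ m
  ... | box j i' c' a b _ _ = ≤-trans (≤-reflexive (label j i' a b)) a

  heads : ∀ j → j ≤ c → ∃ λ b → ∃ λ rest → filterB (λ z → j ≤ᵇ lab z) bs ≡ b ∷ rest × lab b ≡ j
  heads j jc with filterB (λ z → j ≤ᵇ lab z) bs in eq
  ... | [] = ⊥-elim (none (subst (fb j ∈_) eq (∈-filterB⁺ (λ z → j ≤ᵇ lab z) (⇒∈ (first-box j jc)) (≤ᵇ-yes (≤-reflexive (sym (label j 0 jc z≤n)))))))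
    where
    none : ∀ {b : Box} → b ∈ [] → ⊥
    none ()
  ... | b ∷ rest = b , rest , refl , ≤-antisym lower upper
    where
    b∈ : b ∈ filterB (λ z → j ≤ᵇ lab z) bs
    b∈ = subst (b ∈_) (sym eq) (here refl)
    upper : j ≤ lab b
    upper = ≤ᵇ-true {j} {lab b} (proj₂ (∈-filterB⁻ _ bs b∈))
    first∈ : fb j ∈ (b ∷ rest)
    first∈ = subst (fb j ∈_) eq (∈-filterB⁺ (λ z → j ≤ᵇ lab z) (⇒∈ (first-box j jc)) (≤ᵇ-yes (≤-reflexive (sym (label j 0 jc z≤n)))))
    asc : Asc (proj₁ b) (b ∷ rest)
    asc = ≤-refl , proj₂ (subst (Asc 0) eq (asc-filterB _ bs (asc-filterB _ (boxes κ) (asc-boxes κ))))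
    lower : lab b ≤ j
    lower with ∈⇒ (proj₁ (∈-filterB⁻ _ bs b∈)) | asc-head asc first∈
    ... | box j' i' _ a ii _ _ | h = ≮⇒≥ λ lt → <⇒≱ (<-≤-trans (row-next j 0 jc z≤n) (it-le p0 (subst (j <_) (label j' i' a ii) lt)))
          (≤-trans (m≤m+n (x j') i') (ℕ.s≤s⁻¹ h))

  module Cs = Components labelled c lab≤c heads

  ∈-comp : ∀ j {b} → b ∈ Cs.comp j → InSkew b × lab b ≡ j
  ∈-comp j m with ∈-filterB⁻ _ bs m
  ... | a , e = ∈⇒ a , ≡ᵇ-true e

  comp-minRow : ∀ j → j ≤ c → minRow (Cs.comp j) ≡ suc (x j)
  comp-minRow j jc = minRow-char (Cs.comp j) (suc (x j))
    (_ , ∈-filterB⁺ _ (⇒∈ (first-box j jc)) (cong (_≡ᵇ j) (label j 0 jc z≤n) ∙ ≡ᵇ-refl j) , cong suc (+-identityʳ (x j)))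
    λ m → ge (∈-comp j m)
    where
    ge : ∀ {b} → InSkew b × lab b ≡ j → suc (x j) ≤ proj₁ b
    ge (box j' i' _ a b _ _ , e) = s≤s (subst (λ z → x z ≤ x j' + i') (sym (label j' i' a b) ∙ e) (m≤m+n (x j') i'))

  comp-maxRow : ∀ j → j ≤ c → maxRow (Cs.comp j) ≡ suc (x j + i)
  comp-maxRow j jc = maxRow-char (Cs.comp j) (suc (x j + i))
    (_ , ∈-filterB⁺ _ (⇒∈ (box j i _ jc ≤-refl (below j i jc ≤-refl) ≤-refl)) (cong (_≡ᵇ j) (label j i jc ≤-refl) ∙ ≡ᵇ-refl j) , refl)
    λ m → le (∈-comp j m)
    where
    le : ∀ {b} → InSkew b × lab b ≡ j → proj₁ b ≤ suc (x j + i)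
    le (box j' i' _ a b _ _ , e) = s≤s (subst (λ z → x j' + i' ≤ x z + i) (sym (label j' i' a b) ∙ e) (+-monoʳ-≤ (x j') b))

  comp-height : ∀ j → j ≤ c → heightC (Cs.comp j) ∸ 1 ≡ i
  comp-height j jc = cong₂ _∸_ (comp-maxRow j jc) (comp-minRow j jc) ∙ m+n∸m≡n (x j) i

  x-mono : ∀ {a b} → a ≤ b → x a ≤ x b
  x-mono = it-le p0

  -- Components are listed from top to bottom, so those strictly below number j are j + 1, ..., c.
  -- The maximum accounts for a list that begins only at number a.
  later : ∀ t a j → j ≤ c → a + t ≡ suc c → length (filterB (λ D → minRow (Cs.comp j) <ᵇ minRow D) (map Cs.comp (interval a t))) ≡ suc c ∸ (a ⊔ suc j)
  later zero a j jc e = sym (m≤n⇒m∸n≡0 (≤-trans (≤-reflexive (sym e)) (≤-trans (≤-reflexive (+-identityʳ a)) (m≤m⊔n a (suc j)))))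
  later (suc t) a j jc e with minRow (Cs.comp j) <ᵇ minRow (Cs.comp a) in eq
  ... | true = cong suc (later t (suc a) j jc (sym (+-suc a t) ∙ e) ∙ cong (suc c ∸_) (m≥n⇒m⊔n≡m (m≤n⇒m≤1+n j<a))) ∙ sym (+-∸-assoc 1 a≤c) ∙ cong (suc c ∸_) (sym (m≥n⇒m⊔n≡m j<a))
    where
    a≤c : a ≤ c
    a≤c = ℕ.s≤s⁻¹ (≤-trans (s≤s (m≤m+n a t)) (≤-reflexive (sym (+-suc a t) ∙ e)))
    j<a : j < a
    j<a = ≰⇒> λ h → <⇒≱ (subst₂ _<_ (comp-minRow j jc) (comp-minRow a a≤c) (<ᵇ⇒< _ _ (true-T eq))) (s≤s (x-mono h))
  ... | false = later t (suc a) j jc (sym (+-suc a t) ∙ e) ∙ cong (suc c ∸_) (m≤n⇒m⊔n≡n (s≤s a≤j) ∙ sym (m≤n⇒m⊔n≡n (m≤n⇒m≤1+n a≤j)))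
    where
    a≤c : a ≤ c
    a≤c = ℕ.s≤s⁻¹ (≤-trans (s≤s (m≤m+n a t)) (≤-reflexive (sym (+-suc a t) ∙ e)))
    a≤j : a ≤ j
    a≤j = ≮⇒≥ λ h → subst T eq (<⇒<ᵇ (subst₂ _<_ (sym (comp-minRow j jc)) (sym (comp-minRow a a≤c)) (s≤s (≤-trans (s≤s (m≤m+n (x j) 0)) (≤-trans (row-next j 0 jc z≤n) (x-mono h))))))

  -- The spin formula becomes explicit: c + 1 components of height i + 1, of which c - j lie below
  -- number j. The successor in the mark converts 0-based rows to the 1-based rows of the statement.
  marks : map (λ C → (minRow C , length (components bs) * (heightC C ∸ 1) + length (filterB (λ D → minRow C <ᵇ minRow D) (components bs)))) (components bs)
    ≡ map (λ j → (suc (x j) , suc c * i + (c ∸ j))) (interval 0 (suc c))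
  marks rewrite Cs.components≡ = sym (map-∘ (interval 0 (suc c))) ∙ map-cong-local (All.tabulate λ {j} m → each j (ℕ.s≤s⁻¹ (proj₂ (∈-interval 0 (suc c) m))))
    where
    cs : List (List Box)
    cs = map Cs.comp (interval 0 (suc c))
    each : ∀ j → j ≤ c → (minRow (Cs.comp j) , length cs * (heightC (Cs.comp j) ∸ 1) + length (filterB (λ D → minRow (Cs.comp j) <ᵇ minRow D) cs)) ≡ (suc (x j) , suc c * i + (c ∸ j))
    each j jc = cong₂ _,_ (comp-minRow j jc) (cong₂ _+_ (cong₂ _*_ (length-map Cs.comp (interval 0 (suc c)) ∙ length-interval 0 (suc c)) (comp-height j jc)) (later (suc c) 0 j jc refl))

-- Sums over strong marked covers

sumℤ : ∀ {A : Set} → List A → (A → ℤ) → ℤ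
sumℤ [] f = + 0
sumℤ (x ∷ xs) f = f x ℤ.+ sumℤ xs f

sumℤ-++ : ∀ {A : Set} (xs ys : List A) f → sumℤ (xs ++ ys) f ≡ sumℤ xs f ℤ.+ sumℤ ys f
sumℤ-++ [] ys f = sym (ℤP.+-identityˡ _)
sumℤ-++ (x ∷ xs) ys f = cong (λ z → f x ℤ.+ z) (sumℤ-++ xs ys f) ∙ sym (ℤP.+-assoc (f x) _ _)

sumℤ-map : ∀ {A B : Set} (g : A → B) xs f → sumℤ (map g xs) f ≡ sumℤ xs (λ x → f (g x))
sumℤ-map g [] f = refl
sumℤ-map g (x ∷ xs) f = cong (λ z → f (g x) ℤ.+ z) (sumℤ-map g xs f)

sumℤ-concatMap : ∀ {A B : Set} (g : A → List B) xs f → sumℤ (concatMap g xs) f ≡ sumℤ xs (λ x → sumℤ (g x) f)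
sumℤ-concatMap g [] f = refl
sumℤ-concatMap g (x ∷ xs) f = sumℤ-++ (g x) (concatMap g xs) f ∙ cong (λ z → sumℤ (g x) f ℤ.+ z) (sumℤ-concatMap g xs f)

sumℤ-filterB : ∀ {A : Set} (p : A → Bool) xs f → sumℤ (filterB p xs) f ≡ sumℤ xs (λ x → if p x then f x else + 0)
sumℤ-filterB p [] f = refl
sumℤ-filterB p (x ∷ xs) f with p x
... | true = cong (λ z → f x ℤ.+ z) (sumℤ-filterB p xs f)
... | false = sumℤ-filterB p xs f ∙ sym (ℤP.+-identityˡ _)

sumℤ-cong : ∀ {A : Set} xs {f g : A → ℤ} → (∀ x → f x ≡ g x) → sumℤ xs f ≡ sumℤ xs g
sumℤ-cong [] h = refl
sumℤ-cong (x ∷ xs) h = cong₂ ℤ._+_ (h x) (sumℤ-cong xs h)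

sumℤ-+ : ∀ {A : Set} xs (f g : A → ℤ) → sumℤ xs (λ x → f x ℤ.+ g x) ≡ sumℤ xs f ℤ.+ sumℤ xs g
sumℤ-+ [] f g = refl
sumℤ-+ (x ∷ xs) f g = cong (λ z → (f x ℤ.+ g x) ℤ.+ z) (sumℤ-+ xs f g) ∙ ring (f x) (g x) (sumℤ xs f) (sumℤ xs g)
  where
  ring : ∀ a b c d → (a ℤ.+ b) ℤ.+ (c ℤ.+ d) ≡ (a ℤ.+ c) ℤ.+ (b ℤ.+ d)
  ring = ℤS.solve-∀

sumℤ-zero : ∀ {A : Set} (xs : List A) → sumℤ xs (λ _ → + 0) ≡ + 0
sumℤ-zero [] = refl
sumℤ-zero (x ∷ xs) = ℤP.+-identityˡ _ ∙ sumℤ-zero xs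

sumℤ-sh : ∀ {A : Set} (xs : List A) (f : A → Ser) n → sumℤ xs (λ x → sh (f x) n) ≡ sh (λ m → sumℤ xs (λ x → f x m)) n
sumℤ-sh xs f zero = sumℤ-zero xs
sumℤ-sh xs f (suc n) = refl

sumℤ-interval-zero : ∀ j t (h : ℕ → ℤ) → (∀ a → j ≤ a → a < j + t → h a ≡ + 0) → sumℤ (interval j t) h ≡ + 0
sumℤ-interval-zero j zero h z = refl
sumℤ-interval-zero j (suc t) h z = cong₂ ℤ._+_ (z j ≤-refl (m<m+n j (s≤s z≤n)))
  (sumℤ-interval-zero (suc j) t h (λ a p q → z a (<⇒≤ p) (subst (a <_) (sym (+-suc j t)) q)))

sumℤ-interval-delta : ∀ j t a₀ (h : ℕ → ℤ) → j ≤ a₀ → a₀ < j + t → (∀ a → j ≤ a → a < j + t → a ≢ a₀ → h a ≡ + 0) →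
  sumℤ (interval j t) h ≡ h a₀
sumℤ-interval-delta j zero a₀ h p q z = ⊥-elim (<⇒≱ q (≤-trans (≤-reflexive (+-identityʳ j)) p))
sumℤ-interval-delta j (suc t) a₀ h p q z with j ≟ a₀
... | yes refl = cong (λ y → h j ℤ.+ y) (sumℤ-interval-zero (suc j) t h (λ a u v → z a (<⇒≤ u) (subst (a <_) (sym (+-suc j t)) v) (>⇒≢ u))) ∙ ℤP.+-identityʳ _
... | no ne = cong₂ ℤ._+_ (z j ≤-refl (m<m+n j (s≤s z≤n)) ne)
    (sumℤ-interval-delta (suc j) t a₀ h (≤∧≢⇒< p ne) (subst (a₀ <_) (+-suc j t) q) (λ a u v → z a (<⇒≤ u) (subst (a <_) (sym (+-suc j t)) v))) ∙ ℤP.+-identityˡ _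

upTo-interval : ∀ n → upTo n ≡ interval 0 n
upTo-interval n = go n (λ x → x) 0 (λ i → refl)
  where
  go : ∀ n (f : ℕ → ℕ) j → (∀ i → f i ≡ j + i) → applyUpTo f n ≡ interval j n
  go zero f j h = refl
  go (suc n) f j h = cong₂ _∷_ (h 0 ∙ +-identityʳ j) (go n (λ i → f (suc i)) (suc j) (λ i → h (suc i) ∙ +-suc j i))

Fits : List ℕ → List ℕ → Set
Fits = Pointwise _≤_

choices-zero : ∀ κ (g : List ℕ → ℤ) → (∀ L → Fits L κ → g L ≡ + 0) → sumℤ (choices κ) g ≡ + 0
choices-zero [] g h = cong (ℤ._+ + 0) (h [] [])
choices-zero (x ∷ κ) g h = sumℤ-concatMap (λ a → map (a ∷_) (choices κ)) (upTo (suc x)) g ∙ cong (λ xs → sumℤ xs (λ a → sumℤ (map (a ∷_) (choices κ)) g)) (upTo-interval (suc x))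
  ∙ sumℤ-interval-zero 0 (suc x) _ (λ a _ q → sumℤ-map (a ∷_) (choices κ) g ∙ choices-zero κ (λ L → g (a ∷ L)) (λ L f → h (a ∷ L) (ℕ.s≤s⁻¹ q ∷ f)))

choices-delta : ∀ κ (g : List ℕ → ℤ) L₀ → Fits L₀ κ → (∀ L → Fits L κ → L ≢ L₀ → g L ≡ + 0) → sumℤ (choices κ) g ≡ g L₀
choices-delta [] g [] [] h = ℤP.+-identityʳ _
choices-delta (x ∷ κ) g (a₀ ∷ L₀) (p ∷ f) h = sumℤ-concatMap (λ a → map (a ∷_) (choices κ)) (upTo (suc x)) g ∙ cong (λ xs → sumℤ xs (λ a → sumℤ (map (a ∷_) (choices κ)) g)) (upTo-interval (suc x))
  ∙ sumℤ-interval-delta 0 (suc x) a₀ _ z≤n (s≤s p)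
      (λ a _ q ne → sumℤ-map (a ∷_) (choices κ) g ∙ choices-zero κ (λ L → g (a ∷ L)) (λ L f' → h (a ∷ L) (ℕ.s≤s⁻¹ q ∷ f') (λ { refl → ne refl })))
  ∙ sumℤ-map (a₀ ∷_) (choices κ) g
  ∙ choices-delta κ (λ L → g (a₀ ∷ L)) L₀ f (λ L f' ne → h (a₀ ∷ L) (p ∷ f') (λ { refl → ne refl }))

choices-cong : ∀ κ {g g' : List ℕ → ℤ} → (∀ L → Fits L κ → g L ≡ g' L) → sumℤ (choices κ) g ≡ sumℤ (choices κ) g'
choices-cong κ {g} {g'} h = sub-eq (sym (sumℤ-+ (choices κ) g (λ L → - g' L)) ∙ choices-zero κ _ (λ L f → cong (ℤ._- g' L) (h L f) ∙ ℤP.+-inverseʳ (g' L))) (neg (choices κ))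
  where
  neg : ∀ xs → sumℤ xs (λ L → - g' L) ≡ - sumℤ xs g'
  neg [] = refl
  neg (x ∷ xs) = cong (λ z → - g' x ℤ.+ z) (neg xs) ∙ sym (ℤP.neg-distrib-+ (g' x) _)
  sub-eq : ∀ {a b c} → a ℤ.+ b ≡ + 0 → b ≡ - c → a ≡ c
  sub-eq {a} {b} {c} e refl = ring a c ∙ cong (ℤ._+ c) e ∙ ℤP.+-identityˡ c
    where
    ring : ∀ a c → a ≡ (a ℤ.+ - c) ℤ.+ c
    ring = ℤS.solve-∀

decreasing⇒Desc : ∀ L → decreasingᵇ L ≡ true → Desc L
decreasing⇒Desc [] _ r = z≤n
decreasing⇒Desc (x ∷ []) _ zero = z≤n
decreasing⇒Desc (x ∷ []) _ (suc r) = z≤n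
decreasing⇒Desc (x ∷ y ∷ L) e zero = ≤ᵇ-true {y} {x} (proj₁ (∧-true e))
decreasing⇒Desc (x ∷ y ∷ L) e (suc r) = decreasing⇒Desc (y ∷ L) (proj₂ (∧-true {y ≤ᵇ x} e)) r

Desc⇒decreasing : ∀ L → Desc L → decreasingᵇ L ≡ true
Desc⇒decreasing [] h = refl
Desc⇒decreasing (x ∷ []) h = refl
Desc⇒decreasing (x ∷ y ∷ L) h = cong₂ _∧_ (≤ᵇ-yes (h 0)) (Desc⇒decreasing (y ∷ L) (λ r → h (suc r)))

strip : List ℕ → List ℕ
strip = filterB nonzero

strip-nth : ∀ L → Desc L → ∀ r → nth (strip L) (suc r) ≡ nth L (suc r)
strip-nth [] h r = refl
strip-nth (zero ∷ L) h r = strip-nth L (λ r → h (suc r)) r ∙ zeros r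
  where
  zeros : ∀ r → nth L (suc r) ≡ nth (zero ∷ L) (suc r)
  zeros r = n≤0⇒n≡0 (desc-≤ {zero ∷ L} h {0} {suc r} z≤n) ∙ sym (n≤0⇒n≡0 (desc-≤ {zero ∷ L} h {0} {r} z≤n))
strip-nth (suc x ∷ L) h zero = refl
strip-nth (suc x ∷ L) h (suc r) = strip-nth L (λ r → h (suc r)) r

strip-pos : ∀ L → All (_> 0) (strip L)
strip-pos [] = []
strip-pos (zero ∷ L) = strip-pos L
strip-pos (suc x ∷ L) = s≤s z≤n ∷ strip-pos L

list-ext : ∀ {L M : List ℕ} → length L ≡ length M → (∀ r → nth L (suc r) ≡ nth M (suc r)) → L ≡ M
list-ext {[]} {[]} _ h = refl
list-ext {x ∷ L} {y ∷ M} e h = cong₂ _∷_ (h 0) (list-ext (suc-injective e) (λ r → h (suc r)))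

fits-nth : ∀ {L κ} → Fits L κ → ∀ r → nth L (suc r) ≤ nth κ (suc r)
fits-nth [] r = z≤n
fits-nth (p ∷ f) zero = p
fits-nth (p ∷ f) (suc r) = fits-nth f r

nth-fits : ∀ L κ → length L ≡ length κ → (∀ r → nth L (suc r) ≤ nth κ (suc r)) → Fits L κ
nth-fits [] [] e h = []
nth-fits (x ∷ L) (y ∷ κ) e h = h 0 ∷ nth-fits L κ (suc-injective e) (λ r → h (suc r))

core-from-ν : ∀ {k ℓ κ ν d κ₂ ν₂ d₂} → Core k ℓ κ ν d → Core k ℓ κ₂ ν₂ d₂ → (∀ r → ν r ≡ ν₂ r) → ∀ r → κ r ≡ κ₂ r
core-from-ν {k} {ℓ} {κ} {ν} {d} {κ₂} {ν₂} {d₂} A B h r = go ℓ r (m≤n+m ℓ r)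
  where
  d≡ : ∀ r → d r ≡ d₂ r
  d≡ r = +-cancelʳ-≡ (ν r) _ _ (Core.code A r ∙ sym (Core.code B r) ∙ cong (λ z → d₂ r + z) (sym (h r)))
  go : ∀ f r → ℓ ≤ r + f → κ r ≡ κ₂ r
  go zero r p = Core.zero-from A r p' ∙ sym (Core.zero-from B r p')
    where
    p' : ℓ ≤ r
    p' = subst (ℓ ≤_) (+-identityʳ r) p
  go (suc f) r p = Core.κ-d A r ∙ cong₂ _+_ (h r) (go f (d r) (≤-trans p (≤-trans (≤-reflexive (+-suc r f)) (+-monoˡ-≤ f (Core.up A r)))) ∙ cong κ₂ (d≡ r)) ∙ sym (Core.κ-d B r)

weigh : ℕ → Ser → ℕ → ℕ × ℕ → ℤ
weigh p f n (r , s) = if r ≡ᵇ p then shN s f n else + 0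

opaque
  -- One strong Pieri operator: if F τ is the coefficient series of the basis element of τ, this is
  -- that of the basis element of κ acted on by u_p.
  mval : ℕ → List ℕ → ℕ → (List ℕ → Ser) → Ser
  mval k κ p F n = sumℤ (markedCovers k κ) (λ m → weigh p (F (proj₁ m)) n (proj₂ m))

  mval-def : ∀ k κ p F n → mval k κ p F n ≡ sumℤ (markedCovers k κ) (λ m → weigh p (F (proj₁ m)) n (proj₂ m))
  mval-def k κ p F n = refl

marking : List ℕ → List ℕ → List Box → ℕ × ℕ
marking κ τ C = minRow C , length (components (skew τ κ)) * (heightC C ∸ 1) + length (filterB (λ D → minRow C <ᵇ minRow D) (components (skew τ κ)))

inner : List ℕ → ℕ → (List ℕ → Ser) → List ℕ → Ser
inner κ p F τ n = sumℤ (map (marking κ τ) (components (skew τ κ))) (weigh p (F τ) n)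

isCover : ℕ → List ℕ → List ℕ → Bool
isCover k κ τ = isCoreᵇ (suc k) τ ∧ (suc (sumN (𝔭 k τ)) ≡ᵇ sumN (𝔭 k κ))

-- Extending the summand by zero to all lists fitting into κ gives the sums for different letters
-- the same index set, so that they can be subtracted list by list.
term : ℕ → List ℕ → ℕ → (List ℕ → Ser) → List ℕ → Ser
term k κ p F L n = if decreasingᵇ L then (if isCover k κ (strip L) then inner κ p F (strip L) n else + 0) else + 0

mval-choices : ∀ k κ p F n → mval k κ p F n ≡ sumℤ (choices κ) (λ L → term k κ p F L n)
mval-choices k κ p F n = mval-def k κ p F n ∙ sumℤ-concatMap covers (strongCovers k κ) (λ m → weigh p (F (proj₁ m)) n (proj₂ m))
  ∙ sumℤ-cong (strongCovers k κ) (λ τ → sumℤ-map (λ C → τ , marking κ τ C) (components (skew τ κ)) (λ m → weigh p (F (proj₁ m)) n (proj₂ m))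
      ∙ sym (sumℤ-map (marking κ τ) (components (skew τ κ)) (weigh p (F τ) n)))
  ∙ sumℤ-filterB (isCover k κ) (subPartitions κ) (λ τ → inner κ p F τ n)
  ∙ sumℤ-map strip (filterB decreasingᵇ (choices κ)) (λ τ → if isCover k κ τ then inner κ p F τ n else + 0)
  ∙ sumℤ-filterB decreasingᵇ (choices κ) (λ L → if isCover k κ (strip L) then inner κ p F (strip L) n else + 0)
  where
  covers : List ℕ → List (List ℕ × ℕ × ℕ)
  covers τ = map (λ C → τ , marking κ τ C) (components (skew τ κ))

blockSum : (ℕ → ℕ) → ℕ → ℕ → ℕ → Ser → Ser
blockSum x c i p f n = sumℤ (interval 0 (suc c)) (λ j → if suc (x j) ≡ᵇ suc p then shN (suc c * i + (c ∸ j)) f n else + 0)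

module OnCore {k ℓ : ℕ} {κ : List ℕ} (gκ : Good k ℓ κ) where
  open Good gκ using (K; ν; d; core)
  open Core core using (mono; up)
  open RowMap d mono up

  record Active (L : List ℕ) : Set where
    field
      descL : Desc L
      good : Good k ℓ (strip L)
      {p0 c i q} : ℕ
      swp : Swapping core p0 c i q
      rows-eq : ∀ r → nth (strip L) (suc r) ≡ Swapping.κ' swp r
      value : ∀ p F n → term k κ (suc p) F L n ≡ blockSum (λ j → it d j p0) c i p (F (strip L)) n

  activeValue : ∀ L → decreasingᵇ L ≡ true → isCover k κ (strip L) ≡ true → Desc (strip L) → ∀ {p0 c i q} (swp : Swapping core p0 c i q) →
    (∀ r → nth (strip L) (suc r) ≡ Swapping.κ' swp r) → ∀ p F n → term k κ (suc p) F L n ≡ blockSum (λ j → it d j p0) c i p (F (strip L)) n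
  activeValue L dec cov descτ {p0} {c} {i} swp eqK p F n = cong (λ b → if b then (if isCover k κ (strip L) then inner κ (suc p) F (strip L) n else + 0) else + 0) dec
      ∙ cong (λ b → if b then inner κ (suc p) F (strip L) n else + 0) cov
      ∙ cong (λ xs → sumℤ xs (weigh (suc p) (F (strip L)) n)) (Ribbons.marks gκ descτ swp eqK)
      ∙ sumℤ-map (λ j → suc (it d j p0) , suc c * i + (c ∸ j)) (interval 0 (suc c)) (weigh (suc p) (F (strip L)) n)

  activate : ∀ L → decreasingᵇ L ≡ true → isCover k κ (strip L) ≡ true → Fits L κ → Active L
  activate L dec cov fits = build (classify core (Good.core g) (λ r → ≤-trans (≤-reflexive (strip-nth L desc r)) (fits-nth fits r))
      (cong suc (sym (Good.𝔭-sum g)) ∙ ≡ᵇ-true (proj₂ split) ∙ Good.𝔭-sum gκ))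
    where
    split : isCoreᵇ (suc k) (strip L) ≡ true × (suc (sumN (𝔭 k (strip L))) ≡ᵇ sumN (𝔭 k κ)) ≡ true
    split = ∧-true {isCoreᵇ (suc k) (strip L)} cov
    desc : Desc L
    desc = decreasing⇒Desc L dec
    descτ : Desc (strip L)
    descτ r = subst₂ _≤_ (sym (strip-nth L desc (suc r))) (sym (strip-nth L desc r)) (desc r)
    g : Good k ℓ (strip L)
    g = record { desc = descτ ; positive = strip-pos L
      ; short = ≤-trans (length-filterB nonzero L) (≤-trans (≤-reflexive (Pw.Pointwise-length fits)) (Good.short gκ)) ; noHook = isCore⇒ k (strip L) (true-T (proj₁ split)) }
    build : (∃ λ p0 → ∃ λ c → ∃ λ i → ∃ λ q → Σ (Swapping core p0 c i q) λ swp → ∀ r → nth (strip L) (suc r) ≡ Swapping.κ' swp r) → Active L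
    build (p0 , c , i , q , swp , eqK) = record { descL = desc ; good = g ; swp = swp ; rows-eq = eqK ; value = activeValue L dec cov descτ swp eqK }

  active? : ∀ L → Fits L κ → (∀ p F n → term k κ p F L n ≡ + 0) ⊎ Active L
  active? L fits = go (decreasingᵇ L) refl (isCover k κ (strip L)) refl
    where
    go : ∀ a → decreasingᵇ L ≡ a → ∀ b → isCover k κ (strip L) ≡ b → (∀ p F n → term k κ p F L n ≡ + 0) ⊎ Active L
    go false e b e' = inj₁ λ p F n → cong (λ b → if b then (if isCover k κ (strip L) then inner κ p F (strip L) n else + 0) else + 0) e
    go true e false e' = inj₁ λ p F n → cong (λ b → if b then (if isCover k κ (strip L) then inner κ p F (strip L) n else + 0) else + 0) e
      ∙ cong (λ b → if b then inner κ p F (strip L) n else + 0) e'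
    go true e true e' = inj₂ (activate L e e' fits)

  if-yes : ∀ {A : Set} {a b} {x y : A} → a ≡ b → (if a ≡ᵇ b then x else y) ≡ x
  if-yes {a = a} refl rewrite ≡ᵇ-refl a = refl

  if-no : ∀ {A : Set} {a b} {x y : A} → a ≢ b → (if a ≡ᵇ b then x else y) ≡ y
  if-no {a = a} {b} ne rewrite ≡ᵇ-no a b ne = refl

  it-inj : ∀ p0 a b → it d a p0 ≡ it d b p0 → a ≡ b
  it-inj p0 a b e with a <? b | b <? a
  ... | yes h | _ = ⊥-elim (<⇒≢ (<-≤-trans (up (it d a p0)) (it-le {suc a} {b} p0 h)) e)
  ... | no _ | yes h = ⊥-elim (>⇒≢ (<-≤-trans (up (it d b p0)) (it-le {suc b} {a} p0 h)) e)
  ... | no h | no h' = ≤-antisym (≮⇒≥ h') (≮⇒≥ h)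

  blockSum-at : ∀ p0 c i f n j₀ p → j₀ ≤ c → it d j₀ p0 ≡ p → blockSum (λ j → it d j p0) c i p f n ≡ shN (suc c * i + (c ∸ j₀)) f n
  blockSum-at p0 c i f n j₀ p jc e = sumℤ-interval-delta 0 (suc c) j₀ _ z≤n (s≤s jc)
      (λ a _ _ ne → if-no (λ x → ne (it-inj p0 a j₀ (x ∙ sym e)))) ∙ if-yes e

  blockSum-away : ∀ p0 c i f n p → (∀ j → j ≤ c → it d j p0 ≢ p) → blockSum (λ j → it d j p0) c i p f n ≡ + 0
  blockSum-away p0 c i f n p h = sumℤ-interval-zero 0 (suc c) _ (λ a _ q → if-no (h a (ℕ.s≤s⁻¹ q)))

  onChain? : ∀ p0 c p → (∃ λ j → j ≤ c × it d j p0 ≡ p) ⊎ (∀ j → j ≤ c → it d j p0 ≢ p)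
  onChain? p0 zero p with p0 ≟ p
  ... | yes e = inj₁ (0 , z≤n , e)
  ... | no ne = inj₂ λ { zero _ → ne }
  onChain? p0 (suc c) p with it d (suc c) p0 ≟ p | onChain? p0 c p
  ... | yes e | _ = inj₁ (suc c , ≤-refl , e)
  ... | no ne | inj₁ (j , a , e) = inj₁ (j , m≤n⇒m≤1+n a , e)
  ... | no ne | inj₂ h = inj₂ go
    where
    go : ∀ j → j ≤ suc c → it d j p0 ≢ p
    go j a with j ≟ suc c
    ... | yes refl = ne
    ... | no ne' = h j (ℕ.s≤s⁻¹ (≤∧≢⇒< a ne'))

  -- A component at row p that is not the last one lies above the component at row d p, with one more below it.
  blockSum-step : ∀ p0 c i f n p → (∀ r → d r ≢ p0) → blockSum (λ j → it d j p0) c i p f n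
    ≡ (if it d c p0 ≡ᵇ p then shN (suc c * i) f n else + 0) ℤ.+ sh (blockSum (λ j → it d j p0) c i (d p) f) n
  blockSum-step p0 c i f n p top with onChain? p0 c p
  ... | inj₂ away = blockSum-away p0 c i f n p away ∙ sym (cong₂ ℤ._+_ (if-no (away c ≤-refl)) (sh-zero n))
    where
    away-d : ∀ j → j ≤ c → it d j p0 ≢ d p
    away-d zero _ e = top p (sym e)
    away-d (suc j) a e = away j (<⇒≤ a) (d-inj e)
    sh-zero : ∀ n → sh (blockSum (λ j → it d j p0) c i (d p) f) n ≡ + 0
    sh-zero zero = refl
    sh-zero (suc n) = blockSum-away p0 c i f n (d p) away-d
  ... | inj₁ (j , jc , e) with j ≟ c
  ...   | yes refl = blockSum-at p0 c i f n c p jc e ∙ cong (λ z → shN z f n) (cong (λ z → suc c * i + z) (n∸n≡0 c) ∙ +-identityʳ _)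
          ∙ sym (ℤP.+-identityʳ _) ∙ sym (cong₂ ℤ._+_ (if-yes e) (sh-zero n))
    where
    sh-zero : ∀ n → sh (blockSum (λ j → it d j p0) c i (d p) f) n ≡ + 0
    sh-zero zero = refl
    sh-zero (suc n) = blockSum-away p0 c i f n (d p) (λ j a e' → <⇒≢ (s≤s a) (it-inj p0 j (suc c) (e' ∙ cong d (sym e))))
  ...   | no ne = blockSum-at p0 c i f n j p jc e ∙ cong (λ z → shN z f n) (cong (λ z → suc c * i + z) (sym (suc-pred-∸ c j j<c)) ∙ +-suc _ _)
          ∙ sh-cong (λ m → sym (blockSum-at p0 c i f m (suc j) (d p) j<c (cong d e))) n
          ∙ sym (ℤP.+-identityˡ _) ∙ cong (ℤ._+ sh (blockSum (λ j → it d j p0) c i (d p) f) n) (sym (if-no (λ x → ne (it-inj p0 j c (e ∙ sym x)))))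
    where
    j<c : j < c
    j<c = ≤∧≢⇒< jc ne
    suc-pred-∸ : ∀ c j → j < c → suc (c ∸ suc j) ≡ c ∸ j
    suc-pred-∸ c j h = sym (+-∸-assoc 1 h)

  -- Stripping d from both sides ends at a row outside its image, so a row determines its chain and
  -- its depth in it.
  it-top-unique : ∀ a b p0 p0' → (∀ r → d r ≢ p0) → (∀ r → d r ≢ p0') → it d a p0 ≡ it d b p0' → a ≡ b × p0 ≡ p0'
  it-top-unique zero zero p0 p0' t t' e = refl , e
  it-top-unique zero (suc b) p0 p0' t t' e = ⊥-elim (t _ (sym e))
  it-top-unique (suc a) zero p0 p0' t t' e = ⊥-elim (t' _ e)
  it-top-unique (suc a) (suc b) p0 p0' t t' e = cong suc (proj₁ ih) , proj₂ ih
    where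
    ih : a ≡ b × p0 ≡ p0'
    ih = it-top-unique a b p0 p0' t t' (d-inj e)

  tower-i-unique : ∀ {p0 c i q i' q'} → Tower d p0 c i q → Last d p0 c i → Tower d p0 c i' q' → Last d p0 c i' → i ≡ i'
  tower-i-unique {p0} {c} {i} {q} {i'} {q'} T l T' l' with i <? i' | i' <? i
  ... | yes h | _ = ⊥-elim (l (cong d (sym (+-suc _ i)) ∙ Tower.blk T' c (suc i) ≤-refl h ∙ +-suc _ i))
  ... | no _ | yes h = ⊥-elim (l' (cong d (sym (+-suc _ i')) ∙ Tower.blk T c (suc i') ≤-refl h ∙ +-suc _ i'))
  ... | no h | no h' = ≤-antisym (≮⇒≥ h') (≮⇒≥ h)

  -- For i = 0 the row q enters through an empty indicator; for i > 0 it is the unique preimage of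
  -- p0 + 1.
  swap-unique : ∀ {p0 c i q q'} (s : Swapping core p0 c i q) (s' : Swapping core p0 c i q') → ∀ r → Swapping.κ' s r ≡ Swapping.κ' s' r
  swap-unique {p0} {c} {i} {q} {q'} s s' = core-from-ν (Swapping.core' s) (Swapping.core' s') λ r →
    +-cancelʳ-≡ (ind (it d c p0) (suc i) r) _ _ (Swapping.ν'-spec s r ∙ cong (λ z → ν r + z) (same-ind i refl r) ∙ sym (Swapping.ν'-spec s' r))
    where
    same-ind : ∀ m → m ≡ i → ∀ r → ind q m r ≡ ind q' m r
    same-ind zero _ r = refl
    same-ind (suc m) e r = cong (λ z → ind z (suc m) r) (d-inj (cong d (sym (+-identityʳ q)) ∙ Tower.rais (Swapping.tower s) 0 0<i
        ∙ sym (Tower.rais (Swapping.tower s') 0 0<i) ∙ cong d (+-identityʳ q')))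
      where
      0<i : 0 < i
      0<i = subst (0 <_) e (s≤s z≤n)

  -- Agreement is demanded only on cores reached by a cover with a component starting in row p. This
  -- restriction lets conditions such as full upper rows be carried along a word.
  mval-cong : ∀ p {F F' : List ℕ → Ser} → (∀ {p0 c i q} (s : Swapping core p0 c i q) j → j ≤ c → it d j p0 ≡ p →
      ∀ {τ} → Good k ℓ τ → (∀ r → nth τ (suc r) ≡ Swapping.κ' s r) → ∀ n → F τ n ≡ F' τ n) →
    ∀ n → mval k κ (suc p) F n ≡ mval k κ (suc p) F' n
  mval-cong p {F} {F'} h n = mval-choices k κ (suc p) F n ∙ choices-cong κ each ∙ sym (mval-choices k κ (suc p) F' n)
    where
    each : ∀ L → Fits L κ → term k κ (suc p) F L n ≡ term k κ (suc p) F' L n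
    each L fits with active? L fits
    ... | inj₁ z = z (suc p) F n ∙ sym (z (suc p) F' n)
    ... | inj₂ a with onChain? (Active.p0 a) (Active.c a) p
    ...   | inj₂ away = Active.value a p F n ∙ blockSum-away _ _ (Active.i a) _ n p away ∙ sym (Active.value a p F' n ∙ blockSum-away _ _ (Active.i a) _ n p away)
    ...   | inj₁ (j , jc , e) = Active.value a p F n ∙ blockSum-at _ _ (Active.i a) _ n j p jc e
              ∙ shN-cong (suc (Active.c a) * Active.i a + (Active.c a ∸ j)) (h (Active.swp a) j jc e (Active.good a) (Active.rows-eq a)) n
              ∙ sym (Active.value a p F' n ∙ blockSum-at _ _ (Active.i a) _ n j p jc e)

  lastTerm : ∀ {L} → Active L → ℕ → (List ℕ → Ser) → Ser
  lastTerm {L} a p F n = if it d (Active.c a) (Active.p0 a) ≡ᵇ p then shN (suc (Active.c a) * Active.i a) (F (strip L)) n else + 0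

  -- Subtracting t times the sum for row d p cancels every cover except those whose lowest component
  -- starts in row p; this mirrors the splitting of F_p on the Catalan side.
  difference : ∀ p F n → mval k κ (suc p) F n ≡ sumℤ (choices κ) (λ L → term k κ (suc p) F L n ℤ.- sh (term k κ (suc (d p)) F L) n) ℤ.+ sh (mval k κ (suc (d p)) F) n
  difference p F n = mval-choices k κ (suc p) F n
    ∙ sumℤ-cong (choices κ) (λ L → ring (term k κ (suc p) F L n) (sh (term k κ (suc (d p)) F L) n))
    ∙ sumℤ-+ (choices κ) _ _
    ∙ cong (λ z → sumℤ (choices κ) (λ L → term k κ (suc p) F L n ℤ.- sh (term k κ (suc (d p)) F L) n) ℤ.+ z)
        (sumℤ-sh (choices κ) (term k κ (suc (d p)) F) n ∙ sh-cong (λ m → sym (mval-choices k κ (suc (d p)) F m)) n)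
    where
    ring : ∀ a b → a ≡ (a ℤ.- b) ℤ.+ b
    ring = ℤS.solve-∀

  active-difference : ∀ {L} (a : Active L) p F n → term k κ (suc p) F L n ℤ.- sh (term k κ (suc (d p)) F L) n ≡ lastTerm a p F n
  active-difference {L} a p F n = cong₂ ℤ._-_ (Active.value a p F n ∙ blockSum-step (Active.p0 a) (Active.c a) (Active.i a) (F (strip L)) n p (Tower.top (Swapping.tower (Active.swp a))))
        (sh-cong (Active.value a (d p) F) n) ∙ ring (lastTerm a p F n) _
    where
    ring : ∀ a b → (a ℤ.+ b) ℤ.- b ≡ a
    ring = ℤS.solve-∀

  difference-term : ∀ L → Fits L κ → (∀ p F n → term k κ (suc p) F L n ℤ.- sh (term k κ (suc (d p)) F L) n ≡ + 0)
    ⊎ Σ (Active L) λ a → ∀ p F n → term k κ (suc p) F L n ℤ.- sh (term k κ (suc (d p)) F L) n ≡ lastTerm a p F n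
  difference-term L fits with active? L fits
  ... | inj₁ z = inj₁ λ p F n → cong₂ ℤ._-_ (z (suc p) F n) (sh-zero p F n)
    where
    sh-zero : ∀ p F n → sh (term k κ (suc (d p)) F L) n ≡ + 0
    sh-zero p F zero = refl
    sh-zero p F (suc n) = z (suc (d p)) F n
  ... | inj₂ a = inj₂ (a , active-difference a)

  -- The combinatorial counterpart of `Absent`: a surviving cover would be a swap on the chain of p0
  -- and of depth c, that is, a maximal tower.
  mval-absent : ∀ p0 c → (∀ r → d r ≢ p0) → (∀ i q → Tower d p0 c i q → Last d p0 c i → ⊥) → ∀ F n →
    mval k κ (suc (it d c p0)) F n ≡ sh (mval k κ (suc (d (it d c p0))) F) n
  mval-absent p0 c top none F n = difference (it d c p0) F n
    ∙ cong (ℤ._+ sh (mval k κ (suc (d (it d c p0))) F) n) (choices-zero κ _ each) ∙ ℤP.+-identityˡ _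
    where
    each : ∀ L → Fits L κ → term k κ (suc (it d c p0)) F L n ℤ.- sh (term k κ (suc (d (it d c p0))) F L) n ≡ + 0
    each L fits with difference-term L fits
    ... | inj₁ z = z _ F n
    ... | inj₂ (a , e) = e _ F n ∙ if-no (no-match (Active.swp a))
      where
      no-match : ∀ {p0' c' i' q'} → Swapping core p0' c' i' q' → it d c' p0' ≢ it d c p0
      no-match {p0'} {c'} s' x with it-top-unique c' c p0' p0 (Tower.top (Swapping.tower s')) top x
      ... | refl , refl = none _ _ (Swapping.tower s') (Swapping.last s')

  -- `choices` lists tuples of the length of κ, so the swapped core has to be found there with its
  -- zero rows; they are stripped afterwards.
  padded : (ℕ → ℕ) → List ℕ
  padded f = map f (upTo (length κ))

  -- The combinatorial counterpart of `Found`: depth, top and maximal height are determined by the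
  -- row, so exactly one cover survives, and its exponent is the lowest spin (c + 1) i.
  mval-found : ∀ {p0 c i q} (s : Swapping core p0 c i q) F (f : Ser) →
    (∀ {τ} → Good k ℓ τ → (∀ r → nth τ (suc r) ≡ Swapping.κ' s r) → ∀ n → F τ n ≡ f n) → ∀ n →
    mval k κ (suc (it d c p0)) F n ≡ shN (suc c * i) f n ℤ.+ sh (mval k κ (suc (d (it d c p0))) F) n
  mval-found {p0} {c} {i} {q} s F f hF n = difference (it d c p0) F n
    ∙ cong (ℤ._+ sh (mval k κ (suc (d (it d c p0))) F) n) (choices-delta κ _ L₀ fits₀ others ∙ at-L₀)
    where
    κ' : ℕ → ℕ
    κ' = Swapping.κ' s
    p : ℕ
    p = it d c p0
    L₀ : List ℕ
    L₀ = padded κ'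
    len : length L₀ ≡ length κ
    len = length-map κ' (upTo (length κ)) ∙ length-upTo (length κ)
      where open import Data.List.Properties using (length-upTo)
    nth-map-upTo : ∀ m (g : ℕ → ℕ) r → r < m → nth (map κ' (applyUpTo g m)) (suc r) ≡ κ' (g r)
    nth-map-upTo (suc m) g zero h = refl
    nth-map-upTo (suc m) g (suc r) (s≤s h) = nth-map-upTo m (λ x → g (suc x)) r h
    nth₀ : ∀ r → nth L₀ (suc r) ≡ κ' r
    nth₀ r with r <? length κ
    ... | yes h = nth-map-upTo (length κ) (λ x → x) r h
    ... | no h = nth-out L₀ r (≤-trans (≤-reflexive len) (≮⇒≥ h)) ∙ sym (n≤0⇒n≡0 (≤-trans (Swapping.κ'≤κ s r) (≤-reflexive (nth-out κ r (≮⇒≥ h)))))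
    fits₀ : Fits L₀ κ
    fits₀ = nth-fits L₀ κ len (λ r → subst (_≤ K r) (sym (nth₀ r)) (Swapping.κ'≤κ s r))
    desc₀ : Desc L₀
    desc₀ r = subst₂ _≤_ (sym (nth₀ (suc r))) (sym (nth₀ r)) (Core.desc (Swapping.core' s) r)
    τ₀ : List ℕ
    τ₀ = strip L₀
    nthτ : ∀ r → nth τ₀ (suc r) ≡ κ' r
    nthτ r = strip-nth L₀ desc₀ r ∙ nth₀ r
    descτ : Desc τ₀
    descτ r = subst₂ _≤_ (sym (nthτ (suc r))) (sym (nthτ r)) (Core.desc (Swapping.core' s) r)
    coreτ : Core k ℓ (λ r → nth τ₀ (suc r)) (Swapping.ν' s) (Swapping.d' s)
    coreτ = record { code = Core.code (Swapping.core' s) ; κ-d = λ r → nthτ r ∙ Core.κ-d (Swapping.core' s) r ∙ cong (λ z → Swapping.ν' s r + z) (sym (nthτ _))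
      ; desc = descτ ; zero-from = λ r h → nthτ r ∙ Core.zero-from (Swapping.core' s) r h ; up = Core.up (Swapping.core' s) ; mono = Core.mono (Swapping.core' s) }
    good₀ : Good k ℓ τ₀
    good₀ = record { desc = descτ ; positive = strip-pos L₀ ; short = ≤-trans (length-filterB nonzero L₀) (≤-trans (≤-reflexive len) (Good.short gκ))
      ; noHook = ToList.noHook k ℓ τ₀ _ _ descτ coreτ }
    cover₀ : isCover k κ τ₀ ≡ true
    cover₀ = cong₂ _∧_ (T-true (⇒isCore k τ₀ (Good.noHook good₀)))
      (cong₂ _≡ᵇ_ (cong suc (Good.𝔭-sum good₀ ∙ sumTo-cong ℓ (λ r _ → ToList.rowCount-ν k ℓ τ₀ _ _ descτ coreτ r)) ∙ Swapping.size s ∙ sym (Good.𝔭-sum gκ)) (refl {x = sumN (𝔭 k κ)}) ∙ ≡ᵇ-refl (sumN (𝔭 k κ)))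
    match : ∀ {p0' c' i' q'} (s' : Swapping core p0' c' i' q') → it d c' p0' ≡ p → ∀ r → Swapping.κ' s' r ≡ κ' r
    match {p0'} {c'} s' x with it-top-unique c' c p0' p0 (Tower.top (Swapping.tower s')) (Tower.top (Swapping.tower s)) x
    ... | refl , refl with tower-i-unique (Swapping.tower s') (Swapping.last s') (Swapping.tower s) (Swapping.last s)
    ...   | refl = swap-unique s' s
    others : ∀ L → Fits L κ → L ≢ L₀ → term k κ (suc p) F L n ℤ.- sh (term k κ (suc (d p)) F L) n ≡ + 0
    others L fits ne with difference-term L fits
    ... | inj₁ z = z p F n
    ... | inj₂ (a , e) = e p F n ∙ if-no λ x → ne (list-ext (Pw.Pointwise-length fits ∙ sym len)
          (λ r → sym (strip-nth L (Active.descL a) r) ∙ Active.rows-eq a r ∙ match (Active.swp a) x r ∙ sym (nth₀ r)))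
    at-L₀ : term k κ (suc p) F L₀ n ℤ.- sh (term k κ (suc (d p)) F L₀) n ≡ shN (suc c * i) f n
    at-L₀ = active-difference a₀ p F n ∙ if-yes {a = it d c p0} {b = it d c p0} {x = shN (suc c * i) (F τ₀) n} {y = + 0} refl ∙ shN-cong (suc c * i) (hF good₀ nthτ) n
      where
      a₀ : Active L₀
      a₀ = record { descL = desc₀ ; good = good₀ ; swp = s ; rows-eq = nthτ ; value = activeValue L₀ (Desc⇒decreasing L₀ desc₀) cover₀ descτ s nthτ }

-- The Pieri rule

tail : ℕ → ℕ → W → ℤ
tail j zero γ = + 0
tail j (suc t) γ = γ j ℤ.+ tail (suc j) t γ

tail-+ : ∀ j t (γ ω : W) → tail j t (λ r → γ r ℤ.+ ω r) ≡ tail j t γ ℤ.+ tail j t ω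
tail-+ j zero γ ω = refl
tail-+ j (suc t) γ ω = cong (λ z → (γ j ℤ.+ ω j) ℤ.+ z) (tail-+ (suc j) t γ ω) ∙ ring (γ j) (ω j) _ _
  where
  ring : ∀ a b c d → (a ℤ.+ b) ℤ.+ (c ℤ.+ d) ≡ (a ℤ.+ c) ℤ.+ (b ℤ.+ d)
  ring = ℤS.solve-∀

tail-mono : ∀ j t {γ ω : W} → (∀ r → j ≤ r → r < j + t → γ r ℤ.≤ ω r) → tail j t γ ℤ.≤ tail j t ω
tail-mono j zero h = ℤP.≤-refl
tail-mono j (suc t) h = ℤP.+-mono-≤ (h j ≤-refl (m<m+n j (s≤s z≤n)))
  (tail-mono (suc j) t (λ r p q → h r (<⇒≤ p) (subst (r <_) (sym (+-suc j t)) q)))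

tail-zero : ∀ j t {γ : W} → (∀ r → j ≤ r → r < j + t → γ r ≡ + 0) → tail j t γ ≡ + 0
tail-zero j zero h = refl
tail-zero j (suc t) h = cong₂ ℤ._+_ (h j ≤-refl (m<m+n j (s≤s z≤n)))
  (tail-zero (suc j) t (λ r p q → h r (<⇒≤ p) (subst (r <_) (sym (+-suc j t)) q)))

rt-off : ∀ a b r → r ≢ a → r ≢ b → rt (a , b) r ≡ + 0
rt-off a b r p q rewrite ι-no r a p | ι-no r b q = refl

rt-after : ∀ a b r → a < r → b < r → rt (a , b) r ≡ + 0
rt-after a b r p q = rt-off a b r (>⇒≢ p) (>⇒≢ q)

tail-raised : ∀ j b i t → j < i → i ≤ b → b < i + t → + 1 ℤ.+ tail i t (rt (j , b)) ℤ.≤ + 0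
tail-raised j b i zero u v w = ⊥-elim (<⇒≱ w (≤-trans (≤-reflexive (+-identityʳ i)) v))
tail-raised j b i (suc t) u v w with i ≟ b
... | yes refl rewrite ι-no i j (>⇒≢ u) | ι-eq i | tail-zero (suc i) t {rt (j , i)} (λ r h _ → rt-after j i r (<-trans u h) h) = ℤP.≤-refl
... | no ne = ℤP.≤-trans (ℤP.≤-reflexive (cong (λ z → + 1 ℤ.+ z) (cong (ℤ._+ tail (suc i) t (rt (j , b))) (rt-off j b i (>⇒≢ u) ne) ∙ ℤP.+-identityˡ (tail (suc i) t (rt (j , b))))))
    (tail-raised j b (suc i) t (m≤n⇒m≤1+n u) (≤∧≢⇒< v ne) (subst (b <_) (+-suc i t) w))

-- A raising operator moves a unit of weight to an earlier row, so no tail sum can grow.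
tail-root : ∀ j t a b → a < b → b < j + t → tail j t (rt (a , b)) ℤ.≤ + 0
tail-root j zero a b p q = ℤP.≤-refl
tail-root j (suc t) a b p q with j ≟ a | j ≟ b
... | yes refl | yes refl = ⊥-elim (<⇒≢ p refl)
... | no ne | no ne' rewrite ι-no j a ne | ι-no j b ne' = subst (ℤ._≤ + 0) (sym (ℤP.+-identityˡ _)) (tail-root (suc j) t a b p (subst (b <_) (+-suc j t) q))
... | no ne | yes refl rewrite ι-no j a ne | ι-eq j = ℤP.≤-trans (ℤP.+-monoʳ-≤ -[1+ 0 ] (ℤP.≤-reflexive (tail-zero (suc j) t (λ r h _ → rt-after a j r (<-trans p h) h)))) ℤ.-≤+
... | yes refl | no ne' rewrite ι-eq j | ι-no j b ne' = tail-raised j b (suc j) t (n<1+n j) p (subst (b <_) (+-suc j t) q)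

TailNeg : ℕ → ℕ → W → Set
TailNeg ℓ j γ = ∃ λ t → j + t ≡ ℓ × tail j t γ ℤ.≤ -[1+ 0 ]

Inner : ℕ → List Root → Set
Inner ℓ = All (λ { (a , b) → a < b × b < ℓ })

-- A negative tail sum persists in every weight of the expansion, and S vanishes on all of them.
HL-tail : ∀ {ℓ j S} → (∀ γ → TailNeg ℓ j γ → S γ ≡ + 0) → ∀ Ψ → Inner ℓ Ψ → ∀ γ → TailNeg ℓ j γ → ∀ n → HL Ψ S γ n ≡ + 0
HL-tail v [] [] γ h zero = v γ h
HL-tail v [] [] γ h (suc n) = refl
HL-tail v (δ ∷ Ψ) (_ ∷ ok) γ h zero = HL-tail v Ψ ok γ h zero
HL-tail {ℓ} {j} {S} v ((a , b) ∷ Ψ) ((p , q) ∷ ok) γ (t , e , h) (suc n) = cong₂ ℤ._+_ (HL-tail v Ψ ok γ (t , e , h) (suc n))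
  (HL-tail v ((a , b) ∷ Ψ) ((p , q) ∷ ok) (R (a , b) γ) (t , e , lower) n)
  where
  lower : tail j t (R (a , b) γ) ℤ.≤ -[1+ 0 ]
  lower = ℤP.≤-trans (ℤP.≤-reflexive (tail-+ j t γ (rt (a , b)))) (ℤP.≤-trans (ℤP.+-mono-≤ h (tail-root j t a b p (subst (b <_) (sym e) q))) ℤP.≤-refl)

All-cat : ∀ {A : Set} {P : A → Set} n {f : ℕ → List A} → (∀ i → i < n → All P (f i)) → All P (cat n f)
All-cat zero h = []
All-cat (suc n) h = All-++ (All-cat n (λ i p → h i (<-trans p (n<1+n n)))) (h n (n<1+n n))

roots-inner : ∀ ℓ e → (∀ r → r < e r) → Inner ℓ (roots ℓ e)
roots-inner ℓ e up = All-cat ℓ λ i _ → All-cat ℓ λ j p → one i j p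
  where
  one : ∀ i j → j < ℓ → Inner ℓ (opt (e i ≤ᵇ j) (i , j))
  one i j p with e i ≤ᵇ j in eq
  ... | true = (<-≤-trans (up i) (≤ᵇ-true {e i} {j} eq) , p) ∷ []
  ... | false = []

if-case : ∀ (f : ℤ → ℤ) (b : Bool) {x y z : ℤ} → (b ≡ true → f x ≡ z) → (b ≡ false → f y ≡ z) → f (if b then x else y) ≡ z
if-case f true h h' = h refl
if-case f false h h' = h' refl

module Branch (k ℓ : ℕ) (S : W → ℤ) (loc : Local ℓ S) (i0 : ℕ)
  (anti : ∀ z → i0 ≤ z → suc z < ℓ → AntiAt S z) (vanish : ∀ j → i0 ≤ j → ∀ γ → TailNeg ℓ j γ → S γ ≡ + 0) where
  open Catalan ℓ S loc

  value : (ℕ → ℕ) → List ℕ → Ser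
  value low κ = H (rowStart k κ) (wt (λ r → rowCount k κ (suc r)) low)

  -- The current letter marks row M = i0 + m; the m letters that follow it in the column account for
  -- the indicator of the rows i0, ..., M - 1.
  module Step (κ : List ℕ) (gκ : Good k ℓ κ) (full : ∀ r → r < i0 → rowCount k κ (suc r) ≡ k) (m : ℕ) (M<ℓ : i0 + m < ℓ) where
    open Good gκ using (K; ν; d; core)
    open Core core using (mono; up; code)
    open RowMap d mono up
    open Towers d mono up

    low : ℕ → ℕ
    low = ind i0 m
    M : ℕ
    M = i0 + m

    full-d : ∀ z → z < i0 → d z ≡ suc z
    full-d z h = (lia ((d z) ∷ (ν z) ∷ k ∷ z ∷ []) (v0 ⊕ v1 ≛ su (v2 ⊕ v3) ∷ v1 ≛ v2 ∷ []) (v0 ≛ su v3) ((1 ∷ 1 ∷ 0 ∷ 0 ∷ 1 ∷ []) , (1 ∷ 0 ∷ 1 ∷ 1 ∷ []))) (code z) (full z h)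

    module St = Stages d mono up k ν code ℓ S loc i0 anti full-d low

    -- The root ideal stays that of κ while one more box is taken from row p. Starting from p = M
    -- the recursion runs through M, d M, d (d M), ....
    F : ℕ → Ser
    F p = H d (wt ν (λ r → low r + ι r p))

    Rooted : ℕ → Set
    Rooted p = ∃ λ p0 → ∃ λ c → it d c p0 ≡ p × (∀ r → d r ≢ p0)

    extend : ∀ {r p} → d r ≡ p → Rooted r → Rooted p
    extend e (p0 , c , e' , t) = p0 , suc c , cong d e' ∙ e , t

    topOf : ∀ f p → p ≤ f → Rooted p
    topOf f p h = go f p h (preimage? p)
      where
      go : ∀ f p → p ≤ f → (∃ λ r → d r ≡ p) ⊎ (∀ r → d r ≢ p) → Rooted p
      go f p h (inj₂ none) = p , 0 , refl , none
      go zero p h (inj₁ (r , e)) = ⊥-elim (<⇒≱ (≤-<-trans z≤n (up r)) (≤-trans (≤-reflexive e) h))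
      go (suc f) p h (inj₁ (r , e)) = extend e (go f r (ℕ.s≤s⁻¹ (≤-trans (up r) (≤-trans (≤-reflexive e) h))) (preimage? r))

    OnChain : ℕ → ℕ → Set
    OnChain p0 c = ∃ λ j → j ≤ c × it d j p0 ≡ M

    longer : ∀ {p0 c} → OnChain p0 c → OnChain p0 (suc c)
    longer (j , a , y) = j , m≤n⇒m≤1+n a , y

    on-chain : ∀ e p0 c → (∀ r → d r ≢ p0) → it d c p0 ≡ it d e M → OnChain p0 c
    on-chain zero p0 c t x = c , ≤-refl , x
    on-chain (suc e) p0 zero t x = ⊥-elim (t _ (sym x))
    on-chain (suc e) p0 (suc c) t x = longer (on-chain e p0 c t (d-inj x))

    -- From i0 on `low` jumps only between rows M - 1 and M. Since M lies on the chain, the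
    -- hypothesis on z + 1 excludes exactly this jump.
    lowU : ∀ p0 c → OnChain p0 c → ∀ z → i0 ≤ z → (∀ m → m ≤ c → it d m p0 ≢ suc z) → low z ≡ low (suc z)
    lowU p0 c (j , jc , e) z iz h with suc z <? M | M ≤? z
    ... | yes a | _ = ind-in i0 m z iz (<-trans (n<1+n z) a) ∙ sym (ind-in i0 m (suc z) (m≤n⇒m≤1+n iz) a)
    ... | no _ | yes b = ind-high i0 m z b ∙ sym (ind-high i0 m (suc z) (m≤n⇒m≤1+n b))
    ... | no a | no b = ⊥-elim (h j jc (e ∙ ≤-antisym (≮⇒≥ a) (≰⇒> b)))

    -- The raising operator of the root (p , d p) moves the missing box from row p to row d p, so
    -- the extra term is again of the form F. If d p is at least ℓ, row p has no root to remove.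
    F-split : ∀ p → p < ℓ → ∀ n → F p n ≡ H (inc p d) (wt ν (λ r → low r + ι r p)) n ℤ.+ (if d p <ᵇ ℓ then sh (F (d p)) n else + 0)
    F-split p pl n = sym (if-case (λ z → H (inc p d) (wt ν (λ r → low r + ι r p)) n ℤ.+ z) (d p <ᵇ ℓ) (λ eq → sym (removed eq)) (λ eq → sym (unchanged eq)))
      where
      removed : (d p <ᵇ ℓ) ≡ true → F p n ≡ H (inc p d) (wt ν (λ r → low r + ι r p)) n ℤ.+ sh (F (d p)) n
      removed eq = H-remove d p _ pl (<ᵇ⇒< (d p) ℓ (true-T eq)) n ∙ cong (λ z → H (inc p d) (wt ν (λ r → low r + ι r p)) n ℤ.+ z)
          (sh-cong (H-cong {d} (λ _ _ → refl) (λ r _ → R-wt p (d p) ν (λ r → low r + ι r p) r ∙ diff-eq (ν r + ι r p) (low r + ι r p + ι r (d p)) (ν r) (low r + ι r (d p))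
             (lia ((ν r) ∷ (ι r p) ∷ (low r) ∷ (ι r (d p)) ∷ []) [] (v0 ⊕ v1 ⊕ (v2 ⊕ v3) ≛ v0 ⊕ (v2 ⊕ v1 ⊕ v3)) ((1 ∷ []) , (1 ∷ []))))) n)
      unchanged : (d p <ᵇ ℓ) ≡ false → F p n ≡ H (inc p d) (wt ν (λ r → low r + ι r p)) n ℤ.+ + 0
      unchanged eq = H-out d p _ (≮⇒≥ (λ h → subst T eq (<⇒<ᵇ h))) n ∙ sym (ℤP.+-identityʳ _)

    -- All ν vanish from an empty row on, so taking a box there produces a negative tail sum.
    F-empty : ∀ p → i0 ≤ p → p < ℓ → ν p ≡ 0 → ∀ n → F p n ≡ + 0
    F-empty p ip pl νp n = HL-tail (vanish p ip) (roots ℓ d) (roots-inner ℓ d up) γ (ℓ ∸ p , m+[n∸m]≡n (<⇒≤ pl) , low-tail (ℓ ∸ p) (m<n⇒0<n∸m pl)) n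
      where
      ν0 : ∀ r → p ≤ r → ν r ≡ 0
      ν0 r h = n≤0⇒n≡0 ((lia ((d p) ∷ (ν p) ∷ k ∷ p ∷ (d r) ∷ (ν r) ∷ r ∷ u ∷ []) (v0 ⊕ v1 ≛ su (v2 ⊕ v3) ∷ v4 ⊕ v5 ≛ su (v2 ⊕ v6) ∷ v0 ⊕ v7 ≼ v4 ∷ v3 ⊕ v7 ≛ v6 ∷ v1 ≛ li 0 ∷ []) (v5 ≼ li 0) ((1 ∷ 0 ∷ 1 ∷ 1 ∷ 0 ∷ 1 ∷ 0 ∷ 1 ∷ 1 ∷ []) , []))
        (code p) (code r) (subst (λ z → d p + (r ∸ p) ≤ d z) (m+[n∸m]≡n h) (d-add p (r ∸ p))) (m+[n∸m]≡n h) νp)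
        where
        u : ℕ
        u = r ∸ p
      γ : W
      γ = wt ν (λ r → low r + ι r p)
      rest : ∀ r → p ≤ r → γ r ℤ.≤ + 0
      rest r h = ℤP.≤-trans (ℤP.≤-reflexive (cong (λ y → + y ℤ.- + (low r + ι r p)) (ν0 r h) ∙ ℤP.+-identityˡ (- + (low r + ι r p)))) (ℤP.neg-≤-pos {low r + ι r p} {0})
      low-tail : ∀ t → 0 < t → tail p t γ ℤ.≤ -[1+ 0 ]
      low-tail (suc t) _ = ℤP.≤-trans (ℤP.+-mono-≤ first (tail-mono (suc p) t (λ r h _ → rest r (<⇒≤ h)))) (ℤP.≤-reflexive (cong (λ z → -[1+ 0 ] ℤ.+ z) (tail-zero (suc p) t (λ _ _ _ → refl))))
        where
        first : γ p ℤ.≤ -[1+ 0 ]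
        first = ℤP.≤-trans (ℤP.≤-reflexive (cong₂ (λ y z → + y ℤ.- + z) νp (cong (λ z → low p + z) (ι-eq p) ∙ +-comm (low p) 1))) (ℤ.-≤- z≤n)

    Φ : List ℕ → Ser
    Φ = value low

    mval-empty : ∀ p → K p ≡ 0 → ∀ n → mval k κ (suc p) Φ n ≡ + 0
    mval-empty p z n = OnCore.mval-cong gκ p {Φ} {λ _ _ → + 0} (λ s j jc e _ _ _ → ⊥-elim (<⇒≱ (Swapping.κ'<κ s j 0 jc z≤n)
        (≤-trans (≤-reflexive (cong K (+-identityʳ _ ∙ e) ∙ z)) z≤n))) n
      ∙ mval-choices k κ (suc p) (λ _ _ → + 0) n ∙ choices-zero κ _ (λ L f → zero-term L f)
      where
      zero-if : ∀ (b : Bool) (x : ℤ) → x ≡ + 0 → (if b then x else + 0) ≡ + 0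
      zero-if true x e = e
      zero-if false x e = refl
      zero-term : ∀ L → Fits L κ → term k κ (suc p) (λ _ _ → + 0) L n ≡ + 0
      zero-term L f = zero-if (decreasingᵇ L) _ (zero-if (isCover k κ (strip L)) _
        (sumℤ-cong (map (marking κ (strip L)) (components (skew (strip L) κ))) (λ { (r , s) → zero-if (r ≡ᵇ suc p) _ (shN-0 s n) })
         ∙ sumℤ-zero (map (marking κ (strip L)) (components (skew (strip L) κ)))))

    Q-part : ℕ → ℕ → ℕ → Ser
    Q-part p0 c p = H (inc p d) (wt ν (λ r → low r + ι r p))

    -- Induction down the chain of M, where e counts the steps: `F-split` followed by `decide` on
    -- one side and `mval-found` or `mval-absent` on the other give the same recursion. Keeping the
    -- row in the form d^e M is what places M on its chain, as `lowU` requires.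
    pieri : ∀ f e → ℓ ≤ it d e M + f → it d e M < ℓ → ∀ n → F (it d e M) n ≡ mval k κ (suc (it d e M)) Φ n
    pieri zero e h lt n = ⊥-elim (<⇒≱ lt (subst (ℓ ≤_) (+-identityʳ _) h))
    pieri (suc f) e h lt n = go (ν p ≟ 0)
      where
      p : ℕ
      p = it d e M
      ip : i0 ≤ p
      ip = ≤-trans (m≤m+n i0 m) (it-le {0} {e} M z≤n)
      next : ∀ n → (if d p <ᵇ ℓ then sh (F (d p)) n else + 0) ≡ sh (mval k κ (suc (d p)) Φ) n
      next n = if-case (λ z → z) (d p <ᵇ ℓ) within beyond
        where
        within : (d p <ᵇ ℓ) ≡ true → sh (F (d p)) n ≡ sh (mval k κ (suc (d p)) Φ) n
        within eq = sh-cong (pieri f (suc e) (≤-trans h (≤-trans (≤-reflexive (+-suc p f)) (+-monoˡ-≤ f (up p)))) (<ᵇ⇒< (d p) ℓ (true-T eq))) n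
        beyond : (d p <ᵇ ℓ) ≡ false → + 0 ≡ sh (mval k κ (suc (d p)) Φ) n
        beyond eq = sym (sh-cong {g = λ _ → + 0} (mval-empty (d p) (Core.zero-from core (d p) (≮⇒≥ (λ h → subst T eq (<⇒<ᵇ h))))) n ∙ shN-0 1 n)
      go : _ → F p n ≡ mval k κ (suc p) Φ n
      go (yes z) = F-empty p ip lt z n ∙ sym (mval-empty p Kp0 n)
        where
        Kp0 : K p ≡ 0
        Kp0 = n≤0⇒n≡0 (≮⇒≥ (λ q → <⇒≢ (ν-pos core p q) (sym z)))
      go (no nz) = main (topOf p p ≤-refl)
        where
        main : Rooted p → F p n ≡ mval k κ (suc p) Φ n
        main (p0 , c , x , top) = F-split p lt n ∙ cong₂ ℤ._+_ (subst (λ y → Q-part p0 c y n ≡ St.Column.Q p0 c ic top lu n) x Q≡) (next n) ∙ fin dec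
          where
          ic : i0 ≤ it d c p0
          ic = subst (i0 ≤_) (sym x) ip
          lu : ∀ z → i0 ≤ z → (∀ m → m ≤ c → it d m p0 ≢ suc z) → low z ≡ low (suc z)
          lu = lowU p0 c (on-chain e p0 c top x)
          dec : St.Column.Found p0 c ic top lu ⊎ St.Column.Absent p0 c ic top lu
          dec = St.Column.decide p0 c ic top lu (subst (_< ℓ) (sym x) lt) (n≢0⇒n>0 (subst (λ y → ν y ≢ 0) (sym x) nz)) (Core.ν-out core)
          Q≡ : Q-part p0 c (it d c p0) n ≡ St.Column.Q p0 c ic top lu n
          Q≡ = H-cong (λ r _ → +-comm (ι r P) (d r) ∙ cong (λ y → d r + ι r y) (sym (+-identityʳ P)))
                 (λ r _ → cong₂ (λ a b → + a ℤ.- + (low r + ι r b)) (sym (+-identityʳ (ν r))) (sym (+-identityʳ P))) n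
            where
            P : ℕ
            P = it d c p0
          fin : _ → St.Column.Q p0 c ic top lu n ℤ.+ sh (mval k κ (suc (d p)) Φ) n ≡ mval k κ (suc p) Φ n
          fin (inj₂ (z , none)) = cong (ℤ._+ sh (mval k κ (suc (d p)) Φ) n) (z n) ∙ ℤP.+-identityˡ _
            ∙ subst (λ y → sh (mval k κ (suc (d y)) Φ) n ≡ mval k κ (suc y) Φ n) x (sym (OnCore.mval-absent gκ p0 c top none Φ n))
          fin (inj₁ (i , q , tw , last , ins , hq)) = cong (ℤ._+ sh (mval k κ (suc (d p)) Φ) n) (hq n ∙ cong (λ s → shN s G n) (*-comm i (suc c)))
            ∙ subst (λ y → shN (suc c * i) G n ℤ.+ sh (mval k κ (suc (d y)) Φ) n ≡ mval k κ (suc y) Φ n) x (sym (OnCore.mval-found gκ s Φ G agree n))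
            where
            s : Swapping core p0 c i q
            s = Swapped.swapping k ℓ K ν d core p0 c i q tw last ins
            G : Ser
            G = H (St.eS (it d c p0) (suc i) q i) (St.γS (it d c p0) (suc i) q i)
            -- The last stage has the row map of the swapped core, and its weight is ν' minus `low`;
            -- it is therefore the value of Φ at that core, whichever list represents it.
            agree : ∀ {τ} → Good k ℓ τ → (∀ r → nth τ (suc r) ≡ Swapping.κ' s r) → ∀ n → Φ τ n ≡ G n
            agree {τ} gτ e n = H-cong (λ r _ → d≡ r ∙ Swapping.d'-def s r) (λ r _ → weight r) n
              where
              coreτ : Core k ℓ (Swapping.κ' s) (Good.ν gτ) (Good.d gτ)
              coreτ = record { code = Core.code (Good.core gτ) ; κ-d = λ r → sym (e r) ∙ Core.κ-d (Good.core gτ) r ∙ cong (λ z → Good.ν gτ r + z) (e _)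
                ; desc = Core.desc (Swapping.core' s) ; zero-from = Core.zero-from (Swapping.core' s) ; up = Core.up (Good.core gτ) ; mono = Core.mono (Good.core gτ) }
              ν≡ : ∀ r → Good.ν gτ r ≡ Swapping.ν' s r
              ν≡ = core-unique (Swapping.core' s) coreτ (λ r → refl)
              weight : ∀ r → wt (λ r → rowCount k τ (suc r)) low r ≡ St.γS (it d c p0) (suc i) q i r
              weight r = diff-eq a₁ b₁ (ν r + a₂) (b₁ + a₃) ((lia (a₁ ∷ a₄ ∷ a₃ ∷ v ∷ a₂ ∷ b₁ ∷ []) (v0 ≛ v1 ∷ v1 ⊕ v2 ≛ v3 ⊕ v4 ∷ []) (v0 ⊕ (v5 ⊕ v2) ≛ v3 ⊕ v4 ⊕ v5) ((1 ∷ 1 ∷ 0 ∷ 1 ∷ []) , (1 ∷ 0 ∷ 1 ∷ 0 ∷ 1 ∷ []))) (ν≡ r) (Swapping.ν'-spec s r))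
                where
                a₁ a₂ a₃ a₄ b₁ v : ℕ
                a₁ = Good.ν gτ r
                a₂ = ind q i r
                a₃ = ind (it d c p0) (suc i) r
                a₄ = Swapping.ν' s r
                b₁ = low r
                v = ν r
              d≡ : ∀ r → Good.d gτ r ≡ Swapping.d' s r
              d≡ r = +-cancelʳ-≡ (Good.ν gτ r) _ _ (Core.code (Good.core gτ) r ∙ sym (Core.code (Swapping.core' s) r) ∙ cong (λ z → Swapping.d' s r + z) (sym (ν≡ r)))

    branch : ∀ n → value (ind i0 (suc m)) κ n ≡ mval k κ (suc (i0 + m)) (value (ind i0 m)) n
    branch = pieri ℓ 0 (m≤n+m ℓ M) M<ℓ

-- Coefficients of Jacobi–Trudi determinants

coeff-++ : ∀ p q n α → coeff (p ++ q) n α ≡ coeff p n α ℤ.+ coeff q n α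
coeff-++ [] q n α = sym (ℤP.+-identityˡ _)
coeff-++ ((c , e , m) ∷ p) q n α with (e ≡ᵇ n) ∧ eqL m α
... | true = cong (λ z → c ℤ.+ z) (coeff-++ p q n α) ∙ sym (ℤP.+-assoc c _ _)
... | false = coeff-++ p q n α

coeff-sumP : ∀ {A : Set} (xs : List A) (f : A → Poly) n α → coeff (sumP (map f xs)) n α ≡ sumℤ xs (λ x → coeff (f x) n α)
coeff-sumP [] f n α = refl
coeff-sumP (x ∷ xs) f n α = coeff-++ (f x) _ n α ∙ cong (λ z → coeff (f x) n α ℤ.+ z) (coeff-sumP xs f n α)

coeff-negP : ∀ p n α → coeff (negP p) n α ≡ - coeff p n α
coeff-negP [] n α = refl
coeff-negP ((c , e , m) ∷ p) n α with (e ≡ᵇ n) ∧ eqL m α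
... | true = cong (λ z → - c ℤ.+ z) (coeff-negP p n α) ∙ sym (ℤP.neg-distrib-+ c _)
... | false = coeff-negP p n α

coeff-tpow : ∀ m p n α → coeff (tpow m p) n α ≡ shN m (λ n → coeff p n α) n
coeff-tpow m [] n α = sym (shN-0 m n)
coeff-tpow m ((c , e , μ) ∷ p) n α = cong (λ z → if (m + e ≡ᵇ n) ∧ eqL μ α then c ℤ.+ z else z) (coeff-tpow m p n α) ∙ split m n
  where
  split : ∀ m n → (if (m + e ≡ᵇ n) ∧ eqL μ α then c ℤ.+ shN m (λ n → coeff p n α) n else shN m (λ n → coeff p n α) n)
    ≡ shN m (λ n → coeff ((c , e , μ) ∷ p) n α) n
  split zero n = refl
  split (suc m) zero = refl
  split (suc m) (suc n) = split m n

eqL-refl : ∀ α → eqL α α ≡ true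
eqL-refl [] = refl
eqL-refl (x ∷ α) = cong₂ _∧_ (≡ᵇ-refl x) (eqL-refl α)

eqL-true : ∀ α β → eqL α β ≡ true → α ≡ β
eqL-true [] [] e = refl
eqL-true (x ∷ α) (y ∷ β) e = cong₂ _∷_ (≡ᵇ-true (proj₁ (∧-true e))) (eqL-true α β (proj₂ (∧-true {x ≡ᵇ y} e)))

eqL-no : ∀ {α β} → α ≢ β → eqL α β ≡ false
eqL-no {α} {β} ne with eqL α β in e
... | false = refl
... | true = ⊥-elim (ne (eqL-true α β e))

-- Divisibility of a monomial by h_x is tested by deleting x and inserting it again; this treats all
-- lists uniformly, sorted or not.
del : ℕ → Mono → Mono
del x [] = []
del x (y ∷ ys) = if x ≡ᵇ y then ys else y ∷ del x ys

del-ins : ∀ x m → del x (insM x m) ≡ m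
del-ins x [] rewrite ≡ᵇ-refl x = refl
del-ins x (y ∷ ys) with x ≤ᵇ y in e
... | true rewrite ≡ᵇ-refl x = refl
... | false rewrite ≡ᵇ-no x y (λ { refl → <⇒≢ (≤ᵇ-false {x} {x} e) refl }) = cong (y ∷_) (del-ins x ys)

ins-yes : ∀ x y ys → x ≤ y → insM x (y ∷ ys) ≡ x ∷ y ∷ ys
ins-yes x y ys h rewrite ≤ᵇ-yes h = refl

ins-no : ∀ x y ys → y < x → insM x (y ∷ ys) ≡ y ∷ insM x ys
ins-no x y ys h rewrite ≤ᵇ-no h = refl

ins-comm≤ : ∀ x y m → x ≤ y → insM x (insM y m) ≡ insM y (insM x m)
ins-comm≤ x y [] h with x ≟ y
... | yes refl = refl
... | no ne rewrite ≤ᵇ-yes h | ≤ᵇ-no (≤∧≢⇒< h ne) = refl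
ins-comm≤ x y (z ∷ m) h with y ≤? z | x ≤? z | x ≟ y
... | _ | _ | yes refl = refl
... | yes yz | _ | no ne = cong (insM x) (ins-yes y z m yz) ∙ ins-yes x y (z ∷ m) h
      ∙ sym (cong (insM y) (ins-yes x z m (≤-trans h yz)) ∙ ins-no y x (z ∷ m) (≤∧≢⇒< h ne) ∙ cong (x ∷_) (ins-yes y z m yz))
... | no yz | yes xz | no ne = cong (insM x) (ins-no y z m (≰⇒> yz)) ∙ ins-yes x z (insM y m) xz
      ∙ sym (cong (insM y) (ins-yes x z m xz) ∙ ins-no y x (z ∷ m) (≤∧≢⇒< h ne) ∙ cong (x ∷_) (ins-no y z m (≰⇒> yz)))
... | no yz | no xz | no ne = cong (insM x) (ins-no y z m (≰⇒> yz)) ∙ ins-no x z (insM y m) (≰⇒> xz) ∙ cong (z ∷_) (ins-comm≤ x y m h)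
      ∙ sym (cong (insM y) (ins-no x z m (≰⇒> xz)) ∙ ins-no y z (insM x m) (≰⇒> yz))

ins-comm : ∀ x y m → insM x (insM y m) ≡ insM y (insM x m)
ins-comm x y m with x ≤? y
... | yes h = ins-comm≤ x y m h
... | no h = sym (ins-comm≤ y x m (<⇒≤ (≰⇒> h)))

-- Multiplication by h_d on coefficient functions.
X : ℤ → (Mono → ℤ) → Mono → ℤ
X (+ zero) f α = f α
X (+ suc d) f α = if eqL (insM (suc d) (del (suc d) α)) α then f (del (suc d) α) else + 0
X -[1+ _ ] f α = + 0

X-hit : ∀ d f m → X (+ suc d) f (insM (suc d) m) ≡ f m
X-hit d f m rewrite del-ins (suc d) m | eqL-refl (insM (suc d) m) = refl

X-miss : ∀ d f α → (∀ m → α ≢ insM (suc d) m) → X (+ suc d) f α ≡ + 0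
X-miss d f α h rewrite eqL-no {insM (suc d) (del (suc d) α)} {α} (λ e → h (del (suc d) α) (sym e)) = refl

hit? : ∀ d α → (∃ λ m → α ≡ insM (suc d) m) ⊎ (∀ m → α ≢ insM (suc d) m)
hit? d α with eqL (insM (suc d) (del (suc d) α)) α in e
... | true = inj₁ (del (suc d) α , sym (eqL-true (insM (suc d) (del (suc d) α)) α e))
... | false = inj₂ λ m x → false≢true (sym e ∙ cong (λ β → eqL (insM (suc d) β) α) (cong (del (suc d)) x ∙ del-ins (suc d) m)
      ∙ cong (λ β → eqL β α) (sym x) ∙ eqL-refl α)
  where
  false≢true : false ≡ true → ⊥
  false≢true ()

X-cong : ∀ z {f g : Mono → ℤ} → (∀ α → f α ≡ g α) → ∀ α → X z f α ≡ X z g α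
X-cong (+ zero) h α = h α
X-cong (+ suc d) h α = cong (λ v → if eqL (insM (suc d) (del (suc d) α)) α then v else + 0) (h _)
X-cong -[1+ _ ] h α = refl

if-0 : ∀ (b : Bool) → (if b then + 0 else + 0) ≡ + 0
if-0 true = refl
if-0 false = refl

X-0 : ∀ z α → X z (λ _ → + 0) α ≡ + 0
X-0 (+ zero) α = refl
X-0 (+ suc d) α = if-0 (eqL (insM (suc d) (del (suc d) α)) α)
X-0 -[1+ _ ] α = refl

X-sub : ∀ z f g α → X z (λ β → f β ℤ.- g β) α ≡ X z f α ℤ.- X z g α
X-sub (+ zero) f g α = refl
X-sub (+ suc d) f g α with eqL (insM (suc d) (del (suc d) α)) α
... | true = refl
... | false = refl
X-sub -[1+ _ ] f g α = refl

X-comm : ∀ y z f α → X y (X z f) α ≡ X z (X y f) α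
X-comm (+ zero) z f α = X-cong z (λ _ → refl) α
X-comm (+ suc a) (+ zero) f α = refl
X-comm -[1+ _ ] z f α = sym (X-0 z α)
X-comm (+ suc a) -[1+ _ ] f α = X-0 (+ suc a) α
X-comm (+ suc a) (+ suc b) f α with hit? a α | hit? b α
... | inj₂ h | inj₂ h' = X-miss a (X (+ suc b) f) α h ∙ sym (X-miss b (X (+ suc a) f) α h')
... | inj₂ h | inj₁ (m , refl) = X-miss a (X (+ suc b) f) α h ∙ sym (X-hit b (X (+ suc a) f) m ∙ X-miss a f m (λ m' e → h (insM (suc b) m') (cong (insM (suc b)) e ∙ ins-comm (suc b) (suc a) m')))
... | inj₁ (m , refl) | inj₂ h' = X-hit a (X (+ suc b) f) m ∙ X-miss b f m (λ m' e → h' (insM (suc a) m') (cong (insM (suc a)) e ∙ ins-comm (suc a) (suc b) m')) ∙ sym (X-miss b (X (+ suc a) f) α h')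
... | inj₁ (m , refl) | inj₁ (m' , e) with hit? b m
...   | inj₁ (μ , refl) = X-hit a (X (+ suc b) f) (insM (suc b) μ) ∙ X-hit b f μ ∙ sym (cong (X (+ suc b) (X (+ suc a) f)) (ins-comm (suc a) (suc b) μ) ∙ X-hit b (X (+ suc a) f) (insM (suc a) μ) ∙ X-hit a f μ)
...   | inj₂ h = X-hit a (X (+ suc b) f) m ∙ X-miss b f m h ∙ sym (cong (X (+ suc b) (X (+ suc a) f)) e ∙ X-hit b (X (+ suc a) f) m'
          ∙ X-miss a f m' (λ μ x → h μ (ins-inj (suc a) (e ∙ cong (insM (suc b)) x ∙ ins-comm (suc b) (suc a) μ))))
    where
    ins-inj : ∀ x {m m'} → insM x m ≡ insM x m' → m ≡ m'
    ins-inj x {m} {m'} e = sym (del-ins x m) ∙ cong (del x) e ∙ del-ins x m'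

coeff-hh : ∀ z p n α → coeff (hh z *P p) n α ≡ X z (coeff p n) α
coeff-hh (+ zero) p n α = go _ (λ _ _ _ → refl) p
  where
  go : ∀ (F : Term → Term) → (∀ c e m → F (c , e , m) ≡ (+ 1 ℤ.* c , e , m)) → ∀ p → coeff (map F p ++ []) n α ≡ coeff p n α
  go F h [] = refl
  go F h ((c , e , m) ∷ p) rewrite h c e m = cong₂ (λ u v → if (e ≡ᵇ n) ∧ eqL m α then u ℤ.+ v else v) (ℤP.*-identityˡ c) (go F h p)
coeff-hh (+ suc d) p n α = go _ (λ _ _ _ → refl) p
  where
  match : ∀ m → eqL (insM (suc d) m) α ≡ eqL (insM (suc d) (del (suc d) α)) α ∧ eqL m (del (suc d) α)
  match m = iff-≡ hit found
    where
    hit : eqL (insM (suc d) m) α ≡ true → eqL (insM (suc d) (del (suc d) α)) α ∧ eqL m (del (suc d) α) ≡ true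
    hit e with eqL-true (insM (suc d) m) α e
    ... | refl rewrite del-ins (suc d) m | eqL-refl (insM (suc d) m) | eqL-refl m = refl
    found : eqL (insM (suc d) (del (suc d) α)) α ∧ eqL m (del (suc d) α) ≡ true → eqL (insM (suc d) m) α ≡ true
    found e = cong (λ β → eqL (insM (suc d) β) α) (eqL-true m _ (proj₂ (∧-true {eqL (insM (suc d) (del (suc d) α)) α} e))) ∙ proj₁ (∧-true e)
  distribute : ∀ b b' a c v → (if a ∧ (b ∧ b') then c ℤ.+ (if b then v else + 0) else (if b then v else + 0)) ≡ (if b then (if a ∧ b' then c ℤ.+ v else v) else + 0)
  distribute true b' a c v = refl
  distribute false b' true c v = refl
  distribute false b' false c v = refl
  go : ∀ (F : Term → Term) → (∀ c e m → F (c , e , m) ≡ (+ 1 ℤ.* c , e , insM (suc d) m)) → ∀ p → coeff (map F p ++ []) n α ≡ X (+ suc d) (coeff p n) α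
  go F h [] = sym (if-0 (eqL (insM (suc d) (del (suc d) α)) α))
  go F h ((c , e , m) ∷ p) rewrite h c e m = cong₂ (λ u v → if (e ≡ᵇ n) ∧ eqL (insM (suc d) m) α then u ℤ.+ v else v) (ℤP.*-identityˡ c) (go F h p)
    ∙ cong (λ b → if (e ≡ᵇ n) ∧ b then c ℤ.+ X (+ suc d) (coeff p n) α else X (+ suc d) (coeff p n) α) (match m)
    ∙ distribute (eqL (insM (suc d) (del (suc d) α)) α) (eqL m (del (suc d) α)) (e ≡ᵇ n) c (coeff p n (del (suc d) α))
coeff-hh -[1+ _ ] p n α = refl

-- Laplace expansion along the first row: ± signs over the choice of one column.
pick1 : List ℕ → (ℕ → List ℕ → Mono → ℤ) → Mono → ℤ
pick1 [] f α = + 0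
pick1 (c ∷ cs) f α = f c cs α ℤ.- pick1 cs (λ c' r → f c' (c ∷ r)) α

-- Determinant with entries h_{b + c} for row bases b and columns c, as a coefficient function.
D : List ℤ → List ℕ → Mono → ℤ
D [] cols α = if eqL [] α then + 1 else + 0
D (b ∷ bs) cols = pick1 cols (λ c r → X (b ℤ.+ + c) (D bs r))

pick1-cong : ∀ cols {f g : ℕ → List ℕ → Mono → ℤ} → (∀ c r α → f c r α ≡ g c r α) → ∀ α → pick1 cols f α ≡ pick1 cols g α
pick1-cong [] h α = refl
pick1-cong (c ∷ cs) h α = cong₂ ℤ._-_ (h c cs α) (pick1-cong cs (λ c' r → h c' (c ∷ r)) α)

pick1-neg : ∀ cols (f : ℕ → List ℕ → Mono → ℤ) α → pick1 cols (λ c r β → - f c r β) α ≡ - pick1 cols f α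
pick1-neg [] f α = refl
pick1-neg (c ∷ cs) f α = cong (λ z → - f c cs α ℤ.- z) (pick1-neg cs (λ c' r → f c' (c ∷ r)) α) ∙ sym (ℤP.neg-distrib-+ (f c cs α) _)

X-neg : ∀ z f α → X z (λ β → - f β) α ≡ - X z f α
X-neg (+ zero) f α = refl
X-neg (+ suc d) f α with eqL (insM (suc d) (del (suc d) α)) α
... | true = refl
... | false = refl
X-neg -[1+ _ ] f α = refl

X-pick1 : ∀ z cols (f : ℕ → List ℕ → Mono → ℤ) α → X z (pick1 cols f) α ≡ pick1 cols (λ c r → X z (f c r)) α
X-pick1 z [] f α = X-0 z α
X-pick1 z (c ∷ cs) f α = X-sub z (f c cs) (pick1 cs (λ c' r → f c' (c ∷ r))) α ∙ cong (λ v → X z (f c cs) α ℤ.- v) (X-pick1 z cs (λ c' r → f c' (c ∷ r)) α)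

pick1-sub : ∀ cols (f g : ℕ → List ℕ → Mono → ℤ) α → pick1 cols (λ c r β → f c r β ℤ.- g c r β) α ≡ pick1 cols f α ℤ.- pick1 cols g α
pick1-sub [] f g α = refl
pick1-sub (c ∷ cs) f g α = cong (λ z → (f c cs α ℤ.- g c cs α) ℤ.- z) (pick1-sub cs (λ c' r → f c' (c ∷ r)) (λ c' r → g c' (c ∷ r)) α)
  ∙ ring (f c cs α) (g c cs α) _ _
  where
  ring : ∀ a b x y → (a ℤ.- b) ℤ.- (x ℤ.- y) ≡ (a ℤ.- x) ℤ.- (b ℤ.- y)
  ring = ℤS.solve-∀

pick2 : List ℕ → (ℕ → ℕ → List ℕ → Mono → ℤ) → Mono → ℤ
pick2 cols f = pick1 cols (λ c r → pick1 r (λ c' r' → f c c' r'))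

-- Split by the first column c of the list: it is chosen first, chosen second, or left over. The
-- first two cases are exchanged with opposite signs and the third is the induction.
pick2-anti : ∀ cols (f : ℕ → ℕ → List ℕ → Mono → ℤ) α → pick2 cols (λ c c' → f c' c) α ≡ - pick2 cols f α
pick2-anti [] f α = refl
pick2-anti (c ∷ cs) f α = cong (λ z → A' ℤ.- z) (expand (λ c c' → f c' c)) ∙ cong (λ z → A' ℤ.- (A ℤ.- z)) (pick2-anti cs (λ c' c″ r → f c' c″ (c ∷ r)) α)
  ∙ ring A' A P ∙ cong (λ z → - (A ℤ.- z)) (sym (expand f))
  where
  A A' P : ℤ
  A = pick1 cs (λ c' r → f c c' r) α
  A' = pick1 cs (λ c' r → f c' c r) α
  P = pick2 cs (λ c' c″ r → f c' c″ (c ∷ r)) α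
  expand : ∀ (g : ℕ → ℕ → List ℕ → Mono → ℤ) → pick1 cs (λ c' r → pick1 (c ∷ r) (λ c″ r' → g c' c″ r')) α
    ≡ pick1 cs (λ c' r → g c' c r) α ℤ.- pick2 cs (λ c' c″ r → g c' c″ (c ∷ r)) α
  expand g = pick1-sub cs (λ c' r → g c' c r) (λ c' r → pick1 r (λ c″ r' → g c' c″ (c ∷ r'))) α
  ring : ∀ a' a p → a' ℤ.- (a ℤ.- (- p)) ≡ - (a ℤ.- (a' ℤ.- p))
  ring = ℤS.solve-∀

-- Both row factors are drawn out of the inner expansion, where they commute. What changes is which
-- of the two rows takes which column, and that is the antisymmetry of `pick2`.
D-swap : ∀ pre b b' bs cols α → D (pre ++ b' ∷ b ∷ bs) cols α ≡ - D (pre ++ b ∷ b' ∷ bs) cols α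
D-swap [] b b' bs cols α = pick1-cong cols (λ c r β → X-pick1 (b' ℤ.+ + c) r (λ c' r' → X (b ℤ.+ + c') (D bs r')) β) α
  ∙ pick1-cong cols (λ c r → pick1-cong r (λ c' r' → X-comm (b' ℤ.+ + c) (b ℤ.+ + c') (D bs r'))) α
  ∙ pick2-anti cols (λ c c' r → X (b ℤ.+ + c) (X (b' ℤ.+ + c') (D bs r))) α
  ∙ cong -_ (sym (pick1-cong cols (λ c r β → X-pick1 (b ℤ.+ + c) r (λ c' r' → X (b' ℤ.+ + c') (D bs r')) β) α))
D-swap (x ∷ pre) b b' bs cols α = pick1-cong cols (λ c r β → X-cong (x ℤ.+ + c) (D-swap pre b b' bs r) β ∙ X-neg (x ℤ.+ + c) (D (pre ++ b ∷ b' ∷ bs) r) β) α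
  ∙ pick1-neg cols (λ c r → X (x ℤ.+ + c) (D (pre ++ b ∷ b' ∷ bs) r)) α

Incr : ℕ → ℕ → List ℕ → Set
Incr lo n [] = ⊤
Incr lo n (c ∷ cs) = lo ≤ c × c < n × Incr (suc c) n cs

incr-weaken : ∀ {lo lo' n} cs → lo' ≤ lo → Incr lo n cs → Incr lo' n cs
incr-weaken [] p _ = tt
incr-weaken (c ∷ cs) p (a , h) = ≤-trans p a , h

pick1-zero : ∀ {lo n} cols → Incr lo n cols → (f : ℕ → List ℕ → Mono → ℤ) → ∀ α →
  (∀ c r → lo ≤ c → c < n → Incr lo n r → suc (length r) ≡ length cols → + sumN r ℤ.+ + c ≡ + sumN cols → f c r α ≡ + 0) → pick1 cols f α ≡ + 0
pick1-zero [] _ f α h = refl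
pick1-zero {lo} {n} (c ∷ cs) (a , b , i) f α h = cong₂ ℤ._-_ (h c cs a b (incr-weaken cs (m≤n⇒m≤1+n a) i) refl (cong +_ (+-comm (sumN cs) c)))
  (pick1-zero cs i (λ c' r → f c' (c ∷ r)) α (λ c' r p q ir l s → h c' (c ∷ r) (≤-trans a (<⇒≤ p)) q (a , b , ir) (cong suc l)
    (cong +_ (+-assoc c (sumN r) c' ∙ cong (λ z → c + z) (ℤP.+-injective s)))))

sumB : List ℤ → ℤ
sumB [] = + 0
sumB (b ∷ bs) = b ℤ.+ sumB bs

X-negative : ∀ z f α → z ℤ.≤ -[1+ 0 ] → X z f α ≡ + 0
X-negative (+ _) f α ()
X-negative -[1+ _ ] f α _ = refl

-- Every product in the expansion has total degree the sum of all row bases and columns. If this is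
-- negative, either the first factor has negative index or the remaining minor has negative degree.
D-degree : ∀ {lo n} bs cols → Incr lo n cols → length bs ≡ length cols → sumB bs ℤ.+ + sumN cols ℤ.≤ -[1+ 0 ] → ∀ α → D bs cols α ≡ + 0
D-degree [] [] i l () α
D-degree (b ∷ bs) cols i l h α = pick1-zero cols i _ α λ c r p q ir lr s → each c r ir lr s
  where
  ring : ∀ b s r c → b ℤ.+ s ℤ.+ (r ℤ.+ c) ≡ (b ℤ.+ c) ℤ.+ (s ℤ.+ r)
  ring = ℤS.solve-∀
  each : ∀ c r → _ → suc (length r) ≡ length cols → + sumN r ℤ.+ + c ≡ + sumN cols → X (b ℤ.+ + c) (D bs r) α ≡ + 0
  each c r ir lr s with (b ℤ.+ + c) ℤP.≤? -[1+ 0 ]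
  ... | yes neg = X-negative (b ℤ.+ + c) (D bs r) α neg
  ... | no nneg = X-cong (b ℤ.+ + c) (D-degree bs r ir (suc-injective (l ∙ sym lr)) rest) α ∙ X-0 (b ℤ.+ + c) α
    where
    total : (b ℤ.+ + c) ℤ.+ (sumB bs ℤ.+ + sumN r) ℤ.≤ -[1+ 0 ]
    total = subst (ℤ._≤ -[1+ 0 ]) (cong (λ z → (b ℤ.+ sumB bs) ℤ.+ z) (sym s) ∙ ring b (sumB bs) (+ sumN r) (+ c)) h
    nonneg : + 0 ℤ.≤ b ℤ.+ + c
    nonneg = ℤP.i<j⇒suc[i]≤j (ℤP.≰⇒> nneg)
    rest : sumB bs ℤ.+ + sumN r ℤ.≤ -[1+ 0 ]
    rest = ℤP.≤-trans (ℤP.≤-trans (ℤP.≤-reflexive (sym (ℤP.+-identityˡ _))) (ℤP.+-monoˡ-≤ (sumB bs ℤ.+ + sumN r) nonneg)) total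

pick1-neglect : ∀ {n} cols → Incr 0 n cols → {f g : ℕ → List ℕ → Mono → ℤ} → ∀ α →
  (∀ c r → c < n → Incr 0 n r → suc (length r) ≡ length cols → f c r α ≡ g c r α) → pick1 cols f α ≡ pick1 cols g α
pick1-neglect cols i {f} {g} α h = equal _ _ (sym (pick1-sub cols f g α)
  ∙ pick1-zero cols i (λ c r β → f c r β ℤ.- g c r β) α (λ c r _ p ir l _ → cong (ℤ._- g c r α) (h c r p ir l) ∙ ℤP.+-inverseʳ (g c r α)))
  where
  equal : ∀ x y → x ℤ.- y ≡ + 0 → x ≡ y
  equal = ℤP.i-j≡0⇒i≡j

incr-length : ∀ {lo n} cols → lo ≤ n → Incr lo n cols → lo + length cols ≤ n
incr-length {lo} {n} [] p _ = subst (_≤ n) (sym (+-identityʳ lo)) p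
incr-length {lo} {n} (c ∷ cs) p (a , b , i) = ≤-trans (≤-reflexive (+-suc lo _)) (≤-trans (+-monoˡ-≤ (length cs) (s≤s a)) (incr-length cs b i))

incr-sum : ∀ {lo} j t cols → length cols ≡ t → Incr lo (j + t) cols → + sumN cols ℤ.≤ tail j t (λ r → + r)
incr-sum j zero [] l i = ℤP.≤-refl
incr-sum j (suc t) (c ∷ cs) l (a , b , i) = ℤP.+-mono-≤ (ℤ.+≤+ c≤j) (incr-sum (suc j) t cs (suc-injective l) (subst (λ n → Incr (suc c) n cs) (+-suc j t) i))
  where
  c≤j : c ≤ j
  c≤j = ℕ.s≤s⁻¹ (+-cancelʳ-≤ t (suc c) (suc j) (subst₂ (λ x y → suc c + x ≤ y) (suc-injective l) (+-suc j t) (incr-length cs b i)))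

-- Whatever columns the upper rows use, the t columns left for the lower rows sum to at most the t
-- largest ones, so those rows have negative total degree.
D-suffix : ∀ j t pre post cols → Incr 0 (j + t) cols → length post ≡ t → length cols ≡ length pre + t →
  sumB post ℤ.+ tail j t (λ r → + r) ℤ.≤ -[1+ 0 ] → ∀ α → D (pre ++ post) cols α ≡ + 0
D-suffix j t [] post cols i lp lc h α = D-degree post cols i (lp ∙ sym lc) (ℤP.≤-trans (ℤP.+-monoʳ-≤ (sumB post) (incr-sum j t cols lc i)) h) α
D-suffix j t (b ∷ pre) post cols i lp lc h α = pick1-zero cols i _ α λ c r _ _ ir lr _ →
  X-cong (b ℤ.+ + c) (D-suffix j t pre post r ir lp (suc-injective (lr ∙ lc)) h) α ∙ X-0 (b ℤ.+ + c) α

pick1-snoc : ∀ cols m (f : ℕ → List ℕ → Mono → ℤ) α → f m cols α ≡ + 0 → pick1 (cols ++ m ∷ []) f α ≡ pick1 cols (λ c r → f c (r ++ m ∷ [])) α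
pick1-snoc [] m f α h = cong (ℤ._- + 0) h
pick1-snoc (c ∷ cs) m f α h = cong (λ z → f c (cs ++ m ∷ []) α ℤ.- z) (pick1-snoc cs m (λ c' r → f c' (c ∷ r)) α h)

-- The last row has entries h_(c - m), that is 1 in column m and 0 before it. A term in which
-- another row takes column m leaves a zero row.
D-pad : ∀ bs m cols → Incr 0 m cols → length cols ≡ length bs → ∀ α → D (bs ++ - + m ∷ []) (cols ++ m ∷ []) α ≡ D bs cols α
D-pad [] m [] i l α = ℤP.+-identityʳ _ ∙ cong (λ z → X z (D [] []) α) (ℤP.+-inverseˡ (+ m))
D-pad (b ∷ bs) m cols i l α = pick1-snoc cols m (λ c r → X (b ℤ.+ + c) (D (bs ++ - + m ∷ []) r)) α
    (X-cong (b ℤ.+ + m) (last m i l) α ∙ X-0 (b ℤ.+ + m) α)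
  ∙ pick1-neglect cols i α (λ c r _ ir lr → X-cong (b ℤ.+ + c) (D-pad bs m r ir (suc-injective (lr ∙ l))) α)
  where
  last : ∀ m → Incr 0 m cols → length cols ≡ suc (length bs) → ∀ β → D (bs ++ - + m ∷ []) cols β ≡ + 0
  last zero i l β = ⊥-elim (<⇒≱ (subst (0 <_) (sym l) (s≤s z≤n)) (incr-length cols z≤n i))
  last (suc m) i l β = D-suffix m 1 bs (-[1+ m ] ∷ []) cols (subst (λ n → Incr 0 n cols) (+-comm 1 m) i) refl (l ∙ +-comm 1 (length bs)) (ℤP.≤-reflexive (ring (+ m))) β
    where
    ring : ∀ m → (- (+ 1 ℤ.+ m) ℤ.+ + 0) ℤ.+ (m ℤ.+ + 0) ≡ - + 1
    ring = ℤS.solve-∀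

bases : ℕ → ℕ → W → List ℤ
bases j zero γ = []
bases j (suc t) γ = (γ j ℤ.- + j) ∷ bases (suc j) t γ

bases-cong : ∀ j t {γ γ'} → (∀ r → j ≤ r → r < j + t → γ r ≡ γ' r) → bases j t γ ≡ bases j t γ'
bases-cong j zero h = refl
bases-cong j (suc t) h = cong₂ (λ x y → (x ℤ.- + j) ∷ y) (h j ≤-refl (m<m+n j (s≤s z≤n)))
  (bases-cong (suc j) t (λ r p q → h r (<⇒≤ p) (subst (r <_) (sym (+-suc j t)) q)))

bases-++ : ∀ j a b γ → bases j (a + b) γ ≡ bases j a γ ++ bases (j + a) b γ
bases-++ j zero b γ = cong (λ z → bases z b γ) (sym (+-identityʳ j))
bases-++ j (suc a) b γ = cong (_ ∷_) (bases-++ (suc j) a b γ ∙ cong (λ z → bases (suc j) a γ ++ bases z b γ) (sym (+-suc j a)))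

length-bases : ∀ j t γ → length (bases j t γ) ≡ t
length-bases j zero γ = refl
length-bases j (suc t) γ = cong suc (length-bases (suc j) t γ)

sumB-bases : ∀ j t γ → sumB (bases j t γ) ℤ.+ tail j t (λ r → + r) ≡ tail j t γ
sumB-bases j zero γ = refl
sumB-bases j (suc t) γ = ring (γ j) (+ j) _ _ ∙ cong (λ z → γ j ℤ.+ z) (sumB-bases (suc j) t γ)
  where
  ring : ∀ a b c d → ((a ℤ.- b) ℤ.+ c) ℤ.+ (b ℤ.+ d) ≡ a ℤ.+ (c ℤ.+ d)
  ring = ℤS.solve-∀

interval-incr : ∀ j t → Incr j (j + t) (interval j t)
interval-incr j zero = tt
interval-incr j (suc t) = ≤-refl , m<m+n j (s≤s z≤n) , subst (λ n → Incr (suc j) n (interval (suc j) t)) (sym (+-suc j t)) (interval-incr (suc j) t)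

interval-snoc : ∀ j t → interval j (suc t) ≡ interval j t ++ j + t ∷ []
interval-snoc j zero = cong (_∷ []) (sym (+-identityʳ j))
interval-snoc j (suc t) = cong (j ∷_) (interval-snoc (suc j) t ∙ cong (λ z → interval (suc j) t ++ z ∷ []) (sym (+-suc j t)))

-- The coefficient of the monomial α in s_γ, where γ has length ℓ.
schur : ℕ → Mono → W → ℤ
schur ℓ α γ = D (bases 0 ℓ γ) (interval 0 ℓ) α

schur-local : ∀ ℓ α → Local ℓ (schur ℓ α)
schur-local ℓ α h = cong (λ z → D z (interval 0 ℓ) α) (bases-cong 0 ℓ (λ r _ p → h r p))

-- The shift by one in `sw` is exactly what turns an exchange of the determinant rows, with bases
-- γ_r - r, into an operation on the weight.
schur-anti : ∀ ℓ α z → suc z < ℓ → AntiAt (schur ℓ α) z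
schur-anti ℓ α z lt γ = cong (λ L → D L (interval 0 ℓ) α) (split (sw z γ) ∙ cong₂ _++_ before (cong₂ _∷_ at (cong₂ _∷_ at' after')))
  ∙ D-swap (bases 0 z γ) (γ z ℤ.- + z) (γ (suc z) ℤ.- + suc z) (bases (suc (suc z)) u γ) (interval 0 ℓ) α ∙ cong (λ L → - D L (interval 0 ℓ) α) (sym (split γ))
  where
  u : ℕ
  u = ℓ ∸ suc (suc z)
  ℓ≡ : ℓ ≡ z + suc (suc u)
  ℓ≡ = (lia (z ∷ u ∷ ℓ ∷ []) ((su (su v0)) ⊕ v1 ≛ v2 ∷ []) (v2 ≛ v0 ⊕ (su (su v1))) ((1 ∷ 0 ∷ 1 ∷ []) , (1 ∷ 1 ∷ []))) (m+[n∸m]≡n lt)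
  split : ∀ γ → bases 0 ℓ γ ≡ bases 0 z γ ++ (γ z ℤ.- + z) ∷ (γ (suc z) ℤ.- + suc z) ∷ bases (suc (suc z)) u γ
  split γ = cong (λ n → bases 0 n γ) ℓ≡ ∙ bases-++ 0 z (suc (suc u)) γ
  fixed : ∀ r → r ≢ z → r ≢ suc z → sw z γ r ≡ γ r
  fixed r p q rewrite swi-other z r p q | ι-no r z p | ι-no r (suc z) q = ℤP.+-identityʳ (γ r)
  before : bases 0 z (sw z γ) ≡ bases 0 z γ
  before = bases-cong 0 z (λ r _ p → fixed r (<⇒≢ p) (<⇒≢ (<-trans p (n<1+n z))))
  after' : bases (suc (suc z)) u (sw z γ) ≡ bases (suc (suc z)) u γ
  after' = bases-cong (suc (suc z)) u (λ r p _ → fixed r (>⇒≢ (<-trans (n<1+n z) p)) (>⇒≢ p))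
  at : sw z γ z ℤ.- + z ≡ γ (suc z) ℤ.- + suc z
  at rewrite swi-z z | ι-no z (suc z) (<⇒≢ (n<1+n z)) | ι-eq z = ring (γ (suc z)) (+ z)
    where
    ring : ∀ a z → (a ℤ.+ (+ 0 ℤ.- + 1)) ℤ.- z ≡ a ℤ.- (+ 1 ℤ.+ z)
    ring = ℤS.solve-∀
  at' : sw z γ (suc z) ℤ.- + suc z ≡ γ z ℤ.- + z
  at' rewrite swi-sz z | ι-eq z | ι-no (suc z) z (λ ()) = ring (γ z) (+ z)
    where
    ring : ∀ a z → (a ℤ.+ (+ 1 ℤ.- + 0)) ℤ.- (+ 1 ℤ.+ z) ≡ a ℤ.- z
    ring = ℤS.solve-∀

schur-tail : ∀ ℓ α j γ → TailNeg ℓ j γ → schur ℓ α γ ≡ + 0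
schur-tail ℓ α j γ (t , refl , h) = cong (λ L → D L (interval 0 ℓ) α) (bases-++ 0 j t γ)
  ∙ D-suffix j t (bases 0 j γ) (bases j t γ) (interval 0 ℓ) (interval-incr 0 ℓ) (length-bases j t γ)
      (length-interval 0 ℓ ∙ cong (_+ t) (sym (length-bases 0 j γ))) (subst (ℤ._≤ -[1+ 0 ]) (sym (sumB-bases j t γ)) h) α

schur-pad : ∀ m u α γ → (∀ r → m ≤ r → r < m + u → γ r ≡ + 0) → schur (m + u) α γ ≡ schur m α γ
schur-pad m zero α γ h = cong (λ n → schur n α γ) (+-identityʳ m)
schur-pad m (suc u) α γ h = cong (λ n → schur n α γ) (+-suc m u)
  ∙ cong₂ (λ L C → D L C α) (cong (λ n → bases 0 n γ) (+-comm 1 (m + u)) ∙ bases-++ 0 (m + u) 1 γ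
      ∙ cong (λ z → bases 0 (m + u) γ ++ z ∷ []) (cong (ℤ._- + (m + u)) (h (m + u) (m≤m+n m u) (≤-reflexive (sym (+-suc m u)))) ∙ ℤP.+-identityˡ _))
    (interval-snoc 0 (m + u))
  ∙ D-pad (bases 0 (m + u) γ) (m + u) (interval 0 (m + u)) (interval-incr 0 (m + u)) (length-interval 0 (m + u) ∙ sym (length-bases 0 (m + u) γ)) α
  ∙ schur-pad m u α γ (λ r p q → h r p (≤-trans q (≤-trans (n≤1+n (m + u)) (≤-reflexive (sym (+-suc m u))))))

-- Polynomial determinants of the statement as Laplace expansions

sg : ℕ → ℤ → ℤ
sg zero x = x
sg (suc n) x = - sg n x

coeff-sgn : ∀ n p e α → coeff (sgn n p) e α ≡ sg n (coeff p e α)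
coeff-sgn zero p e α = refl
coeff-sgn (suc zero) p e α = coeff-negP p e α
coeff-sgn (suc (suc n)) p e α = coeff-sgn n p e α ∙ sym (ℤP.neg-involutive _)

sg-0 : ∀ n → sg n (+ 0) ≡ + 0
sg-0 zero = refl
sg-0 (suc n) = cong -_ (sg-0 n)

sumℤ-neg : ∀ {A : Set} (xs : List A) f → sumℤ xs (λ x → - f x) ≡ - sumℤ xs f
sumℤ-neg [] f = refl
sumℤ-neg (x ∷ xs) f = cong (λ z → - f x ℤ.+ z) (sumℤ-neg xs f) ∙ sym (ℤP.neg-distrib-+ (f x) _)

-- The sign of a column position becomes the number of nested subtractions in `pick1`.
laplace : ∀ n (C : Fin (suc n) → ℕ) (f : ℕ → List ℕ → Mono → ℤ) α →
  sumℤ (allFin (suc n)) (λ j → sg (toℕ j) (f (C j) (tabulate (λ c → C (punchIn j c))) α)) ≡ pick1 (tabulate C) f α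
laplace zero C f α = refl
laplace (suc n) C f α = cong (λ z → f (C fzero) (tabulate (λ c → C (fsuc c))) α ℤ.+ z)
  (cong (λ L → sumℤ L (λ j → sg (toℕ j) (f (C j) (tabulate (λ c → C (punchIn j c))) α))) (sym (map-tabulate (λ j → j) fsuc))
   ∙ sumℤ-map fsuc (allFin (suc n)) (λ j → sg (toℕ j) (f (C j) (tabulate (λ c → C (punchIn j c))) α))
   ∙ sumℤ-neg (allFin (suc n)) (λ j → sg (toℕ j) (f (C (fsuc j)) (C fzero ∷ tabulate (λ c → C (fsuc (punchIn j c)))) α))
   ∙ cong -_ (laplace n (λ c → C (fsuc c)) (λ c r → f c (C fzero ∷ r)) α))

det-expand : ∀ n (M : Fin (suc n) → Fin (suc n) → Poly) (z : Fin (suc n) → ℤ) e α → (∀ c → M fzero c ≡ hh (z c)) → coeff (det (suc n) M) e α ≡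
  sumℤ (allFin (suc n)) (λ j → sg (toℕ j) (X (z j) (coeff (det n (λ r c → M (fsuc r) (punchIn j c))) e) α))
det-expand n M z e α h = coeff-sumP (allFin (suc n)) (λ j → sgn (toℕ j) (M fzero j *P minor j)) e α
  ∙ sumℤ-cong (allFin (suc n)) (λ j → coeff-sgn (toℕ j) (M fzero j *P minor j) e α
      ∙ cong (sg (toℕ j)) (cong (λ p → coeff (p *P minor j) e α) (h j) ∙ coeff-hh (z j) (minor j) e α))
  where
  minor : Fin (suc n) → Poly
  minor j = det n (λ r c → M (fsuc r) (punchIn j c))

coeff-det : ∀ n (M : Fin n → Fin n → Poly) (B : Fin n → ℤ) (C : Fin n → ℕ) → (∀ r c → M r c ≡ hh (B r ℤ.+ + C c)) → ∀ α →
  coeff (det n M) 0 α ≡ D (tabulate B) (tabulate C) α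
coeff-det zero M B C h [] = refl
coeff-det zero M B C h (_ ∷ _) = refl
coeff-det (suc n) M B C h α = det-expand n M (λ c → B fzero ℤ.+ + C c) 0 α (h fzero)
  ∙ sumℤ-cong (allFin (suc n)) (λ j → cong (sg (toℕ j)) (X-cong (B fzero ℤ.+ + C j)
      (coeff-det n (λ r c → M (fsuc r) (punchIn j c)) (λ r → B (fsuc r)) (λ c → C (punchIn j c)) (λ r c → h (fsuc r) (punchIn j c))) α))
  ∙ laplace n C (λ c r → X (B fzero ℤ.+ + c) (D (tabulate (λ r → B (fsuc r))) r)) α

coeff-det-suc : ∀ n (M : Fin n → Fin n → Poly) (z : Fin n → Fin n → ℤ) → (∀ r c → M r c ≡ hh (z r c)) → ∀ e α → coeff (det n M) (suc e) α ≡ + 0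
coeff-det-suc zero M z h e α = refl
coeff-det-suc (suc n) M z h e α = det-expand n M (z fzero) (suc e) α (h fzero)
  ∙ sumℤ-cong (allFin (suc n)) (λ j → cong (sg (toℕ j)) (X-cong (z fzero j) (coeff-det-suc n (λ r c → M (fsuc r) (punchIn j c)) (λ r c → z (fsuc r) (punchIn j c)) (λ r c → h (fsuc r) (punchIn j c)) e) α
      ∙ X-0 (z fzero j) α) ∙ sg-0 (toℕ j))
  ∙ sumℤ-zero (allFin (suc n))

listOf : ℕ → ℕ → W → List ℤ
listOf j zero γ = []
listOf j (suc t) γ = γ j ∷ listOf (suc j) t γ

length-listOf : ∀ j t γ → length (listOf j t γ) ≡ t
length-listOf j zero γ = refl
length-listOf j (suc t) γ = cong suc (length-listOf (suc j) t γ)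

bases-tabulate : ∀ j t γ → tabulate {n = length (listOf j t γ)} (λ r → lookup (listOf j t γ) r ℤ.- + (j + toℕ r)) ≡ bases j t γ
bases-tabulate j zero γ = refl
bases-tabulate j (suc t) γ = cong₂ _∷_ (cong (λ z → γ j ℤ.- + z) (+-identityʳ j))
  (tabulate-cong (λ r → cong (λ z → lookup (listOf (suc j) t γ) r ℤ.- + z) (+-suc j (toℕ r))) ∙ bases-tabulate (suc j) t γ)

interval-tabulate : ∀ j n → tabulate {n = n} (λ r → j + toℕ r) ≡ interval j n
interval-tabulate j zero = refl
interval-tabulate j (suc n) = cong₂ _∷_ (+-identityʳ j) (tabulate-cong (λ r → +-suc j (toℕ r)) ∙ interval-tabulate (suc j) n)

schurSer : ℕ → Mono → W → Ser
schurSer ℓ α = HL [] (schur ℓ α)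

coeff-sγ : ∀ ℓ γ n α → coeff (sγ (listOf 0 ℓ γ)) n α ≡ schurSer ℓ α γ n
coeff-sγ ℓ γ zero α = coeff-det (length (listOf 0 ℓ γ)) _ (λ r → lookup (listOf 0 ℓ γ) r ℤ.- + toℕ r) toℕ
    (λ r c → cong hh (x+y+z (lookup (listOf 0 ℓ γ) r) (+ toℕ c) (- + toℕ r))) α
  ∙ cong₂ (λ L C → D L C α) (bases-tabulate 0 ℓ γ) (interval-tabulate 0 _ ∙ cong (interval 0) (length-listOf 0 ℓ γ))
coeff-sγ ℓ γ (suc n) α = coeff-det-suc (length (listOf 0 ℓ γ)) _ (λ r c → (lookup (listOf 0 ℓ γ) r ℤ.+ + toℕ c) ℤ.- + toℕ r) (λ r c → refl) n α

-- Truncated Catalan functions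

sumℤ-shN : ∀ {A : Set} s (xs : List A) (f : A → Ser) n → sumℤ xs (λ x → shN s (f x) n) ≡ shN s (λ m → sumℤ xs (λ x → f x m)) n
sumℤ-shN zero xs f n = refl
sumℤ-shN (suc s) xs f n = sumℤ-sh xs (λ x → shN s (f x)) n ∙ sh-cong (sumℤ-shN s xs f) n

raise : ℕ → Root → W → W
raise zero δ γ = γ
raise (suc m) δ γ = raise m δ (R δ γ)

raise-at : ∀ m δ γ r → raise m δ γ r ≡ γ r ℤ.+ + m ℤ.* rt δ r
raise-at zero δ γ r = sym (cong (λ z → γ r ℤ.+ z) (ℤP.*-zeroˡ (rt δ r)) ∙ ℤP.+-identityʳ (γ r))
raise-at (suc m) δ γ r = raise-at m δ (R δ γ) r ∙ ring (γ r) (rt δ r) (+ m)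
  where
  ring : ∀ g t m → (g ℤ.+ t) ℤ.+ m ℤ.* t ≡ g ℤ.+ (+ 1 ℤ.+ m) ℤ.* t
  ring = ℤS.solve-∀

raise-cong : ∀ {ℓ} m δ {γ γ'} → Agree ℓ γ γ' → Agree ℓ (raise m δ γ) (raise m δ γ')
raise-cong zero δ h = h
raise-cong (suc m) δ h = raise-cong m δ (R-cong δ h)

raise-comm : ∀ a δ b δ' γ r → raise a δ (raise b δ' γ) r ≡ raise b δ' (raise a δ γ) r
raise-comm a δ b δ' γ r = raise-at a δ (raise b δ' γ) r ∙ cong (ℤ._+ + a ℤ.* rt δ r) (raise-at b δ' γ r)
  ∙ x+y+z (γ r) (+ b ℤ.* rt δ' r) (+ a ℤ.* rt δ r) ∙ sym (raise-at b δ' (raise a δ γ) r ∙ cong (ℤ._+ + b ℤ.* rt δ' r) (raise-at a δ γ r))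

-- H(Ψ;γ) with every exponent m_δ cut off at N.
Cut : ℕ → List Root → (W → Ser) → W → Ser
Cut N [] F γ n = F γ n
Cut N (δ ∷ Ψ) F γ n = sumℤ (upTo (suc N)) (λ m → shN m (Cut N Ψ F (raise m δ γ)) n)

Cut-resp : ∀ {ℓ} N Ψ {F} → Respects ℓ F → Respects ℓ (Cut N Ψ F)
Cut-resp N [] h p n = h p n
Cut-resp N (δ ∷ Ψ) h p n = sumℤ-cong (upTo (suc N)) (λ m → shN-cong m (Cut-resp N Ψ h (raise-cong m δ p)) n)

Cut-cong : ∀ N Ψ {F G : W → Ser} → (∀ γ n → F γ n ≡ G γ n) → ∀ γ n → Cut N Ψ F γ n ≡ Cut N Ψ G γ n
Cut-cong N [] h γ n = h γ n
Cut-cong N (δ ∷ Ψ) h γ n = sumℤ-cong (upTo (suc N)) (λ m → shN-cong m (Cut-cong N Ψ h (raise m δ γ)) n)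

Cut-raise : ∀ {ℓ} N Ψ {F} → Respects ℓ F → ∀ a δ γ n → Cut N Ψ (λ β → F (raise a δ β)) γ n ≡ Cut N Ψ F (raise a δ γ) n
Cut-raise N [] h a δ γ n = refl
Cut-raise N (δ' ∷ Ψ) h a δ γ n = sumℤ-cong (upTo (suc N)) (λ m → shN-cong m (λ n →
  Cut-raise N Ψ h a δ (raise m δ' γ) n ∙ Cut-resp N Ψ h (λ r _ → raise-comm a δ m δ' γ r) n) n)

listOf-cong : ∀ j t {γ γ'} → (∀ r → j ≤ r → r < j + t → γ r ≡ γ' r) → listOf j t γ ≡ listOf j t γ'
listOf-cong j zero h = refl
listOf-cong j (suc t) h = cong₂ _∷_ (h j ≤-refl (m<m+n j (s≤s z≤n)))
  (listOf-cong (suc j) t (λ r p q → h r (<⇒≤ p) (subst (r <_) (sym (+-suc j t)) q)))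

addAt-listOf : ∀ i z j t γ → addAt (suc i) z (listOf j t γ) ≡ listOf j t (λ r → if r ≡ᵇ j + i then γ r ℤ.+ z else γ r)
addAt-listOf i z j zero γ = refl
addAt-listOf zero z j (suc t) γ = cong₂ _∷_ (sym (cong (λ b → if b then γ j ℤ.+ z else γ j) (cong (j ≡ᵇ_) (+-identityʳ j) ∙ ≡ᵇ-refl j)))
  (listOf-cong (suc j) t (λ r p _ → sym (cong (λ b → if b then γ r ℤ.+ z else γ r) (≡ᵇ-no r (j + 0) (λ e → >⇒≢ p (e ∙ +-identityʳ j))))))
addAt-listOf (suc i) z j (suc t) γ = cong₂ _∷_ (sym (cong (λ b → if b then γ j ℤ.+ z else γ j) (≡ᵇ-no j (j + suc i) (<⇒≢ (m<m+n j (s≤s z≤n))))))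
  (addAt-listOf i z (suc j) t γ ∙ listOf-cong (suc j) t (λ r _ _ → cong (λ x → if r ≡ᵇ x then γ r ℤ.+ z else γ r) (sym (+-suc j i))))

addAt-raise : ∀ ℓ a b m γ → addAt (suc a) (+ m) (addAt (suc b) (- + m) (listOf 0 ℓ γ)) ≡ listOf 0 ℓ (raise m (a , b) γ)
addAt-raise ℓ a b m γ = cong (addAt (suc a) (+ m)) (addAt-listOf b (- + m) 0 ℓ γ) ∙ addAt-listOf a (+ m) 0 ℓ _
  ∙ listOf-cong 0 ℓ (λ r _ _ → flags (r ≡ᵇ a) (r ≡ᵇ b) (γ r) (+ m) ∙ ι-sym r ∙ sym (raise-at m (a , b) γ r))
  where
  flags : ∀ x y g m → (if x then (if y then g ℤ.- m else g) ℤ.+ m else (if y then g ℤ.- m else g)) ≡ g ℤ.+ m ℤ.* ((+ (if x then 1 else 0)) ℤ.- (+ (if y then 1 else 0)))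
  flags true true = ring
    where
    ring : ∀ g m → (g ℤ.- m) ℤ.+ m ≡ g ℤ.+ m ℤ.* (+ 1 ℤ.- + 1)
    ring = ℤS.solve-∀
  flags true false = ring
    where
    ring : ∀ g m → g ℤ.+ m ≡ g ℤ.+ m ℤ.* (+ 1 ℤ.- + 0)
    ring = ℤS.solve-∀
  flags false true = ring
    where
    ring : ∀ g m → g ℤ.- m ≡ g ℤ.+ m ℤ.* (+ 0 ℤ.- + 1)
    ring = ℤS.solve-∀
  flags false false = ring
    where
    ring : ∀ g m → g ≡ g ℤ.+ m ℤ.* (+ 0 ℤ.- + 0)
    ring = ℤS.solve-∀
  ι-sym : ∀ r → γ r ℤ.+ + m ℤ.* ((+ (if r ≡ᵇ a then 1 else 0)) ℤ.- (+ (if r ≡ᵇ b then 1 else 0))) ≡ γ r ℤ.+ + m ℤ.* rt (a , b) r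
  ι-sym r = refl

up1 : Root → Root
up1 (i , j) = suc i , suc j

-- `assign` shifts by the first root after all the others, `Cut` before them; the two agree because
-- shifts commute, by `Cut-raise`.
assign-Cut : ∀ ℓ N Ψ (f : List ℤ → Ser) γ n → sumℤ (assign N (map up1 Ψ) (listOf 0 ℓ γ)) (λ x → shN (proj₁ x) (f (proj₂ x)) n) ≡ Cut N Ψ (λ β → f (listOf 0 ℓ β)) γ n
assign-Cut ℓ N [] f γ n = ℤP.+-identityʳ _
assign-Cut ℓ N ((a , b) ∷ Ψ) f γ n = sumℤ-concatMap (λ m → map (step m) tot) (upTo (suc N)) G
  ∙ sumℤ-cong (upTo (suc N)) (λ m → sumℤ-map (step m) tot G
      ∙ sumℤ-cong tot (λ x → sym (shN-+ m (proj₁ x) (f (proj₂ (step m x))) n))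
      ∙ sumℤ-shN m tot (λ x → shN (proj₁ x) (f (proj₂ (step m x)))) n
      ∙ shN-cong m (λ n → assign-Cut ℓ N Ψ (λ L → f (addAt (suc a) (+ m) (addAt (suc b) (- + m) L))) γ n
          ∙ Cut-cong N Ψ (λ β n → cong (λ L → f L n) (addAt-raise ℓ a b m β)) γ n
          ∙ Cut-raise N Ψ (λ {γ} {γ'} p n → cong (λ L → f L n) (listOf-cong 0 ℓ {γ} {γ'} (λ r _ q → p r q))) m (a , b) γ n) n)
  where
  tot : List (ℕ × List ℤ)
  tot = assign N (map up1 Ψ) (listOf 0 ℓ γ)
  step : ℕ → ℕ × List ℤ → ℕ × List ℤ
  step m (s , β) = m + s , addAt (suc a) (+ m) (addAt (suc b) (- + m) β)
  G : ℕ × List ℤ → ℤ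
  G x = shN (proj₁ x) (f (proj₂ x)) n

-- The geometric series cut after M terms, with its remainder; truncating is correct once the
-- remainder is shown to vanish.
inv-unroll : ∀ M δ f γ n → inv δ f γ n ≡ sumℤ (upTo M) (λ m → shN m (f (raise m δ γ)) n) ℤ.+ shN M (inv δ f (raise M δ γ)) n
inv-unroll zero δ f γ n = sym (ℤP.+-identityˡ _)
inv-unroll (suc M) δ f γ n = inv-step n ∙ cong (λ z → f γ n ℤ.+ z) (sh-cong (inv-unroll M δ f (R δ γ)) n ∙ sh-+ n
    ∙ cong (ℤ._+ shN (suc M) (inv δ f (raise (suc M) δ γ)) n) (sym (sumℤ-sh (upTo M) (λ m → shN m (f (raise m δ (R δ γ)))) n)
        ∙ sym (sumℤ-map suc (upTo M) (λ m → shN m (f (raise m δ γ)) n)) ∙ cong (λ L → sumℤ L (λ m → shN m (f (raise m δ γ)) n)) (map-upTo suc M)))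
  ∙ sym (ℤP.+-assoc (f γ n) _ _)
  where
  inv-step : ∀ n → inv δ f γ n ≡ f γ n ℤ.+ sh (inv δ f (R δ γ)) n
  inv-step zero = sym (ℤP.+-identityʳ _)
  inv-step (suc n) = refl
  g h : Ser
  g n = sumℤ (upTo M) (λ m → shN m (f (raise m δ (R δ γ))) n)
  h = shN M (inv δ f (raise M δ (R δ γ)))
  sh-+ : ∀ n → sh (λ m → g m ℤ.+ h m) n ≡ sh g n ℤ.+ sh h n
  sh-+ zero = refl
  sh-+ (suc n) = refl

-- Σ (r+1)γ_r as the sum of all tails; every raising operator lowers it.
Φ : ℕ → ℕ → W → ℤ
Φ j zero γ = + 0
Φ j (suc t) γ = tail j (suc t) γ ℤ.+ Φ (suc j) t γ

Φ-+ : ∀ j t (γ ω : W) → Φ j t (λ r → γ r ℤ.+ ω r) ≡ Φ j t γ ℤ.+ Φ j t ω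
Φ-+ j zero γ ω = refl
Φ-+ j (suc t) γ ω = cong₂ ℤ._+_ (tail-+ j (suc t) γ ω) (Φ-+ (suc j) t γ ω) ∙ ring (tail j (suc t) γ) (tail j (suc t) ω) _ _
  where
  ring : ∀ a b c d → (a ℤ.+ b) ℤ.+ (c ℤ.+ d) ≡ (a ℤ.+ c) ℤ.+ (b ℤ.+ d)
  ring = ℤS.solve-∀

Φ-root≤ : ∀ j t a b → a < b → b < j + t → Φ j t (rt (a , b)) ℤ.≤ + 0
Φ-root≤ j zero a b p q = ℤP.≤-refl
Φ-root≤ j (suc t) a b p q = ℤP.+-mono-≤ (tail-root j (suc t) a b p q) (Φ-root≤ (suc j) t a b p (subst (b <_) (+-suc j t) q))

tail-last : ∀ t a b → a < b → tail b (suc t) (rt (a , b)) ≡ -[1+ 0 ]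
tail-last t a b p = cong₂ ℤ._+_ (cong₂ (λ x y → + x ℤ.- + y) (ι-no b a (>⇒≢ p)) (ι-eq b)) (tail-zero (suc b) t (λ r h _ → rt-after a b r (<-trans p h) h))

Φ-root : ∀ j t a b → a < b → j ≤ b → b < j + t → Φ j t (rt (a , b)) ℤ.≤ -[1+ 0 ]
Φ-root j zero a b p u q = ⊥-elim (<⇒≱ q (≤-trans (≤-reflexive (+-identityʳ j)) u))
Φ-root j (suc t) a b p u q with j ≟ b
... | yes refl = ℤP.≤-trans (ℤP.+-mono-≤ (ℤP.≤-reflexive (tail-last t a j p)) (Φ-root≤ (suc j) t a j p (subst (j <_) (+-suc j t) q))) ℤP.≤-refl
... | no ne = ℤP.≤-trans (ℤP.+-mono-≤ (tail-root j (suc t) a b p q) (Φ-root (suc j) t a b p (≤∧≢⇒< u ne) (subst (b <_) (+-suc j t) q))) ℤP.≤-refl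

-- A sum of tails is negative only if one of them is, and a negative tail is what makes s_γ vanish.
Φ-negative : ∀ j t γ → Φ j t γ ℤ.≤ -[1+ 0 ] → ∃ λ i → TailNeg (j + t) i γ
Φ-negative j zero γ ()
Φ-negative j (suc t) γ h with tail j (suc t) γ ℤP.≤? -[1+ 0 ]
... | yes n = j , suc t , refl , n
... | no nn = proj₁ rest , subst (λ ℓ → TailNeg ℓ (proj₁ rest) γ) (sym (+-suc j t)) (proj₂ rest)
  where
  nonneg : + 0 ℤ.≤ tail j (suc t) γ
  nonneg = ℤP.i<j⇒suc[i]≤j (ℤP.≰⇒> nn)
  rest : ∃ λ i → TailNeg (suc j + t) i γ
  rest = Φ-negative (suc j) t γ (ℤP.≤-trans (ℤP.≤-trans (ℤP.≤-reflexive (sym (ℤP.+-identityˡ _))) (ℤP.+-monoˡ-≤ (Φ (suc j) t γ) nonneg)) h)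

-- One raising along (a , b) lowers the weighted sum by b - a, hence by at least one.
Φ-raise : ∀ ℓ m a b γ → a < b → b < ℓ → Φ 0 ℓ (raise m (a , b) γ) ℤ.+ + m ℤ.≤ Φ 0 ℓ γ
Φ-raise ℓ zero a b γ p q = ℤP.≤-reflexive (ℤP.+-identityʳ _)
Φ-raise ℓ (suc m) a b γ p q = ℤP.≤-trans (ℤP.≤-reflexive (ring (Φ 0 ℓ (raise m (a , b) (R (a , b) γ))) (+ m)))
  (ℤP.≤-trans (ℤP.+-monoˡ-≤ (+ 1) (ℤP.≤-trans (Φ-raise ℓ m a b (R (a , b) γ) p q)
      (ℤP.≤-trans (ℤP.≤-reflexive (Φ-+ 0 ℓ γ (rt (a , b)))) (ℤP.+-monoʳ-≤ (Φ 0 ℓ γ) (Φ-root 0 ℓ a b p z≤n q)))))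
    (ℤP.≤-reflexive (ring' (Φ 0 ℓ γ))))
  where
  ring : ∀ x m → x ℤ.+ (+ 1 ℤ.+ m) ≡ (x ℤ.+ m) ℤ.+ + 1
  ring = ℤS.solve-∀
  ring' : ∀ x → (x ℤ.+ -[1+ 0 ]) ℤ.+ + 1 ≡ x
  ring' x = ℤP.+-assoc x _ _ ∙ ℤP.+-identityʳ x

-- After N + 1 raisings along one root the statistic has dropped below zero, so the remainder of
-- that geometric series vanishes. The bound is inherited by the raised weights on which the
-- remaining roots act.
Cut-HL : ∀ ℓ N S → (∀ j γ → TailNeg ℓ j γ → S γ ≡ + 0) → ∀ Ψ → Inner ℓ Ψ → ∀ γ → Φ 0 ℓ γ ℤ.≤ + N → ∀ n → Cut N Ψ (HL [] S) γ n ≡ HL Ψ S γ n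
Cut-HL ℓ N S v [] ok γ h n = refl
Cut-HL ℓ N S v ((a , b) ∷ Ψ) ((p , q) ∷ ok) γ h n =
  sumℤ-cong (upTo (suc N)) (λ m → shN-cong m (Cut-HL ℓ N S v Ψ ok (raise m (a , b) γ) (ℤP.≤-trans (ℤP.i≤i+j _ (+ m)) (ℤP.≤-trans (Φ-raise ℓ m a b γ p q) h))) n)
  ∙ sym (ℤP.+-identityʳ _)
  ∙ cong (λ z → sumℤ (upTo (suc N)) (λ m → shN m (HL Ψ S (raise m (a , b) γ)) n) ℤ.+ z)
      (sym (shN-cong (suc N) (HL-tail (v (proj₁ neg)) ((a , b) ∷ Ψ) ((p , q) ∷ ok) _ (proj₂ neg)) n ∙ shN-0 (suc N) n))
  ∙ sym (inv-unroll (suc N) (a , b) (HL Ψ S) γ n)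
  where
  small : Φ 0 ℓ (raise (suc N) (a , b) γ) ℤ.≤ -[1+ 0 ]
  small = ℤP.≤-trans (ℤP.≤-reflexive (ring (Φ 0 ℓ (raise (suc N) (a , b) γ)) (+ N)))
      (ℤP.≤-trans (ℤP.+-monoˡ-≤ (- + suc N) (ℤP.≤-trans (Φ-raise ℓ (suc N) a b γ p q) h)) (ℤP.≤-reflexive (ring' (+ N))))
    where
    ring : ∀ x n → x ≡ (x ℤ.+ (+ 1 ℤ.+ n)) ℤ.- (+ 1 ℤ.+ n)
    ring = ℤS.solve-∀
    ring' : ∀ n → n ℤ.- (+ 1 ℤ.+ n) ≡ - + 1
    ring' = ℤS.solve-∀
  neg : ∃ λ i → TailNeg ℓ i (raise (suc N) (a , b) γ)
  neg = Φ-negative 0 ℓ _ small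

coeff-HTr : ∀ ℓ N Ψ → Inner ℓ Ψ → ∀ γ → Φ 0 ℓ γ ℤ.≤ + N → ∀ n α → coeff (HTr (map up1 Ψ) (listOf 0 ℓ γ) N) n α ≡ HL Ψ (schur ℓ α) γ n
coeff-HTr ℓ N Ψ ok γ h n α = coeff-sumP L _ n α
  ∙ sumℤ-cong L (λ x → coeff-tpow (proj₁ x) (sγ (proj₂ x)) n α)
  ∙ assign-Cut ℓ N Ψ (λ β n → coeff (sγ β) n α) γ n
  ∙ Cut-cong N Ψ (λ β n → coeff-sγ ℓ β n α) γ n
  ∙ Cut-HL ℓ N (schur ℓ α) (schur-tail ℓ α) Ψ ok γ h n
  where
  L : List (ℕ × List ℤ)
  L = assign N (map up1 Ψ) (listOf 0 ℓ γ)

-- The origin of the threshold in the theorem: at most ℓ tails, each with at most ℓ entries bounded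
-- by k.
Φ-bound : ∀ k j t γ → (∀ r → j ≤ r → r < j + t → γ r ℤ.≤ + k) → Φ j t γ ℤ.≤ + (t * (t * k))
Φ-bound k j zero γ h = ℤP.≤-refl
Φ-bound k j (suc t) γ h = ℤP.≤-trans (ℤP.+-mono-≤ (tails j (suc t) h)
    (Φ-bound k (suc j) t γ (λ r p q → h r (<⇒≤ p) (subst (r <_) (sym (+-suc j t)) q))))
  (ℤ.+≤+ (+-monoʳ-≤ (suc t * k) (*-monoʳ-≤ t (m≤n+m (t * k) k))))
  where
  tails : ∀ j t → (∀ r → j ≤ r → r < j + t → γ r ℤ.≤ + k) → tail j t γ ℤ.≤ + (t * k)
  tails j zero h = ℤP.≤-refl
  tails j (suc t) h = ℤP.+-mono-≤ (h j ≤-refl (m<m+n j (s≤s z≤n))) (tails (suc j) t (λ r p q → h r (<⇒≤ p) (subst (r <_) (sym (+-suc j t)) q)))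

inside : ℕ → Root → Bool
inside m δ = proj₂ δ <ᵇ m

-- A root reaching the zero part of the weight makes a tail negative.
HL-restrict : ∀ m u {S S'} → (∀ j γ → TailNeg (m + u) j γ → S γ ≡ + 0) → (∀ γ → (∀ r → m ≤ r → r < m + u → γ r ≡ + 0) → S γ ≡ S' γ) →
  ∀ Ψ → Inner (m + u) Ψ → ∀ γ → (∀ r → m ≤ r → r < m + u → γ r ≡ + 0) → ∀ n → HL Ψ S γ n ≡ HL (filterB (inside m) Ψ) S' γ n
HL-restrict m u v e [] ok γ h zero = e γ h
HL-restrict m u v e [] ok γ h (suc n) = refl
HL-restrict m u {S} {S'} v e ((a , b) ∷ Ψ) ((p , q) ∷ ok) γ h n = split (b <? m)
  where
  rest : ∀ γ → (∀ r → m ≤ r → r < m + u → γ r ≡ + 0) → ∀ n → HL Ψ S γ n ≡ HL (filterB (inside m) Ψ) S' γ n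
  rest = HL-restrict m u v e Ψ ok
  both : b < m → ∀ n γ → (∀ r → m ≤ r → r < m + u → γ r ≡ + 0) → inv (a , b) (HL Ψ S) γ n ≡ inv (a , b) (HL (filterB (inside m) Ψ) S') γ n
  both lt zero γ h = rest γ h 0
  both lt (suc n) γ h = cong₂ ℤ._+_ (rest γ h (suc n)) (both lt n (R (a , b) γ) (λ r x y → cong₂ ℤ._+_ (h r x y) (rt-after a b r (<-≤-trans (<-trans p lt) x) (<-≤-trans lt x))))
  single : m ≤ b → ∀ n → HL ((a , b) ∷ Ψ) S γ n ≡ HL Ψ S γ n
  single mb zero = refl
  single mb (suc n) = cong (λ z → HL Ψ S γ (suc n) ℤ.+ z) (HL-tail (v b) ((a , b) ∷ Ψ) ((p , q) ∷ ok) (R (a , b) γ) (suc t , b+t , ℤP.≤-reflexive neg) n) ∙ ℤP.+-identityʳ _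
    where
    t : ℕ
    t = m + u ∸ suc b
    b+t : b + suc t ≡ m + u
    b+t = +-suc b t ∙ m+[n∸m]≡n q
    neg : tail b (suc t) (R (a , b) γ) ≡ -[1+ 0 ]
    neg = tail-+ b (suc t) γ (rt (a , b)) ∙ cong₂ ℤ._+_ (tail-zero b (suc t) (λ r x y → h r (≤-trans mb x) (subst (r <_) b+t y))) (tail-last t a b p)
  split : _ → HL ((a , b) ∷ Ψ) S γ n ≡ HL (filterB (inside m) ((a , b) ∷ Ψ)) S' γ n
  split (yes lt) = both lt n γ h ∙ cong (λ c → HL (if c then (a , b) ∷ filterB (inside m) Ψ else filterB (inside m) Ψ) S' γ n) (sym (T-true (<⇒<ᵇ lt)))
  split (no ge) = single (≮⇒≥ ge) n ∙ rest γ h n ∙ cong (λ c → HL (if c then (a , b) ∷ filterB (inside m) Ψ else filterB (inside m) Ψ) S' γ n) (sym (<ᵇ-no (≮⇒≥ ge)))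

cat-ext : ∀ {A : Set} n {f g : ℕ → List A} → (∀ i → i < n → f i ≡ g i) → cat n f ≡ cat n g
cat-ext zero h = refl
cat-ext (suc n) h = cong₂ _++_ (cat-ext n (λ i p → h i (<-trans p (n<1+n n)))) (h n (n<1+n n))

filterB-cat : ∀ {A : Set} (p : A → Bool) n (f : ℕ → List A) → filterB p (cat n f) ≡ cat n (λ i → filterB p (f i))
filterB-cat p zero f = refl
filterB-cat p (suc n) f = filterB-++ p (cat n f) (f n) ∙ cong (_++ filterB p (f n)) (filterB-cat p n f)

cat-short : ∀ {A : Set} m u (f : ℕ → List A) → (∀ i → m ≤ i → f i ≡ []) → cat (m + u) f ≡ cat m f
cat-short m zero f h = cong (λ n → cat n f) (+-identityʳ m)
cat-short m (suc u) f h = cong (λ n → cat n f) (+-suc m u) ∙ cong (cat (m + u) f ++_) (h (m + u) (m≤m+n m u)) ∙ ++-identityʳ _ ∙ cat-short m u f h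

cat-empty : ∀ {A : Set} n (f : ℕ → List A) → (∀ i → i < n → f i ≡ []) → cat n f ≡ []
cat-empty zero f h = refl
cat-empty (suc n) f h = cong₂ _++_ (cat-empty n f (λ i p → h i (<-trans p (n<1+n n)))) (h n (n<1+n n))

filterB-opt : ∀ (p : Root → Bool) b δ → filterB p (opt b δ) ≡ opt (b ∧ p δ) δ
filterB-opt p true δ = refl
filterB-opt p false δ = refl

roots-restrict : ∀ m u d → (∀ r → r < d r) → filterB (inside m) (roots (m + u) d) ≡ roots m d
roots-restrict m u d up = filterB-cat (inside m) (m + u) (rowR (m + u) d) ∙ cat-short m u _ (λ i p → row i ∙ cat-empty m _ (λ j q → cong (λ b → opt b (i , j)) (≤ᵇ-no (<-trans (<-≤-trans q p) (up i)))))
  ∙ cat-ext m (λ i _ → row i)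
  where
  row : ∀ i → filterB (inside m) (rowR (m + u) d i) ≡ rowR m d i
  row i = filterB-cat (inside m) (m + u) _ ∙ cat-short m u _ (λ j p → filterB-opt (inside m) (d i ≤ᵇ j) (i , j) ∙ cong (λ b → opt b (i , j)) (cong ((d i ≤ᵇ j) ∧_) (<ᵇ-no p) ∙ ∧-zeroʳ _))
    ∙ cat-ext m (λ j p → filterB-opt (inside m) (d i ≤ᵇ j) (i , j) ∙ cong (λ b → opt b (i , j)) (cong ((d i ≤ᵇ j) ∧_) (T-true (<⇒<ᵇ p)) ∙ ∧-identityʳ _))

concatMap-range : ∀ {A : Set} n (f : ℕ → List A) → concatMap f (range n) ≡ cat n (λ i → f (suc i))
concatMap-range zero f = refl
concatMap-range (suc n) f = cong (concatMap f) (range-suc n) ∙ concatMap-++ f (range n) (suc n ∷ []) ∙ cong₂ _++_ (concatMap-range n f) (++-identityʳ (f (suc n)))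

row-range : ∀ n (p : ℕ → Bool) i → map (λ j → (i , j)) (filterB p (range n)) ≡ cat n (λ j → opt (p (suc j)) (i , suc j))
row-range zero p i = refl
row-range (suc n) p i = cong (λ L → map (λ j → (i , j)) (filterB p L)) (range-suc n) ∙ cong (map (λ j → (i , j))) (filterB-++ p (range n) (suc n ∷ []))
  ∙ map-++ (λ j → (i , j)) (filterB p (range n)) (filterB p (suc n ∷ [])) ∙ cong₂ _++_ (row-range n p i) (one (p (suc n)))
  where
  one : ∀ b → map (λ j → (i , j)) (if b then suc n ∷ [] else []) ≡ opt b (i , suc n)
  one true = refl
  one false = refl

map-roots : ∀ ℓ d → map up1 (roots ℓ d) ≡ cat ℓ (λ i → cat ℓ (λ j → opt (d i ≤ᵇ j) (suc i , suc j)))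
map-roots ℓ d = map-cat up1 ℓ (rowR ℓ d) ∙ cat-ext ℓ (λ i _ → map-cat up1 ℓ _ ∙ cat-ext ℓ (λ j _ → map-opt up1 (d i ≤ᵇ j) (i , j)))

Δ⁺-roots : ∀ ℓ → Δ⁺ ℓ ≡ map up1 (roots ℓ suc)
Δ⁺-roots ℓ = concatMap-range ℓ _ ∙ cat-ext ℓ (λ i _ → row-range ℓ (λ j → suc i <ᵇ j) (suc i)) ∙ sym (map-roots ℓ suc)

Δᵏ-roots : ∀ k μ d → (∀ i → d i ≡ suc (k ∸ nth μ (suc i) + i)) → Δᵏ k μ ≡ map up1 (roots (length μ) d)
Δᵏ-roots k μ d h = cong (filterB _) (Δ⁺-roots ℓ ∙ map-roots ℓ suc) ∙ filterB-cat _ ℓ _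
  ∙ cat-ext ℓ (λ i _ → filterB-cat _ ℓ _ ∙ cat-ext ℓ (λ j _ → filterB-opt _ (suc i ≤ᵇ j) (suc i , suc j) ∙ cong (λ b → opt b (suc i , suc j)) (flag i j)))
  ∙ sym (map-roots ℓ d)
  where
  ℓ : ℕ
  ℓ = length μ
  flag : ∀ i j → (suc i ≤ᵇ j) ∧ ((k ∸ nth μ (suc i)) + suc i <ᵇ suc j) ≡ (d i ≤ᵇ j)
  flag i j = iff-≡ (λ e → ≤ᵇ-yes (≤-trans (≤-reflexive (h i ∙ sym (+-suc _ i))) (ℕ.s≤s⁻¹ (<ᵇ⇒< _ _ (true-T (proj₂ (∧-true {suc i ≤ᵇ j} e)))))))
    (λ e → cong₂ _∧_ (≤ᵇ-yes (≤-trans (≤-trans (m≤n+m (suc i) (k ∸ nth μ (suc i))) (≤-reflexive (+-suc _ i ∙ sym (h i)))) (≤ᵇ-true e)))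
      (T-true (<⇒<ᵇ (s≤s (≤-trans (≤-reflexive (+-suc _ i ∙ sym (h i))) (≤ᵇ-true e))))))

listOf-nth : ∀ L → map +_ L ≡ listOf 0 (length L) (λ r → + nth L (suc r))
listOf-nth L = go 0 L _ (λ r → refl)
  where
  go : ∀ j L (γ : W) → (∀ r → γ (j + r) ≡ + nth L (suc r)) → map +_ L ≡ listOf j (length L) γ
  go j [] γ h = refl
  go j (x ∷ L) γ h = cong₂ _∷_ (sym (cong γ (sym (+-identityʳ j)) ∙ h 0)) (go (suc j) L γ (λ r → cong γ (sym (+-suc j r)) ∙ h (suc r)))

coeff-Hμ : ∀ k ℓ μ N → length μ ≡ ℓ → (∀ r → nth μ (suc r) ≤ k) → ℓ * (ℓ * k) ≤ N → ∀ n α →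
  coeff (HTr (Δ⁺ ℓ) (map +_ μ) N) n α ≡ HL (roots ℓ suc) (schur ℓ α) (λ r → + nth μ (suc r)) n
coeff-Hμ k ℓ μ N refl h b n α = cong₂ (λ Ψ L → coeff (HTr Ψ L N) n α) (Δ⁺-roots ℓ) (listOf-nth μ)
  ∙ coeff-HTr ℓ N (roots ℓ suc) (roots-inner ℓ suc n<1+n) _ (ℤP.≤-trans (Φ-bound k 0 ℓ _ (λ r _ _ → ℤ.+≤+ (h r))) (ℤ.+≤+ b)) n α

-- The partition 𝔭 τ may have fewer than ℓ rows. It is padded with zeros to length ℓ so that the
-- basis elements of all cores are computed from the single functional `schur ℓ α`.
coeff-kSchur : ∀ {k ℓ τ} N → Good k ℓ τ → ℓ * (ℓ * k) ≤ N → ∀ n α →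
  coeff (kSchurTr k (𝔭 k τ) N) n α ≡ HL (roots ℓ (rowStart k τ)) (schur ℓ α) (wt (λ r → rowCount k τ (suc r)) (λ _ → 0)) n
coeff-kSchur {k} {ℓ} {τ} N g b n α = cong₂ (λ Ψ L → coeff (HTr Ψ L N) n α) (Δᵏ-roots k lm d d≡) (listOf-nth lm)
  ∙ coeff-HTr m N (roots m d) (roots-inner m d up) γ (ℤP.≤-trans (Φ-bound k 0 m γ (λ r _ _ → ℤ.+≤+ (≤-trans (≤-reflexive (𝔭-nth r)) (ν≤k r))))
      (ℤ.+≤+ (≤-trans (*-mono-≤ m≤ℓ (*-monoˡ-≤ k m≤ℓ)) b))) n α
  ∙ cong (λ Ψ → HL Ψ (schur m α) γ n) (sym (roots-restrict m u d up))
  ∙ sym (HL-restrict m u (schur-tail (m + u) α) (schur-pad m u α) (roots (m + u) d) (roots-inner (m + u) d up) γ (λ r p _ → cong +_ (nth-out lm r p)) n)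
  ∙ cong (λ ℓ → HL (roots ℓ d) (schur ℓ α) γ n) (m+[n∸m]≡n m≤ℓ)
  ∙ HL-resp (schur-local ℓ α) (roots ℓ d) (λ r _ → cong +_ (𝔭-nth r) ∙ sym (ℤP.+-identityʳ _)) n
  where
  open Good g using (ν; core; 𝔭-nth; 𝔭-length; short)
  open Core core using (code; up)
  d : ℕ → ℕ
  d = rowStart k τ
  lm : List ℕ
  lm = 𝔭 k τ
  m u : ℕ
  m = length lm
  m≤ℓ : m ≤ ℓ
  m≤ℓ = ≤-trans (≤-reflexive 𝔭-length) short
  u = ℓ ∸ m
  γ : W
  γ r = + nth lm (suc r)
  ν≤k : ∀ r → ν r ≤ k
  ν≤k r = (lia ((d r) ∷ (ν r) ∷ k ∷ r ∷ []) (v0 ⊕ v1 ≛ su (v2 ⊕ v3) ∷ v3 ≺ v0 ∷ []) (v1 ≼ v2) ((1 ∷ 1 ∷ 0 ∷ 1 ∷ []) , [])) (code r) (up r)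
  d≡ : ∀ i → d i ≡ suc (k ∸ nth lm (suc i) + i)
  d≡ i = (lia ((d i) ∷ (ν i) ∷ k ∷ i ∷ v ∷ w ∷ []) (v0 ⊕ v1 ≛ su (v2 ⊕ v3) ∷ v4 ⊕ v1 ≛ v2 ∷ v5 ≛ v4 ∷ []) (v0 ≛ su (v5 ⊕ v3)) ((1 ∷ 1 ∷ 0 ∷ 0 ∷ 1 ∷ 0 ∷ 1 ∷ []) , (1 ∷ 0 ∷ 1 ∷ 1 ∷ 0 ∷ 1 ∷ []))) (code i) (m∸n+n≡m (ν≤k i)) (cong (k ∸_) (𝔭-nth i))
    where
    v w : ℕ
    v = k ∸ ν i
    w = k ∸ nth lm (suc i)

-- Reading words and strong tableaux

-- A recursive evaluation of a word at a core, to which the iterated operators and the sum over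
-- strong tableaux both reduce.
walk : ℕ → (List ℕ → Ser) → List ℕ → List ℕ → Ser
walk k F [] κ = F κ
walk k F (w ∷ ws) κ = mval k κ w (walk k F ws)

mval-ext : ∀ k κ w {F F' : List ℕ → Ser} → (∀ τ n → F τ n ≡ F' τ n) → ∀ n → mval k κ w F n ≡ mval k κ w F' n
mval-ext k κ w {F} {F'} h n = mval-def k κ w F n ∙ sumℤ-cong (markedCovers k κ) (λ { (τ , r , s) → cong (λ x → if r ≡ᵇ w then x else + 0) (shN-cong s (h τ) n) })
  ∙ sym (mval-def k κ w F' n)

walk-++ : ∀ k F ws vs κ n → walk k F (ws ++ vs) κ n ≡ walk k (walk k F vs) ws κ n
walk-++ k F [] vs κ n = refl
walk-++ k F (w ∷ ws) vs κ n = mval-ext k κ w (walk-++ k F ws vs) n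

shN-if : ∀ s (b : Bool) (f : Ser) n → (if b then shN s f n else + 0) ≡ shN s (λ n → if b then f n else + 0) n
shN-if s true f n = refl
shN-if s false f n = sym (shN-0 s n)

uWord-walk : ∀ k F ws comb n → sumℤ (uWord k ws comb) (λ x → shN (proj₁ x) (F (proj₂ x)) n) ≡ sumℤ comb (λ x → shN (proj₁ x) (walk k F ws (proj₂ x)) n)
uWord-walk k F [] comb n = refl
uWord-walk k F (w ∷ ws) comb n = uWord-walk k F ws (uOp k w comb) n ∙ sumℤ-concatMap _ comb G
  ∙ sumℤ-cong comb (λ { (s , κ) → sumℤ-concatMap _ (markedCovers k κ) G
      ∙ sumℤ-cong (markedCovers k κ) (λ { (τ , r , p) → single (r ≡ᵇ w) (s + p , τ) ∙ cong (λ x → if r ≡ᵇ w then x else + 0) (sym (shN-+ s p (V τ) n)) ∙ shN-if s (r ≡ᵇ w) (shN p (V τ)) n })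
      ∙ sumℤ-shN s (markedCovers k κ) (λ m n → weigh w (V (proj₁ m)) n (proj₂ m)) n
      ∙ shN-cong s (λ n → sym (mval-def k κ w V n)) n })
  where
  V : List ℕ → Ser
  V = walk k F ws
  G : ℕ × List ℕ → ℤ
  G x = shN (proj₁ x) (V (proj₂ x)) n
  single : ∀ (b : Bool) x → sumℤ (if b then x ∷ [] else []) G ≡ (if b then G x else + 0)
  single true x = ℤP.+-identityʳ _
  single false x = refl

-- A tableau is extended by appending the outer core at the end of its list. The function on lists
-- is generalized so that the induction can absorb this; it depends only on the head, the inside
-- core.
SMT-walk : ∀ k (F : List ℕ → Ser) (F' : List (List ℕ) → Ser) → (∀ κ cs n → F' (κ ∷ cs) n ≡ F κ n) → ∀ ws κ n →
  sumℤ (SMT k ws κ) (λ x → shN (proj₂ x) (F' (proj₁ x)) n) ≡ walk k F ws κ n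
SMT-walk k F F' h [] κ n = ℤP.+-identityʳ _ ∙ h κ [] n
SMT-walk k F F' h (w ∷ ws) κ n = sumℤ-concatMap _ (markedCovers k κ) (λ x → shN (proj₂ x) (F' (proj₁ x)) n)
  ∙ sumℤ-cong (markedCovers k κ) (λ { (τ , r , p) → split (r ≡ᵇ w) _ (sumℤ-map _ (SMT k ws τ) (λ x → shN (proj₂ x) (F' (proj₁ x)) n)
      ∙ sumℤ-cong (SMT k ws τ) (λ { (cs , s) → cong (λ q → shN q (F' (cs ++ κ ∷ [])) n) (+-comm s p) ∙ sym (shN-+ p s (F' (cs ++ κ ∷ [])) n) })
      ∙ sumℤ-shN p (SMT k ws τ) (λ x → shN (proj₂ x) (F' (proj₁ x ++ κ ∷ []))) n
      ∙ shN-cong p (SMT-walk k F (λ cs → F' (cs ++ κ ∷ [])) (λ κ' cs → h κ' (cs ++ κ ∷ [])) ws τ) n) })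
  ∙ sym (mval-def k κ w (walk k F ws) n)
  where
  split : ∀ (b : Bool) L {x} → sumℤ L (λ x → shN (proj₂ x) (F' (proj₁ x)) n) ≡ x → sumℤ (if b then L else []) (λ x → shN (proj₂ x) (F' (proj₁ x)) n) ≡ (if b then x else + 0)
  split true L e = e
  split false L e = refl

Full : ℕ → ℕ → List ℕ → Set
Full k i κ = ∀ r → r < i → rowCount k κ (suc r) ≡ k

Above : ℕ → ℕ → Set
Above i w = ∃ λ p → w ≡ suc p × i ≤ p

rowCount-≤ : ∀ {k ℓ κ} → Good k ℓ κ → ∀ r → rowCount k κ (suc r) ≤ k
rowCount-≤ {k} g r = (lia ((d r) ∷ (ν r) ∷ k ∷ r ∷ []) (v0 ⊕ v1 ≛ su (v2 ⊕ v3) ∷ v3 ≺ v0 ∷ []) (v1 ≼ v2) ((1 ∷ 1 ∷ 0 ∷ 1 ∷ []) , [])) (Core.code core r) (Core.up core r)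
  where open Good g using (ν; d; core)

-- Boxes of ν are lost only in the bottom block, which lies at or below the marked component. Rows
-- above it can only gain, and k is the maximum.
full-below : ∀ {k ℓ κ} (g : Good k ℓ κ) {p0 c i q} (s : Swapping (Good.core g) p0 c i q) j → j ≤ c → ∀ a → a ≤ it (Good.d g) j p0 → Full k a κ →
  ∀ {τ} → Good k ℓ τ → (∀ r → nth τ (suc r) ≡ Swapping.κ' s r) → Full k a τ
full-below {k} {ℓ} {κ} g {p0} {c} {i} {q} s j jc a ap full {τ} gτ e r ra =
  (lia (x ∷ v' ∷ u ∷ v ∷ t ∷ k ∷ []) (v0 ≛ v1 ∷ v1 ⊕ v2 ≛ v3 ⊕ v4 ∷ v2 ≛ li 0 ∷ v3 ≛ v5 ∷ v0 ≼ v5 ∷ []) (v0 ≛ v5) ((1 ∷ 0 ∷ 0 ∷ 0 ∷ 0 ∷ 0 ∷ 0 ∷ 0 ∷ 0 ∷ 1 ∷ []) , (1 ∷ 0 ∷ 1 ∷ 0 ∷ 1 ∷ 1 ∷ 0 ∷ 0 ∷ 1 ∷ [])))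
    (core-unique (Swapping.core' s) (Good.core gτ) e r) (Swapping.ν'-spec s r)
    (ind-low (it d c p0) (suc i) r (<-≤-trans ra (≤-trans ap (it-le {j} {c} p0 jc)))) (full r ra) (rowCount-≤ gτ r)
  where
  open Good g using (ν; d; core)
  open RowMap d (Core.mono core) (Core.up core) using (it-le)
  x v v' u t : ℕ
  x = rowCount k τ (suc r)
  v = ν r
  v' = Swapping.ν' s r
  u = ind (it d c p0) (suc i) r
  t = ind q i r

walk-cong : ∀ {k ℓ} a {F F' : List ℕ → Ser} → (∀ {τ} → Good k ℓ τ → Full k a τ → ∀ n → F τ n ≡ F' τ n) → ∀ ws → All (Above a) ws →
  ∀ {κ} → Good k ℓ κ → Full k a κ → ∀ n → walk k F ws κ n ≡ walk k F' ws κ n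
walk-cong a h [] [] g full n = h g full n
walk-cong {k} {ℓ} a h (w ∷ ws) ((p , refl , ap) ∷ ok) g full n = OnCore.mval-cong g p
  (λ s j jc e gτ eκ n → walk-cong a h ws ok gτ (full-below g s j jc a (≤-trans ap (≤-reflexive (sym e))) full gτ eκ) n) n

module Columns (k ℓ : ℕ) where

  Tails : ℕ → (W → ℤ) → Set
  Tails a S = ∀ j → a ≤ j → ∀ γ → TailNeg ℓ j γ → S γ ≡ + 0

  Antis : ℕ → (W → ℤ) → Set
  Antis a S = ∀ z → a ≤ z → suc z < ℓ → AntiAt S z

  value : (W → ℤ) → (ℕ → ℕ) → List ℕ → Ser
  value S low κ = HL (roots ℓ (rowStart k κ)) S (wt (λ r → rowCount k κ (suc r)) low)

  down : ℕ → ℕ → List ℕ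
  down a zero = []
  down a (suc q) = suc (a + q) ∷ down a q

  down-above : ∀ a b q → a ≤ b → All (Above a) (down b q)
  down-above a b zero h = []
  down-above a b (suc q) h = (b + q , refl , ≤-trans h (m≤m+n b q)) ∷ down-above a b q h

  column : ∀ S → Local ℓ S → ∀ a → Antis a S → Tails a S → ∀ q → a + q ≤ ℓ → ∀ {τ} → Good k ℓ τ → Full k a τ → ∀ n →
    walk k (value S (λ _ → 0)) (down a q) τ n ≡ value S (ind a q) τ n
  column S loc a anti vanish zero h g full n = refl
  column S loc a anti vanish (suc q) h {τ} g full n = OnCore.mval-cong g (a + q)
      (λ s j jc e gτ eκ n → column S loc a anti vanish q (<⇒≤ lt) gτ (full-below g s j jc a (≤-trans (m≤m+n a q) (≤-reflexive (sym e))) full gτ eκ) n) n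
    ∙ sym (Branch.Step.branch k ℓ S loc a anti vanish τ g full q lt n)
    where
    lt : a + q < ℓ
    lt = ≤-trans (≤-reflexive (sym (+-suc a q))) h

  -- Once a column has been read its loss of weight is stored in the functional, so that the
  -- preceding column again acts on an unmodified k-Schur value.
  lower : ℕ → (W → ℤ) → W → ℤ
  lower a S β = S (λ r → β r ℤ.- + ind a (ℓ ∸ a) r)

  lower-local : ∀ a {S} → Local ℓ S → Local ℓ (lower a S)
  lower-local a loc h = loc (λ r p → cong (ℤ._- + ind a (ℓ ∸ a) r) (h r p))

  -- The subtracted indicator takes the same value in rows z and z + 1 when both are at least a, so
  -- it commutes with their exchange; across row a it would not.
  lower-antis : ∀ a {S} → Local ℓ S → a ≤ ℓ → Antis a S → Antis a (lower a S)
  lower-antis a {S} loc aℓ anti z az lt γ = loc (λ r p → commute r (pos z r)) ∙ anti z az lt (λ r → γ r ℤ.- + ind a (ℓ ∸ a) r)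
    where
    end : a + (ℓ ∸ a) ≡ ℓ
    end = m+[n∸m]≡n aℓ
    one : ∀ r → a ≤ r → r < ℓ → ind a (ℓ ∸ a) r ≡ 1
    one r p q = ind-in a (ℓ ∸ a) r p (≤-trans q (≤-reflexive (sym end)))
    commute : ∀ r → Pos z r → sw z γ r ℤ.- + ind a (ℓ ∸ a) r ≡ sw z (λ r → γ r ℤ.- + ind a (ℓ ∸ a) r) r
    same : ∀ r → ind a (ℓ ∸ a) r ≡ ind a (ℓ ∸ a) (swi z r) → sw z γ r ℤ.- + ind a (ℓ ∸ a) r ≡ sw z (λ r → γ r ℤ.- + ind a (ℓ ∸ a) r) r
    same r e = cong (λ x → (γ (swi z r) ℤ.+ rt (suc z , z) r) ℤ.- + x) e ∙ x+y+z (γ (swi z r)) (rt (suc z , z) r) (- + ind a (ℓ ∸ a) (swi z r))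
    commute r (at-z refl) = same z (one z az (<-trans (n<1+n z) lt) ∙ sym (one (suc z) (m≤n⇒m≤1+n az) lt) ∙ cong (ind a (ℓ ∸ a)) (sym (swi-z z)))
    commute r (at-sz refl) = same (suc z) (one (suc z) (m≤n⇒m≤1+n az) lt ∙ sym (one z az (<-trans (n<1+n z) lt)) ∙ cong (ind a (ℓ ∸ a)) (sym (swi-sz z)))
    commute r (off p q) = same r (cong (ind a (ℓ ∸ a)) (sym (swi-other z r p q)))

  lower-tails : ∀ a {S} → Tails a S → Tails a (lower a S)
  lower-tails a vanish j aj γ (t , e , h) = vanish j aj _ (t , e , ℤP.≤-trans (tail-mono j t (λ r _ _ → ℤP.i-j≤i (γ r) (+ ind a (ℓ ∸ a) r))) h)

  lower-value : ∀ a {S} → Local ℓ S → ∀ τ n → value S (ind a (ℓ ∸ a)) τ n ≡ value (lower a S) (λ _ → 0) τ n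
  lower-value a {S} loc τ n = HL-resp loc (roots ℓ (rowStart k τ)) (λ r _ → cong (ℤ._- + ind a (ℓ ∸ a) r) (sym (ℤP.+-identityʳ (+ rowCount k τ (suc r))))) n
    ∙ sym (HL-translate loc (λ r → + ind a (ℓ ∸ a) r) (roots ℓ (rowStart k τ)) (wt (λ r → rowCount k τ (suc r)) (λ _ → 0)) n)

  module Word (μ : List ℕ) (len : length μ ≡ ℓ) (desc : Desc μ) where

    conj-≤ : ∀ c → conj μ c ≤ ℓ
    conj-≤ c = ≤-trans (length-filterB _ μ) (≤-reflexive len)

    conj-anti : ∀ c → conj μ (suc c) ≤ conj μ c
    conj-anti zero = ≤-trans (conj-≤ 1) (≤-reflexive (sym len ∙ all-zero μ))
      where
      all-zero : ∀ L → length L ≡ conj L 0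
      all-zero [] = refl
      all-zero (x ∷ L) = cong suc (all-zero L)
    conj-anti (suc c) = bound (conj μ (suc (suc c))) refl
      where
      bound : ∀ r → conj μ (suc (suc c)) ≡ r → r ≤ conj μ (suc c)
      bound zero e = z≤n
      bound (suc r) e = proj₂ (conj-galois μ desc (suc c) (s≤s z≤n) r)
        (≤-trans (n≤1+n (suc c)) (proj₁ (conj-galois μ desc (suc (suc c)) (s≤s z≤n) r) (≤-reflexive (sym e))))

    col : ℕ → List ℕ
    col c = down (conj μ (suc c)) (ℓ ∸ conj μ (suc c))

    readings : ∀ a (p : ℕ → Bool) → (∀ r → p (suc r) ≡ (a ≤ᵇ r)) → ∀ n → filterB p (reverse (range n)) ≡ down a (n ∸ a)
    readings a p h zero = cong (down a) (sym (0∸n≡0 a))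
    readings a p h (suc n) = cong (filterB p) (cong reverse (range-suc n) ∙ reverse-++ (range n) (suc n ∷ [])) ∙ choose (a ≤? n)
      where
      choose : _ → filterB p (suc n ∷ reverse (range n)) ≡ down a (suc n ∸ a)
      choose (yes q) = cong (λ b → if b then suc n ∷ filterB p (reverse (range n)) else filterB p (reverse (range n))) (h n ∙ ≤ᵇ-yes q)
        ∙ cong₂ _∷_ (cong suc (sym (m+[n∸m]≡n q))) (readings a p h n) ∙ cong (down a) (sym (+-∸-assoc 1 q))
      choose (no q) = cong (λ b → if b then suc n ∷ filterB p (reverse (range n)) else filterB p (reverse (range n))) (h n ∙ ≤ᵇ-no (≰⇒> q))
        ∙ readings a p h n ∙ cong (down a) (m≤n⇒m∸n≡0 (<⇒≤ (≰⇒> q)) ∙ sym (m≤n⇒m∸n≡0 (≰⇒> q)))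

    creading-cols : creadingZ k μ ≡ cat k col
    creading-cols = concatMap-range k _ ∙ cat-ext k (λ c _ → cong (λ n → filterB (λ i → nth μ i <ᵇ suc c) (reverse (range n))) len
        ∙ readings (conj μ (suc c)) _ (λ r → flag c r) ℓ)
      where
      flag : ∀ c r → (nth μ (suc r) <ᵇ suc c) ≡ (conj μ (suc c) ≤ᵇ r)
      flag c r = iff-≡ (λ e → ≤ᵇ-yes (≮⇒≥ (λ q → <⇒≱ (<ᵇ⇒< (nth μ (suc r)) (suc c) (true-T e)) (proj₁ (conj-galois μ desc (suc c) (s≤s z≤n) r) q))))
        (λ e → T-true (<⇒<ᵇ (≰⇒> (λ q → <⇒≱ (s≤s (≤ᵇ-true {conj μ (suc c)} e)) (proj₂ (conj-galois μ desc (suc c) (s≤s z≤n) r) q)))))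

    cols-above : ∀ c → All (Above (conj μ c)) (cat c col)
    cols-above c = go c ≤-refl
      where
      anti≤ : ∀ {a b} → a ≤ b → conj μ b ≤ conj μ a
      anti≤ {a} {zero} z≤n = ≤-refl
      anti≤ {a} {suc b} h with a ≟ suc b
      ... | yes refl = ≤-refl
      ... | no ne = ≤-trans (conj-anti b) (anti≤ (ℕ.s≤s⁻¹ (≤∧≢⇒< h ne)))
      go : ∀ n → n ≤ c → All (Above (conj μ c)) (cat n col)
      go zero h = []
      go (suc n) h = All-++ (go n (<⇒≤ h)) (down-above (conj μ c) (conj μ (suc n)) _ (anti≤ h))

    -- What row r retains after columns 1, ..., c of the skew shape have been read, namely k -
    -- max(0, c - μ_r). It runs from k at c = 0 to μ_r at c = k.
    weight : ℕ → W
    weight c r = + (k ⊓ (nth μ (suc r) + (k ∸ c)))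

    weight-step : ∀ c → c < k → ∀ r → r < ℓ → weight c r ℤ.- + ind (conj μ (suc c)) (ℓ ∸ conj μ (suc c)) r ≡ weight (suc c) r
    weight-step c ck r rℓ = choose (r <? a)
      where
      a x m : ℕ
      a = conj μ (suc c)
      x = k ∸ suc c
      m = nth μ (suc r)
      k∸c : k ∸ c ≡ suc x
      k∸c = +-∸-assoc 1 ck
      x+c : x + suc c ≡ k
      x+c = m∸n+n≡m ck
      choose : _ → weight c r ℤ.- + ind a (ℓ ∸ a) r ≡ weight (suc c) r
      choose (yes h) = cong₂ (λ u v → + u ℤ.- + v) (m≤n⇒m⊓n≡m (subst (λ z → k ≤ m + z) (sym k∸c) (≤-trans big (+-monoʳ-≤ m (n≤1+n x))))) (ind-low a (ℓ ∸ a) r h)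
          ∙ ℤP.+-identityʳ _ ∙ cong +_ (sym (m≤n⇒m⊓n≡m big))
        where
        big : k ≤ m + x
        big = (lia (x ∷ c ∷ k ∷ m ∷ []) (v0 ⊕ (su v1) ≛ v2 ∷ su v1 ≼ v3 ∷ []) (v2 ≼ v3 ⊕ v0) ((1 ∷ 0 ∷ 1 ∷ 1 ∷ []) , [])) x+c (proj₁ (conj-galois μ desc (suc c) (s≤s z≤n) r) h)
      choose (no h) = cong₂ (λ u v → + u ℤ.- + v) (m≥n⇒m⊓n≡n (subst (λ z → m + z ≤ k) (sym k∸c) small) ∙ cong (λ z → m + z) k∸c)
            (ind-in a (ℓ ∸ a) r (≮⇒≥ h) (≤-trans rℓ (≤-reflexive (sym (m+[n∸m]≡n (conj-≤ (suc c)))))))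
          ∙ cong (λ z → + z ℤ.- + 1) (+-suc m x) ∙ cong +_ (sym (m≥n⇒m⊓n≡n (≤-trans (+-monoʳ-≤ m (n≤1+n x)) small)))
        where
        small : m + suc x ≤ k
        small = (lia (x ∷ c ∷ k ∷ m ∷ []) (v0 ⊕ (su v1) ≛ v2 ∷ v3 ≺ su v1 ∷ []) (v3 ⊕ (su v0) ≼ v2) ((1 ∷ 1 ∷ 0 ∷ 1 ∷ []) , [])) x+c (≰⇒> (λ q → h (proj₂ (conj-galois μ desc (suc c) (s≤s z≤n) r) q)))

    module From (κ : List ℕ) (gκ : Good k ℓ κ) (full : Full k ℓ κ) where

      start : ∀ r → r < ℓ → rowStart k κ r ≡ suc r
      start r p = (lia ((d r) ∷ (ν r) ∷ k ∷ r ∷ []) (v0 ⊕ v1 ≛ su (v2 ⊕ v3) ∷ v1 ≛ v2 ∷ []) (v0 ≛ su v3) ((1 ∷ 1 ∷ 0 ∷ 0 ∷ 1 ∷ []) , (1 ∷ 0 ∷ 1 ∷ 1 ∷ []))) (Core.code (Good.core gκ) r) (full r p)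
        where open Good gκ using (d; ν)

      -- The functional is quantified inside the induction because removing the last column replaces
      -- S by `lower a S`. Antisymmetry and vanishing then weaken correctly, as columns to the left
      -- begin at the same row or further down.
      columns : ∀ c → c ≤ k → ∀ S → Local ℓ S → Antis (conj μ c) S → Tails (conj μ c) S → ∀ n →
        walk k (value S (λ _ → 0)) (cat c col) κ n ≡ HL (roots ℓ suc) S (weight c) n
      columns zero h S loc anti vanish n = Catalan.H-cong ℓ S loc start (λ r p → ℤP.+-identityʳ _
        ∙ cong +_ (full r p ∙ sym (m≤n⇒m⊓n≡m (m≤n+m k (nth μ (suc r)))))) n
      columns (suc c) h S loc anti vanish n = walk-++ k (value S (λ _ → 0)) (cat c col) (col c) κ n
        ∙ walk-cong a (λ {τ} g f n → column S loc a anti vanish (ℓ ∸ a) (≤-reflexive (m+[n∸m]≡n (conj-≤ (suc c)))) g f n ∙ lower-value a loc τ n)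
            (cat c col) (All.map (λ { (p , e , q) → p , e , ≤-trans (conj-anti c) q }) (cols-above c)) gκ (λ r p → full r (<-≤-trans p (conj-≤ (suc c)))) n
        ∙ columns c (<⇒≤ h) (lower a S) (lower-local a loc)
            (λ z p → lower-antis a loc (conj-≤ (suc c)) anti z (≤-trans (conj-anti c) p)) (λ j p → lower-tails a vanish j (≤-trans (conj-anti c) p)) n
        ∙ HL-translate loc (λ r → + ind a (ℓ ∸ a) r) (roots ℓ suc) (weight c) n
        ∙ HL-resp loc (roots ℓ suc) (weight-step c h) n
        where
        a : ℕ
        a = conj μ (suc c)

-- Assembly for the core of the rectangle

nth-replicate : ∀ ℓ x r → r < ℓ → nth (replicateN ℓ x) (suc r) ≡ x
nth-replicate (suc ℓ) x zero p = refl
nth-replicate (suc ℓ) x (suc r) (s≤s p) = nth-replicate ℓ x r p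

length-replicateN : ∀ ℓ (x : ℕ) → length (replicateN ℓ x) ≡ ℓ
length-replicateN zero x = refl
length-replicateN (suc ℓ) x = cong suc (length-replicateN ℓ x)

nth-All : ∀ {k L} → All (_≤ k) L → ∀ r → nth L (suc r) ≤ k
nth-All [] r = z≤n
nth-All (h ∷ hs) zero = h
nth-All (h ∷ hs) (suc r) = nth-All hs r

module Main (k ℓ : ℕ) (μ : List ℕ) (len : length μ ≡ ℓ) (lin : Linked _≥_ μ) (μ≤k : All (_≤ k) μ)
  (κ : List ℕ) (linκ : Linked _≥_ κ) (posκ : All (_> 0) κ) (coreκ : T (isCoreᵇ (suc k) κ)) (𝔭κ : 𝔭 k κ ≡ replicateN ℓ k)
  (N : ℕ) (big : ℓ * (ℓ * k) ≤ N) where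

  -- The row bound is left open: it is used once with the length of κ itself to learn that this
  -- length is ℓ, and then with ℓ.
  good : ∀ m → length κ ≤ m → Good k m κ
  good m h = record { desc = linked-desc linκ ; positive = posκ ; short = h ; noHook = isCore⇒ k κ coreκ }

  lenκ : length κ ≡ ℓ
  lenκ = sym (Good.𝔭-length (good (length κ) ≤-refl)) ∙ cong length 𝔭κ ∙ length-replicateN ℓ k

  gκ : Good k ℓ κ
  gκ = good ℓ (≤-reflexive lenκ)

  full : Full k ℓ κ
  full r p = sym (Good.𝔭-nth gκ r) ∙ cong (λ L → nth L (suc r)) 𝔭κ ∙ nth-replicate ℓ k r p

  basis : Mono → List ℕ → Ser
  basis α τ n = coeff (kSchurTr k (𝔭 k τ) N) n α

  open Columns k ℓ
  open Word μ len (linked-desc lin)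
  open From κ gκ full

  above-all : ∀ {a} ws → All (Above a) ws → All (Above 0) ws
  above-all ws = All.map (λ { (p , e , _) → p , e , z≤n })

  expansion : ∀ n α → coeff (HTr (Δ⁺ ℓ) (map +_ μ) N) n α ≡ walk k (basis α) (creadingZ k μ) κ n
  expansion n α = coeff-Hμ k ℓ μ N len (nth-All μ≤k) big n α
    ∙ HL-resp loc (roots ℓ suc) (λ r _ → cong +_ (sym (m≥n⇒m⊓n≡n (≤-trans (≤-reflexive (e r)) (nth-All μ≤k r)) ∙ e r))) n
    ∙ sym (columns k ≤-refl (schur ℓ α) loc (λ z _ → schur-anti ℓ α z) (λ j _ → schur-tail ℓ α j) n)
    ∙ walk-cong 0 (λ g _ n → sym (coeff-kSchur N g big n α)) (cat k col) (above-all _ (cols-above k)) gκ (λ _ ()) n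
    ∙ cong (λ ws → walk k (basis α) ws κ n) (sym creading-cols)
    where
    loc : Local ℓ (schur ℓ α)
    loc = schur-local ℓ α
    e : ∀ r → nth μ (suc r) + (k ∸ k) ≡ nth μ (suc r)
    e r = cong (λ z → nth μ (suc r) + z) (n∸n≡0 k) ∙ +-identityʳ _

  operators : ∀ n α → coeff (realizeTr k N (uWord k (creadingZ k μ) ((0 , κ) ∷ []))) n α ≡ walk k (basis α) (creadingZ k μ) κ n
  operators n α = coeff-sumP word _ n α ∙ sumℤ-cong word (λ { (s , τ) → coeff-tpow s (kSchurTr k (𝔭 k τ) N) n α })
    ∙ uWord-walk k (basis α) (creadingZ k μ) ((0 , κ) ∷ []) n ∙ ℤP.+-identityʳ _
    where
    word : List (ℕ × List ℕ)
    word = uWord k (creadingZ k μ) ((0 , κ) ∷ [])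

  tableaux : ∀ n α → sumℤ (SMT k (creadingZ k μ) κ) (λ x → shN (proj₂ x) (basis α (insideCore (proj₁ x))) n) ≡ walk k (basis α) (creadingZ k μ) κ n
  tableaux n α = SMT-walk k (basis α) (λ cs → basis α (insideCore cs)) (λ _ _ _ → refl) (creadingZ k μ) κ n

theorem4p1 : (k ℓ : ℕ) → k ≥ 1 →
    (μ : List ℕ) → length μ ≡ ℓ → Linked _≥_ μ → All (_≤ k) μ →
    (κ : List ℕ) → Linked _≥_ κ → All (_> 0) κ → T (isCoreᵇ (ℕ.suc k) κ) →
    𝔭 k κ ≡ replicateN ℓ k →
    ∃ λ N₀ → ∀ N → N ≥ N₀ →
    (HTr (Δ⁺ ℓ) (map +_ μ) N
    ≈ realizeTr k N (uWord k (creadingZ k μ) ((0 , κ) ∷ [])))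
    ×
    (HTr (Δ⁺ ℓ) (map +_ μ) N
    ≈ sumP (map (λ { (cs , s) → tpow s (kSchurTr k (𝔭 k (insideCore cs)) N) })
    (SMT k (creadingZ k μ) κ)))
theorem4p1 k ℓ _ μ len lin μ≤k κ linκ posκ coreκ 𝔭κ = ℓ * (ℓ * k) , λ N big →
  let open Main k ℓ μ len lin μ≤k κ linκ posκ coreκ 𝔭κ N big in
  (λ n α → expansion n α ∙ sym (operators n α)) ,
  (λ n α → expansion n α ∙ sym (coeff-sumP (SMT k (creadingZ k μ) κ) _ n α
    ∙ sumℤ-cong (SMT k (creadingZ k μ) κ) (λ { (cs , s) → coeff-tpow s (kSchurTr k (𝔭 k (insideCore cs)) N) n α })
    ∙ tableaux n α))
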